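{- For all positive integers $r,c$, as formal power series in $s$ with coefficients in $\mathbb{Q}(q,t)$, $$ \sum_{\pi \in \mathcal{P}(r,c)}F_\pi(q,t)\,s^{|\pi|}=\prod_{i=1}^{r}\prod_{j=1}^{c} \frac{(ts^{i+j-1};q)_\infty}{(s^{i+j-1};q)_{\infty}}. $$ In particular, $$ \sum_{\pi \in \mathcal{P}}F_\pi(q,t)\,s^{|\pi|}=\prod_{n=1}^{\infty} \left[\frac{(ts^{n};q)_\infty}{(s^{n};q)_{\infty}}\right]^n. $$
   Context: A plane partition is an array $\pi=(\pi(i,j))_{i,j\ge 1}$ of nonnegative integers, only finitely many nonzero, that is nonincreasing along each row and each column; its support is the set of boxes $(i,j)$ with $\pi(i,j)>0$ and its weight is $|\pi|=\sum_{i,j}\pi(i,j)$. $\mathcal{P}$ is the set of all plane partitions and $\mathcal{P}(r,c)$ the set of those with $\pi(i,j)=0$ whenever $i>r$ or $j>c$. $(s;q)_\infty=\prod_{n\ge0}(1-sq^n)$. For nonnegative integers $n,m$ let $f(n,m)=\prod_{i=0}^{n-1}\frac{1-q^{i}t^{m+1}}{1-q^{i+1}t^{m}}$ if $n\ge1$ and $f(0,m)=1$. For a box $(i,j)$ in the support of $\pi$ define the partitions $\lambda=(\pi(i,j),\pi(i+1,j+1),\dots)$, $\mu=(\pi(i+1,j),\pi(i+2,j+1),\dots)$, $\nu=(\pi(i,j+1),\pi(i+1,j+2),\dots)$ and set $$F_\pi(i,j)(q,t)=\prod_{m=0}^{\infty}\frac{f(\lambda_1-\mu_{m+1},m)\,f(\lambda_1-\nu_{m+1},m)}{f(\lambda_1-\lambda_{m+1},m)\,f(\lambda_1-\lambda_{m+2},m)}$$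 (only finitely many factors differ from 1). Then $F_\pi(q,t)=\prod_{(i,j)\in\text{support of }\pi}F_\pi(i,j)(q,t)$. -}

module Defs where

open import Data.Nat as ℕ using (ℕ; zero; suc; _≤_; _∸_; _≡ᵇ_)
open import Data.Bool using (Bool; true; false; _∧_)
open import Data.Integer as ℤ using (ℤ; 0ℤ; 1ℤ)
open import Data.List using (List; map)
open import Data.List.Membership.Propositional using (_∈_)
open import Data.List.Relation.Unary.AllPairs using (AllPairs)
open import Data.Product using (Σ; _×_; ∃)
open import Data.Sum using (_⊎_)
open import Relation.Nullary using (¬_)
open import Relation.Binary.PropositionalEquality using (_≡_)

-- Formal power series in three variables s, q, t with integer
-- coefficients:  A x y z  is the coefficient of  s^x q^y t^z.
-- (All rational functions of q,t occurring in the theorem have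
-- denominators that are products of factors 1 - q^a t^b, (a,b) ≠ (0,0),
-- so they are expanded as power series in q,t.)

PS : Set
PS = ℕ → ℕ → ℕ → ℤ

sumTo : ℕ → (ℕ → ℤ) → ℤ
sumTo zero    g = 0ℤ
sumTo (suc n) g = sumTo n g ℤ.+ g n

sumℕ : ℕ → (ℕ → ℕ) → ℕ
sumℕ zero    g = 0
sumℕ (suc n) g = sumℕ n g ℕ.+ g n

ind : Bool → ℤ
ind true  = 1ℤ
ind false = 0ℤ

_⊕_ : PS → PS → PS
(A ⊕ B) x y z = A x y z ℤ.+ B x y z

neg : PS → PS
neg A x y z = ℤ.- A x y z

_⊗_ : PS → PS → PS
(A ⊗ B) x y z =
  sumTo (suc x) λ i → sumTo (suc y) λ j → sumTo (suc z) λ k →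
    A i j k ℤ.* B (x ∸ i) (y ∸ j) (z ∸ k)

mono : ℕ → ℕ → ℕ → PS
mono a b c x y z = ind ((a ≡ᵇ x) ∧ (b ≡ᵇ y) ∧ (c ≡ᵇ z))

𝟙 : PS
𝟙 = mono 0 0 0

oneMinus : ℕ → ℕ → ℕ → PS
oneMinus a b c = 𝟙 ⊕ neg (mono a b c)

-- the expansion of 1 / (1 - s^a q^b t^c) = Σ_{m ≥ 0} s^{am} q^{bm} t^{cm};
-- only used with a + b + c ≥ 1 (then m ≤ x + y + z for every contributing m)
geo : ℕ → ℕ → ℕ → PS
geo a b c x y z =
  sumTo (suc (x ℕ.+ y ℕ.+ z)) λ m →
    ind (((a ℕ.* m) ≡ᵇ x) ∧ ((b ℕ.* m) ≡ᵇ y) ∧ ((c ℕ.* m) ≡ᵇ z))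

prodTo : ℕ → (ℕ → PS) → PS
prodTo zero    F = 𝟙
prodTo (suc n) F = prodTo n F ⊗ F n

pow : PS → ℕ → PS
pow A zero    = 𝟙
pow A (suc n) = pow A n ⊗ A

-- Infinite product ∏_{n ≥ 0} F n, for families where F n - 1 only has
-- terms of total degree ≥ n (always the case below): the coefficient of
-- s^x q^y t^z is that of the finite product over n ≤ x + y + z.
infProd : (ℕ → PS) → PS
infProd F x y z = prodTo (suc (x ℕ.+ y ℕ.+ z)) F x y z

pochT : ℕ → PS
pochT k = infProd λ n → oneMinus k n 1

invPoch : ℕ → PS
invPoch k = infProd λ n → geo k n 0

ratio : ℕ → PS
ratio k = pochT k ⊗ invPoch k

-- ∏_{i=1}^r ∏_{j=1}^c ratio (i + j - 1)   (0-based i, j below)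
rhsBox : ℕ → ℕ → PS
rhsBox r c = prodTo r λ i → prodTo c λ j → ratio (i ℕ.+ j ℕ.+ 1)

rhsAll : PS
rhsAll = infProd λ m → pow (ratio (suc m)) (suc m)

-- Plane partitions.  arr i j is π(i+1, j+1) (0-based indices);
-- bound witnesses finiteness of the support (support ⊆ bound × bound).

record PlanePartition : Set where
  field
    arr      : ℕ → ℕ → ℕ
    bound    : ℕ
    zero-out : ∀ i j → bound ≤ i ⊎ bound ≤ j → arr i j ≡ 0
    row-mono : ∀ i j → arr i (suc j) ≤ arr i j
    col-mono : ∀ i j → arr (suc i) j ≤ arr i j
open PlanePartition public

weight : PlanePartition → ℕ
weight π = sumℕ (bound π) λ i → sumℕ (bound π) λ j → arr π i j

InBox : ℕ → ℕ → PlanePartition → Set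
InBox r c π = ∀ i j → r ≤ i ⊎ c ≤ j → arr π i j ≡ 0

SamePP : PlanePartition → PlanePartition → Set
SamePP π ρ = ∀ i j → arr π i j ≡ arr ρ i j

f : ℕ → ℕ → PS
f n m = prodTo n λ i → oneMinus 0 i (suc m) ⊗ geo 0 (suc i) m

finv : ℕ → ℕ → PS
finv n m = prodTo n λ i → oneMinus 0 (suc i) m ⊗ geo 0 i (suc m)

-- F_π(i+1, j+1).  With λ_{m+1} = π(i+m,j+m), μ_{m+1} = π(i+1+m,j+m),
-- ν_{m+1} = π(i+m,j+1+m) (0-based arr); factors with m ≥ bound are 1.
Fbox : PlanePartition → ℕ → ℕ → PS
Fbox π i j = prodTo (suc (bound π)) λ m →
  ((f (l1 ∸ arr π (suc i ℕ.+ m) (j ℕ.+ m)) m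
    ⊗ f (l1 ∸ arr π (i ℕ.+ m) (suc j ℕ.+ m)) m)
   ⊗ finv (l1 ∸ arr π (i ℕ.+ m) (j ℕ.+ m)) m)
   ⊗ finv (l1 ∸ arr π (suc i ℕ.+ m) (suc j ℕ.+ m)) m
  where l1 = arr π i j

onSupport : ℕ → PS → PS
onSupport zero    X = 𝟙
onSupport (suc _) X = X

F : PlanePartition → PS
F π = prodTo (bound π) λ i → prodTo (bound π) λ j →
        onSupport (arr π i j) (Fbox π i j)

Enumerates : (PlanePartition → Set) → List PlanePartition → Set
Enumerates P L =
  (∀ π → π ∈ L → P π) ×
  (∀ π → P π → Σ PlanePartition λ ρ → ρ ∈ L × SamePP π ρ) ×
  AllPairs (λ π ρ → ¬ SamePP π ρ) L

sumList : List ℤ → ℤ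
sumList Data.List.[] = 0ℤ
sumList (x Data.List.∷ xs) = x ℤ.+ sumList xs

lhsCoeff : List PlanePartition → ℕ → ℕ → ℤ
lhsCoeff L a b = sumList (map (λ π → F π 0 a b) L)

{-# OPTIONS --safe #-}
-- Along its diagonals, F_π is a product of one-step weights of interlacing partitions over weights W(κ), so the
-- generating function is a matrix entry of a word in lowering and raising operators. Exchanging two of them
-- (a skew Cauchy identity) costs Σ_j f(j,0) z^j = (tz;q)_∞ / (z;q)_∞, one factor for each box of the rectangle.
-- The Cauchy identity is a q-adic limit of the commutation of two families U_l, V_k on functions on ℤⁿ. For the
-- latter put row i at s^(n-1-i) q^κ_i: Lagrange interpolation gives one-box exchange relations, which force
-- [U_l , V_k] to be a scalar; it is invariant under s ↦ q s and vanishes at s = 0, so it is 0. Then let s = t.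
module Submission where

-- At `s = t` the argument for the commutation would break down: a position of one row can then
-- equal q/t times a position of the next row, and `T κ κ` vanishes as soon as some entry of κ
-- exceeds the one before it, so that the weight 1 / `T κ κ` has a pole. With s independent all
-- these quantities are nonzero on the whole of ℤⁿ. The price is paid when s becomes t: the poles
-- must be seen to cancel term by term. The commutation on ℤⁿ contains no scalar kernel. The kernel
-- appears when the last entry of one argument moves to -L: the values f(k, d) with k ≥ L agree
-- modulo q^L, and the one freedom left in the last row, a surplus j, contributes f(j, 0). This is
-- why vectors have more entries than the partitions they carry. The commutator is diagonal because
-- it commutes with D, the multiplication by the sum of the positions, whose values are distinct;
-- one-box operators weighted by positions express [D , [U , V]] through commutators of smaller
-- index. All sums stay finite because identities of series are checked modulo powers of s and q.

module Kit where

 -- Finite sums and products, polynomial identities, and integral domains.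

 open import Level using (0ℓ)
 open import Algebra.Bundles using (CommutativeRing; RawRing)
 open import Data.Nat as N using (ℕ; zero; suc)
 import Data.Nat.Properties as NP
 import Algebra.Solver.Ring as RingSolver
 open import Data.Fin using (Fin; zero; suc)
 open import Data.Maybe using (Maybe; just; nothing)
 open import Data.Product as Product using (Σ; _,_; proj₁; proj₂)
 open import Data.Empty using (⊥; ⊥-elim)
 open import Function using (_∘_)
 open import Relation.Nullary using (¬_; yes; no)
 open import Relation.Binary.PropositionalEquality as E using (_≡_)
 CRing : Set₁
 CRing = CommutativeRing 0ℓ 0ℓ
 module RingKit (R : CRing) where
  open CommutativeRing R using (setoid; ring; semiring; +-monoid; +-abelianGroup; +-commutativeSemigroup)
  open CommutativeRing R public using (_≈_; _+_; _*_; -_; 0#; 1#; refl; sym; distribˡ; distribʳ; -‿inverseˡ; -‿inverseʳ)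
   renaming (*-congˡ to *ˡ; *-congʳ to *ʳ; +-congˡ to +ˡ; +-congʳ to +ʳ; *-identityˡ to il; *-identityʳ to *1; +-identityˡ to 0+; +-identityʳ to +0; reflexive to rf; Carrier to Car; trans to tr; zeroˡ to 0*; zeroʳ to *0; *-assoc to *a; *-comm to *c; +-assoc to +a; +-comm to +c; *-cong to *~; +-cong to +~; -‿cong to -~)
  open import Algebra.Properties.Ring ring public using (-‿distribˡ-*; -‿distribʳ-*; -‿involutive; -0#≈0#)
  open import Relation.Binary.Reasoning.Setoid setoid public using (begin_; _∎; step-≈-⟩; step-≈-⟨)
  opaque
   Σs : ∀ {n} -> (Fin n -> Car) -> Car
   Σs {zero} f = 0#
   Σs {suc n} f = f zero + Σs (f ∘ suc)
   Πs : ∀ {n} -> (Fin n -> Car) -> Car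
   Πs {zero} f = 1#
   Πs {suc n} f = f zero * Πs (f ∘ suc)
   Σs-cong : ∀ {n} {f g : Fin n -> Car} -> (∀ i -> f i ≈ g i) -> Σs f ≈ Σs g
   Σs-cong {zero} h = refl
   Σs-cong {suc n} h = +~ (h zero) (Σs-cong (h ∘ suc))
   Πs-cong : ∀ {n} {f g : Fin n -> Car} -> (∀ i -> f i ≈ g i) -> Πs f ≈ Πs g
   Πs-cong {zero} h = refl
   Πs-cong {suc n} h = *~ (h zero) (Πs-cong (h ∘ suc))
  open import Algebra.Properties.Monoid.Mult +-monoid using (_×_; ×-homo-+)
  open import Algebra.Properties.Semiring.Mult semiring using (×1-homo-*)
  private
   norm : ℕ Product.× ℕ -> ℕ Product.× ℕ
   norm (a , b) = (a N.∸ b , b N.∸ a)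
   norm-diff : ∀ a b -> (a N.∸ b) N.+ b ≡ a N.+ (b N.∸ a)
   norm-diff zero zero = E.refl
   norm-diff zero (suc b) = E.refl
   norm-diff (suc a) zero = E.refl
   norm-diff (suc a) (suc b) = E.trans (NP.+-suc (a N.∸ b) b) (E.cong suc (norm-diff a b))
   -- Integers as pairs (a , b) standing for a - b. Sums and products are reduced by `norm`, which
   -- makes one part 0, so the coefficients in normal forms stay small.
   Coeff : RawRing 0ℓ 0ℓ
   Coeff = record { Carrier = ℕ Product.× ℕ ; _≈_ = _≡_ ; _+_ = \ (a , b) (c , d) -> norm (a N.+ c , b N.+ d) ; _*_ = \ (a , b) (c , d) -> norm (a N.* c N.+ b N.* d , a N.* d N.+ b N.* c) ; -_ = \ (a , b) -> (b , a) ; 0# = (0 , 0) ; 1# = (1 , 0) }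
   module C = RawRing Coeff
   open import Algebra.Solver.Ring.AlmostCommutativeRing
   open import Algebra.Properties.AbelianGroup +-abelianGroup using (⁻¹-∙-comm)
   import Algebra.Properties.CommutativeSemigroup +-commutativeSemigroup as CS
   ⟦_⟧′ : C.Carrier -> Car
   ⟦ (a , b) ⟧′ = (a × 1#) + - (b × 1#)
   diff-eq : ∀ a b c d -> a N.+ d ≡ c N.+ b -> ⟦ (a , b) ⟧′ ≈ ⟦ (c , d) ⟧′
   diff-eq a b c d eq = begin A + - B ≈⟨ +0 _ ⟨ (A + - B) + 0# ≈⟨ +ˡ (-‿inverseʳ D) ⟨ (A + - B) + (D + - D) ≈⟨ CS.interchange _ _ _ _ ⟩ (A + D) + (- B + - D) ≈⟨ +~ A+D (+c _ _) ⟩ (C + B) + (- D + - B) ≈⟨ CS.interchange _ _ _ _ ⟩ (C + - D) + (B + - B) ≈⟨ +ˡ (-‿inverseʳ B) ⟩ (C + - D) + 0# ≈⟨ +0 _ ⟩ C + - D ∎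
    where
    A = a × 1# ; B = b × 1# ; C = c × 1# ; D = d × 1#
    A+D : A + D ≈ C + B
    A+D = tr (sym (×-homo-+ 1# a d)) (tr (rf (E.cong (_× 1#) eq)) (×-homo-+ 1# c b))
   norm-≈ : ∀ x -> ⟦ norm x ⟧′ ≈ ⟦ x ⟧′
   norm-≈ (a , b) = diff-eq (a N.∸ b) (b N.∸ a) a b (norm-diff a b)
   +-h : ∀ x y -> ⟦ x C.+ y ⟧′ ≈ ⟦ x ⟧′ + ⟦ y ⟧′
   +-h (a , b) (c , d) = tr (norm-≈ (a N.+ c , b N.+ d)) (begin ((a N.+ c) × 1#) + - ((b N.+ d) × 1#) ≈⟨ +~ (×-homo-+ 1# a c) (-~ (×-homo-+ 1# b d)) ⟩ ((a × 1#) + (c × 1#)) + - ((b × 1#) + (d × 1#)) ≈⟨ +ˡ (⁻¹-∙-comm _ _) ⟨ ((a × 1#) + (c × 1#)) + (- (b × 1#) + - (d × 1#)) ≈⟨ CS.interchange _ _ _ _ ⟩ ((a × 1#) + - (b × 1#)) + ((c × 1#) + - (d × 1#)) ∎)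
   mul-h : ∀ x y z w -> (x + - y) * (z + - w) ≈ (x * z + y * w) + - (x * w + y * z)
   mul-h x y z w = begin (x + - y) * (z + - w) ≈⟨ distribˡ _ _ _ ⟩ (x + - y) * z + (x + - y) * - w ≈⟨ +~ (distribʳ _ _ _) (distribʳ _ _ _) ⟩ (x * z + - y * z) + (x * - w + - y * - w) ≈⟨ +~ (+ˡ (sym (-‿distribˡ-* _ _))) (+~ (sym (-‿distribʳ-* _ _)) (tr (sym (-‿distribˡ-* _ _)) (tr (-~ (sym (-‿distribʳ-* _ _))) (-‿involutive _)))) ⟩ (x * z + - (y * z)) + (- (x * w) + y * w) ≈⟨ +ˡ (+c _ _) ⟩ (x * z + - (y * z)) + (y * w + - (x * w)) ≈⟨ CS.interchange _ _ _ _ ⟩ (x * z + y * w) + (- (y * z) + - (x * w)) ≈⟨ +ˡ (tr (+c _ _) (⁻¹-∙-comm _ _)) ⟩ (x * z + y * w) + - (x * w + y * z) ∎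
   nat-h : ∀ a b c d -> ((a N.* c N.+ b N.* d) × 1#) ≈ (a × 1#) * (c × 1#) + (b × 1#) * (d × 1#)
   nat-h a b c d = tr (×-homo-+ 1# (a N.* c) (b N.* d)) (+~ (×1-homo-* a c) (×1-homo-* b d))
   *-h : ∀ x y -> ⟦ x C.* y ⟧′ ≈ ⟦ x ⟧′ * ⟦ y ⟧′
   *-h (a , b) (c , d) = tr (norm-≈ (a N.* c N.+ b N.* d , a N.* d N.+ b N.* c)) (tr (+~ (nat-h a b c d) (-~ (nat-h a b d c))) (sym (mul-h _ _ _ _)))
   -h : ∀ x -> ⟦ C.- x ⟧′ ≈ - ⟦ x ⟧′
   -h (a , b) = begin (b × 1#) + - (a × 1#) ≈⟨ +c _ _ ⟩ - (a × 1#) + (b × 1#) ≈⟨ +ˡ (-‿involutive _) ⟨ - (a × 1#) + - (- (b × 1#)) ≈⟨ ⁻¹-∙-comm _ _ ⟩ - ((a × 1#) + - (b × 1#)) ∎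
   -- The clauses for 0 and 1 let the constants of the solver evaluate to 0# and 1# themselves
   -- rather than to differences of multiples of 1#, so that solved identities match the terms as
   -- they are written.
   ⟦_⟧c : C.Carrier -> Car
   ⟦ (0 , 0) ⟧c = 0#
   ⟦ (1 , 0) ⟧c = 1#
   ⟦ x ⟧c = ⟦ x ⟧′
   c≈′ : ∀ x -> ⟦ x ⟧c ≈ ⟦ x ⟧′
   c≈′ (0 , 0) = sym (-‿inverseʳ 0#)
   c≈′ (1 , 0) = sym (tr (+~ (+0 1#) -0#≈0#) (+0 1#))
   c≈′ (0 , suc b) = refl
   c≈′ (1 , suc b) = refl
   c≈′ (suc (suc a) , b) = refl
   morph : Coeff -Raw-AlmostCommutative⟶ fromCommutativeRing R
   morph = record { ⟦_⟧ = ⟦_⟧c ; +-homo = \ x y -> tr (c≈′ (x C.+ y)) (tr (+-h x y) (sym (+~ (c≈′ x) (c≈′ y)))) ; *-homo = \ x y -> tr (c≈′ (x C.* y)) (tr (*-h x y) (sym (*~ (c≈′ x) (c≈′ y)))) ; -‿homo = \ x -> tr (c≈′ (C.- x)) (tr (-h x) (sym (-~ (c≈′ x)))) ; 0-homo = refl ; 1-homo = refl }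
   _≟c_ : ∀ x y -> Maybe (⟦ x ⟧c ≈ ⟦ y ⟧c)
   (a , b) ≟c (c , d) with (a N.+ d) N.≟ (c N.+ b)
   ... | yes eq = just (tr (c≈′ (a , b)) (tr (diff-eq a b c d eq) (sym (c≈′ (c , d)))))
   ... | no _ = nothing
  private module RS = RingSolver Coeff (fromCommutativeRing R) morph _≟c_
  open RS public using (solve; _:+_; _:*_; :-_; _:-_; _:=_; con; Polynomial)
  :0 :1 : ∀ {n} -> Polynomial n
  :0 = con (0 , 0)
  :1 = con (1 , 0)
  opaque
   unfolding Σs Πs
   Σ-*ˡ : ∀ {n} c (f : Fin n -> Car) -> c * Σs f ≈ Σs (\ i -> c * f i)
   Σ-*ˡ {zero} c f = *0 c
   Σ-*ˡ {suc n} c f = tr (distribˡ _ _ _) (+ˡ (Σ-*ˡ c (f ∘ suc)))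
   Σ-+ : ∀ {n} (f g : Fin n -> Car) -> Σs (\ i -> f i + g i) ≈ Σs f + Σs g
   Σ-+ {zero} f g = sym (0+ _)
   Σ-+ {suc n} f g = tr (+ˡ (Σ-+ (f ∘ suc) (g ∘ suc))) (solve 4 (\ a b c d -> (a :+ b) :+ (c :+ d) := (a :+ c) :+ (b :+ d)) refl _ _ _ _)
   Π-* : ∀ {n} (f g : Fin n -> Car) -> Πs (\ i -> f i * g i) ≈ Πs f * Πs g
   Π-* {zero} f g = sym (il _)
   Π-* {suc n} f g = tr (*ˡ (Π-* (f ∘ suc) (g ∘ suc))) (solve 4 (\ a b c d -> (a :* b) :* (c :* d) := (a :* c) :* (b :* d)) refl _ _ _ _)
   Σ-neg : ∀ {n} (f : Fin n -> Car) -> Σs (\ i -> - f i) ≈ - Σs f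
   Σ-neg {zero} f = sym -0#≈0#
   Σ-neg {suc n} f = tr (+ˡ (Σ-neg (\ i -> f (suc i)))) (solve 2 (\ a b -> :- a :+ :- b := :- (a :+ b)) refl _ _)
   Σ-zero : ∀ {n} (f : Fin n -> Car) -> (∀ i -> f i ≈ 0#) -> Σs f ≈ 0#
   Σ-zero {zero} f h = refl
   Σ-zero {suc n} f h = tr (+~ (h zero) (Σ-zero (\ i -> f (suc i)) (\ i -> h (suc i)))) (0+ 0#)
   Π-one : ∀ {n} (f : Fin n -> Car) -> (∀ i -> f i ≈ 1#) -> Πs f ≈ 1#
   Π-one {zero} f h = refl
   Π-one {suc n} f h = tr (*~ (h zero) (Π-one (\ i -> f (suc i)) (\ i -> h (suc i)))) (il 1#)
  x-y≈0⇒x≈y : ∀ {x y} -> x + - y ≈ 0# -> x ≈ y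
  x-y≈0⇒x≈y {x} {y} h = begin x ≈⟨ solve 2 (\ x y -> x := (x :+ :- y) :+ y) refl x y ⟩ (x + - y) + y ≈⟨ +ʳ h ⟩ 0# + y ≈⟨ 0+ y ⟩ y ∎
  x≈y⇒x-y≈0 : ∀ {x y} -> x ≈ y -> x + - y ≈ 0#
  x≈y⇒x-y≈0 {x} {y} h = tr (+ʳ h) (-‿inverseʳ y)
  -- The summation convention of Defs: the last term is split off.
  sumR : ℕ -> (ℕ -> Car) -> Car
  sumR zero g = 0#
  sumR (suc n) g = sumR n g + g n
  sumR-cong< : ∀ n {f g : ℕ -> Car} -> (∀ i -> i N.< n -> f i ≈ g i) -> sumR n f ≈ sumR n g
  sumR-cong< zero h = refl
  sumR-cong< (suc n) h = +~ (sumR-cong< n (\ i lt -> h i (NP.m<n⇒m<1+n lt))) (h n NP.≤-refl)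
  sumR-cong : ∀ n {f g : ℕ -> Car} -> (∀ i -> f i ≈ g i) -> sumR n f ≈ sumR n g
  sumR-cong n h = sumR-cong< n (\ i _ -> h i)
  sumR-zero : ∀ n {f : ℕ -> Car} -> (∀ i -> i N.< n -> f i ≈ 0#) -> sumR n f ≈ 0#
  sumR-zero zero h = refl
  sumR-zero (suc n) h = tr (+~ (sumR-zero n (\ i lt -> h i (NP.m<n⇒m<1+n lt))) (h n NP.≤-refl)) (0+ 0#)
  sumR-+ : ∀ n f g -> sumR n (\ i -> f i + g i) ≈ sumR n f + sumR n g
  sumR-+ zero f g = sym (0+ 0#)
  sumR-+ (suc n) f g = tr (+ʳ (sumR-+ n f g)) (solve 4 (\ a b c d -> (a :+ b) :+ (c :+ d) := (a :+ c) :+ (b :+ d)) refl _ _ _ _)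
  sumR-*ˡ : ∀ n c f -> c * sumR n f ≈ sumR n (\ i -> c * f i)
  sumR-*ˡ zero c f = *0 c
  sumR-*ˡ (suc n) c f = tr (distribˡ _ _ _) (+ʳ (sumR-*ˡ n c f))
  sumR-*ʳ : ∀ n c f -> sumR n f * c ≈ sumR n (\ i -> f i * c)
  sumR-*ʳ zero c f = 0* c
  sumR-*ʳ (suc n) c f = tr (distribʳ _ _ _) (+ʳ (sumR-*ʳ n c f))
  sumR-head : ∀ n f -> sumR (suc n) f ≈ f 0 + sumR n (f ∘ suc)
  sumR-head zero f = +c _ _
  sumR-head (suc n) f = tr (+ʳ (sumR-head n f)) (+a _ _ _)
  sumR-rev : ∀ n f -> sumR (suc n) f ≈ sumR (suc n) (\ i -> f (n N.∸ i))
  sumR-rev zero f = refl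
  sumR-rev (suc n) f = begin sumR (suc n) f + f (suc n) ≈⟨ +c _ _ ⟩ f (suc n) + sumR (suc n) f ≈⟨ +ˡ (sumR-rev n f) ⟩ f (suc n) + sumR (suc n) (\ i -> f (n N.∸ i)) ≈⟨ sumR-head (suc n) (\ i -> f (suc n N.∸ i)) ⟨ sumR (suc (suc n)) (\ i -> f (suc n N.∸ i)) ∎
  -- The triangle of all (j , k) with j + k ≤ n, summed by antidiagonals and by rows. The
  -- associativity of convolution and the identification of two series variables both rest on it.
  sumR-triangle : ∀ n (g : ℕ -> ℕ -> Car) -> sumR (suc n) (\ i -> sumR (suc i) (\ j -> g j (i N.∸ j))) ≈ sumR (suc n) (\ j -> sumR (suc (n N.∸ j)) (\ k -> g j k))
  sumR-triangle zero g = refl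
  sumR-triangle (suc n) g = begin sumR (suc n) (\ i -> sumR (suc i) (\ j -> g j (i N.∸ j))) + sumR (suc (suc n)) (\ j -> g j (suc n N.∸ j)) ≈⟨ +ʳ (sumR-triangle n g) ⟩ sumR (suc n) (\ j -> sumR (suc (n N.∸ j)) (g j)) + (sumR (suc n) (\ j -> g j (suc n N.∸ j)) + g (suc n) (n N.∸ n)) ≈⟨ +a _ _ _ ⟨ (sumR (suc n) (\ j -> sumR (suc (n N.∸ j)) (g j)) + sumR (suc n) (\ j -> g j (suc n N.∸ j))) + g (suc n) (n N.∸ n) ≈⟨ +~ (sym (sumR-+ (suc n) _ _)) (tr (rf (E.cong (g (suc n)) (NP.n∸n≡0 n))) (sym (0+ _))) ⟩ sumR (suc n) (\ j -> sumR (suc (n N.∸ j)) (g j) + g j (suc n N.∸ j)) + sumR 1 (g (suc n)) ≈⟨ +~ (sumR-cong< (suc n) step) (rf (E.cong (\ k -> sumR (suc k) (g (suc n))) (E.sym (NP.n∸n≡0 n)))) ⟩ sumR (suc n) (\ j -> sumR (suc (suc n N.∸ j)) (g j)) + sumR (suc (n N.∸ n)) (g (suc n)) ∎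
   where
   step : ∀ j -> j N.< suc n -> sumR (suc (n N.∸ j)) (g j) + g j (suc n N.∸ j) ≈ sumR (suc (suc n N.∸ j)) (g j)
   step j (N.s≤s j≤n) rewrite NP.+-∸-assoc 1 j≤n = refl
  sumR-single : ∀ n i f -> i N.< n -> (∀ k -> k N.< n -> ¬ k ≡ i -> f k ≈ 0#) -> sumR n f ≈ f i
  sumR-single (suc n) i f (N.s≤s i≤n) h with i N.≟ n
  ... | yes E.refl = tr (+ʳ (sumR-zero n (\ k lt -> h k (NP.m<n⇒m<1+n lt) (\ e -> NP.<-irrefl e lt)))) (0+ _)
  ... | no i≢n = tr (+~ (sumR-single n i f (NP.≤∧≢⇒< i≤n i≢n) (\ k lt -> h k (NP.m<n⇒m<1+n lt))) (h n NP.≤-refl (\ e -> i≢n (E.sym e)))) (+0 _)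
  sumR-swap : ∀ m n (f : ℕ -> ℕ -> Car) -> sumR m (\ i -> sumR n (f i)) ≈ sumR n (\ j -> sumR m (\ i -> f i j))
  sumR-swap zero n f = sym (sumR-zero n (\ _ _ -> refl))
  sumR-swap (suc m) n f = tr (+ʳ (sumR-swap m n f)) (sym (sumR-+ n _ _))
 -- Equality of power series is undecidable. Hence the absence of zero divisors is stated as a
 -- contradiction between negations, and equality is only asked to be stable under double negation;
 -- the two together give cancellation.
 record Domain (R : CRing) : Set where
  open CommutativeRing R
  field
   stable : ∀ x y -> ¬ ¬ (x ≈ y) -> x ≈ y
   1~0 : ¬ (1# ≈ 0#)
   nzd : ∀ x y -> x * y ≈ 0# -> ¬ (x ≈ 0#) -> ¬ (y ≈ 0#) -> ⊥
 module DomainKit (R : CRing) (D : Domain R) where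
  open RingKit R
  open Domain D public
  zero-product : ∀ x y -> x * y ≈ 0# -> ¬ (x ≈ 0#) -> y ≈ 0#
  zero-product x y h nx = stable y 0# (nzd x y h nx)
  *-~0 : ∀ {x y} -> ¬ (x ≈ 0#) -> ¬ (y ≈ 0#) -> ¬ (x * y ≈ 0#)
  *-~0 nx ny h = nzd _ _ h nx ny
  cancelˡ : ∀ c {x y} -> ¬ (c ≈ 0#) -> c * x ≈ c * y -> x ≈ y
  cancelˡ c {x} {y} nc h = x-y≈0⇒x≈y (zero-product c (x + - y) (tr (solve 3 (\ c x y -> c :* (x :+ :- y) := c :* x :+ :- (c :* y)) refl c x y) (x≈y⇒x-y≈0 h)) nc)
  opaque
   unfolding Πs
   Π-~0 : ∀ {n} (f : Fin n -> Car) -> (∀ i -> ¬ (f i ≈ 0#)) -> ¬ (Πs f ≈ 0#)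
   Π-~0 {zero} f h = 1~0
   Π-~0 {suc n} f h = *-~0 (h zero) (Π-~0 (f ∘ suc) (h ∘ suc))
 module PickKit (R : CRing) where
  open RingKit R
  opaque
   unfolding Πs
   Π-pick : ∀ {n} (i : Fin n) (f g : Fin n -> Car) x -> f i ≈ x * g i -> (∀ j -> ¬ j ≡ i -> f j ≈ g j) -> Πs f ≈ x * Πs g
   Π-pick zero f g x hi ho = tr (*~ hi (Πs-cong (\ j -> ho (suc j) (\ ())))) (*a _ _ _)
   Π-pick (suc i) f g x hi ho = begin f zero * Πs (f ∘ suc) ≈⟨ *~ (ho zero (\ ())) (Π-pick i (f ∘ suc) (g ∘ suc) x hi (\ j ne -> ho (suc j) (\ { E.refl -> ne E.refl }))) ⟩ g zero * (x * Πs (g ∘ suc)) ≈⟨ solve 3 (\ a x b -> a :* (x :* b) := x :* (a :* b)) refl _ _ _ ⟩ x * (g zero * Πs (g ∘ suc)) ∎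
  opaque
   unfolding Σs
   Σ-single : ∀ {m} (i : Fin m) (g : Fin m -> Car) -> (∀ j -> ¬ j ≡ i -> g j ≈ 0#) -> Σs g ≈ g i
   Σ-single zero g h = tr (+ˡ (Σ-zero (g ∘ suc) (\ j -> h (suc j) (\ ())))) (+0 _)
   Σ-single (suc i) g h = tr (+~ (h zero (\ ())) (Σ-single i (g ∘ suc) (\ j ne -> h (suc j) (\ { E.refl -> ne E.refl })))) (0+ _)
  opaque
   unfolding Πs
   Π-zero : ∀ {k} (i : Fin k) (g : Fin k -> Car) -> g i ≈ 0# -> Πs g ≈ 0#
   Π-zero zero g z = tr (*ʳ z) (0* _)
   Π-zero (suc i) g z = tr (*ˡ (Π-zero i (g ∘ suc) z)) (*0 _)
  Π-single : ∀ {n} (i : Fin n) (f : Fin n -> Car) -> (∀ j -> ¬ j ≡ i -> f j ≈ 1#) -> Πs f ≈ f i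
  Π-single {n} i f h = tr (Π-pick i f (\ _ -> 1#) (f i) (sym (*1 _)) h) (tr (*ˡ (Π-one {n} (\ _ -> 1#) (\ _ -> refl))) (*1 _))
  pow : Car -> ℕ -> Car
  pow x zero = 1#
  pow x (suc n) = x * pow x n
  cat : ∀ {a} {A : Set a} {m n} -> (Fin m -> A) -> (Fin n -> A) -> Fin (m N.+ n) -> A
  cat {m = zero} f g = g
  cat {m = suc m} f g zero = f zero
  cat {m = suc m} f g (suc x) = cat (f ∘ suc) g x
  open import Data.Fin using (_↑ˡ_; _↑ʳ_)
  cat-l : ∀ {a} {A : Set a} {m n} (f : Fin m -> A) (g : Fin n -> A) i -> cat f g (i ↑ˡ n) ≡ f i
  cat-l {m = suc m} f g zero = E.refl
  cat-l {m = suc m} f g (suc i) = cat-l (f ∘ suc) g i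
  cat-r : ∀ {a} {A : Set a} {m n} (f : Fin m -> A) (g : Fin n -> A) j -> cat f g (m ↑ʳ j) ≡ g j
  cat-r {m = zero} f g j = E.refl
  cat-r {m = suc m} f g j = cat-r (f ∘ suc) g j
  data View {m n} : Fin (m N.+ n) -> Set where
   left : ∀ i -> View (i ↑ˡ n)
   right : ∀ j -> View (m ↑ʳ j)
  view : ∀ m {n} (x : Fin (m N.+ n)) -> View {m} {n} x
  view zero x = right x
  view (suc m) zero = left zero
  view (suc m) (suc x) with view m x
  ... | left i = left (suc i)
  ... | right j = right j
  opaque
   unfolding Σs Πs
   Σ-split : ∀ m {n} (h : Fin (m N.+ n) -> Car) -> Σs h ≈ Σs (\ i -> h (i ↑ˡ n)) + Σs (\ j -> h (m ↑ʳ j))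
   Σ-split zero h = sym (0+ _)
   Σ-split (suc m) h = tr (+ˡ (Σ-split m (h ∘ suc))) (sym (+a _ _ _))
   Π-split : ∀ m {n} (h : Fin (m N.+ n) -> Car) -> Πs h ≈ Πs (\ i -> h (i ↑ˡ n)) * Πs (\ j -> h (m ↑ʳ j))
   Π-split zero h = sym (il _)
   Π-split (suc m) h = tr (*ˡ (Π-split m (h ∘ suc))) (sym (*a _ _ _))

open import Data.Nat as N using (ℕ; zero; suc)
import Data.Nat.Properties as NP
open NP using (≤-trans; ≤-reflexive; ≤-refl)
open import Data.Integer as Z using (ℤ; +_; -[1+_]; ∣_∣)
import Data.Integer.Properties as ZP
open import Data.Fin using (Fin; zero; suc; toℕ)
import Data.Fin.Properties as FinP
open import Data.Vec using (Vec; []; _∷_) renaming (lookup to get)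
import Data.Vec.Properties as VecP
open import Data.Product using (Σ; _×_; _,_; proj₁; proj₂)
open import Data.Sum using (_⊎_; inj₁; inj₂)
open import Function using (_∘_)
open import Relation.Nullary using (¬_; yes; no; Dec)
open import Data.Empty using (⊥) renaming (⊥-elim to absurd)
open import Relation.Binary.PropositionalEquality as E using (_≡_; cong; cong₂; subst; subst₂)

infixr 5 _>>_
_>>_ : ∀ {A : Set} {x y z : A} -> x ≡ y -> y ≡ z -> x ≡ z
_>>_ = E.trans

-- Formal power series over a ring and over a domain.

module Ser where
 open Kit
 open import Algebra.Bundles using (CommutativeRing)
 module SerDef (R : CRing) where
  open RingKit R
  infixl 7 _⋆_
  _⋆_ : (ℕ -> Car) -> (ℕ -> Car) -> ℕ -> Car
  (A ⋆ B) n = sumR (suc n) \ i -> A i * B (n N.∸ i)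
  const : Car -> ℕ -> Car
  const c zero = c
  const c (suc n) = 0#
  ⋆-cong : ∀ {A A' B B'} -> (∀ n -> A n ≈ A' n) -> (∀ n -> B n ≈ B' n) -> ∀ n -> (A ⋆ B) n ≈ (A' ⋆ B') n
  ⋆-cong p q n = sumR-cong (suc n) (\ i -> *~ (p i) (q (n N.∸ i)))
  ⋆-comm : ∀ A B n -> (A ⋆ B) n ≈ (B ⋆ A) n
  ⋆-comm A B n = begin sumR (suc n) (\ i -> A i * B (n N.∸ i)) ≈⟨ sumR-rev n _ ⟩ sumR (suc n) (\ i -> A (n N.∸ i) * B (n N.∸ (n N.∸ i))) ≈⟨ sumR-cong< (suc n) (\ { i (N.s≤s i≤n) -> tr (*ˡ (rf (cong B (NP.m∸[m∸n]≡n i≤n)))) (*c _ _) }) ⟩ sumR (suc n) (\ i -> B i * A (n N.∸ i)) ∎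
  ⋆-assoc : ∀ A B C n -> ((A ⋆ B) ⋆ C) n ≈ (A ⋆ (B ⋆ C)) n
  ⋆-assoc A B C n = begin sumR (suc n) (\ i -> sumR (suc i) (\ j -> A j * B (i N.∸ j)) * C (n N.∸ i)) ≈⟨ sumR-cong (suc n) (\ i -> sumR-*ʳ (suc i) _ _) ⟩ sumR (suc n) (\ i -> sumR (suc i) (\ j -> A j * B (i N.∸ j) * C (n N.∸ i))) ≈⟨ sumR-cong (suc n) (\ i -> sumR-cong< (suc i) (\ { j (N.s≤s j≤i) -> *ˡ (rf (cong (\ k -> C (n N.∸ k)) (E.sym (NP.m+[n∸m]≡n j≤i)))) })) ⟩ sumR (suc n) (\ i -> sumR (suc i) (\ j -> A j * B (i N.∸ j) * C (n N.∸ (j N.+ (i N.∸ j))))) ≈⟨ sumR-triangle n (\ j k -> A j * B k * C (n N.∸ (j N.+ k))) ⟩ sumR (suc n) (\ j -> sumR (suc (n N.∸ j)) (\ k -> A j * B k * C (n N.∸ (j N.+ k)))) ≈⟨ sumR-cong (suc n) (\ j -> tr (sumR-cong (suc (n N.∸ j)) (\ k -> tr (*a _ _ _) (*ˡ (*ˡ (rf (cong C (E.sym (NP.∸-+-assoc n j k)))))))) (sym (sumR-*ˡ (suc (n N.∸ j)) _ _))) ⟩ sumR (suc n) (\ j -> A j * (B ⋆ C) (n N.∸ j)) ∎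
  const-⋆ : ∀ c B n -> (const c ⋆ B) n ≈ c * B n
  const-⋆ c B n = tr (sumR-head n _) (tr (+ˡ (sumR-zero n (\ i _ -> 0* _))) (+0 _))
  ⋆-identityˡ : ∀ B n -> (const 1# ⋆ B) n ≈ B n
  ⋆-identityˡ B n = tr (const-⋆ 1# B n) (il _)
  ⋆-distribˡ : ∀ A B C n -> (A ⋆ (\ k -> B k + C k)) n ≈ (A ⋆ B) n + (A ⋆ C) n
  ⋆-distribˡ A B C n = tr (sumR-cong (suc n) (\ i -> distribˡ _ _ _)) (sumR-+ (suc n) _ _)
  ⋆-distribʳ : ∀ A B C n -> ((\ k -> B k + C k) ⋆ A) n ≈ (B ⋆ A) n + (C ⋆ A) n
  ⋆-distribʳ A B C n = tr (sumR-cong (suc n) (\ i -> distribʳ _ _ _)) (sumR-+ (suc n) _ _)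
  Ser : CRing
  Ser = record { Carrier = ℕ -> Car ; _≈_ = \ A B -> ∀ n -> A n ≈ B n ; _+_ = \ A B n -> A n + B n ; _*_ = _⋆_ ; -_ = \ A n -> - A n ; 0# = \ _ -> 0# ; 1# = const 1# ; isCommutativeRing = record { isRing = record { +-isAbelianGroup = record { isGroup = record { isMonoid = record { isSemigroup = record { isMagma = record { isEquivalence = record { refl = \ n -> refl ; sym = \ p n -> sym (p n) ; trans = \ p q n -> tr (p n) (q n) } ; ∙-cong = \ p q n -> +~ (p n) (q n) } ; assoc = \ A B C n -> +a _ _ _ } ; identity = (\ A n -> 0+ _) , (\ A n -> +0 _) } ; inverse = (\ A n -> -‿inverseˡ _) , (\ A n -> -‿inverseʳ _) ; ⁻¹-cong = \ p n -> -~ (p n) } ; comm = \ A B n -> +c _ _ } ; *-cong = ⋆-cong ; *-assoc = ⋆-assoc ; *-identity = ⋆-identityˡ , (\ B n -> tr (⋆-comm B (const 1#) n) (⋆-identityˡ B n)) ; distrib = ⋆-distribˡ , ⋆-distribʳ } ; *-comm = ⋆-comm } }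
  shift : ℕ -> (ℕ -> Car) -> ℕ -> Car
  shift zero A n = A n
  shift (suc k) A zero = 0#
  shift (suc k) A (suc n) = shift k A n
  module SerDomain (D : Domain R) where
   open DomainKit R D
   -- A nonzero coefficient of least index can be found only up to double negation. This suffices
   -- wherever a contradiction is the goal.
   leading : (A : ℕ -> Car) -> ¬ (∀ n -> A n ≈ 0#) -> ¬ ¬ (Σ ℕ \ i -> (∀ k -> k N.< i -> A k ≈ 0#) × ¬ (A i ≈ 0#))
   leading A nA no-lead = nA (\ n -> below (suc n) n ≤-refl)
    where
    below : ∀ n k -> k N.< n -> A k ≈ 0#
    below (suc n) k (N.s≤s k≤n) with k N.≟ n
    ... | yes E.refl = stable _ _ (\ nz -> no-lead (n , below n , nz))
    ... | no k≢n = below n k (NP.≤∧≢⇒< k≤n k≢n)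
   serNzd : (A B : ℕ -> Car) -> (∀ n -> (A ⋆ B) n ≈ 0#) -> ¬ (∀ n -> A n ≈ 0#) -> ¬ (∀ n -> B n ≈ 0#) -> ⊥
   serNzd A B h nA nB = leading A nA \ { (i , bi , ni) -> leading B nB \ { (j , bj , nj) -> nzd _ _ (tr (sym (coeff i j bi bj)) (h (i N.+ j))) ni nj }}
    where
    -- The product of the leading coefficients is the coefficient of index i + j: the summands with
    -- k < i vanish because of A, those with k > i because of B.
    coeff : ∀ i j -> (∀ k -> k N.< i -> A k ≈ 0#) -> (∀ k -> k N.< j -> B k ≈ 0#) -> (A ⋆ B) (i N.+ j) ≈ A i * B j
    coeff i j bi bj = tr (sumR-single (suc (i N.+ j)) i _ (N.s≤s (NP.m≤m+n i j)) others) (*ˡ (rf (cong B (NP.m+n∸m≡n i j))))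
     where
     others : ∀ k -> k N.< suc (i N.+ j) -> ¬ k ≡ i -> A k * B (i N.+ j N.∸ k) ≈ 0#
     others k (N.s≤s k≤) k≢i with k N.<? i
     ... | yes k<i = tr (*ʳ (bi k k<i)) (0* _)
     ... | no k≮i = tr (*ˡ (bj _ lt)) (*0 _)
      where
      i<k : i N.< k
      i<k = NP.≤∧≢⇒< (NP.≮⇒≥ k≮i) (\ e -> k≢i (E.sym e))
      lt : i N.+ j N.∸ k N.< j
      lt = subst (i N.+ j N.∸ k N.<_) (NP.m+n∸m≡n i j) (NP.∸-monoʳ-< i<k k≤)
   SerDom : Domain Ser
   SerDom = record { stable = \ A B nn n -> stable _ _ (\ ne -> nn (\ e -> ne (e n))) ; 1~0 = \ e -> 1~0 (e 0) ; nzd = serNzd }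

-- The field of fractions of a domain.

module Frac where
 open Kit
 open import Level using (0ℓ)
 open import Algebra.Bundles using (CommutativeRing)
 record Field (R : CRing) : Set where
  open RingKit R
  field
   domain : Domain R
   inv : ∀ x -> ¬ (x ≈ 0#) -> Car
   inv-r : ∀ x h -> x * inv x h ≈ 1#
 module FracRaw (R : CRing) (D : Domain R) where
  open RingKit R
  open DomainKit R D
  record Fr : Set where
   constructor frac
   field
    num den : Car
    den~0 : ¬ (den ≈ 0#)
  open Fr public
  record _≃_ (x y : Fr) : Set where
   constructor mk≃
   field un≃ : num x * den y ≈ num y * den x
  open _≃_ public
  _⊞_ _⊠_ : Fr -> Fr -> Fr
  x ⊞ y = frac (num x * den y + num y * den x) (den x * den y) (*-~0 (den~0 x) (den~0 y))
  x ⊠ y = frac (num x * num y) (den x * den y) (*-~0 (den~0 x) (den~0 y))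
  ⊟_ : Fr -> Fr
  ⊟ x = frac (- num x) (den x) (den~0 x)
  ι : Car -> Fr
  ι c = frac c 1# 1~0
  -- The middle denominator d has to be cancelled, which the domain allows.
  ≃-trans : ∀ {x y z} -> x ≃ y -> y ≃ z -> x ≃ z
  ≃-trans {frac a b nb} {frac c d nd} {frac e f nf} (mk≃ p) (mk≃ q) = mk≃ (cancelˡ d nd (begin d * (a * f) ≈⟨ solve 3 (\ d a f -> d :* (a :* f) := (a :* d) :* f) refl d a f ⟩ (a * d) * f ≈⟨ *ʳ p ⟩ (c * b) * f ≈⟨ solve 3 (\ c b f -> (c :* b) :* f := (c :* f) :* b) refl c b f ⟩ (c * f) * b ≈⟨ *ʳ q ⟩ (e * d) * b ≈⟨ solve 3 (\ d e b -> (e :* d) :* b := d :* (e :* b)) refl d e b ⟩ d * (e * b) ∎))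
  ⊞-cong : ∀ {x x' y y'} -> x ≃ x' -> y ≃ y' -> (x ⊞ y) ≃ (x' ⊞ y')
  ⊞-cong {frac a b _} {frac a' b' _} {frac c d _} {frac c' d' _} (mk≃ p) (mk≃ q) = mk≃ (begin (a * d + c * b) * (b' * d') ≈⟨ solve 6 (\ a d c b b' d' -> (a :* d :+ c :* b) :* (b' :* d') := (a :* b') :* (d :* d') :+ (c :* d') :* (b :* b')) refl a d c b b' d' ⟩ (a * b') * (d * d') + (c * d') * (b * b') ≈⟨ +~ (*ʳ p) (*ʳ q) ⟩ (a' * b) * (d * d') + (c' * d) * (b * b') ≈⟨ solve 6 (\ a' d c' b b' d' -> (a' :* b) :* (d :* d') :+ (c' :* d) :* (b :* b') := (a' :* d' :+ c' :* b') :* (b :* d)) refl a' d c' b b' d' ⟩ (a' * d' + c' * b') * (b * d) ∎)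
  ⊠-cong : ∀ {x x' y y'} -> x ≃ x' -> y ≃ y' -> (x ⊠ y) ≃ (x' ⊠ y')
  ⊠-cong {frac a b _} {frac a' b' _} {frac c d _} {frac c' d' _} (mk≃ p) (mk≃ q) = mk≃ (begin (a * c) * (b' * d') ≈⟨ solve 4 (\ a c b d -> (a :* c) :* (b :* d) := (a :* b) :* (c :* d)) refl a c b' d' ⟩ (a * b') * (c * d') ≈⟨ *~ p q ⟩ (a' * b) * (c' * d) ≈⟨ solve 4 (\ a c b d -> (a :* b) :* (c :* d) := (a :* c) :* (b :* d)) refl a' c' b d ⟩ (a' * c') * (b * d) ∎)
  Frac : CRing
  Frac = record { Carrier = Fr ; _≈_ = _≃_ ; _+_ = _⊞_ ; _*_ = _⊠_ ; -_ = ⊟_ ; 0# = ι 0# ; 1# = ι 1# ; isCommutativeRing = record { isRing = record { +-isAbelianGroup = record { isGroup = record { isMonoid = record { isSemigroup = record { isMagma = record { isEquivalence = record { refl = mk≃ refl ; sym = \ p -> mk≃ (sym (un≃ p)) ; trans = ≃-trans } ; ∙-cong = ⊞-cong } ; assoc = \ x y z -> mk≃ (solve 6 (\ a b c d e f -> ((a :* d :+ c :* b) :* f :+ e :* (b :* d)) :* (b :* (d :* f)) := (a :* (d :* f) :+ (c :* f :+ e :* d) :* b) :* ((b :* d) :* f)) refl (num x) (den x) (num y) (den y) (num z) (den z)) } ; identity = (\ x -> mk≃ (solve 2 (\ a b -> (:0 :* b :+ a :* :1) :* b := a :* (:1 :* b)) refl (num x) (den x))) , (\ x -> mk≃ (solve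 2 (\ a b -> (a :* :1 :+ :0 :* b) :* b := a :* (b :* :1)) refl (num x) (den x))) } ; inverse = (\ x -> mk≃ (solve 2 (\ a b -> (:- a :* b :+ a :* b) :* :1 := :0 :* (b :* b)) refl (num x) (den x))) , (\ x -> mk≃ (solve 2 (\ a b -> (a :* b :+ :- a :* b) :* :1 := :0 :* (b :* b)) refl (num x) (den x))) ; ⁻¹-cong = \ {x} {y} p -> mk≃ (tr (sym (-‿distribˡ-* _ _)) (tr (-~ (un≃ p)) (-‿distribˡ-* _ _))) } ; comm = \ x y -> mk≃ (solve 4 (\ a b c d -> (a :* d :+ c :* b) :* (d :* b) := (c :* b :+ a :* d) :* (b :* d)) refl (num x) (den x) (num y) (den y)) } ; *-cong = ⊠-cong ; *-assoc = \ x y z -> mk≃ (solve 6 (\ a b c d e f -> ((a :* c) :* e) :* (b :* (d :* f)) := (a :* (c :* e)) :* ((b :* d) :* f)) refl (num x) (den x) (num y) (den y) (num z) (den z)) ; *-identity = (\ x -> mk≃ (solve 2 (\ a b -> (:1 :* a) :* b := a :* (:1 :* b)) refl (num x) (den x))) , (\ x -> mk≃ (solve 2 (\ a b -> (a :* :1) :* b := a :* (b :* :1)) refl (num x) (den x))) ; distrib = (\ x y z -> mk≃ (solve 6 (\ a b c d e f -> (a :* (c :* f :+ e :* d)) :* ((b :* d) :* (b :* f)) := ((a :* c) :* (b :* f) :+ (a :* e) :* (b :* d)) :* (b :* (d :* f))) refl (num x) (den x) (num y) (den y) (num z) (den z))) , (\ x y z -> mk≃ (solve 6 (\ a b c d e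 f -> ((c :* f :+ e :* d) :* a) :* ((d :* b) :* (f :* b)) := ((c :* a) :* (f :* b) :+ (e :* a) :* (d :* b)) :* ((d :* f) :* b)) refl (num x) (den x) (num y) (den y) (num z) (den z))) } ; *-comm = \ x y -> mk≃ (solve 4 (\ a b c d -> (a :* c) :* (d :* b) := (c :* a) :* (b :* d)) refl (num x) (den x) (num y) (den y)) } }
  ≃0⇒num≈0 : ∀ {x} -> x ≃ ι 0# -> num x ≈ 0#
  ≃0⇒num≈0 {frac a b _} (mk≃ h) = tr (sym (*1 a)) (tr h (0* b))
  num≈0⇒≃0 : ∀ {x} -> num x ≈ 0# -> x ≃ ι 0#
  num≈0⇒≃0 {frac a b _} h = mk≃ (tr (*1 a) (tr h (sym (0* b))))
  FracDom : Domain Frac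
  FracDom = record { stable = \ x y nn -> mk≃ (stable _ _ (\ ne -> nn (\ e -> ne (un≃ e)))) ; 1~0 = \ e -> 1~0 (≃0⇒num≈0 e) ; nzd = \ x y h nx ny -> nzd _ _ (≃0⇒num≈0 h) (\ e -> nx (num≈0⇒≃0 e)) (\ e -> ny (num≈0⇒≃0 e)) }
  FracField : Field Frac
  FracField = record { domain = FracDom ; inv = \ x h -> frac (den x) (num x) (\ e -> h (num≈0⇒≃0 e)) ; inv-r = \ x h -> mk≃ (solve 2 (\ a b -> (a :* b) :* :1 := :1 :* (b :* a)) refl (num x) (den x)) }
  ι-cong : ∀ {x y} -> x ≈ y -> ι x ≃ ι y
  ι-cong h = mk≃ (*ʳ h)
  ι-injective : ∀ {x y} -> ι x ≃ ι y -> x ≈ y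
  ι-injective (mk≃ h) = tr (sym (*1 _)) (tr h (*1 _))
  ι-+ : ∀ x y -> ι (x + y) ≃ (ι x ⊞ ι y)
  ι-+ x y = mk≃ (solve 2 (\ x y -> (x :+ y) :* (:1 :* :1) := (x :* :1 :+ y :* :1) :* :1) refl x y)
  ι-* : ∀ x y -> ι (x * y) ≃ (ι x ⊠ ι y)
  ι-* x y = mk≃ (solve 2 (\ x y -> (x :* y) :* (:1 :* :1) := (x :* y) :* :1) refl x y)
  ι-neg : ∀ x -> ι (- x) ≃ (⊟ ι x)
  ι-neg x = mk≃ refl
 module FracDef (R : CRing) (D : Domain R) where
  private
   module R = RingKit R
   module DK = DomainKit R D
   module Raw = FracRaw R D
  opaque
   Frac : CRing
   Frac = Raw.Frac
  private module K = RingKit Frac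
  Fr : Set
  Fr = K.Car
  opaque
   unfolding Frac
   FracField : Field Frac
   FracField = Raw.FracField
   ι : R.Car -> Fr
   ι = Raw.ι
   ι-cong : ∀ {x y} -> x R.≈ y -> ι x K.≈ ι y
   ι-cong = Raw.ι-cong
   ι-injective : ∀ {x y} -> ι x K.≈ ι y -> x R.≈ y
   ι-injective = Raw.ι-injective
   ι-+ : ∀ x y -> ι (x R.+ y) K.≈ ι x K.+ ι y
   ι-+ = Raw.ι-+
   ι-* : ∀ x y -> ι (x R.* y) K.≈ ι x K.* ι y
   ι-* = Raw.ι-*
   ι-neg : ∀ x -> ι (R.- x) K.≈ K.- ι x
   ι-neg = Raw.ι-neg
   ι-0 : ι R.0# K.≈ K.0#
   ι-0 = K.refl
   ι-1 : ι R.1# K.≈ K.1#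
   ι-1 = K.refl
   num den : Fr -> R.Car
   num = Raw.num
   den = Raw.den
   den~0 : ∀ x -> ¬ (den x R.≈ R.0#)
   den~0 = Raw.den~0
   num-den : ∀ x -> x K.* ι (den x) K.≈ ι (num x)
   num-den x = Raw.mk≃ (R.solve 2 (\ a b -> (a R.:* b) R.:* R.:1 R.:= a R.:* (b R.:* R.:1)) R.refl _ _)
  FracDom : Domain Frac
  FracDom = Field.domain FracField
  ι~0 : ∀ {b} -> ¬ (b R.≈ R.0#) -> ¬ (ι b K.≈ K.0#)
  ι~0 nb e = nb (ι-injective (K.tr e (K.sym ι-0)))

-- Divided differences and the residue identities derived from them.

module Lagrange where
 open Kit
 open Frac using (Field)
 open import Data.Nat using (s≤s; z≤n)
 open import Data.Fin using (_↑ˡ_; _↑ʳ_)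
 module LagrangeDef (R : CRing) where
  open RingKit R
  open PickKit R
  -- Off the diagonal δ i j is 1 / (c i - c j), so that the product of row i of δ is the Lagrange
  -- weight of the node c i. The inverses are carried as data because the ring has no division.
  record Points (N : ℕ) : Set where
   field
    c : Fin N -> Car
    δ : Fin N -> Fin N -> Car
    δ-diag : ∀ i -> δ i i ≈ 1#
    δ-off : ∀ i j -> ¬ i ≡ j -> δ i j * (c i + - c j) ≈ 1#
  open Points
  drop0 : ∀ {N} -> Points (suc N) -> Points N
  drop0 P = record { c = c P ∘ suc ; δ = \ i j -> δ P (suc i) (suc j) ; δ-diag = \ i -> δ-diag P (suc i) ; δ-off = \ i j ne -> δ-off P (suc i) (suc j) (\ e -> ne (FinP.suc-injective e)) }
  skip1 : ∀ {N} -> Fin (suc N) -> Fin (suc (suc N))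
  skip1 zero = zero
  skip1 (suc i) = suc (suc i)
  skip1-inj : ∀ {N} {i j : Fin (suc N)} -> skip1 i ≡ skip1 j -> i ≡ j
  skip1-inj {i = zero} {zero} _ = E.refl
  skip1-inj {i = suc i} {suc j} e = FinP.suc-injective e
  drop1 : ∀ {N} -> Points (suc (suc N)) -> Points (suc N)
  drop1 P = record { c = c P ∘ skip1 ; δ = \ i j -> δ P (skip1 i) (skip1 j) ; δ-diag = \ i -> δ-diag P (skip1 i) ; δ-off = \ i j ne -> δ-off P (skip1 i) (skip1 j) (\ e -> ne (skip1-inj e)) }
  -- The divided difference over all nodes in Lagrange's form, equivalently the sum of the residues
  -- of φ(x) / Π (x - c i) at the nodes.
  dd : ∀ {N} -> Points N -> (Fin N -> Car) -> Car
  dd P φ = Σs (\ i -> φ i * Πs (δ P i))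
  opaque
   unfolding Σs Πs
   dd-one-single : (P : Points 1) -> dd P (\ _ -> 1#) ≈ 1#
   dd-one-single P = tr (+0 _) (tr (il _) (tr (*1 _) (δ-diag P zero)))
   -- The usual recursion of divided differences. At a further node x the factor c 0 - c 1 is
   -- written as (x - c 1) - (x - c 0), and each difference cancels one factor of the Lagrange
   -- weight.
   dd-drops : ∀ {N} (P : Points (suc (suc N))) -> (c P zero + - c P (suc zero)) * dd P (\ _ -> 1#) ≈ dd (drop1 P) (\ _ -> 1#) + - dd (drop0 P) (\ _ -> 1#)
   dd-drops {N} P = begin (c0 + - c1) * (1# * (δ P zero zero * (δ01 * A)) + (1# * (δ10 * (δ P (suc zero) (suc zero) * B)) + Σs rest)) ≈⟨ *ˡ (+~ (*ˡ (*ʳ (δ-diag P zero))) (+ʳ (*ˡ (*ˡ (*ʳ (δ-diag P (suc zero))))))) ⟩ (c0 + - c1) * (1# * (1# * (δ01 * A)) + (1# * (δ10 * (1# * B)) + Σs rest)) ≈⟨ solve 7 (\ c0 c1 d e A B S -> (c0 :+ :- c1) :* (:1 :* (:1 :* (d :* A)) :+ (:1 :* (e :* (:1 :* B)) :+ S)) := (d :* (c0 :+ :- c1)) :* A :+ (:- ((e :* (c1 :+ :- c0)) :* B) :+ (c0 :+ :- c1) :* S)) refl c0 c1 δ01 δ10 A B (Σs rest) ⟩ (δ01 * (c0 + - c1)) * A + (- ((δ10 * (c1 + - c0)) * B) + (c0 + - c1) * Σs rest) ≈⟨ +~ (*ʳ (δ-off P zero (suc zero) (\ ()))) (+~ (-~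 (*ʳ (δ-off P (suc zero) zero (\ ())))) (tr (Σ-*ˡ _ rest) (tr (Σs-cong each) (tr (Σ-+ f1 (\ i -> - f0 i)) (+ˡ (Σ-neg f0)))))) ⟩ 1# * A + (- (1# * B) + (Σs f1 + - Σs f0)) ≈⟨ solve 4 (\ A B S T -> :1 :* A :+ (:- (:1 :* B) :+ (S :+ :- T)) := (:1 :* (:1 :* A) :+ S) :+ :- (:1 :* (:1 :* B) :+ T)) refl A B (Σs f1) (Σs f0) ⟩ (1# * (1# * A) + Σs f1) + - (1# * (1# * B) + Σs f0) ≈⟨ +~ (+ʳ (*ˡ (*ʳ (sym (δ-diag P zero))))) (-~ (+ʳ (*ˡ (*ʳ (sym (δ-diag P (suc zero))))))) ⟩ dd (drop1 P) (\ _ -> 1#) + - dd (drop0 P) (\ _ -> 1#) ∎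
    where
    c0 c1 δ01 δ10 A B : Car
    c0 = c P zero
    c1 = c P (suc zero)
    δ01 = δ P zero (suc zero)
    δ10 = δ P (suc zero) zero
    ss : Fin N -> Fin (suc (suc N))
    ss i = suc (suc i)
    A = Πs (\ j -> δ P zero (ss j))
    B = Πs (\ j -> δ P (suc zero) (ss j))
    C : Fin N -> Car
    C i = Πs (\ j -> δ P (ss i) (ss j))
    rest f0 f1 : Fin N -> Car
    rest i = 1# * (δ P (ss i) zero * (δ P (ss i) (suc zero) * C i))
    f1 i = 1# * (δ P (ss i) zero * C i)
    f0 i = 1# * (δ P (ss i) (suc zero) * C i)
    each : ∀ i -> (c0 + - c1) * rest i ≈ f1 i + - f0 i
    each i = begin (c0 + - c1) * rest i ≈⟨ solve 6 (\ c0 c1 x d e C -> (c0 :+ :- c1) :* (:1 :* (d :* (e :* C))) := (e :* (x :+ :- c1)) :* (d :* C) :+ :- ((d :* (x :+ :- c0)) :* (e :* C))) refl c0 c1 (c P (ss i)) (δ P (ss i) zero) (δ P (ss i) (suc zero)) (C i) ⟩ _ ≈⟨ +~ (*ʳ (δ-off P (ss i) (suc zero) (\ ()))) (-~ (*ʳ (δ-off P (ss i) zero (\ ())))) ⟩ f1 i + - f0 i ∎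
  -- By `dd-drops` it is enough that the two shorter divided differences agree: both are 1 over a
  -- single node, and both are 0 by induction over more nodes.
  dd-one : ∀ {N} (P : Points (suc (suc N))) -> dd P (\ _ -> 1#) ≈ 0#
  dd-one {N} P = begin dd P (\ _ -> 1#) ≈⟨ il _ ⟨ 1# * dd P (\ _ -> 1#) ≈⟨ *ʳ (δ-off P zero (suc zero) (\ ())) ⟨ (δ P zero (suc zero) * (c P zero + - c P (suc zero))) * dd P (\ _ -> 1#) ≈⟨ *a _ _ _ ⟩ δ P zero (suc zero) * ((c P zero + - c P (suc zero)) * dd P (\ _ -> 1#)) ≈⟨ *ˡ (dd-drops P) ⟩ δ P zero (suc zero) * (dd (drop1 P) (\ _ -> 1#) + - dd (drop0 P) (\ _ -> 1#)) ≈⟨ *ˡ (diff N P) ⟩ δ P zero (suc zero) * 0# ≈⟨ *0 _ ⟩ 0# ∎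
   where
   diff : ∀ N (P : Points (suc (suc N))) -> dd (drop1 P) (\ _ -> 1#) + - dd (drop0 P) (\ _ -> 1#) ≈ 0#
   diff zero P = x≈y⇒x-y≈0 (tr (dd-one-single (drop1 P)) (sym (dd-one-single (drop0 P))))
   diff (suc N) P = tr (+~ (dd-one (drop1 P)) (-~ (dd-one (drop0 P)))) (-‿inverseʳ 0#)
  -- The values at the nodes of the monic polynomial with roots d.
  num : ∀ {N e} -> Points N -> (Fin e -> Car) -> Fin N -> Car
  num P d i = Πs (\ k -> c P i + - d k)
  opaque
   unfolding Σs Πs
   -- Write x - d 0 = (x - c 0) + (c 0 - d 0). The first summand kills the node c 0 and removes it
   -- from the other Lagrange weights; the second leaves a polynomial of smaller degree.
   dd-step : ∀ {N e} (P : Points (suc N)) (d : Fin (suc e) -> Car) -> dd P (num P d) ≈ dd (drop0 P) (num (drop0 P) (d ∘ suc)) + (c P zero + - d zero) * dd P (num P (d ∘ suc))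
   dd-step {N} {e} P d = begin Σs (\ i -> num P d i * Πs (δ P i)) ≈⟨ Σs-cong (\ i -> solve 5 (\ x c0 d0 n δ -> ((x :+ :- d0) :* n) :* δ := (n :* (x :+ :- c0)) :* δ :+ (c0 :+ :- d0) :* (n :* δ)) refl (c P i) (c P zero) (d zero) (n i) (Πs (δ P i))) ⟩ Σs (\ i -> (n i * (c P i + - c P zero)) * Πs (δ P i) + (c P zero + - d zero) * (n i * Πs (δ P i))) ≈⟨ Σ-+ (\ i -> (n i * (c P i + - c P zero)) * Πs (δ P i)) (\ i -> (c P zero + - d zero) * (n i * Πs (δ P i))) ⟩ Σs (\ i -> (n i * (c P i + - c P zero)) * Πs (δ P i)) + Σs (\ i -> (c P zero + - d zero) * (n i * Πs (δ P i))) ≈⟨ +~ (+~ (tr (*ʳ (tr (*ˡ (-‿inverseʳ _)) (*0 _))) (0* _)) (Σs-cong each)) (sym (Σ-*ˡ _ (\ i -> n i * Πs (δ P i)))) ⟩ (0# + dd (drop0 P) (num (drop0 P) (d ∘ suc))) + (c P zero + - d zero) * dd P n ≈⟨ +ʳ (0+ _) ⟩ dd (drop0 P) (num (drop0 P) (d ∘ suc)) + (c P zero + - d zero) * dd P n ∎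
    where
    n : Fin (suc N) -> Car
    n = num P (d ∘ suc)
    each : ∀ i -> (n (suc i) * (c P (suc i) + - c P zero)) * (δ P (suc i) zero * Πs (\ j -> δ P (suc i) (suc j))) ≈ n (suc i) * Πs (\ j -> δ P (suc i) (suc j))
    each i = tr (solve 5 (\ n x y d e -> (n :* (x :+ :- y)) :* (d :* e) := (d :* (x :+ :- y)) :* (n :* e)) refl _ _ _ _ _) (tr (*ʳ (δ-off P (suc i) zero (\ ()))) (il _))
  opaque
   unfolding Πs
   dd-one' : ∀ N (P : Points (suc (suc N))) (d : Fin 0 -> Car) -> dd P (num P d) ≈ 0#
   dd-one' N P d = dd-one P
  -- Together with `dd-lead` and `dd-next` this computes the coefficient of 1/x in the expansion of
  -- Π (x - d) / Π (x - c) at infinity, for the three ranges of degrees that occur.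
  dd-low : ∀ e N (P : Points N) (d : Fin e -> Car) -> suc (suc e) N.≤ N -> dd P (num P d) ≈ 0#
  dd-low zero (suc (suc N)) P d _ = dd-one' N P d
  dd-low zero (suc zero) P d (s≤s ())
  dd-low (suc e) (suc N) P d (s≤s le) = begin dd P (num P d) ≈⟨ dd-step P d ⟩ dd (drop0 P) (num (drop0 P) (d ∘ suc)) + (c P zero + - d zero) * dd P (num P (d ∘ suc)) ≈⟨ +~ (dd-low e N (drop0 P) (d ∘ suc) le) (*ˡ (dd-low e (suc N) P (d ∘ suc) (NP.m≤n⇒m≤1+n le))) ⟩ 0# + (c P zero + - d zero) * 0# ≈⟨ tr (0+ _) (*0 _) ⟩ 0# ∎
  opaque
   unfolding Σs Πs
   dd-lead : ∀ e (P : Points (suc e)) (d : Fin e -> Car) -> dd P (num P d) ≈ 1#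
   dd-lead zero P d = dd-one-single P
   dd-lead (suc e) P d = begin dd P (num P d) ≈⟨ dd-step P d ⟩ dd (drop0 P) (num (drop0 P) (d ∘ suc)) + (c P zero + - d zero) * dd P (num P (d ∘ suc)) ≈⟨ +~ (dd-lead e (drop0 P) (d ∘ suc)) (*ˡ (dd-low e (suc (suc e)) P (d ∘ suc) ≤-refl)) ⟩ 1# + (c P zero + - d zero) * 0# ≈⟨ tr (+ˡ (*0 _)) (+0 _) ⟩ 1# ∎
   dd-next : ∀ e (P : Points e) (d : Fin e -> Car) -> dd P (num P d) ≈ Σs (c P) + - Σs d
   dd-next zero P d = sym (-‿inverseʳ 0#)
   dd-next (suc e) P d = begin dd P (num P d) ≈⟨ dd-step P d ⟩ dd (drop0 P) (num (drop0 P) (d ∘ suc)) + (c P zero + - d zero) * dd P (num P (d ∘ suc)) ≈⟨ +~ (dd-next e (drop0 P) (d ∘ suc)) (*ˡ (dd-lead e P (d ∘ suc))) ⟩ (Σs (c P ∘ suc) + - Σs (d ∘ suc)) + (c P zero + - d zero) * 1# ≈⟨ solve 4 (\ a b c d -> (a :+ :- b) :+ (c :+ :- d) :* :1 := (c :+ a) :+ :- (d :+ b)) refl _ _ _ _ ⟩ Σs (c P) + - Σs d ∎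
  with0 : ∀ {N} (P : Points N) (ic : Fin N -> Car) -> (∀ i -> ic i * c P i ≈ 1#) -> Points (suc N)
  with0 {N} P ic h = record { c = c' ; δ = δ' ; δ-diag = diag ; δ-off = off }
   where
   c' : Fin (suc N) -> Car
   c' zero = 0#
   c' (suc i) = c P i
   δ' : Fin (suc N) -> Fin (suc N) -> Car
   δ' zero zero = 1#
   δ' zero (suc j) = - ic j
   δ' (suc i) zero = ic i
   δ' (suc i) (suc j) = δ P i j
   diag : ∀ i -> δ' i i ≈ 1#
   diag zero = refl
   diag (suc i) = δ-diag P i
   off : ∀ i j -> ¬ i ≡ j -> δ' i j * (c' i + - c' j) ≈ 1#
   off zero zero ne = absurd (ne E.refl)
   off zero (suc j) ne = tr (solve 2 (\ a b -> :- a :* (:0 :+ :- b) := a :* b) refl _ _) (h j)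
   off (suc i) zero ne = tr (solve 2 (\ a b -> a :* (b :+ :- :0) := a :* b) refl _ _) (h i)
   off (suc i) (suc j) ne = δ-off P i j (\ e -> ne (cong suc e))
  opaque
   unfolding Σs Πs
   dd-with0 : ∀ {N} (P : Points N) (ic : Fin N -> Car) h (φ : Fin (suc N) -> Car) -> dd (with0 P ic h) φ ≈ φ zero * Πs (\ j -> - ic j) + Σs (\ i -> φ (suc i) * (ic i * Πs (δ P i)))
   dd-with0 P ic h φ = +ʳ (*ˡ (il _))
  -- Dividing by x amounts to adding the node 0. Over the e + 1 nodes the monic numerator of degree
  -- e has divided difference 1, and by the assumption on the products the node 0 alone contributes
  -- Π d / Π c = 1.
  dd-inverse : ∀ e (P : Points e) (d ic : Fin e -> Car) -> (∀ i -> ic i * c P i ≈ 1#) -> Πs d ≈ Πs (c P) -> dd P (\ i -> ic i * num P d i) ≈ 0#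
  dd-inverse e P d ic h hd = begin dd P (\ i -> ic i * num P d i) ≈⟨ Σs-cong (\ i -> solve 3 (\ a b c -> (a :* b) :* c := b :* (a :* c)) refl _ _ _) ⟩ rest ≈⟨ solve 1 (\ r -> r := (:1 :+ r) :+ :- :1) refl rest ⟩ (1# + rest) + - 1# ≈⟨ +ʳ (tr (+ʳ (sym head)) (sym (dd-with0 P ic h (num P' d)))) ⟩ dd P' (num P' d) + - 1# ≈⟨ +ʳ (dd-lead e P' d) ⟩ 1# + - 1# ≈⟨ -‿inverseʳ 1# ⟩ 0# ∎
   where
   P' = with0 P ic h
   rest = Σs (\ i -> num P d i * (ic i * Πs (δ P i)))
   head : Πs (\ k -> 0# + - d k) * Πs (\ j -> - ic j) ≈ 1#
   head = begin Πs (\ k -> 0# + - d k) * Πs (\ j -> - ic j) ≈⟨ Π-* _ _ ⟨ Πs (\ k -> (0# + - d k) * - ic k) ≈⟨ Πs-cong (\ k -> solve 2 (\ a b -> (:0 :+ :- a) :* :- b := a :* b) refl _ _) ⟩ Πs (\ k -> d k * ic k) ≈⟨ Π-* _ _ ⟩ Πs d * Πs ic ≈⟨ *ʳ hd ⟩ Πs (c P) * Πs ic ≈⟨ Π-* _ _ ⟨ Πs (\ k -> c P k * ic k) ≈⟨ Π-one _ (\ k -> tr (*c _ _) (h k)) ⟩ 1# ∎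
 module Residues (R : CRing) (Fd : Field R) where
  open RingKit R
  open PickKit R
  open LagrangeDef R
  open Points
  open Field Fd using (inv; inv-r)
  open DomainKit R (Field.domain Fd)
  -- Partial fractions of Π (x - p a)(x - r b) / Π (x - a)(x - b). Up to the factors (1 - p) a i and
  -- (1 - r) b i, the quantities `ρ` and `σ` are its residues at a i and b i. As p r = 1 and there
  -- are equally many a and b, numerator and denominator agree at x = 0.
  record Tables (n : ℕ) (p r : Car) : Set where
   field
    a b : Fin n -> Car
    A B A' B' : Fin n -> Fin n -> Car
    pr : p * r ≈ 1#
    p≉1 : ¬ (1# + - p ≈ 0#)
    a~0 : ∀ i -> ¬ (a i ≈ 0#)
    b~0 : ∀ i -> ¬ (b i ≈ 0#)
    a≉a : ∀ i j -> ¬ i ≡ j -> ¬ (a i ≈ a j)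
    b≉b : ∀ i j -> ¬ i ≡ j -> ¬ (b i ≈ b j)
    a≉b : ∀ i j -> ¬ (a i ≈ b j)
    A-diag : ∀ i -> A i i ≈ 1#
    A-off : ∀ i j -> ¬ i ≡ j -> A i j * (a i + - a j) ≈ a i + - (p * a j)
    B-all : ∀ i j -> B i j * (a i + - b j) ≈ a i + - (r * b j)
    A'-diag : ∀ i -> A' i i ≈ 1#
    A'-off : ∀ i j -> ¬ i ≡ j -> A' i j * (b i + - b j) ≈ b i + - (r * b j)
    B'-all : ∀ i j -> B' i j * (b i + - a j) ≈ b i + - (p * a j)
   ρ σ : Fin n -> Car
   ρ i = Πs (A i) * Πs (B i)
   σ i = Πs (A' i) * Πs (B' i)
  module _ {n p r} (T : Tables n p r) where
   open Tables T
   private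
    pts : Fin (n N.+ n) -> Car
    pts = cat a b
    distinct : ∀ x y -> ¬ x ≡ y -> ¬ (pts x ≈ pts y)
    distinct x y ne e with view n x | view n y
    ... | left i | left j = a≉a i j (\ { E.refl -> ne E.refl }) (tr (rf (E.sym (cat-l a b i))) (tr e (rf (cat-l a b j))))
    ... | left i | right j = a≉b i j (tr (rf (E.sym (cat-l a b i))) (tr e (rf (cat-r a b j))))
    ... | right i | left j = a≉b j i (tr (rf (E.sym (cat-l a b j))) (tr (sym e) (rf (cat-r a b i))))
    ... | right i | right j = b≉b i j (\ { E.refl -> ne E.refl }) (tr (rf (E.sym (cat-r a b i))) (tr e (rf (cat-r a b j))))
    δT : Fin (n N.+ n) -> Fin (n N.+ n) -> Car
    δT x y with x FinP.≟ y
    ... | yes _ = 1#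
    ... | no ne = inv (pts x + - pts y) (\ e -> distinct x y ne (x-y≈0⇒x≈y e))
    P : Points (n N.+ n)
    P = record { c = pts ; δ = δT ; δ-diag = dg ; δ-off = off }
     where
     dg : ∀ x -> δT x x ≈ 1#
     dg x with x FinP.≟ x
     ... | yes _ = refl
     ... | no ne = absurd (ne E.refl)
     off : ∀ x y -> ¬ x ≡ y -> δT x y * (pts x + - pts y) ≈ 1#
     off x y ne with x FinP.≟ y
     ... | yes e = absurd (ne e)
     ... | no ne' = tr (*c _ _) (inv-r _ _)
    pa rb : Fin n -> Car
    pa k = p * a k
    rb k = r * b k
    d : Fin (n N.+ n) -> Car
    d = cat pa rb
    a-b : ∀ {x y x' y'} -> x ≡ x' -> y ≡ y' -> x + - y ≈ x' + - y'
    a-b E.refl E.refl = refl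
    use : ∀ {q m s t} -> q * s ≈ t -> m * s ≈ 1# -> t * m ≈ q
    use {q} {m} {s} {t} e f = begin t * m ≈⟨ *ʳ e ⟨ (q * s) * m ≈⟨ solve 3 (\ q s m -> (q :* s) :* m := q :* (m :* s)) refl q s m ⟩ q * (m * s) ≈⟨ tr (*ˡ f) (*1 q) ⟩ q ∎
    ↑ˡ-ne : ∀ {i j : Fin n} -> ¬ i ≡ j -> ¬ (i ↑ˡ n) ≡ (j ↑ˡ n)
    ↑ˡ-ne ne e = ne (FinP.↑ˡ-injective n _ _ e)
    ↑ʳ-ne : ∀ {i j : Fin n} -> ¬ i ≡ j -> ¬ (n ↑ʳ i) ≡ (n ↑ʳ j)
    ↑ʳ-ne ne e = ne (FinP.↑ʳ-injective n _ _ e)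
    lr-ne : ∀ m {k} {i : Fin m} {j : Fin k} -> ¬ (i ↑ˡ k) ≡ (m ↑ʳ j)
    lr-ne (suc m) {i = suc i} e = lr-ne m (FinP.suc-injective e)
    merge : ∀ x -> num P d x * Πs (δT x) ≈ Πs (\ k -> (pts x + - (p * a k)) * δT x (k ↑ˡ n)) * Πs (\ k -> (pts x + - (r * b k)) * δT x (n ↑ʳ k))
    merge x = begin num P d x * Πs (δT x) ≈⟨ Π-* (\ k -> pts x + - d k) (δT x) ⟨ Πs (\ k -> (pts x + - d k) * δT x k) ≈⟨ Π-split n _ ⟩ _ ≈⟨ *~ (Πs-cong (\ k -> *ʳ (a-b E.refl (cat-l pa rb k)))) (Πs-cong (\ k -> *ʳ (a-b E.refl (cat-r pa rb k)))) ⟩ _ ∎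
    at-left : ∀ i -> num P d (i ↑ˡ n) * Πs (δT (i ↑ˡ n)) ≈ (1# + - p) * (a i * ρ i)
    at-left i = begin num P d x * Πs (δT x) ≈⟨ merge x ⟩ Πs (\ k -> (pts x + - (p * a k)) * δT x (k ↑ˡ n)) * Πs (\ k -> (pts x + - (r * b k)) * δT x (n ↑ʳ k)) ≈⟨ *~ (Π-pick i _ (A i) ((1# + - p) * a i) diag off) (Πs-cong (\ k -> use (tr (B-all i k) (a-b (E.sym (cat-l a b i)) E.refl)) (tr (*ˡ (a-b (E.sym (cat-l a b i)) (E.sym (cat-r a b k)))) (δ-off P x (n ↑ʳ k) (lr-ne n))))) ⟩ (((1# + - p) * a i) * Πs (A i)) * Πs (B i) ≈⟨ solve 4 (\ p a A B -> ((p :* a) :* A) :* B := p :* (a :* (A :* B))) refl _ _ _ _ ⟩ (1# + - p) * (a i * ρ i) ∎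
     where
     x = i ↑ˡ n
     diag : (pts x + - (p * a i)) * δT x (i ↑ˡ n) ≈ ((1# + - p) * a i) * A i i
     diag = tr (*~ (a-b (cat-l a b i) E.refl) (δ-diag P x)) (tr (solve 2 (\ a p -> (a :+ :- (p :* a)) :* :1 := ((:1 :+ :- p) :* a) :* :1) refl (a i) p) (*ˡ (sym (A-diag i))))
     off : ∀ j -> ¬ j ≡ i -> (pts x + - (p * a j)) * δT x (j ↑ˡ n) ≈ A i j
     off j ne = use (tr (A-off i j (\ e -> ne (E.sym e))) (a-b (E.sym (cat-l a b i)) E.refl)) (tr (*ˡ (a-b (E.sym (cat-l a b i)) (E.sym (cat-l a b j)))) (δ-off P x (j ↑ˡ n) (↑ˡ-ne (\ e -> ne (E.sym e)))))
    at-right : ∀ i -> num P d (n ↑ʳ i) * Πs (δT (n ↑ʳ i)) ≈ (1# + - r) * (b i * σ i)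
    at-right i = begin num P d x * Πs (δT x) ≈⟨ merge x ⟩ Πs (\ k -> (pts x + - (p * a k)) * δT x (k ↑ˡ n)) * Πs (\ k -> (pts x + - (r * b k)) * δT x (n ↑ʳ k)) ≈⟨ *~ (Πs-cong (\ k -> use (tr (B'-all i k) (a-b (E.sym (cat-r a b i)) E.refl)) (tr (*ˡ (a-b (E.sym (cat-r a b i)) (E.sym (cat-l a b k)))) (δ-off P x (k ↑ˡ n) (\ e -> lr-ne n (E.sym e)))))) (Π-pick i _ (A' i) ((1# + - r) * b i) diag off) ⟩ Πs (B' i) * (((1# + - r) * b i) * Πs (A' i)) ≈⟨ solve 4 (\ p a A B -> B :* ((p :* a) :* A) := p :* (a :* (A :* B))) refl _ _ _ _ ⟩ (1# + - r) * (b i * σ i) ∎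
     where
     x = n ↑ʳ i
     diag : (pts x + - (r * b i)) * δT x (n ↑ʳ i) ≈ ((1# + - r) * b i) * A' i i
     diag = tr (*~ (a-b (cat-r a b i) E.refl) (δ-diag P x)) (tr (solve 2 (\ a p -> (a :+ :- (p :* a)) :* :1 := ((:1 :+ :- p) :* a) :* :1) refl (b i) r) (*ˡ (sym (A'-diag i))))
     off : ∀ j -> ¬ j ≡ i -> (pts x + - (r * b j)) * δT x (n ↑ʳ j) ≈ A' i j
     off j ne = use (tr (A'-off i j (\ e -> ne (E.sym e))) (a-b (E.sym (cat-r a b i)) E.refl)) (tr (*ˡ (a-b (E.sym (cat-r a b i)) (E.sym (cat-r a b j)))) (δ-off P x (n ↑ʳ j) (↑ʳ-ne (\ e -> ne (E.sym e)))))
    -- Since p r = 1, the prefactor 1 - r of the residues at the b i is - r (1 - p). So 1 - p is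
    -- common to all residues and can be cancelled.
    factor : ∀ x y -> (1# + - p) * (x + - (r * y)) ≈ (1# + - p) * x + (1# + - r) * y
    factor x y = begin (1# + - p) * (x + - (r * y)) ≈⟨ solve 4 (\ p r x y -> (:1 :+ :- p) :* (x :+ :- (r :* y)) := (:1 :+ :- p) :* x :+ (p :* r :+ :- r) :* y) refl p r x y ⟩ (1# + - p) * x + (p * r + - r) * y ≈⟨ +ˡ (*ʳ (+ʳ pr)) ⟩ (1# + - p) * x + (1# + - r) * y ∎
   -- The residue theorem for the quotient described at `Tables`; its contribution at infinity, sum
   -- of nodes minus sum of roots, is supplied by `dd-next`.
   residue1 : Σs (\ i -> a i * ρ i) + - (r * Σs (\ i -> b i * σ i)) ≈ Σs a + - (r * Σs b)
   residue1 = cancelˡ (1# + - p) p≉1 (begin (1# + - p) * (Σs (\ i -> a i * ρ i) + - (r * Σs (\ i -> b i * σ i))) ≈⟨ factor _ _ ⟩ (1# + - p) * Σs (\ i -> a i * ρ i) + (1# + - r) * Σs (\ i -> b i * σ i) ≈⟨ +~ (Σ-*ˡ _ _) (Σ-*ˡ _ _) ⟩ Σs (\ i -> (1# + - p) * (a i * ρ i)) + Σs (\ i -> (1# + - r) * (b i * σ i)) ≈⟨ +~ (Σs-cong at-left) (Σs-cong at-right) ⟨ Σs (\ i -> num P d (i ↑ˡ n) * Πs (δT (i ↑ˡ n))) + Σs (\ i -> num P d (n ↑ʳ i) * Πs (δT (n ↑ʳ i))) ≈⟨ Σ-split n _ ⟨ dd P (num P d) ≈⟨ dd-next (n N.+ n)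 P d ⟩ Σs pts + - Σs d ≈⟨ +~ (Σ-cat a b) (-~ (Σ-cat (\ k -> p * a k) (\ k -> r * b k))) ⟩ (Σs a + Σs b) + - (Σs (\ k -> p * a k) + Σs (\ k -> r * b k)) ≈⟨ +ˡ (-~ (+~ (Σ-*ˡ p a) (Σ-*ˡ r b))) ⟨ (Σs a + Σs b) + - (p * Σs a + r * Σs b) ≈⟨ solve 4 (\ p r a b -> (a :+ b) :+ :- (p :* a :+ r :* b) := (:1 :+ :- p) :* a :+ (:1 :+ :- r) :* b) refl p r _ _ ⟩ (1# + - p) * Σs a + (1# + - r) * Σs b ≈⟨ factor _ _ ⟨ (1# + - p) * (Σs a + - (r * Σs b)) ∎)
    where
    Σ-cat : (f g : Fin n -> Car) -> Σs (cat f g) ≈ Σs f + Σs g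
    Σ-cat f g = tr (Σ-split n (cat f g)) (+~ (Σs-cong (\ i -> rf (cat-l f g i))) (Σs-cong (\ i -> rf (cat-r f g i))))
   -- The same quotient divided by x. Now the residues at 0 and at infinity cancel, as numerator and
   -- denominator agree at 0; this is `dd-inverse`.
   residue0 : Σs ρ ≈ r * Σs σ
   residue0 = x-y≈0⇒x≈y (zero-product (1# + - p) _ (begin (1# + - p) * (Σs ρ + - (r * Σs σ)) ≈⟨ factor _ _ ⟩ (1# + - p) * Σs ρ + (1# + - r) * Σs σ ≈⟨ +~ (Σ-*ˡ _ _) (Σ-*ˡ _ _) ⟩ Σs (\ i -> (1# + - p) * ρ i) + Σs (\ i -> (1# + - r) * σ i) ≈⟨ +~ (Σs-cong (\ i -> left-term i)) (Σs-cong (\ i -> right-term i)) ⟨ Σs (\ i -> (ic (i ↑ˡ n) * num P d (i ↑ˡ n)) * Πs (δT (i ↑ˡ n))) + Σs (\ i -> (ic (n ↑ʳ i) * num P d (n ↑ʳ i)) * Πs (δT (n ↑ʳ i))) ≈⟨ Σ-split n _ ⟨ dd P (\ x -> ic x * num P d x) ≈⟨ dd-inverse (n N.+ n) P d ic ic-inv Πd ⟩ 0# ∎) p≉1)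
    where
    pts~0 : ∀ x -> ¬ (pts x ≈ 0#)
    pts~0 x e with view n x
    ... | left i = a~0 i (tr (rf (E.sym (cat-l a b i))) e)
    ... | right i = b~0 i (tr (rf (E.sym (cat-r a b i))) e)
    ic : Fin (n N.+ n) -> Car
    ic x = inv (pts x) (pts~0 x)
    ic-inv : ∀ x -> ic x * pts x ≈ 1#
    ic-inv x = tr (*c _ _) (inv-r _ _)
    Πd : Πs d ≈ Πs pts
    Πd = begin Πs d ≈⟨ Π-split n d ⟩ _ ≈⟨ *~ (Πs-cong (\ i -> rf (cat-l pa rb i))) (Πs-cong (\ i -> rf (cat-r pa rb i))) ⟩ Πs (\ k -> p * a k) * Πs (\ k -> r * b k) ≈⟨ *~ (Π-* _ a) (Π-* _ b) ⟩ (Πs {n} (\ _ -> p) * Πs a) * (Πs {n} (\ _ -> r) * Πs b) ≈⟨ solve 4 (\ p a r b -> (p :* a) :* (r :* b) := (p :* r) :* (a :* b)) refl _ _ _ _ ⟩ (Πs {n} (\ _ -> p) * Πs {n} (\ _ -> r)) * (Πs a * Πs b) ≈⟨ *ʳ (tr (sym (Π-* {n} _ _)) (Π-one {n} _ (\ _ -> pr))) ⟩ 1# * (Πs a * Πs b) ≈⟨ il _ ⟩ Πs a * Πs b ≈⟨ *~ (Πs-cong (\ i -> rf (cat-l a b i))) (Πs-cong (\ i -> rf (cat-r a b i))) ⟨ _ ≈⟨ Π-split n pts ⟨ Πs pts ∎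
    gen : ∀ {x y s u v w R'} -> x * y ≈ 1# -> u ≈ y -> v * w ≈ s * (u * R') -> (x * v) * w ≈ s * R'
    gen {x} {y} {s} {u} {v} {w} {R'} e f h = begin (x * v) * w ≈⟨ *a _ _ _ ⟩ x * (v * w) ≈⟨ *ˡ h ⟩ x * (s * (u * R')) ≈⟨ solve 4 (\ x s u r -> x :* (s :* (u :* r)) := (x :* u) :* (s :* r)) refl x s u R' ⟩ (x * u) * (s * R') ≈⟨ *ʳ (tr (*ˡ f) e) ⟩ 1# * (s * R') ≈⟨ il _ ⟩ s * R' ∎
    left-term : ∀ i -> (ic (i ↑ˡ n) * num P d (i ↑ˡ n)) * Πs (δT (i ↑ˡ n)) ≈ (1# + - p) * ρ i
    left-term i = gen (ic-inv (i ↑ˡ n)) (rf (E.sym (cat-l a b i))) (at-left i)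
    right-term : ∀ i -> (ic (n ↑ʳ i) * num P d (n ↑ʳ i)) * Πs (δT (n ↑ʳ i)) ≈ (1# + - r) * σ i
    right-term i = gen (ic-inv (n ↑ʳ i)) (rf (E.sym (cat-r a b i))) (at-right i)

-- The perturbed lattice and the change of its weights when one box moves.

module Core where
 open Kit
 open Frac using (Field)
 open Lagrange
 open import Data.Vec using (updateAt)
 up dn : ∀ {n} -> Fin n -> Vec ℤ n -> Vec ℤ n
 up i κ = updateAt κ i Z.suc
 dn i κ = updateAt κ i Z.pred
 module GridKit (R : CRing) where
  open RingKit R
  open PickKit R
  grid : ∀ {n} -> (Fin n -> Fin n -> Car) -> Car
  grid X = Πs (\ a -> Πs (X a))
  grid-row : ∀ {n} (i : Fin n) (X X' : Fin n -> Fin n -> Car) (r : Fin n -> Car) -> (∀ b -> X' i b ≈ X i b * r b) -> (∀ a b -> ¬ a ≡ i -> X' a b ≈ X a b) -> grid X' ≈ grid X * Πs r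
  grid-row i X X' r hi ho = tr (Π-pick i (\ a -> Πs (X' a)) (\ a -> Πs (X a)) (Πs r) (tr (Πs-cong hi) (tr (Π-* (X i) r) (*c _ _))) (\ a ne -> Πs-cong (\ b -> ho a b ne))) (*c _ _)
  grid-col : ∀ {n} (i : Fin n) (X X' : Fin n -> Fin n -> Car) (r : Fin n -> Car) -> (∀ a -> X' a i ≈ X a i * r a) -> (∀ a b -> ¬ b ≡ i -> X' a b ≈ X a b) -> grid X' ≈ grid X * Πs r
  grid-col i X X' r hi ho = tr (Πs-cong (\ a -> tr (Π-pick i (X' a) (X a) (r a) (tr (hi a) (*c _ _)) (\ b ne -> ho a b ne)) (*c _ _))) (Π-* (\ a -> Πs (X a)) r)
  -- Row i and column i change simultaneously. The entry (i , i) lies on both and stays fixed, which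
  -- is why r i and s i have to be 1.
  grid-cross : ∀ {n} (i : Fin n) (X X' : Fin n -> Fin n -> Car) (r s : Fin n -> Car) -> r i ≈ 1# -> s i ≈ 1# -> X' i i ≈ X i i -> (∀ b -> ¬ b ≡ i -> X' i b ≈ X i b * r b) -> (∀ a -> ¬ a ≡ i -> X' a i ≈ X a i * s a) -> (∀ a b -> ¬ a ≡ i -> ¬ b ≡ i -> X' a b ≈ X a b) -> grid X' ≈ grid X * (Πs r * Πs s)
  grid-cross {n} i X X' r s ri si hii hr hs ho = begin grid X' ≈⟨ Πs-cong each ⟩ Πs (\ a -> G a * Πs (X a)) ≈⟨ Π-* G _ ⟩ Πs G * grid X ≈⟨ *ʳ (Π-pick i G s (Πs r) Gi Go) ⟩ (Πs r * Πs s) * grid X ≈⟨ *c _ _ ⟩ grid X * (Πs r * Πs s) ∎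
   where
   G : Fin n -> Car
   G a with a FinP.≟ i
   ... | yes _ = Πs r
   ... | no _ = s a
   Gi : G i ≈ Πs r * s i
   Gi with i FinP.≟ i
   ... | yes _ = tr (sym (*1 _)) (*ˡ (sym si))
   ... | no ne = absurd (ne E.refl)
   Go : ∀ a -> ¬ a ≡ i -> G a ≈ s a
   Go a ne with a FinP.≟ i
   ... | yes e = absurd (ne e)
   ... | no _ = refl
   row : ∀ b -> X' i b ≈ r b * X i b
   row b with b FinP.≟ i
   ... | yes E.refl = tr hii (tr (sym (il _)) (*ʳ (sym ri)))
   ... | no ne = tr (hr b ne) (*c _ _)
   each : ∀ a -> Πs (X' a) ≈ G a * Πs (X a)
   each a with a FinP.≟ i
   ... | yes E.refl = tr (Πs-cong row) (Π-* r (X i))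
   ... | no ne = Π-pick i (X' a) (X a) (s a) (tr (hs a ne) (*c _ _)) (\ b nb -> ho a b ne nb)
 -- What the commutation uses of the lattice, with p = q/t and r = t/q. An entry a in row i has
 -- position `pos i a`, and `τ i j` is the contribution of row i of one vector and row j of another
 -- to their pair weight. The constants `w` leave room for a normalisation of `τ` in which it
 -- becomes f at s = t.
 record Params (R : CRing) (n : ℕ) : Set where
  open RingKit R
  field
   q t p r : Car
   pt : p * t ≈ q
   pr : p * r ≈ 1#
   p≉1 : ¬ (1# + - p ≈ 0#)
   q~0 : ¬ (q ≈ 0#)
   t~0 : ¬ (t ≈ 0#)
   pos : Fin n -> ℤ -> Car
   pos-suc : ∀ i a -> pos i (Z.suc a) ≈ q * pos i a
   pos~0 : ∀ i a -> ¬ (pos i a ≈ 0#)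
   pos≉row : ∀ i j a b -> ¬ i ≡ j -> ¬ (pos i a ≈ pos j b)
   pos≉col : ∀ i a b -> ¬ a ≡ b -> ¬ (pos i a ≈ pos i b)
   pos≉p : ∀ i j a b -> ¬ (pos i a ≈ p * pos j b)
   sep : ∀ κ μ -> ¬ κ ≡ μ -> ¬ (Σs (\ i -> pos i (get κ i)) ≈ Σs (\ i -> pos i (get μ i)))
   w w⁻ : Fin n -> Fin n -> Car
   w-inv : ∀ i j -> w i j * w⁻ i j ≈ 1#
   w-diag : ∀ i -> w i i ≈ 1#
   w-opp : ∀ i j -> ¬ i ≡ j -> w i j * w j i ≈ p
   τ : Fin n -> Fin n -> ℤ -> ℤ -> Car
   τ-step : ∀ i j k l -> τ i j (Z.suc k) l * (pos j l + - (q * pos i k)) ≈ (w i j * τ i j k l) * (pos j l + - (t * pos i k))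
   τ-shift : ∀ i j k l -> τ i j (Z.suc k) (Z.suc l) ≈ τ i j k l
   τ-diag : ∀ i k -> τ i i k k ≈ 1#
   τ-vanish : ∀ i k -> τ i i k (Z.suc k) ≈ 0#
   τ~0 : ∀ i j k l -> ¬ i ≡ j -> ¬ (τ i j k l ≈ 0#)
 module CoreDef (R : CRing) (Fd : Field R) (n : ℕ) (Pm : Params R n) where
  open RingKit R
  open PickKit R
  open GridKit R
  open Params Pm
  open Field Fd using (inv; inv-r)
  open DomainKit R (Field.domain Fd)
  open Residues R Fd
  at : Vec ℤ n -> Fin n -> Car
  at κ i = pos i (get κ i)
  T : Vec ℤ n -> Vec ℤ n -> Car
  T κ μ = grid (\ i j -> τ i j (get κ i) (get μ j))
  quot : ∀ x y -> ¬ (y ≈ 0#) -> Σ Car \ z -> z * y ≈ x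
  quot x y h = x * inv y h , tr (*a _ _ _) (tr (*ˡ (tr (*c _ _) (inv-r y h))) (*1 x))
  -‿~0 : ∀ {x y} -> ¬ (x ≈ y) -> ¬ (x + - y ≈ 0#)
  -‿~0 h e = h (x-y≈0⇒x≈y e)
  offdiag : Car -> Vec ℤ n -> Fin n -> Fin n -> Car
  offdiag z κ i j with i FinP.≟ j
  ... | yes _ = 1#
  ... | no ne = proj₁ (quot (at κ i + - (z * at κ j)) (at κ i + - at κ j) (-‿~0 (pos≉row i j _ _ ne)))
  offdiag-diag : ∀ z κ i -> offdiag z κ i i ≈ 1#
  offdiag-diag z κ i with i FinP.≟ i
  ... | yes _ = refl
  ... | no ne = absurd (ne E.refl)
  offdiag-off : ∀ z κ i j -> ¬ i ≡ j -> offdiag z κ i j * (at κ i + - at κ j) ≈ at κ i + - (z * at κ j)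
  offdiag-off z κ i j ne with i FinP.≟ j
  ... | yes e = absurd (ne e)
  ... | no ne' = proj₂ (quot (at κ i + - (z * at κ j)) (at κ i + - at κ j) (-‿~0 (pos≉row i j _ _ ne')))
  -- `c` = p r^n = r^(n-1) is the product of w⁻ i j w⁻ j i over all j ≠ i, see `hg⁻`.
  pn rn c : Car
  pn = Πs {n} (\ _ -> p)
  rn = Πs {n} (\ _ -> r)
  c = p * rn
  pn-rn : pn * rn ≈ 1#
  pn-rn = tr (sym (Π-* {n} _ _)) (Π-one {n} _ (\ _ -> pr))
  c-pn : c * pn ≈ p
  c-pn = tr (*a _ _ _) (tr (*ˡ (tr (*c _ _) pn-rn)) (*1 p))
  c-r : c * r ≈ rn
  c-r = tr (solve 3 (\ p x r -> (p :* x) :* r := (p :* r) :* x) refl p rn r) (tr (*ʳ pr) (il _))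
  rp : r * p ≈ 1#
  rp = tr (*c _ _) pr
  rq : r * q ≈ t
  rq = tr (*ˡ (sym pt)) (tr (sym (*a _ _ _)) (tr (*ʳ rp) (il t)))
  r~0 : ¬ (r ≈ 0#)
  r~0 e = 1~0 (tr (sym pr) (tr (*ˡ e) (*0 p)))
  p~0 : ¬ (p ≈ 0#)
  p~0 e = 1~0 (tr (sym pr) (tr (*ʳ e) (0* r)))
  g g⁻ h h⁻ : Fin n -> Car
  g i = Πs (w i)
  g⁻ i = Πs (w⁻ i)
  h i = Πs (\ l -> w⁻ l i)
  h⁻ i = Πs (\ l -> w l i)
  g-inv : ∀ i -> g⁻ i * g i ≈ 1#
  g-inv i = tr (*c _ _) (tr (sym (Π-* (w i) (w⁻ i))) (Π-one _ (w-inv i)))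
  h-inv : ∀ i -> h i * h⁻ i ≈ 1#
  h-inv i = tr (*c _ _) (tr (sym (Π-* (\ l -> w l i) (\ l -> w⁻ l i))) (Π-one _ (\ l -> w-inv l i)))
  w⁻-diag : ∀ i -> w⁻ i i ≈ 1#
  w⁻-diag i = tr (sym (il _)) (tr (*ʳ (sym (w-diag i))) (w-inv i i))
  w⁻-opp : ∀ i j -> ¬ i ≡ j -> w⁻ i j * w⁻ j i ≈ r
  w⁻-opp i j ne = begin w⁻ i j * w⁻ j i ≈⟨ *1 _ ⟨ (w⁻ i j * w⁻ j i) * 1# ≈⟨ *ˡ (tr (*ʳ (w-opp i j ne)) pr) ⟨ (w⁻ i j * w⁻ j i) * ((w i j * w j i) * r) ≈⟨ solve 5 (\ a b c d r -> (a :* b) :* ((c :* d) :* r) := ((c :* a) :* (d :* b)) :* r) refl _ _ _ _ _ ⟩ ((w i j * w⁻ i j) * (w j i * w⁻ j i)) * r ≈⟨ *ʳ (*~ (w-inv i j) (w-inv j i)) ⟩ (1# * 1#) * r ≈⟨ tr (*ʳ (il 1#)) (il r) ⟩ r ∎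
  hg⁻ : ∀ i -> h i * g⁻ i ≈ c
  hg⁻ i = tr (sym (Π-* (\ l -> w⁻ l i) (w⁻ i))) (Π-pick i _ (\ _ -> r) p (tr (*~ (w⁻-diag i) (w⁻-diag i)) (tr (il 1#) (sym pr))) (\ j ne -> w⁻-opp j i ne))
  -- Coefficients of one-box moves: `e i κ` goes with lowering entry i of κ, `f i κ` with raising
  -- it. The products are Lagrange ratios in the positions; the prefactors are chosen so that the
  -- sums in `Adding` and `Removing` get a constant in front that is independent of i.
  e f : Fin n -> Vec ℤ n -> Car
  e i κ = (c * h i) * Πs (offdiag p κ i)
  f i κ = g⁻ i * Πs (offdiag r κ i)
  pos-pred : ∀ i a -> q * pos i (Z.pred a) ≈ pos i a
  pos-pred i a = tr (sym (pos-suc i (Z.pred a))) (rf (cong (pos i) (ZP.suc-pred a)))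
  t-pred : ∀ i a -> t * pos i (Z.pred a) ≈ r * pos i a
  t-pred i a = tr (*ʳ (sym rq)) (tr (*a _ _ _) (*ˡ (pos-pred i a)))
  lookup-same : ∀ i (u : ℤ -> ℤ) (κ : Vec ℤ n) -> get (updateAt κ i u) i ≡ u (get κ i)
  lookup-same i u κ = VecP.lookup∘updateAt i κ
  lookup-diff : ∀ i j (u : ℤ -> ℤ) (κ : Vec ℤ n) -> ¬ j ≡ i -> get (updateAt κ i u) j ≡ get κ j
  lookup-diff i j u κ ne = VecP.lookup∘updateAt′ j i ne κ
  at-up : ∀ i κ -> at (up i κ) i ≈ q * at κ i
  at-up i κ = tr (rf (cong (pos i) (lookup-same i Z.suc κ))) (pos-suc i _)
  at-up′ : ∀ i j κ -> ¬ j ≡ i -> at (up i κ) j ≈ at κ j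
  at-up′ i j κ ne = rf (cong (pos j) (lookup-diff i j Z.suc κ ne))
  T-row : ∀ i (u : ℤ -> ℤ) κ μ (ρ : Fin n -> Car) -> (∀ j -> τ i j (u (get κ i)) (get μ j) ≈ τ i j (get κ i) (get μ j) * ρ j) -> T (updateAt κ i u) μ ≈ T κ μ * Πs ρ
  T-row i u κ μ ρ hyp = grid-row i _ _ ρ (\ b -> tr (rf (cong (\ k -> τ i b k (get μ b)) (lookup-same i u κ))) (hyp b)) (\ a b ne -> rf (cong (\ k -> τ a b k (get μ b)) (lookup-diff i a u κ ne)))
  T-col : ∀ i (u : ℤ -> ℤ) κ μ (ρ : Fin n -> Car) -> (∀ l -> τ l i (get κ l) (u (get μ i)) ≈ τ l i (get κ l) (get μ i) * ρ l) -> T κ (updateAt μ i u) ≈ T κ μ * Πs ρ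
  T-col i u κ μ ρ hyp = grid-col i _ _ ρ (\ a -> tr (rf (cong (τ a i (get κ a)) (lookup-same i u μ))) (hyp a)) (\ a b ne -> rf (cong (τ a b (get κ a)) (lookup-diff i b u μ ne)))
  scale3 : ∀ a x y -> Πs {n} (\ j -> x j * (a * y j)) ≈ (Πs x * Πs {n} (\ _ -> a)) * Πs y
  scale3 a x y = tr (Π-* x (\ j -> a * y j)) (tr (*ˡ (Π-* (\ _ -> a) y)) (sym (*a _ _ _)))
  -- Only row i of the grid changes, every entry by one `τ-step` read backwards; y - r x = - r (x -
  -- p y) turns the ratio into the one of B. The quotients B come from outside since they are
  -- entries of a table of residues.
  T-dn-κ : ∀ i κ μ (B : Fin n -> Car) -> (∀ j -> B j * (at κ i + - (p * at μ j)) ≈ at κ i + - at μ j) -> T (dn i κ) μ ≈ T κ μ * ((g⁻ i * pn) * Πs B)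
  T-dn-κ i κ μ B hB = tr (T-row i Z.pred κ μ (\ j -> w⁻ i j * (p * B j)) step) (*ˡ (scale3 p (w⁻ i) B))
   where
   step : ∀ j -> τ i j (Z.pred (get κ i)) (get μ j) ≈ τ i j (get κ i) (get μ j) * (w⁻ i j * (p * B j))
   step j = cancelˡ (x + - (p * y)) (-‿~0 (pos≉p i j _ _)) (begin (x + - (p * y)) * τ₋ ≈⟨ il _ ⟨ 1# * ((x + - (p * y)) * τ₋) ≈⟨ *ʳ (w-inv i j) ⟨ (w i j * w⁻ i j) * ((x + - (p * y)) * τ₋) ≈⟨ solve 7 (\ a b x p y τ r -> (a :* b) :* ((x :+ :- (p :* y)) :* τ) := b :* ((a :* τ) :* (x :* :1 :+ :- (p :* y)))) refl (w i j) (w⁻ i j) x p y τ₋ r ⟩ w⁻ i j * ((w i j * τ₋) * (x * 1# + - (p * y))) ≈⟨ *ˡ (*ˡ (+ʳ (*ˡ (sym pr)))) ⟩ w⁻ i j * ((w i j * τ₋) * (x * (p * r) + - (p * y))) ≈⟨ solve 6 (\ b aτ x p y r -> b :* (aτ :* (x :* (p :* r) :+ :- (p :* y))) := (b :* (:- p)) :* (aτ :* (y :+ :- (r :* x)))) refl (w⁻ i j) (w i j * τ₋) x p y r ⟩ (w⁻ i j * - p) * ((w i j * τ₋) * (y + - (r * x))) ≈⟨ *ˡ (*ˡ (+ˡ (-~ (sym (t-pred i _))))) ⟩ (w⁻ i j * - p) * ((w i j * τ₋) * (y + - (t * pos i (Z.pred (get κ i))))) ≈⟨ *ˡ (sym (τ-step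 i j _ _)) ⟩ (w⁻ i j * - p) * (τ i j (Z.suc (Z.pred (get κ i))) (get μ j) * (y + - (q * pos i (Z.pred (get κ i))))) ≈⟨ *ˡ (*~ (rf (cong (\ k -> τ i j k (get μ j)) (ZP.suc-pred _))) (+ˡ (-~ (pos-pred i _)))) ⟩ (w⁻ i j * - p) * (τ0 * (y + - x)) ≈⟨ solve 5 (\ b p τ y x -> (b :* :- p) :* (τ :* (y :+ :- x)) := (τ :* b) :* (p :* (x :+ :- y))) refl (w⁻ i j) p τ0 y x ⟩ (τ0 * w⁻ i j) * (p * (x + - y)) ≈⟨ *ˡ (*ˡ (sym (hB j))) ⟩ (τ0 * w⁻ i j) * (p * (B j * (x + - (p * y)))) ≈⟨ solve 5 (\ τ b p B z -> (τ :* b) :* (p :* (B :* z)) := z :* (τ :* (b :* (p :* B)))) refl τ0 (w⁻ i j) p (B j) (x + - (p * y)) ⟩ (x + - (p * y)) * (τ0 * (w⁻ i j * (p * B j))) ∎)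
    where
    x = at κ i
    y = at μ j
    τ₋ = τ i j (Z.pred (get κ i)) (get μ j)
    τ0 = τ i j (get κ i) (get μ j)
  -- A step in the second index is a step back in the first by `τ-shift`; r appears because t times
  -- the position of k - 1 is r times the position of k.
  τ-step2 : ∀ l i k m -> (w l i * τ l i k (Z.suc m)) * (pos i m + - (r * pos l k)) ≈ τ l i k m * (pos i m + - pos l k)
  τ-step2 l i k m = begin (w l i * τ l i k (Z.suc m)) * (pos i m + - (r * pos l k)) ≈⟨ *~ (*ˡ (tr (rf (cong (\ z -> τ l i z (Z.suc m)) (E.sym (ZP.suc-pred k)))) (τ-shift l i _ m))) (+ˡ (-~ (sym (t-pred l k)))) ⟩ (w l i * τ l i (Z.pred k) m) * (pos i m + - (t * pos l (Z.pred k))) ≈⟨ τ-step l i (Z.pred k) m ⟨ τ l i (Z.suc (Z.pred k)) m * (pos i m + - (q * pos l (Z.pred k))) ≈⟨ *~ (rf (cong (\ z -> τ l i z m) (ZP.suc-pred k))) (+ˡ (-~ (pos-pred l k))) ⟩ τ l i k m * (pos i m + - pos l k) ∎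
  T-up-μ : ∀ i κ μ (B : Fin n -> Car) -> (∀ l -> B l * (p * at μ i + - at κ l) ≈ p * at μ i + - (p * at κ l)) -> T κ (up i μ) ≈ T κ μ * (h i * Πs B)
  T-up-μ i κ μ B hB = tr (T-col i Z.suc κ μ (\ l -> w⁻ l i * B l) step) (*ˡ (Π-* _ B))
   where
   step : ∀ l -> τ l i (get κ l) (Z.suc (get μ i)) ≈ τ l i (get κ l) (get μ i) * (w⁻ l i * B l)
   step l = cancelˡ (p * y + - x) (\ z -> pos≉p l i _ _ (sym (x-y≈0⇒x≈y z))) (begin (p * y + - x) * τ₊ ≈⟨ il _ ⟨ 1# * ((p * y + - x) * τ₊) ≈⟨ *ʳ (w-inv l i) ⟨ (w l i * w⁻ l i) * ((p * y + - x) * τ₊) ≈⟨ solve 6 (\ a b p y x τ -> (a :* b) :* ((p :* y :+ :- x) :* τ) := b :* ((a :* τ) :* (p :* y :+ :- (:1 :* x)))) refl (w l i) (w⁻ l i) p y x τ₊ ⟩ w⁻ l i * ((w l i * τ₊) * (p * y + - (1# * x))) ≈⟨ *ˡ (*ˡ (+ˡ (-~ (*ʳ (sym pr))))) ⟩ w⁻ l i * ((w l i * τ₊) * (p * y + - ((p * r) * x))) ≈⟨ solve 6 (\ b aτ p y r x -> b :* (aτ :* (p :* y :+ :- ((p :* r) :* x))) := (b :* p) :* (aτ :* (y :+ :- (r :* x)))) refl (w⁻ l i) (w l i * τ₊) p y r x ⟩ (w⁻ l i * p) * ((w l i * τ₊) * (y + - (r * x))) ≈⟨ *ˡ (τ-step2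 l i _ _) ⟩ (w⁻ l i * p) * (τ0 * (y + - x)) ≈⟨ solve 5 (\ b p τ y x -> (b :* p) :* (τ :* (y :+ :- x)) := (τ :* b) :* (p :* y :+ :- (p :* x))) refl (w⁻ l i) p τ0 y x ⟩ (τ0 * w⁻ l i) * (p * y + - (p * x)) ≈⟨ *ˡ (sym (hB l)) ⟩ (τ0 * w⁻ l i) * (B l * (p * y + - x)) ≈⟨ solve 4 (\ τ b B z -> (τ :* b) :* (B :* z) := z :* (τ :* (b :* B))) refl τ0 (w⁻ l i) (B l) (p * y + - x) ⟩ (p * y + - x) * (τ0 * (w⁻ l i * B l)) ∎)
    where
    x = at κ l
    y = at μ i
    τ₊ = τ l i (get κ l) (Z.suc (get μ i))
    τ0 = τ l i (get κ l) (get μ i)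
  T-dn-μ : ∀ i κ μ (B : Fin n -> Car) -> (∀ l -> ¬ (at μ i ≈ q * at κ l)) -> (∀ l -> B l * (at μ i + - (q * at κ l)) ≈ at μ i + - (r * (q * at κ l))) -> T κ (dn i μ) ≈ T κ μ * (h⁻ i * Πs B)
  T-dn-μ i κ μ B nz hB = tr (T-col i Z.pred κ μ (\ l -> w l i * B l) step) (*ˡ (Π-* _ B))
   where
   step : ∀ l -> τ l i (get κ l) (Z.pred (get μ i)) ≈ τ l i (get κ l) (get μ i) * (w l i * B l)
   step l = cancelˡ (x + - (q * y)) (-‿~0 (nz l)) (begin (x + - (q * y)) * τ₋ ≈⟨ *ʳ (+ʳ (sym (pos-pred i _))) ⟩ (q * x₋ + - (q * y)) * τ₋ ≈⟨ solve 4 (\ q x y τ -> (q :* x :+ :- (q :* y)) :* τ := q :* (τ :* (x :+ :- y))) refl q x₋ y τ₋ ⟩ q * (τ₋ * (x₋ + - y)) ≈⟨ *ˡ (sym (τ-step2 l i _ _)) ⟩ q * ((w l i * τ l i (get κ l) (Z.suc (Z.pred (get μ i)))) * (x₋ + - (r * y))) ≈⟨ *ˡ (*ʳ (*ˡ (rf (cong (τ l i (get κ l)) (ZP.suc-pred _))))) ⟩ q * ((w l i * τ0) * (x₋ + - (r * y))) ≈⟨ solve 6 (\ q w τ x r y -> q :* ((w :* τ) :* (x :+ :- (r :* y))) := (τ :* w) :* (q :* x :+ :- (r :* (q :* y)))) refl q (w l i) τ0 x₋ r y ⟩ (τ0 * w l i) * (q * x₋ + - (r * (q * y))) ≈⟨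 *ˡ (tr (+ʳ (pos-pred i _)) (sym (hB l))) ⟩ (τ0 * w l i) * (B l * (x + - (q * y))) ≈⟨ solve 4 (\ τ b B z -> (τ :* b) :* (B :* z) := z :* (τ :* (b :* B))) refl τ0 (w l i) (B l) (x + - (q * y)) ⟩ (x + - (q * y)) * (τ0 * (w l i * B l)) ∎)
    where
    x = at μ i
    x₋ = pos i (Z.pred (get μ i))
    y = at κ l
    τ₋ = τ l i (get κ l) (Z.pred (get μ i))
    τ0 = τ l i (get κ l) (get μ i)
  T-up-κ : ∀ i κ μ (B : Fin n -> Car) -> (∀ j -> ¬ (at μ j ≈ q * at κ i)) -> (∀ j -> B j * (q * at κ i + - at μ j) ≈ q * at κ i + - (p * at μ j)) -> T (up i κ) μ ≈ T κ μ * ((g i * rn) * Πs B)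
  T-up-κ i κ μ B nz hB = tr (T-row i Z.suc κ μ (\ j -> w i j * (r * B j)) step) (*ˡ (scale3 r (w i) B))
   where
   step : ∀ j -> τ i j (Z.suc (get κ i)) (get μ j) ≈ τ i j (get κ i) (get μ j) * (w i j * (r * B j))
   step j = cancelˡ (y + - (q * x)) (-‿~0 (nz j)) (begin (y + - (q * x)) * τ₊ ≈⟨ *c _ _ ⟩ τ₊ * (y + - (q * x)) ≈⟨ τ-step i j _ _ ⟩ (w i j * τ0) * (y + - (t * x)) ≈⟨ *ˡ (+~ (tr (sym (il y)) (*ʳ (sym rp))) (-~ (*ʳ (sym rq)))) ⟩ (w i j * τ0) * ((r * p) * y + - ((r * q) * x)) ≈⟨ solve 6 (\ wτ r p y q x -> wτ :* ((r :* p) :* y :+ :- ((r :* q) :* x)) := (:- (wτ :* r)) :* (q :* x :+ :- (p :* y))) refl (w i j * τ0) r p y q x ⟩ - ((w i j * τ0) * r) * (q * x + - (p * y)) ≈⟨ *ˡ (sym (hB j)) ⟩ - ((w i j * τ0) * r) * (B j * (q * x + - y)) ≈⟨ solve 6 (\ w τ r B z y -> (:- ((w :* τ) :* r)) :* (B :* (z :+ :- y)) := (y :+ :- z) :* (τ :* (w :* (r :* B)))) refl (w i j) τ0 r (B j) (q * x) y ⟩ (y + - (q * x)) * (τ0 * (w i j * (r * B j))) ∎)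
    where
    x = at κ i
    y = at μ j
    τ₊ = τ i j (Z.suc (get κ i)) (get μ j)
    τ0 = τ i j (get κ i) (get μ j)

-- The one-box exchange relations.

module Ident where
 open Kit
 open Frac using (Field)
 open Lagrange
 open Core
 open import Data.Vec using (updateAt)
 module IdentDef (R : CRing) (Fd : Field R) (n : ℕ) (Pm : Params R n) where
  open RingKit R
  open PickKit R
  open GridKit R
  open Params Pm
  open Field Fd using (inv; inv-r)
  open DomainKit R (Field.domain Fd)
  open Residues R Fd
  open CoreDef R Fd n Pm
  size : Vec ℤ n -> Car
  size κ = Σs (at κ)
  module Adding (κ μ : Vec ℤ n) where
   private
    Bq : ∀ i j -> Σ Car \ z -> z * (at κ i + - (p * at μ j)) ≈ at κ i + - at μ j
    Bq i j = quot _ _ (-‿~0 (pos≉p i j _ _))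
    B'q : ∀ i j -> Σ Car \ z -> z * (p * at μ i + - at κ j) ≈ p * at μ i + - (p * at κ j)
    B'q i j = quot _ _ (-‿~0 (\ z -> pos≉p j i _ _ (sym z)))
    rpx : ∀ x -> r * (p * x) ≈ x
    rpx x = tr (sym (*a _ _ _)) (tr (*ʳ rp) (il x))
    tab : Tables n p r
    tab = record { a = at κ ; b = \ i -> p * at μ i ; A = offdiag p κ ; B = \ i j -> proj₁ (Bq i j) ; A' = offdiag r μ ; B' = \ i j -> proj₁ (B'q i j) ; pr = pr ; p≉1 = p≉1 ; a~0 = \ i -> pos~0 i _ ; b~0 = \ i -> *-~0 p~0 (pos~0 i _) ; a≉a = \ i j ne -> pos≉row i j _ _ ne ; b≉b = \ i j ne z -> pos≉row i j _ _ ne (cancelˡ p p~0 z) ; a≉b = \ i j -> pos≉p i j _ _ ; A-diag = offdiag-diag p κ ; A-off = offdiag-off p κ ; B-all = \ i j -> tr (proj₂ (Bq i j)) (+ˡ (-~ (sym (rpx _)))) ; A'-diag = offdiag-diag r μ ; A'-off = \ i j ne -> tr (solve 4 (\ z p x y -> z :* (p :* x :+ :- (p :* y)) := p :* (z :* (x :+ :- y))) refl _ p _ _) (tr (*ˡ (offdiag-off r μ i j ne)) (solve 4 (\ p x r y -> p :* (x :+ :- (r :* y)) := p :* x :+ :- (r :* (p :* y))) refl p _ r _)) ; B'-all = \ i j -> proj₂ (B'q i j) }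
    open Tables tab using (ρ; σ)
    e-term : ∀ i -> e i κ * T (dn i κ) μ ≈ (c * p) * (T κ μ * ρ i)
    e-term i = begin e i κ * T (dn i κ) μ ≈⟨ *ˡ (T-dn-κ i κ μ (\ j -> proj₁ (Bq i j)) (\ j -> proj₂ (Bq i j))) ⟩ ((c * h i) * Πs (offdiag p κ i)) * (T κ μ * ((g⁻ i * pn) * Πs (\ j -> proj₁ (Bq i j)))) ≈⟨ solve 7 (\ c h A T g pn B -> ((c :* h) :* A) :* (T :* ((g :* pn) :* B)) := ((h :* g) :* (c :* pn)) :* (T :* (A :* B))) refl _ _ _ _ _ _ _ ⟩ ((h i * g⁻ i) * (c * pn)) * (T κ μ * ρ i) ≈⟨ *ʳ (*~ (hg⁻ i) c-pn) ⟩ (c * p) * (T κ μ * ρ i) ∎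
    f-term : ∀ i -> f i μ * T κ (up i μ) ≈ c * (T κ μ * σ i)
    f-term i = begin f i μ * T κ (up i μ) ≈⟨ *ˡ (T-up-μ i κ μ (\ j -> proj₁ (B'q i j)) (\ j -> proj₂ (B'q i j))) ⟩ (g⁻ i * Πs (offdiag r μ i)) * (T κ μ * (h i * Πs (\ j -> proj₁ (B'q i j)))) ≈⟨ solve 5 (\ g A T h B -> (g :* A) :* (T :* (h :* B)) := (h :* g) :* (T :* (A :* B))) refl _ _ _ _ _ ⟩ (h i * g⁻ i) * (T κ μ * σ i) ≈⟨ *ʳ (hg⁻ i) ⟩ c * (T κ μ * σ i) ∎
    pull : (x : Car) (u : Fin n -> Car) -> Σs (\ i -> x * (T κ μ * u i)) ≈ x * (T κ μ * Σs u)
    pull x u = tr (sym (Σ-*ˡ x (\ i -> T κ μ * u i))) (*ˡ (sym (Σ-*ˡ (T κ μ) u)))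
   -- Lowering κ and raising μ are the two kinds of poles of one rational function, whose nodes are
   -- the positions of κ and p times the positions of μ. The plain sum is its `residue0`; `adding1`
   -- is the `residue1` of the same table.
   adding0 : Σs (\ i -> e i κ * T (dn i κ) μ) ≈ Σs (\ i -> f i μ * T κ (up i μ))
   adding0 = begin Σs (\ i -> e i κ * T (dn i κ) μ) ≈⟨ Σs-cong e-term ⟩ Σs (\ i -> (c * p) * (T κ μ * ρ i)) ≈⟨ pull _ ρ ⟩ (c * p) * (T κ μ * Σs ρ) ≈⟨ *ˡ (*ˡ (residue0 tab)) ⟩ (c * p) * (T κ μ * (r * Σs σ)) ≈⟨ solve 5 (\ c p T r S -> (c :* p) :* (T :* (r :* S)) := (p :* r) :* (c :* (T :* S))) refl c p _ r _ ⟩ (p * r) * (c * (T κ μ * Σs σ)) ≈⟨ tr (*ʳ pr) (il _) ⟩ c * (T κ μ * Σs σ) ≈⟨ pull c σ ⟨ Σs (\ i -> c * (T κ μ * σ i)) ≈⟨ Σs-cong f-term ⟨ Σs (\ i -> f i μ * T κ (up i μ)) ∎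
   adding1 : Σs (\ i -> at κ i * (e i κ * T (dn i κ) μ)) + - (p * Σs (\ i -> at μ i * (f i μ * T κ (up i μ)))) ≈ (c * p) * (T κ μ * (size κ + - size μ))
   adding1 = begin Σs (\ i -> at κ i * (e i κ * T (dn i κ) μ)) + - (p * Σs (\ i -> at μ i * (f i μ * T κ (up i μ)))) ≈⟨ +~ (tr (Σs-cong (\ i -> tr (*ˡ (e-term i)) (solve 4 (\ x c T u -> x :* (c :* (T :* u)) := c :* (T :* (x :* u))) refl _ _ _ _))) (pull (c * p) (\ i -> at κ i * ρ i))) (-~ (tr (Σ-*ˡ p _) (tr (Σs-cong (\ i -> tr (*ˡ (*ˡ (f-term i))) (solve 5 (\ p x c T u -> p :* (x :* (c :* (T :* u))) := c :* (T :* ((p :* x) :* u))) refl p _ c _ _))) (pull c (\ i -> (p * at μ i) * σ i))))) ⟩ (c * p) * (T κ μ * Sa) + - (c * (T κ μ * Sb)) ≈⟨ +ˡ (-~ (tr (sym (il _)) (*ʳ (sym pr)))) ⟩ (c * p) * (T κ μ * Sa) + - ((p * r) * (c * (T κ μ * Sb))) ≈⟨ solve 6 (\ c p T A r B -> (c :* p) :* (T :* A) :+ :- ((p :* r) :* (c :* (T :* B))) := (c :* p) :* (T :* (A :+ :- (r :* B)))) refl c p _ Sa r Sb ⟩ (c * p) * (T κ μ * (Sa + - (r * Sb))) ≈⟨ *ˡ (*ˡ (residue1 tab)) ⟩ (c * p) * (T κ μ * (size κ + - (r * Σs (\ i -> p * at μ i)))) ≈⟨ *ˡ (*ˡ (+ˡ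 (-~ (tr (*ˡ (sym (Σ-*ˡ p (at μ)))) (rpx _))))) ⟩ (c * p) * (T κ μ * (size κ + - size μ)) ∎
    where
    Sa = Σs (\ i -> at κ i * ρ i)
    Sb = Σs (\ i -> (p * at μ i) * σ i)
  module Removing (κ μ : Vec ℤ n) (nz : ∀ i j -> ¬ (at μ i ≈ q * at κ j)) where
   private
    Bq : ∀ i j -> Σ Car \ z -> z * (at μ i + - (q * at κ j)) ≈ at μ i + - (r * (q * at κ j))
    Bq i j = quot _ _ (-‿~0 (nz i j))
    B'q : ∀ i j -> Σ Car \ z -> z * (q * at κ i + - at μ j) ≈ q * at κ i + - (p * at μ j)
    B'q i j = quot _ _ (-‿~0 (\ z -> nz j i (sym z)))
    tab : Tables n p r
    tab = record { a = at μ ; b = \ i -> q * at κ i ; A = offdiag p μ ; B = \ i j -> proj₁ (Bq i j) ; A' = offdiag r κ ; B' = \ i j -> proj₁ (B'q i j) ; pr = pr ; p≉1 = p≉1 ; a~0 = \ i -> pos~0 i _ ; b~0 = \ i -> *-~0 q~0 (pos~0 i _) ; a≉a = \ i j ne -> pos≉row i j _ _ ne ; b≉b = \ i j ne z -> pos≉row i j _ _ ne (cancelˡ q q~0 z) ; a≉b = nz ; A-diag = offdiag-diag p μ ; A-off = offdiag-off p μ ; B-all = \ i j -> proj₂ (Bq i j) ; A'-diag = offdiag-diag r κ ; A'-off = \ i j ne -> tr (solve 4 (\ z p x y -> z :* (p :* x :+ :- (p :* y)) := p :* (z :* (x :+ :- y))) refl _ q _ _) (tr (*ˡ (offdiag-off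 r κ i j ne)) (solve 4 (\ p x r y -> p :* (x :+ :- (r :* y)) := p :* x :+ :- (r :* (p :* y))) refl q _ r _)) ; B'-all = \ i j -> proj₂ (B'q i j) }
    open Tables tab using (ρ; σ)
    e-term : ∀ i -> e i μ * T κ (dn i μ) ≈ c * (T κ μ * ρ i)
    e-term i = begin e i μ * T κ (dn i μ) ≈⟨ *ˡ (T-dn-μ i κ μ (\ j -> proj₁ (Bq i j)) (nz i) (\ j -> proj₂ (Bq i j))) ⟩ ((c * h i) * Πs (offdiag p μ i)) * (T κ μ * (h⁻ i * Πs (\ j -> proj₁ (Bq i j)))) ≈⟨ solve 6 (\ c h A T g B -> ((c :* h) :* A) :* (T :* (g :* B)) := (h :* g) :* (c :* (T :* (A :* B)))) refl _ _ _ _ _ _ ⟩ (h i * h⁻ i) * (c * (T κ μ * ρ i)) ≈⟨ tr (*ʳ (h-inv i)) (il _) ⟩ c * (T κ μ * ρ i) ∎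
    f-term : ∀ i -> f i κ * T (up i κ) μ ≈ (c * r) * (T κ μ * σ i)
    f-term i = begin f i κ * T (up i κ) μ ≈⟨ *ˡ (T-up-κ i κ μ (\ j -> proj₁ (B'q i j)) (\ j -> nz j i) (\ j -> proj₂ (B'q i j))) ⟩ (g⁻ i * Πs (offdiag r κ i)) * (T κ μ * ((g i * rn) * Πs (\ j -> proj₁ (B'q i j)))) ≈⟨ solve 6 (\ g A T h rn B -> (g :* A) :* (T :* ((h :* rn) :* B)) := ((g :* h) :* rn) :* (T :* (A :* B))) refl _ _ _ _ _ _ ⟩ ((g⁻ i * g i) * rn) * (T κ μ * σ i) ≈⟨ *ʳ (tr (*ʳ (g-inv i)) (tr (il rn) (sym c-r))) ⟩ (c * r) * (T κ μ * σ i) ∎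
    pull : (x : Car) (u : Fin n -> Car) -> Σs (\ i -> x * (T κ μ * u i)) ≈ x * (T κ μ * Σs u)
    pull x u = tr (sym (Σ-*ˡ x (\ i -> T κ μ * u i))) (*ˡ (sym (Σ-*ˡ (T κ μ) u)))
   -- Here the nodes are the positions of μ and q times those of κ. They are distinct unless an
   -- entry of μ is one more than the corresponding entry of κ, a case that moves along compositions
   -- never produce (`far-∔`, `far-∖`).
   removing0 : Σs (\ i -> e i μ * T κ (dn i μ)) ≈ Σs (\ i -> f i κ * T (up i κ) μ)
   removing0 = begin Σs (\ i -> e i μ * T κ (dn i μ)) ≈⟨ Σs-cong e-term ⟩ Σs (\ i -> c * (T κ μ * ρ i)) ≈⟨ pull c ρ ⟩ c * (T κ μ * Σs ρ) ≈⟨ *ˡ (*ˡ (residue0 tab)) ⟩ c * (T κ μ * (r * Σs σ)) ≈⟨ solve 4 (\ c T r S -> c :* (T :* (r :* S)) := (c :* r) :* (T :* S)) refl c _ r _ ⟩ (c * r) * (T κ μ * Σs σ) ≈⟨ pull (c * r) σ ⟨ Σs (\ i -> (c * r) * (T κ μ * σ i)) ≈⟨ Σs-cong f-term ⟨ Σs (\ i -> f i κ * T (up i κ) μ) ∎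
   removing1 : Σs (\ i -> at μ i * (e i μ * T κ (dn i μ))) + - Σs (\ i -> (q * at κ i) * (f i κ * T (up i κ) μ)) ≈ c * (T κ μ * (size μ + - (t * size κ)))
   removing1 = begin Σs (\ i -> at μ i * (e i μ * T κ (dn i μ))) + - Σs (\ i -> (q * at κ i) * (f i κ * T (up i κ) μ)) ≈⟨ +~ (tr (Σs-cong (\ i -> tr (*ˡ (e-term i)) (solve 4 (\ x c T u -> x :* (c :* (T :* u)) := c :* (T :* (x :* u))) refl _ _ _ _))) (pull c (\ i -> at μ i * ρ i))) (-~ (tr (Σs-cong (\ i -> tr (*ˡ (f-term i)) (solve 4 (\ x c T u -> x :* (c :* (T :* u)) := c :* (T :* (x :* u))) refl _ _ _ _))) (pull (c * r) (\ i -> (q * at κ i) * σ i)))) ⟩ c * (T κ μ * Sa) + - ((c * r) * (T κ μ * Sb)) ≈⟨ solve 5 (\ c T A r B -> c :* (T :* A) :+ :- ((c :* r) :* (T :* B)) := c :* (T :* (A :+ :- (r :* B)))) refl c _ Sa r Sb ⟩ c * (T κ μ * (Sa + - (r * Sb))) ≈⟨ *ˡ (*ˡ (residue1 tab)) ⟩ c * (T κ μ * (size μ + - (r * Σs (\ i -> q * at κ i)))) ≈⟨ *ˡ (*ˡ (+ˡ (-~ (tr (*ˡ (sym (Σ-*ˡ q (at κ)))) (tr (sym (*a _ _ _)) (*ʳ rq)))))) ⟩ c * (T κ μ * (size μ + - (t * size κ))) ∎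
    where
    Sa = Σs (\ i -> at μ i * ρ i)
    Sb = Σs (\ i -> (q * at κ i) * σ i)
  -- This covers the boundary κ i = μ i, where raising only μ in row i gives weight 0. When both
  -- vectors move, the diagonal entry is preserved by shift invariance, and the rest of row i and
  -- column i changes as in `grid-cross`.
  both : ∀ i κ μ -> get κ i ≡ get μ i -> e i (up i μ) * T κ μ ≈ f i κ * T (up i κ) (up i μ)
  both i κ μ eq = sym (begin f i κ * T (up i κ) (up i μ) ≈⟨ *ˡ cross ⟩ (g⁻ i * Πs mf) * (T κ μ * (Πs rr * Πs cc)) ≈⟨ solve 5 (\ g m T r c -> (g :* m) :* (T :* (r :* c)) := T :* (g :* ((m :* r) :* c))) refl _ _ _ _ _ ⟩ T κ μ * (g⁻ i * ((Πs mf * Πs rr) * Πs cc)) ≈⟨ *ˡ (*ˡ (tr (*ʳ (sym (Π-* mf rr))) (sym (Π-* _ cc)))) ⟩ T κ μ * (g⁻ i * Πs (\ j -> (mf j * rr j) * cc j)) ≈⟨ *ˡ (*ˡ (Π-pick i _ (\ j -> (r * me j) * (w i j * w⁻ j i)) p diag off)) ⟩ T κ μ * (g⁻ i * (p * Πs (\ j -> (r * me j) * (w i j * w⁻ j i)))) ≈⟨ *ˡ (*ˡ (*ˡ (tr (Π-* _ _) (*~ (Π-* _ me) (Π-* (w i) _))))) ⟩ T κ μ * (g⁻ i * (p * ((rn * Πs me) * (g i * h i)))) ≈⟨ solve 7 (\ T g p rn m g' h -> T :* (g :* (p :* ((rn :* m) :* (g' :* h)))) := (g :* g') :* ((((p :*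 rn) :* h) :* m) :* T)) refl _ _ _ _ _ _ _ ⟩ (g⁻ i * g i) * (((c * h i) * Πs me) * T κ μ) ≈⟨ tr (*ʳ (g-inv i)) (il _) ⟩ e i (up i μ) * T κ μ ∎)
   where
   mf me : Fin n -> Car
   mf = offdiag r κ i
   me = offdiag p (up i μ) i
   κi≈μi : at κ i ≈ at μ i
   κi≈μi = rf (cong (pos i) eq)
   nz : ∀ b -> ¬ b ≡ i -> ¬ (at μ b ≈ q * at κ i)
   nz b ne z = pos≉row b i _ _ ne (tr z (sym (pos-suc i _)))
   rr-spec : ∀ b -> Σ Car \ z -> (b ≡ i -> z ≈ 1#) × (¬ b ≡ i -> z * (at μ b + - (q * at κ i)) ≈ w i b * (at μ b + - (t * at κ i)))
   rr-spec b with b FinP.≟ i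
   ... | yes e' = 1# , (\ _ -> refl) , (\ ne -> absurd (ne e'))
   ... | no ne = proj₁ Q , (\ e' -> absurd (ne e')) , (\ _ -> proj₂ Q)
    where Q = quot (w i b * (at μ b + - (t * at κ i))) _ (-‿~0 (nz b ne))
   cc-spec : ∀ a -> Σ Car \ z -> (a ≡ i -> z ≈ 1#) × (¬ a ≡ i -> z * (w a i * (at μ i + - (r * at κ a))) ≈ at μ i + - at κ a)
   cc-spec a with a FinP.≟ i
   ... | yes e' = 1# , (\ _ -> refl) , (\ ne -> absurd (ne e'))
   ... | no ne = proj₁ Q , (\ e' -> absurd (ne e')) , (\ _ -> proj₂ Q)
    where
    w~0 : ¬ (w a i ≈ 0#)
    w~0 z = 1~0 (tr (sym (w-inv a i)) (tr (*ʳ z) (0* _)))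
    Q = quot (at μ i + - at κ a) (w a i * (at μ i + - (r * at κ a))) (*-~0 w~0 (\ z -> pos≉p a i _ _ (begin at κ a ≈⟨ il _ ⟨ 1# * at κ a ≈⟨ *ʳ pr ⟨ (p * r) * at κ a ≈⟨ *a _ _ _ ⟩ p * (r * at κ a) ≈⟨ *ˡ (x-y≈0⇒x≈y z) ⟨ p * at μ i ∎)))
   rr cc : Fin n -> Car
   rr b = proj₁ (rr-spec b)
   cc a = proj₁ (cc-spec a)
   luκ : ∀ a -> ¬ a ≡ i -> get (up i κ) a ≡ get κ a
   luκ a = lookup-diff i a Z.suc κ
   luμ : ∀ a -> ¬ a ≡ i -> get (up i μ) a ≡ get μ a
   luμ a = lookup-diff i a Z.suc μ
   cross : T (up i κ) (up i μ) ≈ T κ μ * (Πs rr * Πs cc)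
   cross = grid-cross i _ _ rr cc (proj₁ (proj₂ (rr-spec i)) E.refl) (proj₁ (proj₂ (cc-spec i)) E.refl) (tr (rf (cong₂ (τ i i) (lookup-same i Z.suc κ) (lookup-same i Z.suc μ))) (τ-shift i i _ _)) (\ b ne -> tr (rf (cong₂ (τ i b) (lookup-same i Z.suc κ) (luμ b ne))) (row b ne)) (\ a ne -> tr (rf (cong₂ (τ a i) (luκ a ne) (lookup-same i Z.suc μ))) (col a ne)) (\ a b na nb -> rf (cong₂ (τ a b) (luκ a na) (luμ b nb)))
    where
    row : ∀ b -> ¬ b ≡ i -> τ i b (Z.suc (get κ i)) (get μ b) ≈ τ i b (get κ i) (get μ b) * rr b
    row b ne = cancelˡ _ (-‿~0 (nz b ne)) (begin (at μ b + - (q * at κ i)) * τ i b (Z.suc (get κ i)) (get μ b) ≈⟨ *c _ _ ⟩ τ i b (Z.suc (get κ i)) (get μ b) * (at μ b + - (q * at κ i)) ≈⟨ τ-step i b _ _ ⟩ (w i b * τ i b (get κ i) (get μ b)) * (at μ b + - (t * at κ i)) ≈⟨ solve 3 (\ w τ x -> (w :* τ) :* x := τ :* (w :* x)) refl _ _ _ ⟩ τ i b (get κ i) (get μ b) * (w i b * (at μ b + - (t * at κ i))) ≈⟨ *ˡ (proj₂ (proj₂ (rr-spec b)) ne) ⟨ τ i b (get κ i) (get μ b) * (rr b * (at μ b + - (q * at κ i))) ≈⟨ solve 3 (\ w τ x -> w :* (τ :* x) := x :* (w :* τ)) refl _ _ _ ⟩ (at μ b + - (q * at κ i)) * (τ i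 b (get κ i) (get μ b) * rr b) ∎)
    col : ∀ a -> ¬ a ≡ i -> τ a i (get κ a) (Z.suc (get μ i)) ≈ τ a i (get κ a) (get μ i) * cc a
    col a ne = cancelˡ (at μ i + - at κ a) (-‿~0 (\ z -> pos≉row i a _ _ (\ e' -> ne (E.sym e')) z)) (begin (at μ i + - at κ a) * τ₊ ≈⟨ *ʳ (proj₂ (proj₂ (cc-spec a)) ne) ⟨ (cc a * (w a i * (at μ i + - (r * at κ a)))) * τ₊ ≈⟨ solve 4 (\ c w x τ -> (c :* (w :* x)) :* τ := c :* ((w :* τ) :* x)) refl _ _ _ _ ⟩ cc a * ((w a i * τ₊) * (at μ i + - (r * at κ a))) ≈⟨ *ˡ (τ-step2 a i _ _) ⟩ cc a * (τ a i (get κ a) (get μ i) * (at μ i + - at κ a)) ≈⟨ solve 3 (\ w τ x -> w :* (τ :* x) := x :* (τ :* w)) refl _ _ _ ⟩ (at μ i + - at κ a) * (τ a i (get κ a) (get μ i) * cc a) ∎)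
     where τ₊ = τ a i (get κ a) (Z.suc (get μ i))
   diag : (mf i * rr i) * cc i ≈ p * ((r * me i) * (w i i * w⁻ i i))
   diag = begin (mf i * rr i) * cc i ≈⟨ *~ (*~ (offdiag-diag r κ i) (proj₁ (proj₂ (rr-spec i)) E.refl)) (proj₁ (proj₂ (cc-spec i)) E.refl) ⟩ (1# * 1#) * 1# ≈⟨ solve 0 ((:1 :* :1) :* :1 := :1) refl ⟩ 1# ≈⟨ pr ⟨ p * r ≈⟨ solve 2 (\ p r -> p :* r := p :* ((r :* :1) :* :1)) refl p r ⟩ p * ((r * 1#) * 1#) ≈⟨ *ˡ (*~ (*ˡ (sym (offdiag-diag p (up i μ) i))) (sym (w-inv i i))) ⟩ p * ((r * me i) * (w i i * w⁻ i i)) ∎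
   off : ∀ j -> ¬ j ≡ i -> (mf j * rr j) * cc j ≈ (r * me j) * (w i j * w⁻ j i)
   -- Multiplication by x and y clears the quotients `mf j` and `rr j`. What remains follows from
   -- the defining relations of `cc j` and `me j`, and w j i w⁻ j i = 1 is inserted to make the
   -- former applicable.
   off j ne = cancelˡ x x~0 (cancelˡ y y~0 (begin y * (x * ((mf j * rr j) * cc j)) ≈⟨ solve 5 (\ y x m r c -> y :* (x :* ((m :* r) :* c)) := (m :* x) :* (c :* (r :* y))) refl y x _ _ _ ⟩ (mf j * x) * (cc j * (rr j * y)) ≈⟨ *~ (offdiag-off r κ i j (\ e' -> ne (E.sym e'))) (*ˡ (proj₂ (proj₂ (rr-spec j)) ne)) ⟩ (at κ i + - (r * at κ j)) * (cc j * (w i j * (at μ j + - (t * at κ i)))) ≈⟨ *~ (tr (+ʳ κi≈μi) (sym (il _))) (*ˡ (*ˡ mu-t)) ⟩ (1# * (at μ i + - (r * at κ j))) * (cc j * (w i j * - (r * (me j * z)))) ≈⟨ *ʳ (*ʳ (sym (w-inv j i))) ⟩ ((w j i * w⁻ j i) * (at μ i + - (r * at κ j))) * (cc j * (w i j * - (r * (me j * z)))) ≈⟨ solve 8 (\ a b s c wi r me z -> ((a :* b) :* s) :* (c :* (wi :* (:- (r :* (me :* z))))) := (c :* (a :* s)) :* ((:- z) :* ((r :* me) :* (wi :* b)))) refl (w j i) (w⁻ j i) (at μ i + - (r * at κ j)) (cc j) (w i j) r (me j) z ⟩ (cc j * (w j i * (at μ i + - (r * at κ j)))) * (- z * ((r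 * me j) * (w i j * w⁻ j i))) ≈⟨ *~ (tr (proj₂ (proj₂ (cc-spec j)) ne) (+ʳ (sym κi≈μi))) (*ʳ -z≈y) ⟩ x * (y * ((r * me j) * (w i j * w⁻ j i))) ≈⟨ solve 3 (\ x y u -> x :* (y :* u) := y :* (x :* u)) refl x y _ ⟩ y * (x * ((r * me j) * (w i j * w⁻ j i))) ∎))
    where
    x y z : Car
    x = at κ i + - at κ j
    y = at μ j + - (q * at κ i)
    z = at (up i μ) i + - at (up i μ) j
    x~0 : ¬ (x ≈ 0#)
    x~0 = -‿~0 (pos≉row i j _ _ (\ e' -> ne (E.sym e')))
    y~0 : ¬ (y ≈ 0#)
    y~0 = -‿~0 (nz j ne)
    upi : at (up i μ) i ≈ q * at κ i
    upi = tr (at-up i μ) (*ˡ (sym κi≈μi))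
    upj : at (up i μ) j ≈ at μ j
    upj = at-up′ i j μ ne
    -z≈y : - z ≈ y
    -z≈y = tr (-~ (+~ upi (-~ upj))) (solve 2 (\ a b -> :- (a :+ :- b) := b :+ :- a) refl _ _)
    mu-t : at μ j + - (t * at κ i) ≈ - (r * (me j * z))
    mu-t = sym (begin - (r * (me j * z)) ≈⟨ -~ (*ˡ (offdiag-off p (up i μ) i j (\ e' -> ne (E.sym e')))) ⟩ - (r * (at (up i μ) i + - (p * at (up i μ) j))) ≈⟨ -~ (*ˡ (+~ upi (-~ (*ˡ upj)))) ⟩ - (r * (q * at κ i + - (p * at μ j))) ≈⟨ solve 5 (\ r q k p m -> :- (r :* (q :* k :+ :- (p :* m))) := (r :* p) :* m :+ :- ((r :* q) :* k)) refl r q (at κ i) p (at μ j) ⟩ (r * p) * at μ j + - ((r * q) * at κ i) ≈⟨ +~ (tr (*ʳ rp) (il _)) (-~ (*ʳ rq)) ⟩ at μ j + - (t * at κ i) ∎)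

-- Box moves on integer vectors and sums over compositions.

module Comp where
 open Kit
 open Core using (up; dn)
 open import Data.Vec using (updateAt; zipWith; sum)
 inc : ∀ {n} -> Fin n -> Vec ℕ n -> Vec ℕ n
 inc i m = updateAt m i suc
 infixl 6 _∔_ _∖_
 _∔_ _∖_ : ∀ {n} -> Vec ℤ n -> Vec ℕ n -> Vec ℤ n
 κ ∔ m = zipWith (\ a b -> a Z.+ + b) κ m
 κ ∖ m = zipWith (\ a b -> a Z.- + b) κ m
 ℤ-+-suc : ∀ a m -> a Z.+ + suc m ≡ Z.suc (a Z.+ + m)
 ℤ-+-suc a m = cong (\ z -> a Z.+ z) (ZP.pos-+ 1 m) >> E.sym (ZP.+-assoc a Z.1ℤ (+ m)) >> cong (Z._+ + m) (ZP.+-comm a Z.1ℤ) >> ZP.+-assoc Z.1ℤ a (+ m)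
 private
  suc-+ : ∀ a b -> Z.suc a Z.+ b ≡ Z.suc (a Z.+ b)
  suc-+ a b = ZP.+-assoc Z.1ℤ a b
  -suc : ∀ a m -> a Z.- + suc m ≡ Z.pred (a Z.- + m)
  -suc a m = cong (\ z -> a Z.+ z) (cong Z.-_ (ZP.pos-+ 1 m) >> ZP.neg-distrib-+ Z.1ℤ (+ m)) >> E.sym (ZP.+-assoc a Z.-1ℤ (Z.- + m)) >> cong (Z._- + m) (ZP.+-comm a Z.-1ℤ) >> ZP.+-assoc Z.-1ℤ a (Z.- + m)
 ∔-up : ∀ {n} i (κ : Vec ℤ n) m -> up i κ ∔ m ≡ κ ∔ inc i m
 ∔-up zero (a ∷ κ) (b ∷ m) = cong (_∷ (κ ∔ m)) (suc-+ a (+ b) >> E.sym (ℤ-+-suc a b))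
 ∔-up (suc i) (a ∷ κ) (b ∷ m) = cong (_ ∷_) (∔-up i κ m)
 up-∔ : ∀ {n} i (κ : Vec ℤ n) m -> up i (κ ∔ m) ≡ κ ∔ inc i m
 up-∔ zero (a ∷ κ) (b ∷ m) = cong (_∷ (κ ∔ m)) (E.sym (ℤ-+-suc a b))
 up-∔ (suc i) (a ∷ κ) (b ∷ m) = cong (_ ∷_) (up-∔ i κ m)
 dn-up : ∀ {n} i (κ : Vec ℤ n) -> dn i (up i κ) ≡ κ
 dn-up zero (a ∷ κ) = cong (_∷ κ) (ZP.pred-suc a)
 dn-up (suc i) (a ∷ κ) = cong (a ∷_) (dn-up i κ)
 up-dn : ∀ {n} i (κ : Vec ℤ n) -> up i (dn i κ) ≡ κ
 up-dn zero (a ∷ κ) = cong (_∷ κ) (ZP.suc-pred a)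
 up-dn (suc i) (a ∷ κ) = cong (a ∷_) (up-dn i κ)
 ∖-dn : ∀ {n} i (κ : Vec ℤ n) m -> dn i κ ∖ m ≡ κ ∖ inc i m
 ∖-dn zero (a ∷ κ) (b ∷ m) = cong (_∷ (κ ∖ m)) (ZP.+-assoc Z.-1ℤ a (Z.- + b) >> E.sym (-suc a b))
 ∖-dn (suc i) (a ∷ κ) (b ∷ m) = cong (_ ∷_) (∖-dn i κ m)
 dn-∖ : ∀ {n} i (κ : Vec ℤ n) m -> dn i (κ ∖ m) ≡ κ ∖ inc i m
 dn-∖ zero (a ∷ κ) (b ∷ m) = cong (_∷ (κ ∖ m)) (E.sym (-suc a b))
 dn-∖ (suc i) (a ∷ κ) (b ∷ m) = cong (_ ∷_) (dn-∖ i κ m)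
 dn-∔ : ∀ {n} i (κ : Vec ℤ n) m -> dn i (κ ∔ inc i m) ≡ κ ∔ m
 dn-∔ i κ m = cong (dn i) (E.sym (up-∔ i κ m)) >> dn-up i (κ ∔ m)
 up-∖ : ∀ {n} i (κ : Vec ℤ n) m -> up i (κ ∖ inc i m) ≡ κ ∖ m
 up-∖ i κ m = cong (up i) (E.sym (dn-∖ i κ m)) >> up-dn i (κ ∖ m)
 dn-∔′ : ∀ {n} i (κ : Vec ℤ n) m -> dn i κ ∔ m ≡ dn i (κ ∔ m)
 dn-∔′ i κ m = E.sym (dn-up i (dn i κ ∔ m)) >> cong (dn i) (up-∔ i (dn i κ) m >> E.sym (∔-up i (dn i κ) m) >> cong (_∔ m) (up-dn i κ))
 up-∖′ : ∀ {n} i (κ : Vec ℤ n) m -> up i κ ∖ m ≡ up i (κ ∖ m)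
 up-∖′ i κ m = E.sym (up-dn i (up i κ ∖ m)) >> cong (up i) (dn-∖ i (up i κ) m >> E.sym (∖-dn i (up i κ) m) >> cong (_∖ m) (dn-up i κ))
 lookup-∔ : ∀ {n} i (κ : Vec ℤ n) m -> get (κ ∔ m) i ≡ get κ i Z.+ + get m i
 lookup-∔ zero (a ∷ κ) (b ∷ m) = E.refl
 lookup-∔ (suc i) (a ∷ κ) (b ∷ m) = lookup-∔ i κ m
 lookup-∖ : ∀ {n} i (κ : Vec ℤ n) m -> get (κ ∖ m) i ≡ get κ i Z.- + get m i
 lookup-∖ zero (a ∷ κ) (b ∷ m) = E.refl
 lookup-∖ (suc i) (a ∷ κ) (b ∷ m) = lookup-∖ i κ m
 ∔-∖-comm : ∀ {n} (κ : Vec ℤ n) m m' -> κ ∔ m ∖ m' ≡ κ ∖ m' ∔ m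
 ∔-∖-comm [] [] [] = E.refl
 ∔-∖-comm (a ∷ κ) (b ∷ m) (c ∷ m') = cong₂ _∷_ (ZP.+-assoc a (+ b) (Z.- + c) >> cong (\ z -> a Z.+ z) (ZP.+-comm (+ b) (Z.- + c)) >> E.sym (ZP.+-assoc a (Z.- + c) (+ b))) (∔-∖-comm κ m m')
 ∔-comm : ∀ {n} (κ : Vec ℤ n) m m' -> κ ∔ m ∔ m' ≡ κ ∔ m' ∔ m
 ∔-comm [] [] [] = E.refl
 ∔-comm (a ∷ κ) (b ∷ m) (c ∷ m') = cong₂ _∷_ (ZP.+-assoc a (+ b) (+ c) >> cong (\ z -> a Z.+ z) (ZP.+-comm (+ b) (+ c)) >> E.sym (ZP.+-assoc a (+ c) (+ b))) (∔-comm κ m m')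
 module CompKit (R : CRing) where
  open RingKit R
  -- The sum over the weak compositions of l into n parts, organised by whether the first part is 0
  -- or can be lowered by one.
  Σc : ∀ n -> ℕ -> (Vec ℕ n -> Car) -> Car
  Σc zero zero g = g []
  Σc zero (suc l) g = 0#
  Σc (suc n) zero g = Σc n zero (\ m -> g (0 ∷ m))
  Σc (suc n) (suc l) g = Σc n (suc l) (\ m -> g (0 ∷ m)) + Σc (suc n) l (\ m -> g (inc zero m))
  Σc-cong∈ : ∀ n l {g h : Vec ℕ n -> Car} -> (∀ m -> sum m ≡ l -> g m ≈ h m) -> Σc n l g ≈ Σc n l h
  Σc-cong∈ zero zero e = e [] E.refl
  Σc-cong∈ zero (suc l) e = refl
  Σc-cong∈ (suc n) zero e = Σc-cong∈ n zero (\ m s -> e (0 ∷ m) s)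
  Σc-cong∈ (suc n) (suc l) e = +~ (Σc-cong∈ n (suc l) (\ m s -> e (0 ∷ m) s)) (Σc-cong∈ (suc n) l (\ { (a ∷ m) s -> e (suc a ∷ m) (cong suc s) }))
  Σc-cong : ∀ n l {g h : Vec ℕ n -> Car} -> (∀ m -> g m ≈ h m) -> Σc n l g ≈ Σc n l h
  Σc-cong n l e = Σc-cong∈ n l (\ m _ -> e m)
  Σc-zero : ∀ n l (g : Vec ℕ n -> Car) -> (∀ m -> g m ≈ 0#) -> Σc n l g ≈ 0#
  Σc-zero zero zero g e = e []
  Σc-zero zero (suc l) g e = refl
  Σc-zero (suc n) zero g e = Σc-zero n zero _ (\ m -> e (0 ∷ m))
  Σc-zero (suc n) (suc l) g e = tr (+~ (Σc-zero n (suc l) _ (\ m -> e (0 ∷ m))) (Σc-zero (suc n) l _ (\ m -> e (inc zero m)))) (0+ 0#)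
  Σc-+ : ∀ n l (g h : Vec ℕ n -> Car) -> Σc n l (\ m -> g m + h m) ≈ Σc n l g + Σc n l h
  Σc-+ zero zero g h = refl
  Σc-+ zero (suc l) g h = sym (0+ 0#)
  Σc-+ (suc n) zero g h = Σc-+ n zero _ _
  Σc-+ (suc n) (suc l) g h = tr (+~ (Σc-+ n (suc l) _ _) (Σc-+ (suc n) l _ _)) (solve 4 (\ a b c d -> (a :+ b) :+ (c :+ d) := (a :+ c) :+ (b :+ d)) refl _ _ _ _)
  Σc-*ˡ : ∀ n l x (g : Vec ℕ n -> Car) -> x * Σc n l g ≈ Σc n l (\ m -> x * g m)
  Σc-*ˡ zero zero x g = refl
  Σc-*ˡ zero (suc l) x g = *0 x
  Σc-*ˡ (suc n) zero x g = Σc-*ˡ n zero x _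
  Σc-*ˡ (suc n) (suc l) x g = tr (distribˡ _ _ _) (+~ (Σc-*ˡ n (suc l) x _) (Σc-*ˡ (suc n) l x _))
  opaque
   unfolding Σs
   Σc-Σs : ∀ n l {k} (g : Fin k -> Vec ℕ n -> Car) -> Σs (\ i -> Σc n l (g i)) ≈ Σc n l (\ m -> Σs (\ i -> g i m))
   Σc-Σs n l {zero} g = sym (Σc-zero n l _ (\ _ -> refl))
   Σc-Σs n l {suc k} g = tr (+ˡ (Σc-Σs n l (g ∘ suc))) (sym (Σc-+ n l _ _))
  Σc-swap : ∀ n l n' l' (g : Vec ℕ n -> Vec ℕ n' -> Car) -> Σc n l (\ m -> Σc n' l' (g m)) ≈ Σc n' l' (\ m' -> Σc n l (\ m -> g m m'))
  Σc-swap zero zero n' l' g = refl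
  Σc-swap zero (suc l) n' l' g = sym (Σc-zero n' l' _ (\ _ -> refl))
  Σc-swap (suc n) zero n' l' g = Σc-swap n zero n' l' (\ m -> g (0 ∷ m))
  Σc-swap (suc n) (suc l) n' l' g = tr (+~ (Σc-swap n (suc l) n' l' (\ m -> g (0 ∷ m))) (Σc-swap (suc n) l n' l' (\ m -> g (inc zero m)))) (sym (Σc-+ n' l' _ _))
  Σc-0 : ∀ n (g : Vec ℕ n -> Car) -> Σc n 0 g ≈ g (Data.Vec.replicate n 0)
  Σc-0 zero g = refl
  Σc-0 (suc n) g = Σc-0 n (\ m -> g (0 ∷ m))
  -- The part of `Σc` in which part i is 0, that is, the boundary terms that are missed when
  -- compositions are produced by `inc i`.
  Bd : ∀ {n} -> Fin n -> ℕ -> (Vec ℕ n -> Car) -> Car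
  Bd {suc n} zero l g = Σc n l (\ m -> g (0 ∷ m))
  Bd (suc i) zero g = Bd i zero (\ m -> g (0 ∷ m))
  Bd (suc i) (suc l) g = Bd i (suc l) (\ m -> g (0 ∷ m)) + Bd (suc i) l (\ m -> g (inc zero m))
  Bd-cong : ∀ {n} (i : Fin n) l {g h : Vec ℕ n -> Car} -> (∀ m -> get m i ≡ 0 -> g m ≈ h m) -> Bd i l g ≈ Bd i l h
  Bd-cong {suc n} zero l e = Σc-cong n l (\ m -> e (0 ∷ m) E.refl)
  Bd-cong (suc i) zero e = Bd-cong i zero (\ m z -> e (0 ∷ m) z)
  Bd-cong (suc i) (suc l) e = +~ (Bd-cong i (suc l) (\ m z -> e (0 ∷ m) z)) (Bd-cong (suc i) l (\ { (a ∷ m) z -> e (suc a ∷ m) z }))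
  Bd-zero : ∀ {n} (i : Fin n) l (g : Vec ℕ n -> Car) -> (∀ m -> get m i ≡ 0 -> g m ≈ 0#) -> Bd i l g ≈ 0#
  Bd-zero {suc n} zero l g e = Σc-zero n l _ (\ m -> e (0 ∷ m) E.refl)
  Bd-zero (suc i) zero g e = Bd-zero i zero _ (\ m z -> e (0 ∷ m) z)
  Bd-zero (suc i) (suc l) g e = tr (+~ (Bd-zero i (suc l) _ (\ m z -> e (0 ∷ m) z)) (Bd-zero (suc i) l _ (\ { (a ∷ m) z -> e (suc a ∷ m) z }))) (0+ 0#)
  Σc-Bd : ∀ {n} (i : Fin n) l (g : Vec ℕ n -> Car) -> Σc n (suc l) g ≈ Bd i (suc l) g + Σc n l (\ m -> g (inc i m))
  Σc-Bd0 : ∀ {n} (i : Fin n) (g : Vec ℕ n -> Car) -> Σc n zero g ≈ Bd i zero g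
  Σc-Bd0 zero g = refl
  Σc-Bd0 (suc i) g = Σc-Bd0 i (\ m -> g (0 ∷ m))
  Σc-Bd zero l g = refl
  Σc-Bd {suc n} (suc i) zero g = begin Σc n 1 (\ m -> g (0 ∷ m)) + Σc n 0 (\ m -> g (1 ∷ m)) ≈⟨ +~ (Σc-Bd i 0 (\ m -> g (0 ∷ m))) (Σc-Bd0 i (\ m -> g (1 ∷ m))) ⟩ (Bd i 1 (\ m -> g (0 ∷ m)) + Σc n 0 (\ m -> g (0 ∷ inc i m))) + Bd i 0 (\ m -> g (1 ∷ m)) ≈⟨ solve 3 (\ a b c -> (a :+ b) :+ c := (a :+ c) :+ b) refl _ _ _ ⟩ (Bd i 1 (\ m -> g (0 ∷ m)) + Bd i 0 (\ m -> g (1 ∷ m))) + Σc n 0 (\ m -> g (0 ∷ inc i m)) ∎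
  Σc-Bd {suc n} (suc i) (suc l) g = begin Σc n (suc (suc l)) (\ m -> g (0 ∷ m)) + Σc (suc n) (suc l) (\ m -> g (inc zero m)) ≈⟨ +~ (Σc-Bd i (suc l) (\ m -> g (0 ∷ m))) (Σc-Bd (suc i) l (\ m -> g (inc zero m))) ⟩ (Bd i (suc (suc l)) (\ m -> g (0 ∷ m)) + Σc n (suc l) (\ m -> g (0 ∷ inc i m))) + (Bd (suc i) (suc l) (\ m -> g (inc zero m)) + Σc (suc n) l (\ m -> g (inc zero (inc (suc i) m)))) ≈⟨ solve 4 (\ a b c d -> (a :+ b) :+ (c :+ d) := (a :+ c) :+ (b :+ d)) refl _ _ _ _ ⟩ (Bd i (suc (suc l)) (\ m -> g (0 ∷ m)) + Bd (suc i) (suc l) (\ m -> g (inc zero m))) + (Σc n (suc l) (\ m -> g (0 ∷ inc i m)) + Σc (suc n) l (\ m -> g (inc zero (inc (suc i) m)))) ≈⟨ +ˡ (+ˡ (Σc-cong (suc n) l (\ { (a ∷ m) -> refl }))) ⟩ (Bd i (suc (suc l)) (\ m -> g (0 ∷ m)) + Bd (suc i) (suc l) (\ m -> g (inc zero m))) + (Σc n (suc l) (\ m -> g (0 ∷ inc i m)) + Σc (suc n) l (\ m -> g (inc (suc i) (inc zero m)))) ∎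

-- The families U and V, the one-box operators, and their composites.

module Ops where
 open Kit
 open Frac using (Field)
 open Core
 open Ident
 open Comp
 open import Data.Bool using (Bool; true; false)
 open import Data.Vec using (updateAt)
 module OpsDef (R : CRing) (Fd : Field R) (n : ℕ) (Pm : Params R n) where
  open RingKit R
  open PickKit R
  open GridKit R
  open Params Pm
  open Field Fd using (inv; inv-r)
  open DomainKit R (Field.domain Fd)
  open CoreDef R Fd n Pm
  open IdentDef R Fd n Pm
  open CompKit R
  T-diag~0 : ∀ κ -> ¬ (T κ κ ≈ 0#)
  T-diag~0 κ = Π-~0 _ (\ i -> Π-~0 _ (\ j -> entry i j))
   where
   entry : ∀ i j -> ¬ (τ i j (get κ i) (get κ j) ≈ 0#)
   entry i j with i FinP.≟ j
   ... | yes E.refl = \ z -> 1~0 (tr (sym (τ-diag i _)) z)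
   ... | no ne = τ~0 i j _ _ ne
  Wi : Vec ℤ n -> Car
  Wi κ = inv (T κ κ) (T-diag~0 κ)
  T-Wi : ∀ κ -> T κ κ * Wi κ ≈ 1#
  T-Wi κ = inv-r _ _
  T-zero : ∀ i κ μ -> get μ i ≡ Z.suc (get κ i) -> T κ μ ≈ 0#
  T-zero i κ μ eq = Π-zero i _ (Π-zero i _ (tr (rf (cong (τ i i (get κ i)) eq)) (τ-vanish i _)))
  -- `both` for equal arguments. It says that E and F are transposes of each other up to the weights
  -- `Wi`.
  e-swap : ∀ i κ -> Wi (up i κ) * e i (up i κ) ≈ f i κ * Wi κ
  e-swap i κ = begin Wi' * e i (up i κ) ≈⟨ *ˡ (tr (sym (*1 _)) (*ˡ (sym (T-Wi κ)))) ⟩ Wi' * (e i (up i κ) * (T κ κ * Wi κ)) ≈⟨ solve 4 (\ w e t x -> w :* (e :* (t :* x)) := w :* ((e :* t) :* x)) refl _ _ _ _ ⟩ Wi' * ((e i (up i κ) * T κ κ) * Wi κ) ≈⟨ *ˡ (*ʳ (both i κ κ E.refl)) ⟩ Wi' * ((f i κ * T (up i κ) (up i κ)) * Wi κ) ≈⟨ solve 4 (\ w f t x -> w :* ((f :* t) :* x) := (t :* w) :* (f :* x)) refl _ _ _ _ ⟩ (T (up i κ) (up i κ) * Wi') * (f i κ * Wi κ) ≈⟨ tr (*ʳ (T-Wi (up i κ))) (il _) ⟩ f i κ * Wi κ ∎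
   where Wi' = Wi (up i κ)
  f-swap : ∀ i κ -> Wi (dn i κ) * f i (dn i κ) ≈ e i κ * Wi κ
  f-swap i κ = tr (*c _ _) (tr (sym (e-swap i (dn i κ))) (tr (rf (cong₂ (\ x y -> Wi x * e i y) (up-dn i κ) (up-dn i κ))) (*c _ _)))
  Fun : Set
  Fun = Vec ℤ n -> Car
  -- The flag decides whether a one-box move is weighted by a position. Composites are expanded for
  -- both cases at once, the unweighted one serving the relations of index 0 and the weighted one
  -- those of index 1.
  wt : Bool -> Car -> Car -> Car
  wt true x y = x * y
  wt false x y = y
  wt-cong : ∀ b {x x' y y'} -> x ≈ x' -> y ≈ y' -> wt b x y ≈ wt b x' y'
  wt-cong true p q = *~ p q
  wt-cong false p q = q
  wt-* : ∀ b x y z -> wt b x y * z ≈ wt b x (y * z)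
  wt-* true x y z = *a _ _ _
  wt-* false x y z = refl
  wt-*ˡ : ∀ b x y z -> z * wt b x y ≈ wt b x (z * y)
  wt-*ˡ true x y z = solve 3 (\ x y z -> z :* (x :* y) := x :* (z :* y)) refl _ _ _
  wt-*ˡ false x y z = refl
  -- Operators with the kernels T κ μ Wi μ and T κ μ Wi κ, restricted to vectors whose totals differ
  -- by l: U evaluates its argument at smaller vectors, V at larger ones.
  U V : ℕ -> Fun -> Fun
  U l φ κ = Σc n l (\ m -> T κ (κ ∖ m) * (Wi (κ ∖ m) * φ (κ ∖ m)))
  V l φ μ = Σc n l (\ m -> T (μ ∔ m) μ * (Wi (μ ∔ m) * φ (μ ∔ m)))
  E F : Bool -> Fun -> Fun
  E b φ κ = Σs (\ i -> wt b (at κ i) (e i κ * φ (dn i κ)))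
  F b φ μ = Σs (\ i -> wt b (q * at μ i) (f i μ * φ (up i μ)))
  D : Fun -> Fun
  D φ κ = size κ * φ κ
  private
   wt-zero : ∀ b x {y} -> y ≈ 0# -> wt b x y ≈ 0#
   wt-zero true x z = tr (*ˡ z) (*0 x)
   wt-zero false x z = z
   wt-Σc : ∀ b x y l (g : Vec ℕ n -> Car) -> wt b x (y * Σc n l g) ≈ Σc n l (\ m -> wt b x (y * g m))
   wt-Σc true x y l g = tr (*ˡ (Σc-*ˡ n l y g)) (Σc-*ˡ n l x _)
   wt-Σc false x y l g = Σc-*ˡ n l y g
   Σs-wtʳ : ∀ b (x g : Fin n -> Car) z -> Σs (\ i -> wt b (x i) (g i * z)) ≈ Σs (\ i -> wt b (x i) (g i)) * z
   Σs-wtʳ b x g z = tr (Σs-cong (\ i -> sym (wt-* b (x i) (g i) z))) (tr (Σs-cong (\ i -> *c _ _)) (tr (sym (Σ-*ˡ z _)) (*c _ _)))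
   -- On the left a box has been put in row i, so part i of the new composition is positive. The
   -- right side also contains the terms with part i equal to 0, and the hypothesis makes these
   -- vanish.
   collect : ∀ l (G : Fin n -> Vec ℕ n -> Car) -> (∀ i m -> get m i ≡ 0 -> G i m ≈ 0#) -> Σs (\ i -> Σc n l (\ m -> G i (inc i m))) ≈ Σc n (suc l) (\ ν -> Σs (\ i -> G i ν))
   collect l G z = tr (Σs-cong (\ i -> sym (tr (Σc-Bd i l (G i)) (tr (+ʳ (Bd-zero i (suc l) (G i) (z i))) (0+ _))))) (Σc-Σs n (suc l) G)
   lookup-∖0 : ∀ i κ (m : Vec ℕ n) -> get m i ≡ 0 -> get (κ ∖ m) i ≡ get κ i
   lookup-∖0 i κ m z = lookup-∖ i κ m >> cong (\ k -> get κ i Z.- + k) z >> ZP.+-identityʳ _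
   lookup-∔0 : ∀ i κ (m : Vec ℕ n) -> get m i ≡ 0 -> get (κ ∔ m) i ≡ get κ i
   lookup-∔0 i κ m z = lookup-∔ i κ m >> cong (\ k -> get κ i Z.+ + k) z >> ZP.+-identityʳ _
   T-dn-zero : ∀ i κ μ -> get μ i ≡ get κ i -> T (dn i κ) μ ≈ 0#
   T-dn-zero i κ μ eq = T-zero i (dn i κ) μ (eq >> E.sym (ZP.suc-pred _) >> cong Z.suc (E.sym (lookup-same i Z.pred κ)))
   T-up-zero : ∀ i κ μ -> get μ i ≡ get κ i -> T κ (up i μ) ≈ 0#
   T-up-zero i κ μ eq = T-zero i κ (up i μ) (lookup-same i Z.suc μ >> cong Z.suc eq)
   at-dn : ∀ i κ -> q * at (dn i κ) i ≈ at κ i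
   at-dn i κ = tr (*ˡ (rf (cong (pos i) (lookup-same i Z.pred κ)))) (pos-pred i _)
  -- eT and fT are the two sides of the one-box exchange relations.
  eT fT eT' fT' : Bool -> Vec ℤ n -> Vec ℤ n -> Car
  eT b κ μ = Σs (\ i -> wt b (at κ i) (e i κ * T (dn i κ) μ))
  fT b κ μ = Σs (\ i -> wt b (q * at μ i) (f i μ * T κ (up i μ)))
  eT' b κ μ = Σs (\ i -> wt b (at μ i) (e i μ * T κ (dn i μ)))
  fT' b κ μ = Σs (\ i -> wt b (q * at κ i) (f i κ * T (up i κ) μ))
  -- The four composites of E with U and of F with V all become sums over compositions of l + 1 with
  -- the same factor Wi φ at the far end. Comparing operators is thereby reduced to comparing `eT`
  -- with `fT`.
  EU-sum : ∀ b l φ κ -> E b (U l φ) κ ≈ Σc n (suc l) (\ ν -> eT b κ (κ ∖ ν) * (Wi (κ ∖ ν) * φ (κ ∖ ν)))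
  EU-sum b l φ κ = begin E b (U l φ) κ ≈⟨ Σs-cong (\ i -> tr (wt-Σc b _ _ l _) (Σc-cong n l (\ m -> wt-cong b refl (tr (sym (*a _ _ _)) (rf (cong (\ x -> (e i κ * T (dn i κ) x) * (Wi x * φ x)) (∖-dn i κ m))))))) ⟩ Σs (\ i -> Σc n l (\ m -> G i (inc i m))) ≈⟨ collect l G (\ i m z -> wt-zero b _ (tr (*ʳ (tr (*ˡ (T-dn-zero i κ (κ ∖ m) (lookup-∖0 i κ m z))) (*0 _))) (0* _))) ⟩ Σc n (suc l) (\ ν -> Σs (\ i -> G i ν)) ≈⟨ Σc-cong n (suc l) (\ ν -> Σs-wtʳ b _ _ _) ⟩ Σc n (suc l) (\ ν -> eT b κ (κ ∖ ν) * (Wi (κ ∖ ν) * φ (κ ∖ ν))) ∎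
   where
   G : Fin n -> Vec ℕ n -> Car
   G i ν = wt b (at κ i) ((e i κ * T (dn i κ) (κ ∖ ν)) * (Wi (κ ∖ ν) * φ (κ ∖ ν)))
  UE-sum : ∀ b l φ κ -> U l (E b φ) κ ≈ Σc n (suc l) (\ ν -> fT b κ (κ ∖ ν) * (Wi (κ ∖ ν) * φ (κ ∖ ν)))
  UE-sum b l φ κ = begin U l (E b φ) κ ≈⟨ Σc-cong n l (\ m -> tr (sym (*a _ _ _)) (tr (Σ-*ˡ _ _) (Σs-cong (\ i -> each i m)))) ⟩ Σc n l (\ m -> Σs (\ i -> G i (inc i m))) ≈⟨ Σc-Σs n l (\ i m -> G i (inc i m)) ⟨ Σs (\ i -> Σc n l (\ m -> G i (inc i m))) ≈⟨ collect l G (\ i m z -> wt-zero b _ (tr (*ʳ (tr (*ˡ (T-up-zero i κ (κ ∖ m) (lookup-∖0 i κ m z))) (*0 _))) (0* _))) ⟩ Σc n (suc l) (\ ν -> Σs (\ i -> G i ν)) ≈⟨ Σc-cong n (suc l) (\ ν -> Σs-wtʳ b _ _ _) ⟩ Σc n (suc l) (\ ν -> fT b κ (κ ∖ ν) * (Wi (κ ∖ ν) * φ (κ ∖ ν))) ∎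
   where
   G : Fin n -> Vec ℕ n -> Car
   G i ν = wt b (q * at (κ ∖ ν) i) ((f i (κ ∖ ν) * T κ (up i (κ ∖ ν))) * (Wi (κ ∖ ν) * φ (κ ∖ ν)))
   step : ∀ i μ -> (T κ (up i μ) * Wi (up i μ)) * wt b (at (up i μ) i) (e i (up i μ) * φ (dn i (up i μ))) ≈ wt b (q * at μ i) ((f i μ * T κ (up i μ)) * (Wi μ * φ μ))
   step i μ = tr (wt-*ˡ b _ _ _) (wt-cong b (at-up i μ) (begin (T κ (up i μ) * Wi (up i μ)) * (e i (up i μ) * φ (dn i (up i μ))) ≈⟨ solve 4 (\ t w e φ -> (t :* w) :* (e :* φ) := t :* ((w :* e) :* φ)) refl _ _ _ _ ⟩ T κ (up i μ) * ((Wi (up i μ) * e i (up i μ)) * φ (dn i (up i μ))) ≈⟨ *ˡ (*~ (e-swap i μ) (rf (cong φ (dn-up i μ)))) ⟩ T κ (up i μ) * ((f i μ * Wi μ) * φ μ) ≈⟨ solve 4 (\ t f w φ -> t :* ((f :* w) :* φ) := (f :* t) :* (w :* φ)) refl _ _ _ _ ⟩ (f i μ * T κ (up i μ)) * (Wi μ * φ μ) ∎))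
   each : ∀ i m -> (T κ (κ ∖ m) * Wi (κ ∖ m)) * wt b (at (κ ∖ m) i) (e i (κ ∖ m) * φ (dn i (κ ∖ m))) ≈ G i (inc i m)
   each i m = tr (rf (cong (\ x -> (T κ x * Wi x) * wt b (at x i) (e i x * φ (dn i x))) (E.sym (up-∖ i κ m)))) (step i (κ ∖ inc i m))
  FV-sum : ∀ b l φ μ -> F b (V l φ) μ ≈ Σc n (suc l) (\ ν -> fT b (μ ∔ ν) μ * (Wi (μ ∔ ν) * φ (μ ∔ ν)))
  FV-sum b l φ μ = begin F b (V l φ) μ ≈⟨ Σs-cong (\ i -> tr (wt-Σc b _ _ l _) (Σc-cong n l (\ m -> wt-cong b refl (tr (sym (*a _ _ _)) (rf (cong (\ x -> (f i μ * T x (up i μ)) * (Wi x * φ x)) (∔-up i μ m))))))) ⟩ Σs (\ i -> Σc n l (\ m -> G i (inc i m))) ≈⟨ collect l G (\ i m z -> wt-zero b _ (tr (*ʳ (tr (*ˡ (T-up-zero i (μ ∔ m) μ (E.sym (lookup-∔0 i μ m z)))) (*0 _))) (0* _))) ⟩ Σc n (suc l) (\ ν -> Σs (\ i -> G i ν)) ≈⟨ Σc-cong n (suc l) (\ ν -> Σs-wtʳ b _ _ _) ⟩ Σc n (suc l) (\ ν -> fT b (μ ∔ ν) μ * (Wi (μ ∔ ν) * φ (μ ∔ ν))) ∎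
   where
   G : Fin n -> Vec ℕ n -> Car
   G i ν = wt b (q * at μ i) ((f i μ * T (μ ∔ ν) (up i μ)) * (Wi (μ ∔ ν) * φ (μ ∔ ν)))
  VF-sum : ∀ b l φ μ -> V l (F b φ) μ ≈ Σc n (suc l) (\ ν -> eT b (μ ∔ ν) μ * (Wi (μ ∔ ν) * φ (μ ∔ ν)))
  VF-sum b l φ μ = begin V l (F b φ) μ ≈⟨ Σc-cong n l (\ m -> tr (sym (*a _ _ _)) (tr (Σ-*ˡ _ _) (Σs-cong (\ i -> each i m)))) ⟩ Σc n l (\ m -> Σs (\ i -> G i (inc i m))) ≈⟨ Σc-Σs n l (\ i m -> G i (inc i m)) ⟨ Σs (\ i -> Σc n l (\ m -> G i (inc i m))) ≈⟨ collect l G (\ i m z -> wt-zero b _ (tr (*ʳ (tr (*ˡ (T-dn-zero i (μ ∔ m) μ (E.sym (lookup-∔0 i μ m z)))) (*0 _))) (0* _))) ⟩ Σc n (suc l) (\ ν -> Σs (\ i -> G i ν)) ≈⟨ Σc-cong n (suc l) (\ ν -> Σs-wtʳ b _ _ _) ⟩ Σc n (suc l) (\ ν -> eT b (μ ∔ ν) μ * (Wi (μ ∔ ν) * φ (μ ∔ ν))) ∎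
   where
   G : Fin n -> Vec ℕ n -> Car
   G i ν = wt b (at (μ ∔ ν) i) ((e i (μ ∔ ν) * T (dn i (μ ∔ ν)) μ) * (Wi (μ ∔ ν) * φ (μ ∔ ν)))
   step : ∀ i κ -> (T (dn i κ) μ * Wi (dn i κ)) * wt b (q * at (dn i κ) i) (f i (dn i κ) * φ (up i (dn i κ))) ≈ wt b (at κ i) ((e i κ * T (dn i κ) μ) * (Wi κ * φ κ))
   step i κ = tr (wt-*ˡ b _ _ _) (wt-cong b (at-dn i κ) (begin (T (dn i κ) μ * Wi (dn i κ)) * (f i (dn i κ) * φ (up i (dn i κ))) ≈⟨ solve 4 (\ t w e φ -> (t :* w) :* (e :* φ) := t :* ((w :* e) :* φ)) refl _ _ _ _ ⟩ T (dn i κ) μ * ((Wi (dn i κ) * f i (dn i κ)) * φ (up i (dn i κ))) ≈⟨ *ˡ (*~ (f-swap i κ) (rf (cong φ (up-dn i κ)))) ⟩ T (dn i κ) μ * ((e i κ * Wi κ) * φ κ) ≈⟨ solve 4 (\ t f w φ -> t :* ((f :* w) :* φ) := (f :* t) :* (w :* φ)) refl _ _ _ _ ⟩ (e i κ * T (dn i κ) μ) * (Wi κ * φ κ) ∎))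
   each : ∀ i m -> (T (μ ∔ m) μ * Wi (μ ∔ m)) * wt b (q * at (μ ∔ m) i) (f i (μ ∔ m) * φ (up i (μ ∔ m))) ≈ G i (inc i m)
   each i m = tr (rf (cong (\ x -> (T x μ * Wi x) * wt b (q * at x i) (f i x * φ (up i x))) (E.sym (dn-∔ i μ m)))) (step i (μ ∔ inc i m))
  -- For E with V and F with U the box may move in a row where nothing else moves. By `both` these
  -- boundary terms are the same in either order and form `rest`; the others are sums over
  -- compositions of one less.
  record Split (l : ℕ) (x y : Car) (X Y : Vec ℕ n -> Car) : Set where
   field
    rest : Car
    x-split : x ≈ rest + Σc n l X
    y-split : y ≈ rest + Σc n l Y
  private
   split : ∀ l (G H : Fin n -> Vec ℕ n -> Car) -> (∀ i m -> get m i ≡ 0 -> G i m ≈ H i m) -> ∀ {x y X Y} -> x ≈ Σs (\ i -> Σc n (suc l) (G i)) -> y ≈ Σs (\ i -> Σc n (suc l) (H i)) -> (∀ m -> Σs (\ i -> G i (inc i m)) ≈ X m) -> (∀ m -> Σs (\ i -> H i (inc i m)) ≈ Y m) -> Split l x y X Y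
   split l G H z {x} {y} {X} {Y} hx hy hX hY = record { rest = Σs (\ i -> Bd i (suc l) (G i)) ; x-split = tr hx (half G X hX) ; y-split = tr hy (tr (half H Y hY) (+ʳ (Σs-cong (\ i -> Bd-cong i (suc l) (\ m e -> sym (z i m e)))))) }
    where
    half : ∀ (G : Fin n -> Vec ℕ n -> Car) X -> (∀ m -> Σs (\ i -> G i (inc i m)) ≈ X m) -> Σs (\ i -> Σc n (suc l) (G i)) ≈ Σs (\ i -> Bd i (suc l) (G i)) + Σc n l X
    half G X h = tr (Σs-cong (\ i -> Σc-Bd i l (G i))) (tr (Σ-+ _ _) (+ˡ (tr (Σc-Σs n l (\ i m -> G i (inc i m))) (Σc-cong n l h))))
  EV-split : ∀ b l φ μ -> Split l (E b (V (suc l) φ) μ) (V (suc l) (E b φ) μ) (\ ν -> eT' b (μ ∔ ν) μ * (Wi (μ ∔ ν) * φ (μ ∔ ν))) (\ ν -> fT' b (μ ∔ ν) μ * (Wi (μ ∔ ν) * φ (μ ∔ ν)))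
  EV-split b l φ μ = split l G H edge (Σs-cong (\ i -> tr (wt-Σc b _ _ (suc l) _) (Σc-cong n (suc l) (\ m -> wt-cong b refl (sym (*a _ _ _)))))) (tr (Σc-cong n (suc l) (\ m -> tr (sym (*a _ _ _)) (tr (Σ-*ˡ _ _) (Σs-cong (\ i -> wt-*ˡ b _ _ _))))) (sym (Σc-Σs n (suc l) H))) (\ m -> tr (Σs-cong (\ i -> wt-cong b refl (rf (cong (\ x -> (e i μ * T x (dn i μ)) * (Wi x * φ x)) (E.sym (∔-up i (dn i μ) m) >> cong (_∔ m) (up-dn i μ)))))) (Σs-wtʳ b _ _ _)) (\ m -> tr (Σs-cong (\ i -> tr (rf (cong (\ x -> wt b (at x i) ((T x μ * Wi x) * (e i x * φ (dn i x)))) (E.sym (up-∔ i μ m)))) (inner i (μ ∔ m)))) (Σs-wtʳ b _ _ _))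
   where
   G H : Fin n -> Vec ℕ n -> Car
   G i m = wt b (at μ i) ((e i μ * T (dn i μ ∔ m) (dn i μ)) * (Wi (dn i μ ∔ m) * φ (dn i μ ∔ m)))
   H i m = wt b (at (μ ∔ m) i) ((T (μ ∔ m) μ * Wi (μ ∔ m)) * (e i (μ ∔ m) * φ (dn i (μ ∔ m))))
   inner : ∀ i κ -> wt b (at (up i κ) i) ((T (up i κ) μ * Wi (up i κ)) * (e i (up i κ) * φ (dn i (up i κ)))) ≈ wt b (q * at κ i) ((f i κ * T (up i κ) μ) * (Wi κ * φ κ))
   inner i κ = wt-cong b (at-up i κ) (begin (T (up i κ) μ * Wi (up i κ)) * (e i (up i κ) * φ (dn i (up i κ))) ≈⟨ solve 4 (\ t w e φ -> (t :* w) :* (e :* φ) := t :* ((w :* e) :* φ)) refl _ _ _ _ ⟩ T (up i κ) μ * ((Wi (up i κ) * e i (up i κ)) * φ (dn i (up i κ))) ≈⟨ *ˡ (*~ (e-swap i κ) (rf (cong φ (dn-up i κ)))) ⟩ T (up i κ) μ * ((f i κ * Wi κ) * φ κ) ≈⟨ solve 4 (\ t f w φ -> t :* ((f :* w) :* φ) := (f :* t) :* (w :* φ)) refl _ _ _ _ ⟩ (f i κ * T (up i κ) μ) * (Wi κ * φ κ) ∎)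
   edge' : ∀ i κ μ' -> get κ i ≡ get μ' i -> wt b (at (up i μ') i) ((e i (up i μ') * T κ μ') * (Wi κ * φ κ)) ≈ wt b (at (up i κ) i) ((T (up i κ) (up i μ') * Wi (up i κ)) * (e i (up i κ) * φ (dn i (up i κ))))
   edge' i κ μ' eq = wt-cong b (tr (at-up i μ') (tr (*ˡ (rf (cong (pos i) (E.sym eq)))) (sym (at-up i κ)))) (begin (e i (up i μ') * T κ μ') * (Wi κ * φ κ) ≈⟨ *ʳ (both i κ μ' eq) ⟩ (f i κ * T (up i κ) (up i μ')) * (Wi κ * φ κ) ≈⟨ solve 4 (\ f t w φ -> (f :* t) :* (w :* φ) := t :* ((f :* w) :* φ)) refl _ _ _ _ ⟩ T (up i κ) (up i μ') * ((f i κ * Wi κ) * φ κ) ≈⟨ *ˡ (*~ (sym (e-swap i κ)) (rf (cong φ (E.sym (dn-up i κ))))) ⟩ T (up i κ) (up i μ') * ((Wi (up i κ) * e i (up i κ)) * φ (dn i (up i κ))) ≈⟨ solve 4 (\ t w e φ -> t :* ((w :* e) :* φ) := (t :* w) :* (e :* φ)) refl _ _ _ _ ⟩ (T (up i κ) (up i μ') * Wi (up i κ)) * (e i (up i κ) * φ (dn i (up i κ))) ∎)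
   edge : ∀ i m -> get m i ≡ 0 -> G i m ≈ H i m
   edge i m z = tr (rf (cong (\ x -> wt b (at x i) ((e i x * T (dn i μ ∔ m) (dn i μ)) * (Wi (dn i μ ∔ m) * φ (dn i μ ∔ m)))) (E.sym (up-dn i μ)))) (tr (edge' i (dn i μ ∔ m) (dn i μ) (lookup-∔0 i (dn i μ) m z)) (rf (cong₂ (\ x y -> wt b (at x i) ((T x y * Wi x) * (e i x * φ (dn i x)))) (cong (up i) (dn-∔′ i μ m) >> up-dn i (μ ∔ m)) (up-dn i μ))))
  FU-split : ∀ b l φ κ -> Split l (F b (U (suc l) φ) κ) (U (suc l) (F b φ) κ) (\ ν -> fT' b κ (κ ∖ ν) * (Wi (κ ∖ ν) * φ (κ ∖ ν))) (\ ν -> eT' b κ (κ ∖ ν) * (Wi (κ ∖ ν) * φ (κ ∖ ν)))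
  FU-split b l φ κ = split l G H edge (Σs-cong (\ i -> tr (wt-Σc b _ _ (suc l) _) (Σc-cong n (suc l) (\ m -> wt-cong b refl (sym (*a _ _ _)))))) (tr (Σc-cong n (suc l) (\ m -> tr (sym (*a _ _ _)) (tr (Σ-*ˡ _ _) (Σs-cong (\ i -> wt-*ˡ b _ _ _))))) (sym (Σc-Σs n (suc l) H))) (\ m -> tr (Σs-cong (\ i -> wt-cong b refl (rf (cong (\ x -> (f i κ * T (up i κ) x) * (Wi x * φ x)) (E.sym (∖-dn i (up i κ) m) >> cong (_∖ m) (dn-up i κ)))))) (Σs-wtʳ b _ _ _)) (\ m -> tr (Σs-cong (\ i -> tr (rf (cong (\ x -> wt b (q * at x i) ((T κ x * Wi x) * (f i x * φ (up i x)))) (E.sym (dn-∖ i κ m)))) (inner i (κ ∖ m)))) (Σs-wtʳ b _ _ _))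
   where
   G H : Fin n -> Vec ℕ n -> Car
   G i m = wt b (q * at κ i) ((f i κ * T (up i κ) (up i κ ∖ m)) * (Wi (up i κ ∖ m) * φ (up i κ ∖ m)))
   H i m = wt b (q * at (κ ∖ m) i) ((T κ (κ ∖ m) * Wi (κ ∖ m)) * (f i (κ ∖ m) * φ (up i (κ ∖ m))))
   inner : ∀ i μ -> wt b (q * at (dn i μ) i) ((T κ (dn i μ) * Wi (dn i μ)) * (f i (dn i μ) * φ (up i (dn i μ)))) ≈ wt b (at μ i) ((e i μ * T κ (dn i μ)) * (Wi μ * φ μ))
   inner i μ = wt-cong b (at-dn i μ) (begin (T κ (dn i μ) * Wi (dn i μ)) * (f i (dn i μ) * φ (up i (dn i μ))) ≈⟨ solve 4 (\ t w e φ -> (t :* w) :* (e :* φ) := t :* ((w :* e) :* φ)) refl _ _ _ _ ⟩ T κ (dn i μ) * ((Wi (dn i μ) * f i (dn i μ)) * φ (up i (dn i μ))) ≈⟨ *ˡ (*~ (f-swap i μ) (rf (cong φ (up-dn i μ)))) ⟩ T κ (dn i μ) * ((e i μ * Wi μ) * φ μ) ≈⟨ solve 4 (\ t f w φ -> t :* ((f :* w) :* φ) := (f :* t) :* (w :* φ)) refl _ _ _ _ ⟩ (e i μ * T κ (dn i μ)) * (Wi μ * φ μ) ∎)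
   edge' : ∀ i μ -> get κ i ≡ get μ i -> wt b (q * at κ i) ((f i κ * T (up i κ) (up i μ)) * (Wi (up i μ) * φ (up i μ))) ≈ wt b (q * at μ i) ((T κ μ * Wi μ) * (f i μ * φ (up i μ)))
   edge' i μ eq = wt-cong b (*ˡ (rf (cong (pos i) eq))) (begin (f i κ * T (up i κ) (up i μ)) * (Wi (up i μ) * φ (up i μ)) ≈⟨ *ʳ (both i κ μ eq) ⟨ (e i (up i μ) * T κ μ) * (Wi (up i μ) * φ (up i μ)) ≈⟨ solve 4 (\ f t w φ -> (f :* t) :* (w :* φ) := t :* ((w :* f) :* φ)) refl _ _ _ _ ⟩ T κ μ * ((Wi (up i μ) * e i (up i μ)) * φ (up i μ)) ≈⟨ *ˡ (*ʳ (e-swap i μ)) ⟩ T κ μ * ((f i μ * Wi μ) * φ (up i μ)) ≈⟨ solve 4 (\ t w e φ -> t :* ((w :* e) :* φ) := (t :* e) :* (w :* φ)) refl _ _ _ _ ⟩ (T κ μ * Wi μ) * (f i μ * φ (up i μ)) ∎)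
   edge : ∀ i m -> get m i ≡ 0 -> G i m ≈ H i m
   edge i m z = tr (rf (cong (\ x -> wt b (q * at κ i) ((f i κ * T (up i κ) x) * (Wi x * φ x))) (up-∖′ i κ m))) (edge' i (κ ∖ m) (E.sym (lookup-∖0 i κ m z)))

-- The commutator of U and V is a scalar.

module Comm where
 open Kit
 open Frac using (Field)
 open Core
 open Ident
 open Comp
 open Ops
 open import Data.Bool using (Bool; true; false)
 open import Data.Vec using (updateAt; replicate)
 module CommDef (R : CRing) (Fd : Field R) (n : ℕ) (Pm : Params R n) where
  open RingKit R
  open PickKit R
  open GridKit R
  open Params Pm
  open Field Fd using (inv; inv-r)
  open DomainKit R (Field.domain Fd)
  open CoreDef R Fd n Pm
  open IdentDef R Fd n Pm
  open CompKit R
  open OpsDef R Fd n Pm public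
  _≟v_ : (κ μ : Vec ℤ n) -> Dec (κ ≡ μ)
  _≟v_ = VecP.≡-dec ZP._≟_
  δ : Vec ℤ n -> Fun
  δ μ κ with κ ≟v μ
  ... | yes _ = 1#
  ... | no _ = 0#
  δ-same : ∀ μ -> δ μ μ ≈ 1#
  δ-same μ with μ ≟v μ
  ... | yes _ = refl
  ... | no ne = absurd (ne E.refl)
  δ-diff : ∀ μ κ -> ¬ κ ≡ μ -> δ μ κ ≈ 0#
  δ-diff μ κ ne with κ ≟v μ
  ... | yes e = absurd (ne e)
  ... | no _ = refl
  U-cong : ∀ l {φ ψ : Fun} -> (∀ κ -> φ κ ≈ ψ κ) -> ∀ κ -> U l φ κ ≈ U l ψ κ
  U-cong l h κ = Σc-cong n l (\ m -> *ˡ (*ˡ (h _)))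
  V-cong : ∀ l {φ ψ : Fun} -> (∀ κ -> φ κ ≈ ψ κ) -> ∀ κ -> V l φ κ ≈ V l ψ κ
  V-cong l h κ = Σc-cong n l (\ m -> *ˡ (*ˡ (h _)))
  E-cong : ∀ b {φ ψ : Fun} -> (∀ κ -> φ κ ≈ ψ κ) -> ∀ κ -> E b φ κ ≈ E b ψ κ
  E-cong b h κ = Σs-cong (\ i -> wt-cong b refl (*ˡ (h _)))
  F-cong : ∀ b {φ ψ : Fun} -> (∀ κ -> φ κ ≈ ψ κ) -> ∀ κ -> F b φ κ ≈ F b ψ κ
  F-cong b h κ = Σs-cong (\ i -> wt-cong b refl (*ˡ (h _)))
  U-+ : ∀ l (φ ψ : Fun) κ -> U l (\ μ -> φ μ + ψ μ) κ ≈ U l φ κ + U l ψ κ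
  U-+ l φ ψ κ = tr (Σc-cong n l (\ m -> solve 4 (\ t w a b -> t :* (w :* (a :+ b)) := t :* (w :* a) :+ t :* (w :* b)) refl _ _ _ _)) (Σc-+ n l _ _)
  V-+ : ∀ l (φ ψ : Fun) κ -> V l (\ μ -> φ μ + ψ μ) κ ≈ V l φ κ + V l ψ κ
  V-+ l φ ψ κ = tr (Σc-cong n l (\ m -> solve 4 (\ t w a b -> t :* (w :* (a :+ b)) := t :* (w :* a) :+ t :* (w :* b)) refl _ _ _ _)) (Σc-+ n l _ _)
  U-* : ∀ l x (φ : Fun) κ -> U l (\ μ -> x * φ μ) κ ≈ x * U l φ κ
  U-* l x φ κ = tr (Σc-cong n l (\ m -> solve 4 (\ t w a b -> t :* (w :* (a :* b)) := a :* (t :* (w :* b))) refl _ _ _ _)) (sym (Σc-*ˡ n l x _))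
  V-* : ∀ l x (φ : Fun) κ -> V l (\ μ -> x * φ μ) κ ≈ x * V l φ κ
  V-* l x φ κ = tr (Σc-cong n l (\ m -> solve 4 (\ t w a b -> t :* (w :* (a :* b)) := a :* (t :* (w :* b))) refl _ _ _ _)) (sym (Σc-*ˡ n l x _))
  E-+ : ∀ b (φ ψ : Fun) κ -> E b (\ μ -> φ μ + ψ μ) κ ≈ E b φ κ + E b ψ κ
  E-+ b φ ψ κ = tr (Σs-cong (\ i -> each b)) (Σ-+ _ _)
   where
   each : ∀ b {x y u v} -> wt b x (y * (u + v)) ≈ wt b x (y * u) + wt b x (y * v)
   each true = solve 4 (\ x y u v -> x :* (y :* (u :+ v)) := x :* (y :* u) :+ x :* (y :* v)) refl _ _ _ _
   each false = distribˡ _ _ _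
  E-neg : ∀ b (φ : Fun) κ -> E b (\ μ -> - φ μ) κ ≈ - E b φ κ
  E-neg b φ κ = tr (Σs-cong (\ i -> each b)) (Σ-neg _)
   where
   each : ∀ b {x y u} -> wt b x (y * - u) ≈ - wt b x (y * u)
   each true = solve 3 (\ x y u -> x :* (y :* :- u) := :- (x :* (y :* u))) refl _ _ _
   each false = solve 2 (\ y u -> y :* :- u := :- (y :* u)) refl _ _
  E0U : ∀ l φ κ -> E false (U l φ) κ ≈ U l (E false φ) κ
  E0U l φ κ = tr (EU-sum false l φ κ) (tr (Σc-cong n (suc l) (\ ν -> *ʳ (Adding.adding0 κ (κ ∖ ν)))) (sym (UE-sum false l φ κ)))
  private
   cq : Car
   cq = c * q
   tp : t * p ≈ q
   tp = tr (*c t p) pt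
   adding : ∀ κ μ -> t * eT true κ μ ≈ fT true κ μ + cq * (T κ μ * (size κ + - size μ))
   adding κ μ = begin t * eT true κ μ ≈⟨ solve 3 (\ t A pB -> t :* A := t :* pB :+ t :* (A :+ :- pB)) refl t (eT true κ μ) (p * Bs) ⟩ t * (p * Bs) + t * (eT true κ μ + - (p * Bs)) ≈⟨ +~ (tr (sym (*a _ _ _)) (*ʳ tp)) (*ˡ (Adding.adding1 κ μ)) ⟩ q * Bs + t * ((c * p) * (T κ μ * (size κ + - size μ))) ≈⟨ +~ (tr (Σ-*ˡ q _) (Σs-cong (\ i -> sym (*a _ _ _)))) (tr (solve 4 (\ t c p X -> t :* ((c :* p) :* X) := (c :* (t :* p)) :* X) refl t c p _) (*ʳ (*ˡ tp))) ⟩ fT true κ μ + cq * (T κ μ * (size κ + - size μ)) ∎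
    where Bs = Σs (\ i -> at μ i * (f i μ * T κ (up i μ)))
   removing : ∀ κ μ -> (∀ i -> ¬ get μ i ≡ Z.suc (get κ i)) -> eT' true κ μ ≈ fT' true κ μ + c * (T κ μ * (size μ + - (t * size κ)))
   removing κ μ h = begin eT' true κ μ ≈⟨ solve 2 (\ a b -> a := b :+ (a :+ :- b)) refl _ (fT' true κ μ) ⟩ fT' true κ μ + (eT' true κ μ + - fT' true κ μ) ≈⟨ +ˡ (Removing.removing1 κ μ (far κ μ h)) ⟩ fT' true κ μ + c * (T κ μ * (size μ + - (t * size κ))) ∎
    where
    far : ∀ κ μ -> (∀ i -> ¬ get μ i ≡ Z.suc (get κ i)) -> ∀ i j -> ¬ (at μ i ≈ q * at κ j)
    far κ μ h i j z with i FinP.≟ j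
    ... | yes E.refl = pos≉col i _ _ (h i) (tr z (sym (pos-suc i _)))
    ... | no ne = pos≉row i j _ _ ne (tr z (sym (pos-suc j _)))
   not-suc : ∀ a m -> ¬ a ≡ Z.suc (a Z.+ + m)
   not-suc a m e with E.sym (cancel (+ 0)) >> cong (\ z -> Z.- a Z.+ z) (ZP.+-identityʳ a >> e >> E.sym (ZP.+-assoc Z.1ℤ a (+ m)) >> cong (Z._+ + m) (ZP.+-comm Z.1ℤ a) >> ZP.+-assoc a Z.1ℤ (+ m)) >> cancel (+ suc m)
    where
    cancel : ∀ x -> Z.- a Z.+ (a Z.+ x) ≡ x
    cancel x = E.sym (ZP.+-assoc (Z.- a) a x) >> cong (Z._+ x) (ZP.+-inverseˡ a) >> ZP.+-identityˡ x
   ... | ()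
   far-∔ : ∀ (μ : Vec ℤ n) ν i -> ¬ get μ i ≡ Z.suc (get (μ ∔ ν) i)
   far-∔ μ ν i e = not-suc (get μ i) (get ν i) (e >> cong Z.suc (lookup-∔ i μ ν))
   far-∖ : ∀ (κ : Vec ℤ n) ν i -> ¬ get (κ ∖ ν) i ≡ Z.suc (get κ i)
   far-∖ κ ν i e = not-suc (a Z.- + m) m (E.sym (lookup-∖ i κ ν) >> e >> cong Z.suc (E.sym (ZP.+-assoc a (Z.- + m) (+ m) >> cong (\ z -> a Z.+ z) (ZP.+-inverseˡ (+ m)) >> ZP.+-identityʳ a)))
    where
    a = get κ i
    m = get ν i
  -- `E1U`, `F1V`, `E1V` and `F1U` say that, up to twists by t, the commutator of a
  -- position-weighted one-box operator with U or V is a commutator of D with the member of the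
  -- family of next or previous index. `DX` eliminates E and F from them.
  E1U : ∀ l φ κ -> t * E true (U l φ) κ + cq * U (suc l) (D φ) κ ≈ U l (E true φ) κ + cq * D (U (suc l) φ) κ
  E1U l φ κ = begin t * E true (U l φ) κ + cq * U (suc l) (D φ) κ ≈⟨ +~ (tr (*ˡ (EU-sum true l φ κ)) (Σc-*ˡ n _ t _)) (Σc-*ˡ n _ cq _) ⟩ Σc n (suc l) _ + Σc n (suc l) _ ≈⟨ Σc-+ n (suc l) _ _ ⟨ Σc n (suc l) (\ ν -> t * (eT true κ (κ ∖ ν) * (Wi (κ ∖ ν) * φ (κ ∖ ν))) + cq * (T κ (κ ∖ ν) * (Wi (κ ∖ ν) * (size (κ ∖ ν) * φ (κ ∖ ν))))) ≈⟨ Σc-cong n (suc l) (\ ν -> each (κ ∖ ν)) ⟩ Σc n (suc l) (\ ν -> fT true κ (κ ∖ ν) * (Wi (κ ∖ ν) * φ (κ ∖ ν)) + cq * (size κ * (T κ (κ ∖ ν) * (Wi (κ ∖ ν) * φ (κ ∖ ν))))) ≈⟨ Σc-+ n (suc l) _ _ ⟩ Σc n (suc l) _ + Σc n (suc l) _ ≈⟨ +~ (UE-sum true l φ κ) (tr (*ˡ (Σc-*ˡ n _ (size κ) _)) (Σc-*ˡ n _ cq _)) ⟨ U l (E true φ) κ + cq * D (U (suc l) φ) κ ∎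
   where
   each : ∀ μ -> t * (eT true κ μ * (Wi μ * φ μ)) + cq * (T κ μ * (Wi μ * (size μ * φ μ))) ≈ fT true κ μ * (Wi μ * φ μ) + cq * (size κ * (T κ μ * (Wi μ * φ μ)))
   each μ = begin t * (eT true κ μ * (Wi μ * φ μ)) + cq * (T κ μ * (Wi μ * (size μ * φ μ))) ≈⟨ solve 7 (\ t e w φ c T s -> t :* (e :* (w :* φ)) :+ c :* (T :* (w :* (s :* φ))) := (t :* e :+ c :* (T :* s)) :* (w :* φ)) refl t _ _ _ cq _ _ ⟩ (t * eT true κ μ + cq * (T κ μ * size μ)) * (Wi μ * φ μ) ≈⟨ *ʳ (+ʳ (adding κ μ)) ⟩ ((fT true κ μ + cq * (T κ μ * (size κ + - size μ))) + cq * (T κ μ * size μ)) * (Wi μ * φ μ) ≈⟨ solve 7 (\ f c T s u w φ -> ((f :+ c :* (T :* (s :+ :- u))) :+ c :* (T :* u)) :* (w :* φ) := f :* (w :* φ) :+ c :* (s :* (T :* (w :* φ)))) refl _ cq _ _ _ _ _ ⟩ fT true κ μ * (Wi μ * φ μ) + cq * (size κ * (T κ μ * (Wi μ * φ μ))) ∎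
  F1V : ∀ l φ μ -> cq * D (V (suc l) φ) μ + t * V l (F true φ) μ ≈ F true (V l φ) μ + cq * V (suc l) (D φ) μ
  F1V l φ μ = begin cq * D (V (suc l) φ) μ + t * V l (F true φ) μ ≈⟨ +~ (tr (*ˡ (Σc-*ˡ n _ (size μ) _)) (Σc-*ˡ n _ cq _)) (tr (*ˡ (VF-sum true l φ μ)) (Σc-*ˡ n _ t _)) ⟩ Σc n (suc l) _ + Σc n (suc l) _ ≈⟨ Σc-+ n (suc l) _ _ ⟨ Σc n (suc l) (\ ν -> cq * (size μ * (T (μ ∔ ν) μ * (Wi (μ ∔ ν) * φ (μ ∔ ν)))) + t * (eT true (μ ∔ ν) μ * (Wi (μ ∔ ν) * φ (μ ∔ ν)))) ≈⟨ Σc-cong n (suc l) (\ ν -> each (μ ∔ ν)) ⟩ Σc n (suc l) (\ ν -> fT true (μ ∔ ν) μ * (Wi (μ ∔ ν) * φ (μ ∔ ν)) + cq * (T (μ ∔ ν) μ * (Wi (μ ∔ ν) * (size (μ ∔ ν) * φ (μ ∔ ν))))) ≈⟨ Σc-+ n (suc l) _ _ ⟩ Σc n (suc l) _ + Σc n (suc l) _ ≈⟨ +~ (FV-sum true l φ μ) (Σc-*ˡ n _ cq _) ⟨ F true (V l φ) μ + cq * V (suc l) (D φ) μ ∎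
   where
   each : ∀ κ -> cq * (size μ * (T κ μ * (Wi κ * φ κ))) + t * (eT true κ μ * (Wi κ * φ κ)) ≈ fT true κ μ * (Wi κ * φ κ) + cq * (T κ μ * (Wi κ * (size κ * φ κ)))
   each κ = begin cq * (size μ * (T κ μ * (Wi κ * φ κ))) + t * (eT true κ μ * (Wi κ * φ κ)) ≈⟨ solve 7 (\ t e w φ c T s -> c :* (s :* (T :* (w :* φ))) :+ t :* (e :* (w :* φ)) := (t :* e :+ c :* (T :* s)) :* (w :* φ)) refl t _ _ _ cq _ _ ⟩ (t * eT true κ μ + cq * (T κ μ * size μ)) * (Wi κ * φ κ) ≈⟨ *ʳ (+ʳ (adding κ μ)) ⟩ ((fT true κ μ + cq * (T κ μ * (size κ + - size μ))) + cq * (T κ μ * size μ)) * (Wi κ * φ κ) ≈⟨ solve 7 (\ f c T s u w φ -> ((f :+ c :* (T :* (s :+ :- u))) :+ c :* (T :* u)) :* (w :* φ) := f :* (w :* φ) :+ c :* (T :* (w :* (s :* φ)))) refl _ cq _ _ _ _ _ ⟩ fT true κ μ * (Wi κ * φ κ) + cq * (T κ μ * (Wi κ * (size κ * φ κ))) ∎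
  E1V : ∀ l φ μ -> E true (V (suc l) φ) μ + (t * c) * V l (D φ) μ ≈ V (suc l) (E true φ) μ + c * D (V l φ) μ
  E1V l φ μ = begin E true (V (suc l) φ) μ + (t * c) * V l (D φ) μ ≈⟨ +~ (Split.x-split sp) (Σc-*ˡ n l (t * c) _) ⟩ (Split.rest sp + Σc n l _) + Σc n l _ ≈⟨ tr (+a _ _ _) (+ˡ (sym (Σc-+ n l _ _))) ⟩ Split.rest sp + Σc n l (\ ν -> eT' true (μ ∔ ν) μ * (Wi (μ ∔ ν) * φ (μ ∔ ν)) + (t * c) * (T (μ ∔ ν) μ * (Wi (μ ∔ ν) * (size (μ ∔ ν) * φ (μ ∔ ν))))) ≈⟨ +ˡ (Σc-cong n l (\ ν -> each (μ ∔ ν) (far-∔ μ ν))) ⟩ Split.rest sp + Σc n l (\ ν -> fT' true (μ ∔ ν) μ * (Wi (μ ∔ ν) * φ (μ ∔ ν)) + c * (size μ * (T (μ ∔ ν) μ * (Wi (μ ∔ ν) * φ (μ ∔ ν))))) ≈⟨ tr (+ˡ (Σc-+ n l _ _)) (sym (+a _ _ _)) ⟩ (Split.rest sp + Σc n l _) + Σc n l _ ≈⟨ +~ (Split.y-split sp) (tr (*ˡ (Σc-*ˡ n l (size μ) _)) (Σc-*ˡ n l c _)) ⟨ V (suc l) (E true φ) μ + c * D (V l φ) μ ∎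
   where
   sp = EV-split true l φ μ
   each : ∀ κ -> (∀ i -> ¬ get μ i ≡ Z.suc (get κ i)) -> eT' true κ μ * (Wi κ * φ κ) + (t * c) * (T κ μ * (Wi κ * (size κ * φ κ))) ≈ fT' true κ μ * (Wi κ * φ κ) + c * (size μ * (T κ μ * (Wi κ * φ κ)))
   each κ h = tr (+ʳ (*ʳ (removing κ μ h))) (solve 8 (\ f c T s t u w φ -> (f :+ c :* (T :* (s :+ :- (t :* u)))) :* (w :* φ) :+ (t :* c) :* (T :* (w :* (u :* φ))) := f :* (w :* φ) :+ c :* (s :* (T :* (w :* φ)))) refl _ c _ _ t _ _ _)
  F1U : ∀ l φ κ -> F true (U (suc l) φ) κ + c * U l (D φ) κ ≈ U (suc l) (F true φ) κ + (c * t) * D (U l φ) κ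
  F1U l φ κ = begin F true (U (suc l) φ) κ + c * U l (D φ) κ ≈⟨ +~ (Split.x-split sp) (Σc-*ˡ n l c _) ⟩ (Split.rest sp + Σc n l _) + Σc n l _ ≈⟨ tr (+a _ _ _) (+ˡ (sym (Σc-+ n l _ _))) ⟩ Split.rest sp + Σc n l (\ ν -> fT' true κ (κ ∖ ν) * (Wi (κ ∖ ν) * φ (κ ∖ ν)) + c * (T κ (κ ∖ ν) * (Wi (κ ∖ ν) * (size (κ ∖ ν) * φ (κ ∖ ν))))) ≈⟨ +ˡ (Σc-cong n l (\ ν -> each (κ ∖ ν) (far-∖ κ ν))) ⟩ Split.rest sp + Σc n l (\ ν -> eT' true κ (κ ∖ ν) * (Wi (κ ∖ ν) * φ (κ ∖ ν)) + (c * t) * (size κ * (T κ (κ ∖ ν) * (Wi (κ ∖ ν) * φ (κ ∖ ν))))) ≈⟨ tr (+ˡ (Σc-+ n l _ _)) (sym (+a _ _ _)) ⟩ (Split.rest sp + Σc n l _) + Σc n l _ ≈⟨ +~ (Split.y-split sp) (tr (*ˡ (Σc-*ˡ n l (size κ) _)) (Σc-*ˡ n l (c * t) _)) ⟨ U (suc l) (F true φ) κ + (c * t) * D (U l φ) κ ∎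
   where
   sp = FU-split true l φ κ
   each : ∀ μ -> (∀ i -> ¬ get μ i ≡ Z.suc (get κ i)) -> fT' true κ μ * (Wi μ * φ μ) + c * (T κ μ * (Wi μ * (size μ * φ μ))) ≈ eT' true κ μ * (Wi μ * φ μ) + (c * t) * (size κ * (T κ μ * (Wi μ * φ μ)))
   each μ h = sym (tr (+ʳ (*ʳ (removing κ μ h))) (solve 8 (\ f c T s t u w φ -> (f :+ c :* (T :* (s :+ :- (t :* u)))) :* (w :* φ) :+ (c :* t) :* (u :* (T :* (w :* φ))) := f :* (w :* φ) :+ c :* (T :* (w :* (s :* φ)))) refl _ c _ _ t _ _ _))
  E0V : ∀ l φ μ -> E false (V (suc l) φ) μ ≈ V (suc l) (E false φ) μ
  E0V l φ μ = tr (Split.x-split sp) (tr (+ˡ (Σc-cong n l (\ ν -> *ʳ (removing0' ν)))) (sym (Split.y-split sp)))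
   where
   sp = EV-split false l φ μ
   removing0' : ∀ ν -> eT' false (μ ∔ ν) μ ≈ fT' false (μ ∔ ν) μ
   removing0' ν = Removing.removing0 (μ ∔ ν) μ far
    where
    far : ∀ i j -> ¬ (at μ i ≈ q * at (μ ∔ ν) j)
    far i j z with i FinP.≟ j
    ... | yes E.refl = pos≉col i _ _ (far-∔ μ ν i) (tr z (sym (pos-suc i _)))
    ... | no ne = pos≉row i j _ _ ne (tr z (sym (pos-suc j _)))
  X : ℕ -> ℕ -> Fun -> Fun
  X l k φ κ = U l (V k φ) κ + - V k (U l φ) κ
  -- c q times [D , X] is a linear combination of two instances of each of the four relations, one
  -- before and one after a U or V. The terms with E and F cancel once the operators of smaller
  -- index are known to commute.
  DX : ∀ l k -> (∀ φ κ -> U l (V (suc k) φ) κ ≈ V (suc k) (U l φ) κ) -> (∀ φ κ -> U (suc l) (V k φ) κ ≈ V k (U (suc l) φ) κ) -> (∀ φ κ -> U l (V k φ) κ ≈ V k (U l φ) κ) -> ∀ φ κ -> D (X (suc l) (suc k) φ) κ ≈ X (suc l) (suc k) (D φ) κ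
  DX l k h1 h2 h3 φ κ = x-y≈0⇒x≈y (tr expand (zero-product cq _ (tr (linear t c cq a1 a2 a3 a4 b1 b₂ b3 b4 c1 c2 c3 d2 d3 d4 e2 e4 f2 f4) vanish) cq~0))
   where
   U1 = U (suc l)
   U₀ = U l
   V1 = V (suc k)
   V₀ = V k
   E1 = E true
   F1 = F true
   a1 = E1 (U₀ (V1 φ)) κ
   a2 = U1 (D (V1 φ)) κ
   a3 = U₀ (E1 (V1 φ)) κ
   a4 = D (U1 (V1 φ)) κ
   b1 = V1 (E1 (U₀ φ)) κ
   b₂ = V1 (U1 (D φ)) κ
   b3 = V1 (U₀ (E1 φ)) κ
   b4 = V1 (D (U1 φ)) κ
   c1 = D (V1 (U1 φ)) κ
   c2 = V₀ (F1 (U1 φ)) κ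
   c3 = F1 (V₀ (U1 φ)) κ
   d2 = U1 (V₀ (F1 φ)) κ
   d3 = U1 (F1 (V₀ φ)) κ
   d4 = U1 (V1 (D φ)) κ
   e2 = V₀ (D (U₀ φ)) κ
   e4 = D (V₀ (U₀ φ)) κ
   f2 = V₀ (U₀ (D φ)) κ
   f4 = U₀ (D (V₀ φ)) κ
   cq~0 : ¬ (cq ≈ 0#)
   cq~0 = *-~0 (*-~0 p~0 (Π-~0 {n} _ (\ _ -> r~0))) q~0
   expand : D (X (suc l) (suc k) φ) κ + - X (suc l) (suc k) (D φ) κ ≈ ((a4 + - c1) + - d4) + b₂
   expand = solve 5 (\ s x y z w -> s :* (x :+ :- y) :+ :- (z :+ :- w) := ((s :* x :+ :- (s :* y)) :+ :- z) :+ w) refl _ _ _ _ _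
   -- A ring identity in the values of the composites listed above. The coefficients are dictated by
   -- the elimination of a1, a3, b1, b3, c2, c3, d2, d3, the composites that contain E or F.
   linear : ∀ t c k a1 a2 a3 a4 b1 b₂ b3 b4 c1 c2 c3 d2 d3 d4 e2 e4 f2 f4 -> k * (((a4 + - c1) + - d4) + b₂) ≈ ((- ((t * a1 + k * a2) + - (a3 + k * a4)) + ((t * b1 + k * b₂) + - (b3 + k * b4))) + (- ((k * c1 + t * c2) + - (c3 + k * b4)) + ((k * a2 + t * d2) + - (d3 + k * d4)))) + ((t * ((a1 + (t * c) * e2) + - (b1 + c * e4)) + - ((a3 + (t * c) * f2) + - (b3 + c * f4))) + (- ((c3 + c * f4) + - (d3 + (c * t) * e4)) + t * ((c2 + c * f2) + - (d2 + (c * t) * e2))))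
   linear = solve 21 (\ t c k a1 a2 a3 a4 b1 b₂ b3 b4 c1 c2 c3 d2 d3 d4 e2 e4 f2 f4 -> k :* (((a4 :+ :- c1) :+ :- d4) :+ b₂) := ((:- ((t :* a1 :+ k :* a2) :+ :- (a3 :+ k :* a4)) :+ ((t :* b1 :+ k :* b₂) :+ :- (b3 :+ k :* b4))) :+ (:- ((k :* c1 :+ t :* c2) :+ :- (c3 :+ k :* b4)) :+ ((k :* a2 :+ t :* d2) :+ :- (d3 :+ k :* d4)))) :+ ((t :* ((a1 :+ (t :* c) :* e2) :+ :- (b1 :+ c :* e4)) :+ :- ((a3 :+ (t :* c) :* f2) :+ :- (b3 :+ c :* f4))) :+ (:- ((c3 :+ c :* f4) :+ :- (d3 :+ (c :* t) :* e4)) :+ t :* ((c2 :+ c :* f2) :+ :- (d2 :+ (c :* t) :* e2))))) refl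
   vanish : ((- ((t * a1 + cq * a2) + - (a3 + cq * a4)) + ((t * b1 + cq * b₂) + - (b3 + cq * b4))) + (- ((cq * c1 + t * c2) + - (c3 + cq * b4)) + ((cq * a2 + t * d2) + - (d3 + cq * d4)))) + ((t * ((a1 + (t * c) * e2) + - (b1 + c * e4)) + - ((a3 + (t * c) * f2) + - (b3 + c * f4))) + (- ((c3 + c * f4) + - (d3 + (c * t) * e4)) + t * ((c2 + c * f2) + - (d2 + (c * t) * e2)))) ≈ 0#
   vanish = tr (+~ (+~ (+~ (-~ (x≈y⇒x-y≈0 A)) (x≈y⇒x-y≈0 B)) (+~ (-~ (x≈y⇒x-y≈0 C)) (x≈y⇒x-y≈0 G))) (+~ (+~ (*ˡ (x≈y⇒x-y≈0 H)) (-~ (x≈y⇒x-y≈0 I))) (+~ (-~ (x≈y⇒x-y≈0 J)) (*ˡ (x≈y⇒x-y≈0 K))))) (solve 1 (\ t -> ((:- :0 :+ :0) :+ (:- :0 :+ :0)) :+ ((t :* :0 :+ :- :0) :+ (:- :0 :+ t :* :0)) := :0) refl t)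
    where
    A : t * a1 + cq * a2 ≈ a3 + cq * a4
    A = E1U l (V1 φ) κ
    push-V : ∀ j (φ1 φ2 ψ1 ψ2 : Fun) x y z w -> (∀ μ -> x * φ1 μ + y * φ2 μ ≈ z * ψ1 μ + w * ψ2 μ) -> x * V j φ1 κ + y * V j φ2 κ ≈ z * V j ψ1 κ + w * V j ψ2 κ
    push-V j φ1 φ2 ψ1 ψ2 x y z w h = tr (+~ (sym (V-* j x φ1 κ)) (sym (V-* j y φ2 κ))) (tr (sym (V-+ j (\ μ -> x * φ1 μ) (\ μ -> y * φ2 μ) κ)) (tr (V-cong j h κ) (tr (V-+ j (\ μ -> z * ψ1 μ) (\ μ -> w * ψ2 μ) κ) (+~ (V-* j z ψ1 κ) (V-* j w ψ2 κ)))))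
    push-U : ∀ j (φ1 φ2 ψ1 ψ2 : Fun) x y z w -> (∀ μ -> x * φ1 μ + y * φ2 μ ≈ z * ψ1 μ + w * ψ2 μ) -> x * U j φ1 κ + y * U j φ2 κ ≈ z * U j ψ1 κ + w * U j ψ2 κ
    push-U j φ1 φ2 ψ1 ψ2 x y z w h = tr (+~ (sym (U-* j x φ1 κ)) (sym (U-* j y φ2 κ))) (tr (sym (U-+ j (\ μ -> x * φ1 μ) (\ μ -> y * φ2 μ) κ)) (tr (U-cong j h κ) (tr (U-+ j (\ μ -> z * ψ1 μ) (\ μ -> w * ψ2 μ) κ) (+~ (U-* j z ψ1 κ) (U-* j w ψ2 κ)))))
    1* : ∀ {x} -> 1# * x ≈ x
    1* = il _
    B : t * b1 + cq * b₂ ≈ b3 + cq * b4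
    B = tr (push-V (suc k) (E1 (U₀ φ)) (U1 (D φ)) (U₀ (E1 φ)) (D (U1 φ)) t cq 1# cq (\ μ -> tr (E1U l φ μ) (+ʳ (sym 1*)))) (+ʳ 1*)
    C : cq * c1 + t * c2 ≈ c3 + cq * b4
    C = F1V k (U1 φ) κ
    G : cq * a2 + t * d2 ≈ d3 + cq * d4
    G = tr (push-U (suc l) (D (V1 φ)) (V₀ (F1 φ)) (F1 (V₀ φ)) (V1 (D φ)) cq t 1# cq (\ μ -> tr (F1V k φ μ) (+ʳ (sym 1*)))) (+ʳ 1*)
    H : a1 + (t * c) * e2 ≈ b1 + c * e4
    H = tr (+ʳ (E-cong true {U₀ (V1 φ)} {V1 (U₀ φ)} (\ μ -> h1 φ μ) κ)) (E1V k (U₀ φ) κ)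
    I : a3 + (t * c) * f2 ≈ b3 + c * f4
    I = tr (+ˡ (*ˡ (sym (h3 (D φ) κ)))) (tr (tr (+ʳ (sym 1*)) (push-U l (E1 (V1 φ)) (V₀ (D φ)) (V1 (E1 φ)) (D (V₀ φ)) 1# (t * c) 1# c (\ μ -> tr (+ʳ 1*) (tr (E1V k φ μ) (+ʳ (sym 1*)))))) (+ʳ (tr 1* (h1 (E1 φ) κ))))
    J : c3 + c * f4 ≈ d3 + (c * t) * e4
    J = tr (+ʳ (F-cong true {V₀ (U1 φ)} {U1 (V₀ φ)} (\ μ -> sym (h2 φ μ)) κ)) (tr (F1U l (V₀ φ) κ) (+ˡ (*ˡ (*ˡ (h3 φ κ)))))
    K : c2 + c * f2 ≈ d2 + (c * t) * e2
    K = tr (tr (+ʳ (sym 1*)) (push-V k (F1 (U1 φ)) (U₀ (D φ)) (U1 (F1 φ)) (D (U₀ φ)) 1# c 1# (c * t) (\ μ -> tr (+ʳ 1*) (tr (F1U l φ μ) (+ʳ (sym 1*)))))) (+ʳ (tr 1* (sym (h2 (F1 φ) κ))))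
  X-+ : ∀ l k (φ ψ : Fun) κ -> X l k (\ μ -> φ μ + ψ μ) κ ≈ X l k φ κ + X l k ψ κ
  X-+ l k φ ψ κ = tr (+~ (tr (U-cong l {V k (\ μ -> φ μ + ψ μ)} {\ μ -> V k φ μ + V k ψ μ} (V-+ k φ ψ) κ) (U-+ l (V k φ) (V k ψ) κ)) (-~ (tr (V-cong k {U l (\ μ -> φ μ + ψ μ)} {\ μ -> U l φ μ + U l ψ μ} (U-+ l φ ψ) κ) (V-+ k (U l φ) (U l ψ) κ)))) (solve 4 (\ a b c d -> (a :+ b) :+ :- (c :+ d) := (a :+ :- c) :+ (b :+ :- d)) refl _ _ _ _)
  X-* : ∀ l k x (φ : Fun) κ -> X l k (\ μ -> x * φ μ) κ ≈ x * X l k φ κ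
  X-* l k x φ κ = tr (+~ (tr (U-cong l {V k (\ μ -> x * φ μ)} {\ μ -> x * V k φ μ} (V-* k x φ) κ) (U-* l x (V k φ) κ)) (-~ (tr (V-cong k {U l (\ μ -> x * φ μ)} {\ μ -> x * U l φ μ} (U-* l x φ) κ) (V-* k x (U l φ) κ)))) (solve 3 (\ x a b -> x :* a :+ :- (x :* b) := x :* (a :+ :- b)) refl _ _ _)
  X-cong : ∀ l k {φ ψ : Fun} -> (∀ κ -> φ κ ≈ ψ κ) -> ∀ κ -> X l k φ κ ≈ X l k ψ κ
  X-cong l k {φ} {ψ} h κ = +~ (U-cong l {V k φ} {V k ψ} (V-cong k {φ} {ψ} h) κ) (-~ (V-cong k {U l φ} {U l ψ} (U-cong l {φ} {ψ} h) κ))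
  -- An operator commuting with D is diagonal, because D separates points.
  diagonal : ∀ l k -> (∀ φ κ -> D (X l k φ) κ ≈ X l k (D φ) κ) -> ∀ φ κ -> X l k φ κ ≈ X l k (δ κ) κ * φ κ
  diagonal l k comm φ κ = begin X l k φ κ ≈⟨ X-cong l k {φ} {\ μ -> φ κ * δ κ μ + (size κ * ψ μ + - 1# * D ψ μ)} decompose κ ⟩ X l k (\ μ -> φ κ * δ κ μ + (size κ * ψ μ + - 1# * D ψ μ)) κ ≈⟨ X-+ l k (\ μ -> φ κ * δ κ μ) (\ μ -> size κ * ψ μ + - 1# * D ψ μ) κ ⟩ X l k (\ μ -> φ κ * δ κ μ) κ + X l k (\ μ -> size κ * ψ μ + - 1# * D ψ μ) κ ≈⟨ +~ (X-* l k (φ κ) (δ κ) κ) (tr (X-+ l k (\ μ -> size κ * ψ μ) (\ μ -> - 1# * D ψ μ) κ) (+~ (X-* l k (size κ) ψ κ) (X-* l k (- 1#) (D ψ) κ))) ⟩ φ κ * X l k (δ κ) κ + (size κ * X l k ψ κ + - 1# * X l k (D ψ) κ) ≈⟨ +ˡ (+ˡ (*ˡ (comm ψ κ))) ⟨ φ κ * X l k (δ κ) κ + (size κ * X l k ψ κ + - 1# * (size κ * X l k ψ κ)) ≈⟨ solve 4 (\ a x s y -> a :* x :+ (s :* y :+ :- :1 :* (s :* y)) := x :* a) refl _ _ _ _ ⟩ X l k (δ κ) κ * φ κ ∎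
   where
   ψ : Fun
   ψ μ with κ ≟v μ
   ... | yes _ = 0#
   ... | no ne = proj₁ (quot (φ μ) (size κ + - size μ) (-‿~0 (sep κ μ ne)))
   -- φ is its value at κ times δ κ plus (size κ - D) ψ. As X commutes with D, the value at κ of X
   -- applied to the second part is 0.
   decompose : ∀ μ -> φ μ ≈ φ κ * δ κ μ + (size κ * ψ μ + - 1# * D ψ μ)
   decompose μ with κ ≟v μ
   ... | yes E.refl = sym (tr (+ʳ (*ˡ (δ-same κ))) (solve 2 (\ a s -> a :* :1 :+ (s :* :0 :+ :- :1 :* (s :* :0)) := a) refl _ _))
   ... | no ne = sym (tr (+ʳ (tr (*ˡ (δ-diff κ μ (\ e -> ne (E.sym e)))) (*0 _))) (tr (solve 3 (\ s u z -> :0 :+ (s :* z :+ :- :1 :* (u :* z)) := z :* (s :+ :- u)) refl _ _ _) (proj₂ (quot (φ μ) (size κ + - size μ) (-‿~0 (sep κ μ ne))))))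
  e~0 : ∀ i κ -> ¬ (e i κ ≈ 0#)
  e~0 i κ = *-~0 (*-~0 (*-~0 p~0 (Π-~0 {n} _ (\ _ -> r~0))) (\ z -> 1~0 (tr (sym (h-inv i)) (tr (*ʳ z) (0* _))))) (Π-~0 _ entry)
   where
   entry : ∀ j -> ¬ (offdiag p κ i j ≈ 0#)
   entry j z with i FinP.≟ j
   ... | yes _ = 1~0 z
   ... | no ne = -‿~0 (pos≉p i j _ _) (tr (sym (proj₂ (quot (at κ i + - (p * at κ j)) (at κ i + - at κ j) (-‿~0 (pos≉row i j _ _ ne))))) (tr (*ʳ z) (0* _)))
  private
   not-pred : ∀ a -> ¬ a ≡ Z.pred a
   not-pred a e = not-suc a 0 (E.sym (cong Z.suc (ZP.+-identityʳ a >> e) >> ZP.suc-pred a))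
  dn-inj : ∀ i j (κ : Vec ℤ n) -> dn i κ ≡ dn j κ -> i ≡ j
  dn-inj i j κ eq with i FinP.≟ j
  ... | yes e' = e'
  ... | no ne = absurd (not-pred (get κ i) (E.sym (lookup-diff j i Z.pred κ ne) >> cong (\ v -> get v i) (E.sym eq) >> lookup-same i Z.pred κ))
  -- Tested on the δ at `dn i κ`, only the i-th term of E contributes, and its coefficient e i κ can
  -- be cancelled.
  scalar : ∀ l k (χ : Fun) -> (∀ φ κ -> X l k φ κ ≈ χ κ * φ κ) -> (∀ φ κ -> E false (X l k φ) κ ≈ X l k (E false φ) κ) -> ∀ i κ -> χ κ ≈ χ (dn i κ)
  scalar l k χ hχ comm i κ = cancelˡ (e i κ) (e~0 i κ) (begin e i κ * χ κ ≈⟨ *c _ _ ⟩ χ κ * e i κ ≈⟨ *ˡ (sym Eδ) ⟩ χ κ * E false (δ μ) κ ≈⟨ hχ (E false (δ μ)) κ ⟨ X l k (E false (δ μ)) κ ≈⟨ comm (δ μ) κ ⟨ E false (X l k (δ μ)) κ ≈⟨ E-cong false {X l k (δ μ)} {\ ν -> χ ν * δ μ ν} (hχ (δ μ)) κ ⟩ E false (\ ν -> χ ν * δ μ ν) κ ≈⟨ Σ-single i _ (\ j ne -> tr (*ˡ (tr (*ˡ (off j ne)) (*0 _))) (*0 _)) ⟩ e i κ * (χ μ * δ μ μ) ≈⟨ *ˡ (tr (*ˡ (δ-same μ)) (*1 _)) ⟩ e i κ * χ μ ∎)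
   where
   μ = dn i κ
   off : ∀ j -> ¬ j ≡ i -> δ μ (dn j κ) ≈ 0#
   off j ne = δ-diff μ (dn j κ) (\ e' -> ne (dn-inj j i κ e'))
   Eδ : E false (δ μ) κ ≈ e i κ
   Eδ = tr (Σ-single i _ (\ j ne -> tr (*ˡ (off j ne)) (*0 _))) (tr (*ˡ (δ-same μ)) (*1 _))
  module Commute (base : ∀ l k (χ : Fun) -> (∀ φ κ -> X l k φ κ ≈ χ κ * φ κ) -> (∀ i κ -> χ κ ≈ χ (dn i κ)) -> ∀ κ -> χ κ ≈ 0#) where
   V0 : ∀ φ κ -> V 0 φ κ ≈ φ κ
   V0 φ κ = tr (Σc-0 n _) (tr (rf (cong (\ x -> T x κ * (Wi x * φ x)) (∔-0 κ))) (tr (sym (*a _ _ _)) (tr (*ʳ (T-Wi κ)) (il _))))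
    where
    ∔-0 : ∀ {m} (κ : Vec ℤ m) -> κ ∔ replicate m 0 ≡ κ
    ∔-0 [] = E.refl
    ∔-0 (a ∷ κ) = cong₂ _∷_ (ZP.+-identityʳ a) (∔-0 κ)
   U0 : ∀ φ κ -> U 0 φ κ ≈ φ κ
   U0 φ κ = tr (Σc-0 n _) (tr (rf (cong (\ x -> T κ x * (Wi x * φ x)) (∖-0 κ))) (tr (sym (*a _ _ _)) (tr (*ʳ (T-Wi κ)) (il _))))
    where
    ∖-0 : ∀ {m} (κ : Vec ℤ m) -> κ ∖ replicate m 0 ≡ κ
    ∖-0 [] = E.refl
    ∖-0 (a ∷ κ) = cong₂ _∷_ (ZP.+-identityʳ a) (∖-0 κ)
   -- Induction on the indices. U 0 and V 0 are identities; for positive indices the smaller cases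
   -- reduce the commutator to a scalar, which `base` declares to be 0.
   commute : ∀ l k φ κ -> U l (V k φ) κ ≈ V k (U l φ) κ
   commute zero k φ κ = tr (U0 (V k φ) κ) (V-cong k {φ} {U 0 φ} (\ μ -> sym (U0 φ μ)) κ)
   commute (suc l) zero φ κ = tr (U-cong (suc l) {V 0 φ} {φ} (V0 φ) κ) (sym (V0 (U (suc l) φ) κ))
   commute (suc l) (suc k) φ κ = x-y≈0⇒x≈y (tr (diag φ κ) (tr (*ʳ (base (suc l) (suc k) _ diag (scalar (suc l) (suc k) _ diag EX) κ)) (0* _)))
    where
    diag : ∀ φ κ -> X (suc l) (suc k) φ κ ≈ X (suc l) (suc k) (δ κ) κ * φ κ
    diag = diagonal (suc l) (suc k) (DX l k (commute l (suc k)) (commute (suc l) k) (commute l k))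
    EX : ∀ φ κ -> E false (X (suc l) (suc k) φ) κ ≈ X (suc l) (suc k) (E false φ) κ
    EX φ κ = tr (E-+ false (U (suc l) (V (suc k) φ)) (\ μ -> - V (suc k) (U (suc l) φ) μ) κ) (+~ (tr (E0U (suc l) (V (suc k) φ) κ) (U-cong (suc l) {E false (V (suc k) φ)} {V (suc k) (E false φ)} (E0V k φ) κ)) (tr (E-neg false (V (suc k) (U (suc l) φ)) κ) (-~ (tr (E0V k (U (suc l) φ) κ) (V-cong (suc k) {E false (U (suc l) φ)} {U (suc l) (E false φ)} (E0U (suc l) φ) κ)))))

-- Homomorphisms, specialisation of fractions, and substitutions in power series.

module Spec where
 open Kit
 open Ser
 open Frac
 open Comp
 record Hom (A B : CRing) : Set where
  private
   module A = RingKit A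
   module B = RingKit B
  field
   ev : A.Car -> B.Car
   ev-cong : ∀ {x y} -> x A.≈ y -> ev x B.≈ ev y
   ev-+ : ∀ x y -> ev (x A.+ y) B.≈ (ev x B.+ ev y)
   ev-* : ∀ x y -> ev (x A.* y) B.≈ (ev x B.* ev y)
   ev-1 : ev A.1# B.≈ B.1#
  ev-0 : ev A.0# B.≈ B.0#
  ev-0 = B.tr (B.solve 1 (\ x -> x B.:= (x B.:+ x) B.:+ B.:- x) B.refl _) (B.tr (B.+ʳ (B.tr (B.sym (ev-+ A.0# A.0#)) (ev-cong (A.0+ A.0#)))) (B.-‿inverseʳ _))
  ev-neg : ∀ x -> ev (A.- x) B.≈ (B.- ev x)
  ev-neg x = B.x-y≈0⇒x≈y (B.tr (B.+ˡ (B.-‿involutive _)) (B.tr (B.sym (ev-+ (A.- x) x)) (B.tr (ev-cong (A.-‿inverseˡ x)) ev-0)))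
  opaque
   unfolding A.Σs B.Σs
   ev-Σs : ∀ {n} (f : Fin n -> A.Car) -> ev (A.Σs f) B.≈ B.Σs (ev ∘ f)
   ev-Σs {zero} f = ev-0
   ev-Σs {suc n} f = B.tr (ev-+ _ _) (B.+ˡ (ev-Σs (f ∘ suc)))
   ev-Πs : ∀ {n} (f : Fin n -> A.Car) -> ev (A.Πs f) B.≈ B.Πs (ev ∘ f)
   ev-Πs {zero} f = ev-1
   ev-Πs {suc n} f = B.tr (ev-* _ _) (B.*ˡ (ev-Πs (f ∘ suc)))
  private
   module CA = CompKit A
   module CB = CompKit B
  ev-Σc : ∀ n l (g : Vec ℕ n -> A.Car) -> ev (CA.Σc n l g) B.≈ CB.Σc n l (ev ∘ g)
  ev-Σc zero zero g = B.refl
  ev-Σc zero (suc l) g = ev-0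
  ev-Σc (suc n) zero g = ev-Σc n zero _
  ev-Σc (suc n) (suc l) g = B.tr (ev-+ _ _) (B.+~ (ev-Σc n (suc l) _) (ev-Σc (suc n) l _))
 -- Sp x c : the fraction x specialises to c along the homomorphism, i.e. x has a
 -- representation whose denominator does not vanish there.
 module SpDef (A B : CRing) (DA : Domain A) (DB : Domain B) (H : Hom A B) where
  open Hom H
  private
   module A = RingKit A
   module B = RingKit B
   module FA = FracDef A DA
   module FB = FracDef B DB
   module KA = RingKit FA.Frac
   module KB = RingKit FB.Frac
   module DB = DomainKit B DB
   module DKB = DomainKit FB.Frac FB.FracDom
  record Sp (x : FA.Fr) (c : FB.Fr) : Set where
   constructor mkSp
   field
    a b : A.Car
    xb : x KA.* FA.ι b KA.≈ FA.ι a
    b~0 : ¬ (ev b B.≈ B.0#)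
    cb : c KB.* FB.ι (ev b) KB.≈ FB.ι (ev a)
  sp-cong : ∀ {x x' c c'} -> x KA.≈ x' -> c KB.≈ c' -> Sp x c -> Sp x' c'
  sp-cong ex ec (mkSp a b xb nb cb) = mkSp a b (KA.tr (KA.*ʳ (KA.sym ex)) xb) nb (KB.tr (KB.*ʳ (KB.sym ec)) cb)
  -- Two representations of x satisfy a b' = a' b, an equation in A that the homomorphism preserves.
  sp-unique : ∀ {x c c'} -> Sp x c -> Sp x c' -> c KB.≈ c'
  sp-unique {x} {c} {c'} (mkSp a b xb nb cb) (mkSp a' b' xb' nb' cb') = DKB.cancelˡ (FB.ι (ev b) KB.* FB.ι (ev b')) (DKB.*-~0 (FB.ι~0 nb) (FB.ι~0 nb')) (begin (FB.ι (ev b) * FB.ι (ev b')) * c ≈⟨ solve 3 (\ x y z -> (x :* y) :* z := (z :* x) :* y) refl _ _ _ ⟩ (c * FB.ι (ev b)) * FB.ι (ev b') ≈⟨ *ʳ cb ⟩ FB.ι (ev a) * FB.ι (ev b') ≈⟨ FB.ι-* _ _ ⟨ FB.ι (ev a B.* ev b') ≈⟨ FB.ι-cong (B.tr (B.sym (ev-* a b')) (B.tr (ev-cong cross) (ev-* a' b))) ⟩ FB.ι (ev a' B.* ev b) ≈⟨ FB.ι-* _ _ ⟩ FB.ι (ev a') * FB.ι (ev b) ≈⟨ *ʳ cb' ⟨ (c' * FB.ι (ev b')) * FB.ι (ev b) ≈⟨ solve 3 (\ x y z -> (z :* y) :* x := (x :* y) :* z) refl _ _ _ ⟩ (FB.ι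 (ev b) * FB.ι (ev b')) * c' ∎)
   where
   open KB
   cross : a A.* b' A.≈ a' A.* b
   cross = FA.ι-injective (KA.tr (FA.ι-* a b') (KA.tr (KA.*ʳ (KA.sym xb)) (KA.tr (KA.solve 3 (\ x y z -> (x KA.:* y) KA.:* z KA.:= (x KA.:* z) KA.:* y) KA.refl x (FA.ι b) (FA.ι b')) (KA.tr (KA.*ʳ xb') (KA.sym (FA.ι-* a' b))))))
  sp-ι : ∀ x -> Sp (FA.ι x) (FB.ι (ev x))
  sp-ι x = mkSp x A.1# (KA.tr (KA.*ˡ FA.ι-1) (KA.*1 _)) (\ e -> DB.1~0 (B.tr (B.sym ev-1) e)) (KB.tr (KB.*ˡ (KB.tr (FB.ι-cong ev-1) FB.ι-1)) (KB.*1 _))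
  sp-0 : Sp KA.0# KB.0#
  sp-0 = sp-cong FA.ι-0 (KB.tr (FB.ι-cong ev-0) FB.ι-0) (sp-ι A.0#)
  sp-1 : Sp KA.1# KB.1#
  sp-1 = sp-cong FA.ι-1 (KB.tr (FB.ι-cong ev-1) FB.ι-1) (sp-ι A.1#)
  sp-* : ∀ {x y c d} -> Sp x c -> Sp y d -> Sp (x KA.* y) (c KB.* d)
  sp-* {x} {y} {c} {d} (mkSp a b xb nb cb) (mkSp a' b' xb' nb' cb') = mkSp (a A.* a') (b A.* b') (KA.tr (KA.*ˡ (FA.ι-* b b')) (KA.tr (KA.solve 4 (\ x y b b' -> (x KA.:* y) KA.:* (b KA.:* b') KA.:= (x KA.:* b) KA.:* (y KA.:* b')) KA.refl x y _ _) (KA.tr (KA.*~ xb xb') (KA.sym (FA.ι-* a a'))))) (\ e -> DB.*-~0 nb nb' (B.tr (B.sym (ev-* b b')) e)) (KB.tr (KB.*ˡ (KB.tr (FB.ι-cong (ev-* b b')) (FB.ι-* _ _))) (KB.tr (KB.solve 4 (\ x y b b' -> (x KB.:* y) KB.:* (b KB.:* b') KB.:= (x KB.:* b) KB.:* (y KB.:* b')) KB.refl c d _ _) (KB.tr (KB.*~ cb cb') (KB.tr (KB.sym (FB.ι-* _ _)) (FB.ι-cong (B.sym (ev-* a a')))))))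
  sp-+ : ∀ {x y c d} -> Sp x c -> Sp y d -> Sp (x KA.+ y) (c KB.+ d)
  sp-+ {x} {y} {c} {d} (mkSp a b xb nb cb) (mkSp a' b' xb' nb' cb') = mkSp (a A.* b' A.+ a' A.* b) (b A.* b') (KA.tr (KA.*ˡ (FA.ι-* b b')) (KA.tr (KA.solve 4 (\ x y b b' -> (x KA.:+ y) KA.:* (b KA.:* b') KA.:= (x KA.:* b) KA.:* b' KA.:+ (y KA.:* b') KA.:* b) KA.refl x y _ _) (KA.tr (KA.+~ (KA.*ʳ xb) (KA.*ʳ xb')) (KA.sym (KA.tr (FA.ι-+ _ _) (KA.+~ (FA.ι-* _ _) (FA.ι-* _ _))))))) (\ e -> DB.*-~0 nb nb' (B.tr (B.sym (ev-* b b')) e)) (KB.tr (KB.*ˡ (KB.tr (FB.ι-cong (ev-* b b')) (FB.ι-* _ _))) (KB.tr (KB.solve 4 (\ x y b b' -> (x KB.:+ y) KB.:* (b KB.:* b') KB.:= (x KB.:* b) KB.:* b' KB.:+ (y KB.:* b') KB.:* b) KB.refl c d _ _) (KB.tr (KB.+~ (KB.*ʳ cb) (KB.*ʳ cb')) (KB.sym (KB.tr (FB.ι-cong (B.tr (ev-+ _ _) (B.+~ (ev-* _ _) (ev-* _ _)))) (KB.tr (FB.ι-+ _ _) (KB.+~ (FB.ι-* _ _) (FB.ι-* _ _))))))))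
  sp-neg : ∀ {x c} -> Sp x c -> Sp (KA.- x) (KB.- c)
  sp-neg {x} {c} (mkSp a b xb nb cb) = mkSp (A.- a) b (KA.tr (KA.sym (KA.-‿distribˡ-* x _)) (KA.tr (KA.-~ xb) (KA.sym (FA.ι-neg a)))) nb (KB.tr (KB.sym (KB.-‿distribˡ-* c _)) (KB.tr (KB.-~ cb) (KB.sym (KB.tr (FB.ι-cong (ev-neg a)) (FB.ι-neg _)))))
  -- The representation is turned upside down. The new denominator a does not vanish under `ev`,
  -- because otherwise c would be 0 although it has the inverse d.
  sp-inv : ∀ {x y c d} -> Sp x c -> x KA.* y KA.≈ KA.1# -> c KB.* d KB.≈ KB.1# -> Sp y d
  sp-inv {x} {y} {c} {d} (mkSp a b xb nb cb) xy cd = mkSp b a (KA.tr (KA.*ˡ (KA.sym xb)) (KA.tr (KA.solve 3 (\ x y b -> y KA.:* (x KA.:* b) KA.:= (x KA.:* y) KA.:* b) KA.refl x y _) (KA.tr (KA.*ʳ xy) (KA.il _)))) (\ e -> DKB.1~0 (KB.tr (KB.sym cd) (KB.tr (KB.*ʳ (c≈0 e)) (KB.0* d)))) (KB.tr (KB.*ˡ (KB.sym cb)) (KB.tr (KB.solve 3 (\ x y b -> y KB.:* (x KB.:* b) KB.:= (x KB.:* y) KB.:* b) KB.refl c d _) (KB.tr (KB.*ʳ cd) (KB.il _))))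
   where
   c≈0 : ev a B.≈ B.0# -> c KB.≈ KB.0#
   c≈0 e = DKB.zero-product (FB.ι (ev b)) c (KB.tr (KB.*c _ _) (KB.tr cb (KB.tr (FB.ι-cong e) FB.ι-0))) (FB.ι~0 nb)
  private
   module CA = CompKit FA.Frac
   module CB = CompKit FB.Frac
  opaque
   unfolding KA.Πs KB.Πs
   sp-Π : ∀ {n} {f : Fin n -> FA.Fr} {g : Fin n -> FB.Fr} -> (∀ i -> Sp (f i) (g i)) -> Sp (KA.Πs f) (KB.Πs g)
   sp-Π {zero} h = sp-1
   sp-Π {suc n} h = sp-* (h zero) (sp-Π (h ∘ suc))
  sp-Σc : ∀ n l {f : Vec ℕ n -> FA.Fr} {g : Vec ℕ n -> FB.Fr} -> (∀ m -> Sp (f m) (g m)) -> Sp (CA.Σc n l f) (CB.Σc n l g)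
  sp-Σc zero zero h = h []
  sp-Σc zero (suc l) h = sp-0
  sp-Σc (suc n) zero h = sp-Σc n zero (\ m -> h (0 ∷ m))
  sp-Σc (suc n) (suc l) h = sp-+ (sp-Σc n (suc l) (\ m -> h (0 ∷ m))) (sp-Σc (suc n) l (\ m -> h (inc zero m)))
 module ExtendDef (A B : CRing) (DA : Domain A) (DB : Domain B) (H : Hom A B) (inj : ∀ x -> RingKit._≈_ B (Hom.ev H x) (RingKit.0# B) -> RingKit._≈_ A x (RingKit.0# A)) where
  open Hom H
  open SpDef A B DA DB H
  private
   module FA = FracDef A DA
   module FB = FracDef B DB
   module KA = RingKit FA.Frac
   module KB = RingKit FB.Frac
   open Field FB.FracField using (inv; inv-r)
  -- Under an injective homomorphism no denominator becomes 0, so every fraction specialises and the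
  -- specialisation is a function.
  image : FA.Fr -> FB.Fr
  image x = FB.ι (ev (FA.num x)) KB.* inv (FB.ι (ev (FA.den x))) (FB.ι~0 (\ e -> FA.den~0 x (inj _ e)))
  image-sp : ∀ x -> Sp x (image x)
  image-sp x = mkSp (FA.num x) (FA.den x) (FA.num-den x) (\ e -> FA.den~0 x (inj _ e)) (KB.tr (KB.*a _ _ _) (KB.tr (KB.*ˡ (KB.tr (KB.*c _ _) (inv-r _ _))) (KB.*1 _)))
  extend : Hom FA.Frac FB.Frac
  extend = record { ev = image ; ev-cong = \ {x} {y} e -> sp-unique (image-sp x) (sp-cong (KA.sym e) KB.refl (image-sp y)) ; ev-+ = \ x y -> sp-unique (image-sp _) (sp-+ (image-sp x) (image-sp y)) ; ev-* = \ x y -> sp-unique (image-sp _) (sp-* (image-sp x) (image-sp y)) ; ev-1 = sp-unique (image-sp _) sp-1 }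
  extend-ι : ∀ x -> image (FA.ι x) KB.≈ FB.ι (ev x)
  extend-ι x = sp-unique (image-sp _) (sp-ι x)
 module MonDef (R : CRing) where
  open RingKit R
  open SerDef R
  private module S = RingKit Ser
  mon : ℕ -> Car -> ℕ -> Car
  mon a x = shift a (const x)
  mon-at : ∀ a x -> mon a x a ≈ x
  mon-at zero x = refl
  mon-at (suc a) x = mon-at a x
  mon-off : ∀ a x k -> ¬ a ≡ k -> mon a x k ≈ 0#
  mon-off zero x zero ne = absurd (ne E.refl)
  mon-off zero x (suc k) ne = refl
  mon-off (suc a) x zero ne = refl
  mon-off (suc a) x (suc k) ne = mon-off a x k (\ e -> ne (cong suc e))
  mon-cong : ∀ a {x y} -> x ≈ y -> mon a x S.≈ mon a y
  mon-cong zero e zero = e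
  mon-cong zero e (suc k) = refl
  mon-cong (suc a) e zero = refl
  mon-cong (suc a) e (suc k) = mon-cong a e k
  shift-⋆ : ∀ a A B k -> (shift (suc a) A ⋆ B) (suc k) ≈ (shift a A ⋆ B) k
  shift-⋆ a A B k = tr (sumR-head (suc k) _) (tr (+ʳ (0* _)) (0+ _))
  shift-mul : ∀ a A B -> (shift a A S.* B) S.≈ shift a (A S.* B)
  shift-mul zero A B k = refl
  shift-mul (suc a) A B zero = tr (0+ _) (0* _)
  shift-mul (suc a) A B (suc k) = tr (shift-⋆ a A B k) (shift-mul a A B k)
  shift-cong : ∀ a {A B : ℕ -> Car} -> (∀ k -> A k ≈ B k) -> ∀ k -> shift a A k ≈ shift a B k
  shift-cong zero e k = e k
  shift-cong (suc a) e zero = refl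
  shift-cong (suc a) e (suc k) = shift-cong a e k
  shift-shift : ∀ a b A k -> shift a (shift b A) k ≈ shift (a N.+ b) A k
  shift-shift zero b A k = refl
  shift-shift (suc a) b A zero = refl
  shift-shift (suc a) b A (suc k) = shift-shift a b A k
  const-mul : ∀ x y -> (const x S.* const y) S.≈ const (x * y)
  const-mul x y zero = tr (const-⋆ x (const y) zero) refl
  const-mul x y (suc k) = tr (const-⋆ x (const y) (suc k)) (*0 x)
  mon-mul : ∀ a b x y -> (mon a x S.* mon b y) S.≈ mon (a N.+ b) (x * y)
  mon-mul a b x y = S.tr (shift-mul a (const x) (mon b y)) (S.tr (shift-cong a (S.tr (S.*c (const x) (mon b y)) (S.tr (shift-mul b (const y) (const x)) (shift-cong b (S.tr (S.*c (const y) (const x)) (const-mul x y)))))) (shift-shift a b (const (x * y))))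
  mon-inj : ∀ a b x y -> mon a x S.≈ mon b y -> ¬ (x ≈ 0#) -> (a ≡ b) × (x ≈ y)
  mon-inj a b x y e nx with a N.≟ b
  ... | yes E.refl = E.refl , tr (sym (mon-at a x)) (tr (e a) (mon-at a y))
  ... | no ne = absurd (nx (tr (sym (mon-at a x)) (tr (e a) (mon-off b y a (\ e -> ne (E.sym e))))))
  opaque
   unfolding Σs S.Σs
   Σs-at : ∀ {n} (f : Fin n -> S.Car) k -> S.Σs f k ≈ Σs (\ i -> f i k)
   Σs-at {zero} f k = refl
   Σs-at {suc n} f k = +ˡ (Σs-at (f ∘ suc) k)
  ev0 : Hom Ser R
  ev0 = record { ev = \ A -> A 0 ; ev-cong = \ e -> e 0 ; ev-+ = \ _ _ -> refl ; ev-* = \ _ _ -> 0+ _ ; ev-1 = refl }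
  -- The substitution s ↦ q s.
  dilate : (q : Car) -> Hom Ser Ser
  dilate q = record { ev = \ A k -> pw k * A k ; ev-cong = \ e k -> *ˡ (e k) ; ev-+ = \ A B k -> distribˡ _ _ _ ; ev-* = mul ; ev-1 = \ { zero -> il _ ; (suc k) -> *0 _ } }
   where
   open PickKit R
   pw : ℕ -> Car
   pw = pow q
   pw-+ : ∀ a b -> pw (a N.+ b) ≈ pw a * pw b
   pw-+ zero b = sym (il _)
   pw-+ (suc a) b = tr (*ˡ (pw-+ a b)) (sym (*a _ _ _))
   mul : ∀ A B k -> pw k * (A ⋆ B) k ≈ ((\ k -> pw k * A k) ⋆ (\ k -> pw k * B k)) k
   mul A B k = tr (sumR-*ˡ (suc k) _ _) (sumR-cong< (suc k) (\ { i (N.s≤s i≤k) -> tr (*ʳ (tr (rf (cong pw (E.sym (NP.m+[n∸m]≡n i≤k)))) (pw-+ i (k N.∸ i)))) (solve 4 (\ p q a b -> (p :* q) :* (a :* b) := (p :* a) :* (q :* b)) refl _ _ _ _) }))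
 module CollapseDef (R : CRing) where
  open RingKit R
  open SerDef R
  open MonDef R
  private
   S : CRing
   S = Ser
   module S = RingKit S
   module SS = SerDef S
   module MS = MonDef S
  -- The substitution of the inner variable for the outer one: in total degree m only the finitely
  -- many coefficients A k (m - k) are involved.
  col : (ℕ -> ℕ -> Car) -> ℕ -> Car
  col A m = sumR (suc m) (\ k -> A k (m N.∸ k))
  sumR-at : ∀ n (f : ℕ -> S.Car) k -> S.sumR n f k ≈ sumR n (\ i -> f i k)
  sumR-at zero f k = refl
  sumR-at (suc n) f k = +ʳ (sumR-at n f k)
  private
   col-* : ∀ A B m -> col (A SS.⋆ B) m ≈ (col A ⋆ col B) m
   col-* A B m = begin sumR (suc m) (\ k -> S.sumR (suc k) (\ i -> A i S.* B (k N.∸ i)) (m N.∸ k)) ≈⟨ sumR-cong (suc m) (\ k -> sumR-at (suc k) _ _) ⟩ sumR (suc m) (\ k -> sumR (suc k) (\ i -> (A i ⋆ B (k N.∸ i)) (m N.∸ k))) ≈⟨ sumR-cong (suc m) (\ k -> sumR-cong< (suc k) (\ { i (N.s≤s i≤k) -> rf (cong (\ z -> (A i ⋆ B (k N.∸ i)) (m N.∸ z)) (E.sym (NP.m+[n∸m]≡n i≤k))) })) ⟩ sumR (suc m) (\ k -> sumR (suc k) (\ i -> (A i ⋆ B (k N.∸ i)) (m N.∸ (i N.+ (k N.∸ i))))) ≈⟨ sumR-triangle m (\ i j -> (A i ⋆ B j) (m N.∸ (i N.+ j))) ⟩ sumR (suc m) (\ i -> sumR (suc (m N.∸ i)) (\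 j -> (A i ⋆ B j) (m N.∸ (i N.+ j)))) ≈⟨ sumR-cong (suc m) (\ i -> inner i) ⟩ sumR (suc m) (\ i -> sumR (suc (m N.∸ i)) (\ a -> A i a * col B ((m N.∸ i) N.∸ a))) ≈⟨ sumR-cong (suc m) (\ i -> sumR-cong (suc (m N.∸ i)) (\ a -> *ˡ (rf (cong (col B) (NP.∸-+-assoc m i a))))) ⟩ sumR (suc m) (\ i -> sumR (suc (m N.∸ i)) (\ a -> A i a * col B (m N.∸ (i N.+ a)))) ≈⟨ sumR-triangle m (\ i a -> A i a * col B (m N.∸ (i N.+ a))) ⟨ sumR (suc m) (\ k -> sumR (suc k) (\ i -> A i (k N.∸ i) * col B (m N.∸ (i N.+ (k N.∸ i))))) ≈⟨ sumR-cong (suc m) (\ k -> tr (sumR-cong< (suc k) (\ { i (N.s≤s i≤k) -> *ˡ (rf (cong (\ z -> col B (m N.∸ z)) (NP.m+[n∸m]≡n i≤k))) })) (sym (sumR-*ʳ (suc k) _ _))) ⟩ sumR (suc m) (\ k -> col A k * col B (m N.∸ k)) ∎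
    where
    inner : ∀ i -> sumR (suc (m N.∸ i)) (\ j -> (A i ⋆ B j) (m N.∸ (i N.+ j))) ≈ sumR (suc (m N.∸ i)) (\ a -> A i a * col B ((m N.∸ i) N.∸ a))
    inner i = begin sumR (suc M) (\ j -> (A i ⋆ B j) (m N.∸ (i N.+ j))) ≈⟨ sumR-cong (suc M) (\ j -> tr (rf (cong (A i ⋆ B j) (E.sym (NP.∸-+-assoc m i j)))) (⋆-comm (A i) (B j) (M N.∸ j))) ⟩ sumR (suc M) (\ j -> sumR (suc (M N.∸ j)) (\ b -> B j b * A i (M N.∸ j N.∸ b))) ≈⟨ sumR-cong (suc M) (\ j -> sumR-cong (suc (M N.∸ j)) (\ b -> *ˡ (rf (cong (A i) (NP.∸-+-assoc M j b))))) ⟩ sumR (suc M) (\ j -> sumR (suc (M N.∸ j)) (\ b -> B j b * A i (M N.∸ (j N.+ b)))) ≈⟨ sumR-triangle M (\ j b -> B j b * A i (M N.∸ (j N.+ b))) ⟨ sumR (suc M) (\ k -> sumR (suc k) (\ j -> B j (k N.∸ j) * A i (M N.∸ (j N.+ (k N.∸ j))))) ≈⟨ sumR-cong (suc M) (\ k -> tr (sumR-cong< (suc k) (\ { j (N.s≤s j≤k) -> *ˡ (rf (cong (\ z -> A i (M N.∸ z)) (NP.m+[n∸m]≡n j≤k))) })) (sym (sumR-*ʳ (suc k) _ _))) ⟩ (col B ⋆ A i) M ≈⟨ ⋆-comm (col B) (A i) M ⟩ sumR (suc M) (\ a -> A i a * col B (M N.∸ a)) ∎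
     where M = m N.∸ i
  col-mon : ∀ a x m -> col (MS.mon a x) m ≈ shift a x m
  col-mon a x m with a N.≤? m
  ... | yes a≤m = tr (sumR-single (suc m) a _ (N.s≤s a≤m) (\ k _ ne -> MS.mon-off a x k (\ e -> ne (E.sym e)) (m N.∸ k))) (tr (MS.mon-at a x (m N.∸ a)) (sym (shift-≥ a m a≤m)))
   where
   shift-≥ : ∀ a m -> a N.≤ m -> shift a x m ≈ x (m N.∸ a)
   shift-≥ zero m _ = refl
   shift-≥ (suc a) (suc m) (N.s≤s le) = shift-≥ a m le
  ... | no a≰m = tr (sumR-zero (suc m) (\ { k (N.s≤s k≤m) -> MS.mon-off a x k (\ { E.refl -> a≰m k≤m }) (m N.∸ k) })) (sym (shift-< a m (NP.≰⇒> a≰m)))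
   where
   shift-< : ∀ a m -> m N.< a -> shift a x m ≈ 0#
   shift-< (suc a) zero _ = refl
   shift-< (suc a) (suc m) (N.s≤s lt) = shift-< a m lt
  collapse : Hom SS.Ser S
  collapse = record { ev = col ; ev-cong = \ e m -> sumR-cong (suc m) (\ k -> e k _) ; ev-+ = \ A B m -> sumR-+ (suc m) _ _ ; ev-* = col-* ; ev-1 = \ m -> col-mon 0 (const 1#) m }

-- Positions and pair weights realised by monomials in s, q, t.

module Model where
 open Kit
 open Ser
 open Frac
 open Comp
 open Core
 open Spec
 open import Data.Fin using (opposite)
 open import Data.Vec using (tabulate)
 open import Relation.Binary.Definitions using (tri<; tri≈; tri>)
 -- The relative position of the rows i and j: lt d means j = i + 1 + d.
 data Ord : Set where
  lt gt : ℕ -> Ord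
  eq : Ord
 ordℕ : ℕ -> ℕ -> Ord
 ordℕ zero zero = eq
 ordℕ zero (suc j) = lt j
 ordℕ (suc i) zero = gt i
 ordℕ (suc i) (suc j) = ordℕ i j
 ord : ∀ {n} -> Fin n -> Fin n -> Ord
 ord i j = ordℕ (toℕ i) (toℕ j)
 data OrdView (i j : ℕ) : Ord -> Set where
  v-lt : ∀ d -> j ≡ suc d N.+ i -> OrdView i j (lt d)
  v-gt : ∀ d -> i ≡ suc d N.+ j -> OrdView i j (gt d)
  v-eq : i ≡ j -> OrdView i j eq
 ordView : ∀ i j -> OrdView i j (ordℕ i j)
 ordView zero zero = v-eq E.refl
 ordView zero (suc j) = v-lt j (cong suc (E.sym (NP.+-identityʳ j)))
 ordView (suc i) zero = v-gt i (cong suc (E.sym (NP.+-identityʳ i)))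
 ordView (suc i) (suc j) with ordℕ i j | ordView i j
 ... | _ | v-lt d e = v-lt d (cong suc e >> E.sym (NP.+-suc (suc d) i))
 ... | _ | v-gt d e = v-gt d (cong suc e >> E.sym (NP.+-suc (suc d) j))
 ... | _ | v-eq e = v-eq (cong suc e)
 Mono : Set
 Mono = ℕ × ℕ × ℕ
 -- The two monomials s^a q^b t^c whose difference is the numerator, respectively the denominator,
 -- of τ(e + 1) / τ(e). For i < j and e ≥ 0 the ratio is (1 - s^(d+1) q^e t) / (1 - s^(d+1)
 -- q^(e+1)); negative powers of q are cleared, and for i > j a factor q/t is included. On the
 -- diagonal the values for negative e are fillers, `tz` being 0 there.
 numM denM : Ord -> ℤ -> Mono × Mono
 numM (lt d) (+ e) = (0 , 0 , 0) , (suc d , e , 1)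
 numM (lt d) -[1+ k ] = (0 , suc k , 0) , (suc d , 0 , 1)
 numM (gt d) (+ e) = (suc d , 1 , 0) , (0 , suc e , 1)
 numM (gt d) -[1+ k ] = (suc d , suc k , 0) , (0 , 0 , 1)
 numM eq (+ e) = (0 , 0 , 0) , (0 , e , 1)
 numM eq -[1+ k ] = (0 , 0 , 0) , (0 , 0 , 1)
 denM (lt d) (+ e) = (0 , 0 , 0) , (suc d , suc e , 0)
 denM (lt d) -[1+ k ] = (0 , suc k , 0) , (suc d , 1 , 0)
 denM (gt d) (+ e) = (suc d , 0 , 1) , (0 , suc e , 1)
 denM (gt d) -[1+ k ] = (suc d , k , 1) , (0 , 0 , 1)
 denM eq (+ e) = (0 , 0 , 0) , (0 , suc e , 0)
 denM eq -[1+ k ] = (0 , 0 , 0) , (0 , 1 , 0)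
 numM-≢ : ∀ o e -> ¬ proj₁ (numM o e) ≡ proj₂ (numM o e)
 numM-≢ (lt d) (+ e) ()
 numM-≢ (lt d) -[1+ k ] ()
 numM-≢ (gt d) (+ e) ()
 numM-≢ (gt d) -[1+ k ] ()
 numM-≢ eq (+ e) ()
 numM-≢ eq -[1+ k ] ()
 denM-≢ : ∀ o e -> ¬ proj₁ (denM o e) ≡ proj₂ (denM o e)
 denM-≢ (lt d) (+ e) ()
 denM-≢ (lt d) -[1+ k ] ()
 denM-≢ (gt d) (+ e) ()
 denM-≢ (gt d) -[1+ k ] ()
 denM-≢ eq (+ e) ()
 denM-≢ eq -[1+ k ] ()
 vec-ext : ∀ {n} {A : Set} (κ μ : Vec A n) -> (∀ i -> get κ i ≡ get μ i) -> κ ≡ μ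
 vec-ext κ μ h = E.sym (VecP.tabulate∘lookup κ) >> VecP.tabulate-cong h >> VecP.tabulate∘lookup μ
 record Setting : Set₁ where
  field
   R : CRing
   dom : Domain R
  open RingKit R
  open PickKit R
  field
   q t : Car
   q~0 : ¬ (q ≈ 0#)
   t~0 : ¬ (t ≈ 0#)
   mono-inj : ∀ a b c d -> pow q a * pow t b ≈ pow q c * pow t d -> (a ≡ c) × (b ≡ d)
 module ModelDef (Se : Setting) (n : ℕ) where
  open Setting Se
  private
   module R = RingKit R
   module DR = DomainKit R dom
  open PickKit R using (pow) public
  open SerDef R public using (Ser)
  open SerDef.SerDomain R dom public using (SerDom)
  open MonDef R public
  private module S = RingKit Ser
  open FracDef Ser SerDom public renaming (num to numer; den to denom; den~0 to denom~0; num-den to numer-denom)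
  open RingKit Frac
  open DomainKit Frac FracDom
  open Field FracField using (inv; inv-r)
  m2 : ℕ -> ℕ -> R.Car
  m2 b c = pow q b R.* pow t c
  pow~0 : ∀ {x} -> ¬ (x R.≈ R.0#) -> ∀ a -> ¬ (pow x a R.≈ R.0#)
  pow~0 nx zero = DR.1~0
  pow~0 nx (suc a) = DR.*-~0 nx (pow~0 nx a)
  pow-+ : ∀ x a b -> pow x (a N.+ b) R.≈ pow x a R.* pow x b
  pow-+ x zero b = R.sym (R.il _)
  pow-+ x (suc a) b = R.tr (R.*ˡ (pow-+ x a b)) (R.sym (R.*a _ _ _))
  m2~0 : ∀ b c -> ¬ (m2 b c R.≈ R.0#)
  m2~0 b c = DR.*-~0 (pow~0 q~0 b) (pow~0 t~0 c)
  m2-mul : ∀ b c b' c' -> m2 b c R.* m2 b' c' R.≈ m2 (b N.+ b') (c N.+ c')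
  m2-mul b c b' c' = R.tr (R.solve 4 (\ a b c d -> (a R.:* b) R.:* (c R.:* d) R.:= (a R.:* c) R.:* (b R.:* d)) R.refl _ _ _ _) (R.*~ (R.sym (pow-+ q b b')) (R.sym (pow-+ t c c')))
  M3 : Mono -> S.Car
  M3 (a , b , c) = mon a (m2 b c)
  M3-inj : ∀ m m' -> M3 m S.≈ M3 m' -> m ≡ m'
  M3-inj (a , b , c) (a' , b' , c') e with mon-inj a a' _ _ e (m2~0 b c)
  ... | E.refl , e' with mono-inj b c b' c' e'
  ... | E.refl , E.refl = E.refl
  M3~0 : ∀ m -> ¬ (M3 m S.≈ S.0#)
  M3~0 (a , b , c) e = m2~0 b c (R.tr (R.sym (mon-at a _)) (e a))
  _⊗m_ : Mono -> Mono -> Mono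
  (a , b , c) ⊗m (a' , b' , c') = (a N.+ a' , b N.+ b' , c N.+ c')
  M3-mul : ∀ m m' -> M3 m S.* M3 m' S.≈ M3 (m ⊗m m')
  M3-mul (a , b , c) (a' , b' , c') = S.tr (mon-mul a a' (m2 b c) (m2 b' c')) (mon-cong (a N.+ a') (m2-mul b c b' c'))
  bin : Mono × Mono -> S.Car
  bin (m , m') = M3 m S.+ S.- M3 m'
  bin~0 : ∀ mm -> ¬ proj₁ mm ≡ proj₂ mm -> ¬ (bin mm S.≈ S.0#)
  bin~0 (m , m') ne e = ne (M3-inj m m' (S.x-y≈0⇒x≈y e))
  opaque
   mι : Mono -> Fr
   mι m = ι (M3 m)
   mι-mul : ∀ m m' -> mι m * mι m' ≈ mι (m ⊗m m')
   mι-mul m m' = tr (sym (ι-* _ _)) (ι-cong (M3-mul m m'))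
   mι-inj : ∀ m m' -> mι m ≈ mι m' -> m ≡ m'
   mι-inj m m' e = M3-inj m m' (ι-injective e)
   mι~0 : ∀ m -> ¬ (mι m ≈ 0#)
   mι~0 m = ι~0 (M3~0 m)
   mι-1 : mι (0 , 0 , 0) ≈ 1#
   mι-1 = tr (ι-cong (S.tr (mon-cong 0 (R.il R.1#)) (\ { zero -> R.refl ; (suc k) -> R.refl }))) ι-1
   ι-bin : ∀ mm -> ι (bin mm) ≈ mι (proj₁ mm) + - mι (proj₂ mm)
   ι-bin (m , m') = tr (ι-+ _ _) (+ˡ (ι-neg _))
   mι-def : ∀ m -> mι m ≈ ι (M3 m)
   mι-def m = refl
  Q Tt p r : Fr
  Q = mι (0 , 1 , 0)
  Tt = mι (0 , 0 , 1)
  p = Q * inv Tt (mι~0 _)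
  r = Tt * inv Q (mι~0 _)
  pT : p * Tt ≈ Q
  pT = tr (*a _ _ _) (tr (*ˡ (tr (*c _ _) (inv-r Tt _))) (*1 Q))
  rQ : r * Q ≈ Tt
  rQ = tr (*a _ _ _) (tr (*ˡ (tr (*c _ _) (inv-r Q _))) (*1 Tt))
  pr-1 : p * r ≈ 1#
  pr-1 = cancelˡ Q (mι~0 _) (begin Q * (p * r) ≈⟨ solve 3 (\ q p r -> q :* (p :* r) := p :* (r :* q)) refl Q p r ⟩ p * (r * Q) ≈⟨ *ˡ rQ ⟩ p * Tt ≈⟨ pT ⟩ Q ≈⟨ *1 Q ⟨ Q * 1# ∎)
  q^ s^ : ℕ -> Fr
  q^ k = mι (0 , k , 0)
  s^ k = mι (k , 0 , 0)
  qz : ℤ -> Fr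
  qz (+ k) = q^ k
  qz -[1+ k ] = inv (q^ (suc k)) (mι~0 _)
  q^-suc : ∀ k -> q^ (suc k) ≈ Q * q^ k
  q^-suc k = sym (mι-mul (0 , 1 , 0) (0 , k , 0))
  q-qz- : ∀ k -> q^ (suc k) * qz -[1+ k ] ≈ 1#
  q-qz- k = inv-r _ _
  qz-suc : ∀ a -> qz (Z.suc a) ≈ Q * qz a
  qz-suc (+ k) = q^-suc k
  qz-suc -[1+ zero ] = tr mι-1 (sym (q-qz- 0))
  qz-suc -[1+ suc k ] = cancelˡ (q^ (suc k)) (mι~0 _) (begin q^ (suc k) * qz -[1+ k ] ≈⟨ q-qz- k ⟩ 1# ≈⟨ q-qz- (suc k) ⟨ q^ (suc (suc k)) * qz -[1+ suc k ] ≈⟨ *ʳ (q^-suc (suc k)) ⟩ (Q * q^ (suc k)) * qz -[1+ suc k ] ≈⟨ solve 3 (\ a b c -> (a :* b) :* c := b :* (a :* c)) refl _ _ _ ⟩ q^ (suc k) * (Q * qz -[1+ suc k ]) ∎)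
  qz-+ℕ : ∀ a k -> qz (a Z.+ + k) ≈ qz a * q^ k
  qz-+ℕ a zero = tr (rf (cong qz (ZP.+-identityʳ a))) (sym (tr (*ˡ mι-1) (*1 _)))
  qz-+ℕ a (suc k) = begin qz (a Z.+ + suc k) ≈⟨ rf (cong qz (ℤ-+-suc a k)) ⟩ qz (Z.suc (a Z.+ + k)) ≈⟨ qz-suc (a Z.+ + k) ⟩ Q * qz (a Z.+ + k) ≈⟨ *ˡ (qz-+ℕ a k) ⟩ Q * (qz a * q^ k) ≈⟨ solve 3 (\ q a k -> q :* (a :* k) := a :* (q :* k)) refl _ _ _ ⟩ qz a * (Q * q^ k) ≈⟨ *ˡ (q^-suc k) ⟨ qz a * q^ (suc k) ∎
  qz-+ : ∀ a b -> qz (a Z.+ b) ≈ qz a * qz b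
  qz-+ a (+ k) = qz-+ℕ a k
  qz-+ a -[1+ k ] = cancelˡ (q^ (suc k)) (mι~0 _) (begin q^ (suc k) * qz (a Z.+ -[1+ k ]) ≈⟨ *c _ _ ⟩ qz (a Z.+ -[1+ k ]) * q^ (suc k) ≈⟨ qz-+ℕ (a Z.+ -[1+ k ]) (suc k) ⟨ qz (a Z.+ -[1+ k ] Z.+ + suc k) ≈⟨ rf (cong qz (ZP.+-assoc a -[1+ k ] (+ suc k) >> cong (\ z -> a Z.+ z) (ZP.+-inverseˡ (+ suc k)) >> ZP.+-identityʳ a)) ⟩ qz a ≈⟨ *1 _ ⟨ qz a * 1# ≈⟨ *ˡ (q-qz- k) ⟨ qz a * (q^ (suc k) * qz -[1+ k ]) ≈⟨ solve 3 (\ a b c -> a :* (b :* c) := b :* (a :* c)) refl _ _ _ ⟩ q^ (suc k) * (qz a * qz -[1+ k ]) ∎)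
  qz~0 : ∀ a -> ¬ (qz a ≈ 0#)
  qz~0 (+ k) = mι~0 _
  qz~0 -[1+ k ] e = 1~0 (tr (sym (q-qz- k)) (tr (*ˡ e) (*0 _)))
  -- A common large power of q makes all exponents natural, so that positions can be compared as
  -- monomials.
  clear : ∀ a M -> ∣ a ∣ N.≤ M -> Σ ℕ \ A -> (qz a * q^ M ≈ q^ A) × (a Z.+ + M ≡ + A)
  clear a M le with nonneg a M le
   where
   nonneg : ∀ a M -> ∣ a ∣ N.≤ M -> Σ ℕ \ A -> a Z.+ + M ≡ + A
   nonneg (+ k) M le = k N.+ M , E.refl
   nonneg -[1+ k ] M le = M N.∸ suc k , ZP.⊖-≥ le
  ... | A , e = A , tr (sym (qz-+ℕ a M)) (rf (cong qz e)) , e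
  ℤ-cancel : ∀ a b M -> a Z.+ M ≡ b Z.+ M -> a ≡ b
  ℤ-cancel a b M e = E.sym (back a) >> cong (Z._- M) e >> back b
   where
   back : ∀ x -> x Z.+ M Z.- M ≡ x
   back x = ZP.+-assoc x M (Z.- M) >> cong (\ z -> x Z.+ z) (ZP.+-inverseʳ M) >> ZP.+-identityʳ x
  I : Fin n -> ℕ
  I i = toℕ (opposite i)
  I-inj : ∀ i j -> I i ≡ I j -> i ≡ j
  I-inj i j e = E.sym (FinP.opposite-involutive i) >> cong opposite (FinP.toℕ-injective e) >> FinP.opposite-involutive j
  I-gap : ∀ i j d -> toℕ j ≡ suc d N.+ toℕ i -> I i ≡ suc d N.+ I j
  I-gap i j d e = begin≡
   where
   bound : suc (suc d N.+ toℕ i) N.≤ n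
   bound = subst (\ z -> suc z N.≤ n) e (FinP.toℕ<n j)
   begin≡ : I i ≡ suc d N.+ I j
   begin≡ = FinP.opposite-prop i >> E.sym (NP.m+[n∸m]≡n {suc d} le) >> cong (suc d N.+_) (NP.∸-+-assoc n (suc (toℕ i)) (suc d) >> cong (n N.∸_) (cong suc (NP.+-comm (toℕ i) (suc d)) >> cong suc (E.sym e)) >> E.sym (FinP.opposite-prop j))
    where
    le : suc d N.≤ n N.∸ suc (toℕ i)
    le = subst (N._≤ n N.∸ suc (toℕ i)) (cong (N._∸ suc (toℕ i)) (E.sym (NP.+-suc (suc d) (toℕ i))) >> NP.m+n∸n≡m (suc d) (suc (toℕ i))) (NP.∸-monoˡ-≤ (suc (toℕ i)) bound)
  pos : Fin n -> ℤ -> Fr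
  pos i a = s^ (I i) * qz a
  st : Ord -> ℤ -> Fr
  st o e = ι (bin (numM o e)) * inv (ι (bin (denM o e))) (ι~0 (bin~0 _ (denM-≢ o e)))
  st-den : ∀ o e -> st o e * ι (bin (denM o e)) ≈ ι (bin (numM o e))
  st-den o e = tr (*a _ _ _) (tr (*ˡ (tr (*c _ _) (inv-r _ _))) (*1 _))
  st~0 : ∀ o e -> ¬ (st o e ≈ 0#)
  st~0 o e z = ι~0 (bin~0 _ (numM-≢ o e)) (tr (sym (st-den o e)) (tr (*ʳ z) (0* _)))
  -- `τ` as a function of the difference of the two entries, normalised to 1 at 0 and continued both
  -- ways by the step ratios. On the diagonal the denominator 1 - q^(e+1) vanishes at e = -1, which
  -- forces the value 0 at negative differences.
  tz : Ord -> ℤ -> Fr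
  tz o (+ zero) = 1#
  tz o (+ suc m) = tz o (+ m) * st o (+ m)
  tz eq -[1+ m ] = 0#
  tz o -[1+ zero ] = inv (st o -[1+ 0 ]) (st~0 o _)
  tz o -[1+ suc m ] = tz o -[1+ m ] * inv (st o -[1+ suc m ]) (st~0 o _)
  tz-suc : ∀ o a -> ¬ o ≡ eq -> tz o (Z.suc a) ≈ tz o a * st o a
  tz-suc o (+ m) ne = refl
  tz-suc (lt d) -[1+ zero ] ne = sym (tr (*c _ _) (inv-r _ _))
  tz-suc (gt d) -[1+ zero ] ne = sym (tr (*c _ _) (inv-r _ _))
  tz-suc (lt d) -[1+ suc m ] ne = sym (tr (*a _ _ _) (tr (*ˡ (tr (*c _ _) (inv-r _ _))) (*1 _)))
  tz-suc (gt d) -[1+ suc m ] ne = sym (tr (*a _ _ _) (tr (*ˡ (tr (*c _ _) (inv-r _ _))) (*1 _)))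
  tz-suc eq a ne = absurd (ne E.refl)
  wo wo⁻ : Ord -> Fr
  wo (gt d) = p
  wo _ = 1#
  wo⁻ (gt d) = r
  wo⁻ _ = 1#
  τ : Fin n -> Fin n -> ℤ -> ℤ -> Fr
  τ i j k l = tz (ord i j) (k Z.- l)
  sub-suc : ∀ k l -> Z.suc k Z.- l ≡ Z.suc (k Z.- l)
  sub-suc k l = ZP.+-assoc Z.1ℤ k (Z.- l)
  -- The step relation for a single ratio after the common factor qz l is divided out, so that only
  -- the difference e of the entries is left.
  Rel : Fin n -> Fin n -> Ord -> ℤ -> Set
  Rel i j o e = st o e * (s^ (I j) + - (Q * (s^ (I i) * qz e))) ≈ wo o * (s^ (I j) + - (Tt * (s^ (I i) * qz e)))
  st-lt⁺ : ∀ (i j : Fin n) d k -> toℕ j ≡ suc d N.+ toℕ i -> Rel i j (lt d) (+ k)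
  st-lt⁺ i j d k e' = begin st (lt d) (+ k) * (X + - (Q * (s^ (I i) * z))) ≈⟨ *ˡ (+ˡ (-~ (*ˡ (*ʳ sI)))) ⟩ st (lt d) (+ k) * (X + - (Q * ((S' * X) * z))) ≈⟨ solve 5 (\ a x q s z -> a :* (x :+ :- (q :* ((s :* x) :* z))) := (a :* (:1 :+ :- (s :* (q :* z)))) :* x) refl _ X Q S' z ⟩ (st (lt d) (+ k) * (1# + - (S' * (Q * z)))) * X ≈⟨ *ʳ (*ˡ (sym den)) ⟩ (st (lt d) (+ k) * ι (bin (denM (lt d) (+ k)))) * X ≈⟨ *ʳ (tr (st-den (lt d) (+ k)) num) ⟩ (1# + - (S' * (z * Tt))) * X ≈⟨ solve 4 (\ x t s z -> (:1 :+ :- (s :* (z :* t))) :* x := :1 :* (x :+ :- (t :* ((s :* x) :* z)))) refl X Tt S' z ⟩ 1# * (X + - (Tt * ((S' * X) * z))) ≈⟨ *ˡ (+ˡ (-~ (*ˡ (*ʳ sI)))) ⟨ 1# * (X + - (Tt * (s^ (I i) * z))) ∎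
   where
   X = s^ (I j)
   S' = s^ (suc d)
   z = q^ k
   sI : s^ (I i) ≈ S' * X
   sI = tr (rf (cong s^ (I-gap i j d e'))) (sym (mι-mul (suc d , 0 , 0) (I j , 0 , 0)))
   den : ι (bin (denM (lt d) (+ k))) ≈ 1# + - (S' * (Q * z))
   den = tr (ι-bin (denM (lt d) (+ k))) (+~ mι-1 (-~ (sym (tr (*ˡ (sym (q^-suc k))) (tr (mι-mul (suc d , 0 , 0) (0 , suc k , 0)) (rf (cong (\ x -> mι (x , suc k , 0)) (NP.+-identityʳ (suc d)))))))))
   num : ι (bin (numM (lt d) (+ k))) ≈ 1# + - (S' * (z * Tt))
   num = tr (ι-bin (numM (lt d) (+ k))) (+~ mι-1 (-~ (sym (tr (*ˡ (mι-mul (0 , k , 0) (0 , 0 , 1))) (tr (mι-mul (suc d , 0 , 0) (0 , k N.+ 0 , 1)) (rf (cong₂ (\ x y -> mι (x , y , 1)) (NP.+-identityʳ (suc d)) (NP.+-identityʳ k))))))))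
  st-lt⁻ : ∀ (i j : Fin n) d k -> toℕ j ≡ suc d N.+ toℕ i -> Rel i j (lt d) -[1+ k ]
  st-lt⁻ i j d k e' = begin a * (X + - (Q * (s^ (I i) * z))) ≈⟨ *ˡ (+~ X1 (-~ (*ˡ (*ʳ sI)))) ⟩ a * ((Qk * z) * X + - (Q * ((S' * X) * z))) ≈⟨ solve 6 (\ a k z x q s -> a :* ((k :* z) :* x :+ :- (q :* ((s :* x) :* z))) := (a :* (k :+ :- (s :* q))) :* (z :* x)) refl a Qk z X Q S' ⟩ (a * (Qk + - (S' * Q))) * (z * X) ≈⟨ *ʳ (*ˡ (sym den)) ⟩ (a * ι (bin (denM (lt d) -[1+ k ]))) * (z * X) ≈⟨ *ʳ (tr (st-den (lt d) -[1+ k ]) num) ⟩ (Qk + - (S' * Tt)) * (z * X) ≈⟨ solve 5 (\ k z x t s -> (k :+ :- (s :* t)) :* (z :* x) := :1 :* ((k :* z) :* x :+ :- (t :* ((s :* x) :* z)))) refl Qk z X Tt S' ⟩ 1# * ((Qk * z) * X + - (Tt * ((S' * X) * z))) ≈⟨ *ˡ (+~ X1 (-~ (*ˡ (*ʳ sI)))) ⟨ 1# * (X + - (Tt * (s^ (I i) * z))) ∎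
   where
   a = st (lt d) -[1+ k ]
   X = s^ (I j)
   S' = s^ (suc d)
   z = qz -[1+ k ]
   Qk = q^ (suc k)
   X1 : X ≈ (Qk * z) * X
   X1 = sym (tr (*ʳ (q-qz- k)) (il X))
   sI : s^ (I i) ≈ S' * X
   sI = tr (rf (cong s^ (I-gap i j d e'))) (sym (mι-mul (suc d , 0 , 0) (I j , 0 , 0)))
   den : ι (bin (denM (lt d) -[1+ k ])) ≈ Qk + - (S' * Q)
   den = tr (ι-bin (denM (lt d) -[1+ k ])) (+ˡ (-~ (sym (tr (mι-mul (suc d , 0 , 0) (0 , 1 , 0)) (rf (cong (\ x -> mι (x , 1 , 0)) (NP.+-identityʳ (suc d))))))))
   num : ι (bin (numM (lt d) -[1+ k ])) ≈ Qk + - (S' * Tt)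
   num = tr (ι-bin (numM (lt d) -[1+ k ])) (+ˡ (-~ (sym (tr (mι-mul (suc d , 0 , 0) (0 , 0 , 1)) (rf (cong (\ x -> mι (x , 0 , 1)) (NP.+-identityʳ (suc d))))))))
  st-gt⁺ : ∀ (i j : Fin n) d k -> toℕ i ≡ suc d N.+ toℕ j -> Rel i j (gt d) (+ k)
  st-gt⁺ i j d k e' = cancelˡ Tt (mι~0 _) (begin Tt * (a * (s^ (I j) + - (Q * (X * z)))) ≈⟨ *ˡ (*ˡ (+ʳ sI)) ⟩ Tt * (a * (S' * X + - (Q * (X * z)))) ≈⟨ solve 6 (\ t a s x q z -> t :* (a :* (s :* x :+ :- (q :* (x :* z)))) := (a :* (s :* t :+ :- ((q :* z) :* t))) :* x) refl Tt a S' X Q z ⟩ (a * (S' * Tt + - ((Q * z) * Tt))) * X ≈⟨ *ʳ (*ˡ (sym den)) ⟩ (a * ι (bin (denM (gt d) (+ k)))) * X ≈⟨ *ʳ (tr (st-den (gt d) (+ k)) num) ⟩ (S' * Q + - ((Q * z) * Tt)) * X ≈⟨ solve 5 (\ s q z t x -> (s :* q :+ :- ((q :* z) :* t)) :* x := q :* (s :* x :+ :- (t :* (x :* z)))) refl S' Q z Tt X ⟩ Q * (S' * X + - (Tt * (X * z))) ≈⟨ *~ (sym pT) (+ʳ (sym sI)) ⟩ (p * Tt) * (s^ (I j) + - (Tt * (X * z))) ≈⟨ solve 3 (\ p t y -> (p :* t) :* y := t :* (p :* y)) refl p Tt _ ⟩ Tt * (p * (s^ (I j) + - (Tt * (X *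 z)))) ∎)
   where
   a = st (gt d) (+ k)
   X = s^ (I i)
   S' = s^ (suc d)
   z = q^ k
   sI : s^ (I j) ≈ S' * X
   sI = tr (rf (cong s^ (I-gap j i d e'))) (sym (mι-mul (suc d , 0 , 0) (I i , 0 , 0)))
   low : mι (0 , suc k , 1) ≈ (Q * z) * Tt
   low = sym (tr (*ʳ (sym (q^-suc k))) (tr (mι-mul (0 , suc k , 0) (0 , 0 , 1)) (rf (cong (\ x -> mι (0 , x , 1)) (NP.+-identityʳ (suc k))))))
   den : ι (bin (denM (gt d) (+ k))) ≈ S' * Tt + - ((Q * z) * Tt)
   den = tr (ι-bin (denM (gt d) (+ k))) (+~ (sym (tr (mι-mul (suc d , 0 , 0) (0 , 0 , 1)) (rf (cong (\ x -> mι (x , 0 , 1)) (NP.+-identityʳ (suc d)))))) (-~ low))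
   num : ι (bin (numM (gt d) (+ k))) ≈ S' * Q + - ((Q * z) * Tt)
   num = tr (ι-bin (numM (gt d) (+ k))) (+~ (sym (tr (mι-mul (suc d , 0 , 0) (0 , 1 , 0)) (rf (cong (\ x -> mι (x , 1 , 0)) (NP.+-identityʳ (suc d)))))) (-~ low))
  st-gt⁻ : ∀ (i j : Fin n) d k -> toℕ i ≡ suc d N.+ toℕ j -> Rel i j (gt d) -[1+ k ]
  st-gt⁻ i j d k e' = cancelˡ Tt (mι~0 _) (begin Tt * (a * (s^ (I j) + - (Q * (X * z)))) ≈⟨ *ˡ (*ˡ (+~ sI (-~ (sym X1)))) ⟩ Tt * (a * (((Q * q^ k) * z) * (S' * X) + - (Q * (X * z)))) ≈⟨ solve 7 (\ t a s x q k z -> t :* (a :* (((q :* k) :* z) :* (s :* x) :+ :- (q :* (x :* z)))) := (a :* ((s :* k) :* t :+ :- t)) :* (q :* (x :* z))) refl Tt a S' X Q (q^ k) z ⟩ (a * ((S' * q^ k) * Tt + - Tt)) * (Q * (X * z)) ≈⟨ *ʳ (*ˡ (sym den)) ⟩ (a * ι (bin (denM (gt d) -[1+ k ]))) * (Q * (X * z)) ≈⟨ *ʳ (tr (st-den (gt d) -[1+ k ]) num) ⟩ (S' * (Q * q^ k) + - Tt) * (Q * (X * z)) ≈⟨ solve 6 (\ s q k t x z -> (s :* (q :* k) :+ :- t) :* (q :* (x :* z)) := q :* (((q :* k) :* z) :* (s :* x) :+ :- (t :* (x :* z)))) refl S' Q (q^ k) Tt X z ⟩ Q * (((Q * q^ k)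 * z) * (S' * X) + - (Tt * (X * z))) ≈⟨ *~ (sym pT) (+ʳ (sym sI)) ⟩ (p * Tt) * (s^ (I j) + - (Tt * (X * z))) ≈⟨ solve 3 (\ p t y -> (p :* t) :* y := t :* (p :* y)) refl p Tt _ ⟩ Tt * (p * (s^ (I j) + - (Tt * (X * z)))) ∎)
   where
   a = st (gt d) -[1+ k ]
   X = s^ (I i)
   S' = s^ (suc d)
   z = qz -[1+ k ]
   one : (Q * q^ k) * z ≈ 1#
   one = tr (*ʳ (sym (q^-suc k))) (q-qz- k)
   X1 : Q * (X * z) ≈ Q * (X * z)
   X1 = refl
   sI : s^ (I j) ≈ ((Q * q^ k) * z) * (S' * X)
   sI = tr (tr (rf (cong s^ (I-gap j i d e'))) (sym (mι-mul (suc d , 0 , 0) (I i , 0 , 0)))) (sym (tr (*ʳ one) (il _)))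
   den : ι (bin (denM (gt d) -[1+ k ])) ≈ (S' * q^ k) * Tt + - Tt
   den = tr (ι-bin (denM (gt d) -[1+ k ])) (+ʳ (sym (tr (*ʳ (mι-mul (suc d , 0 , 0) (0 , k , 0))) (tr (mι-mul (suc d N.+ 0 , k , 0) (0 , 0 , 1)) (rf (cong₂ (\ x y -> mι (x , y , 1)) (NP.+-identityʳ _ >> NP.+-identityʳ _) (NP.+-identityʳ k)))))))
   num : ι (bin (numM (gt d) -[1+ k ])) ≈ S' * (Q * q^ k) + - Tt
   num = tr (ι-bin (numM (gt d) -[1+ k ])) (+ʳ (sym (tr (*ˡ (sym (q^-suc k))) (tr (mι-mul (suc d , 0 , 0) (0 , suc k , 0)) (rf (cong (\ x -> mι (x , suc k , 0)) (NP.+-identityʳ (suc d))))))))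
  st-eq′ : ∀ (i j : Fin n) k -> toℕ i ≡ toℕ j -> Rel i j eq (+ k)
  st-eq′ i j k e' = begin a * (s^ (I j) + - (Q * (X * z))) ≈⟨ *ˡ (+ʳ sI) ⟩ a * (X + - (Q * (X * z))) ≈⟨ solve 4 (\ a x q z -> a :* (x :+ :- (q :* (x :* z))) := (a :* (:1 :+ :- (q :* z))) :* x) refl a X Q z ⟩ (a * (1# + - (Q * z))) * X ≈⟨ *ʳ (*ˡ (sym (tr (ι-bin (denM eq (+ k))) (+~ mι-1 (-~ (q^-suc k)))))) ⟩ (a * ι (bin (denM eq (+ k)))) * X ≈⟨ *ʳ (tr (st-den eq (+ k)) (tr (ι-bin (numM eq (+ k))) (+~ mι-1 (-~ low)))) ⟩ (1# + - (z * Tt)) * X ≈⟨ solve 3 (\ x t z -> (:1 :+ :- (z :* t)) :* x := :1 :* (x :+ :- (t :* (x :* z)))) refl X Tt z ⟩ 1# * (X + - (Tt * (X * z))) ≈⟨ *ˡ (+ʳ (sym sI)) ⟩ 1# * (s^ (I j) + - (Tt * (X * z))) ∎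
   where
   a = st eq (+ k)
   X = s^ (I i)
   z = q^ k
   sI : s^ (I j) ≈ X
   sI = rf (cong (\ i -> s^ (I i)) (E.sym (FinP.toℕ-injective e')))
   low : mι (0 , k , 1) ≈ z * Tt
   low = sym (tr (mι-mul (0 , k , 0) (0 , 0 , 1)) (rf (cong (\ x -> mι (0 , x , 1)) (NP.+-identityʳ k))))
  ord-refl : ∀ i -> ordℕ i i ≡ eq
  ord-refl zero = E.refl
  ord-refl (suc i) = ord-refl i
  flip : Ord -> Ord
  flip (lt d) = gt d
  flip (gt d) = lt d
  flip eq = eq
  ord-flip : ∀ i j -> ordℕ j i ≡ flip (ordℕ i j)
  ord-flip zero zero = E.refl
  ord-flip zero (suc j) = E.refl
  ord-flip (suc i) zero = E.refl
  ord-flip (suc i) (suc j) = ord-flip i j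
  ord-eq : (i j : Fin n) -> ord i j ≡ eq -> i ≡ j
  ord-eq i j e with ord i j | ordView (toℕ i) (toℕ j)
  ord-eq i j E.refl | .eq | v-eq e' = FinP.toℕ-injective e'
  inv~0 : ∀ {x} h -> ¬ (inv x h ≈ 0#)
  inv~0 {x} h z = 1~0 (tr (sym (inv-r x h)) (tr (*ˡ z) (*0 x)))
  tz~0 : ∀ o a -> ¬ o ≡ eq -> ¬ (tz o a ≈ 0#)
  tz~0 o (+ zero) ne = 1~0
  tz~0 o (+ suc m) ne = *-~0 (tz~0 o (+ m) ne) (st~0 o _)
  tz~0 (lt d) -[1+ zero ] ne = inv~0 _
  tz~0 (gt d) -[1+ zero ] ne = inv~0 _
  tz~0 (lt d) -[1+ suc m ] ne = *-~0 (tz~0 (lt d) -[1+ m ] ne) (inv~0 _)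
  tz~0 (gt d) -[1+ suc m ] ne = *-~0 (tz~0 (gt d) -[1+ m ] ne) (inv~0 _)
  tz~0 eq a ne = absurd (ne E.refl)
  sub-add : ∀ k l -> k ≡ (k Z.- l) Z.+ l
  sub-add k l = E.sym (ZP.+-assoc k (Z.- l) l >> cong (\ z -> k Z.+ z) (ZP.+-inverseˡ l) >> ZP.+-identityʳ k)
  from-st : ∀ i j o k l -> Rel i j o (k Z.- l) -> (tz o (k Z.- l) * st o (k Z.- l)) * (pos j l + - (Q * pos i k)) ≈ (wo o * tz o (k Z.- l)) * (pos j l + - (Tt * pos i k))
  from-st i j o k l rel = begin (A * B) * (X * z + - (Q * (Y * qz k))) ≈⟨ *ˡ (+ˡ (-~ (*ˡ (*ˡ qk)))) ⟩ (A * B) * (X * z + - (Q * (Y * (ze * z)))) ≈⟨ solve 7 (\ a b x z q y e -> (a :* b) :* (x :* z :+ :- (q :* (y :* (e :* z)))) := (a :* z) :* (b :* (x :+ :- (q :* (y :* e))))) refl A B X z Q Y ze ⟩ (A * z) * (B * (X + - (Q * (Y * ze)))) ≈⟨ *ˡ rel ⟩ (A * z) * (wo o * (X + - (Tt * (Y * ze)))) ≈⟨ solve 7 (\ a z w x t y e -> (a :* z) :* (w :* (x :+ :- (t :* (y :* e)))) := (w :* a) :* (x :* z :+ :- (t :* (y :* (e :* z))))) refl A z (wo o) X Tt Y ze ⟩ (wo o * A) * (X * z + - (Tt * (Y * (ze * z)))) ≈⟨ *ˡ (+ˡ (-~ (*ˡ (*ˡ qk)))) ⟨ (wo o * A) *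 (X * z + - (Tt * (Y * qz k))) ∎
   where
   e = k Z.- l
   A = tz o e
   B = st o e
   X = s^ (I j)
   Y = s^ (I i)
   z = qz l
   ze = qz e
   qk : qz k ≈ ze * z
   qk = tr (rf (cong qz (sub-add k l))) (qz-+ e l)
  st-lt : ∀ i j d e -> toℕ j ≡ suc d N.+ toℕ i -> Rel i j (lt d) e
  st-lt i j d (+ k) = st-lt⁺ i j d k
  st-lt i j d -[1+ k ] = st-lt⁻ i j d k
  st-gt : ∀ i j d e -> toℕ i ≡ suc d N.+ toℕ j -> Rel i j (gt d) e
  st-gt i j d (+ k) = st-gt⁺ i j d k
  st-gt i j d -[1+ k ] = st-gt⁻ i j d k
  pos-suc : ∀ i a -> pos i (Z.suc a) ≈ Q * pos i a
  pos-suc i a = tr (*ˡ (qz-suc a)) (solve 3 (\ s q z -> s :* (q :* z) := q :* (s :* z)) refl _ _ _)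
  τ-step : ∀ i j k l -> τ i j (Z.suc k) l * (pos j l + - (Q * pos i k)) ≈ (wo (ord i j) * τ i j k l) * (pos j l + - (Tt * pos i k))
  τ-step i j k l = tr (*ʳ (rf (cong (tz (ord i j)) (sub-suc k l)))) (go (ord i j) (ordView (toℕ i) (toℕ j)) (k Z.- l) E.refl)
   where
   go : ∀ o -> OrdView (toℕ i) (toℕ j) o -> ∀ e -> e ≡ k Z.- l -> tz o (Z.suc e) * (pos j l + - (Q * pos i k)) ≈ (wo o * tz o e) * (pos j l + - (Tt * pos i k))
   go .(lt d) (v-lt d h) e E.refl = tr (*ʳ (tz-suc (lt d) e (\ ()))) (from-st i j (lt d) k l (st-lt i j d e h))
   go .(gt d) (v-gt d h) e E.refl = tr (*ʳ (tz-suc (gt d) e (\ ()))) (from-st i j (gt d) k l (st-gt i j d e h))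
   go .eq (v-eq h) (+ m) e' = subst (\ e -> (tz eq e * st eq e) * (pos j l + - (Q * pos i k)) ≈ (wo eq * tz eq e) * (pos j l + - (Tt * pos i k))) (E.sym e') (from-st i j eq k l (subst (Rel i j eq) e' (st-eq′ i j m h)))
   -- At this difference τ jumps from 0 to 1. The relation still holds because the factor pos j l -
   -- Q pos i k on the left vanishes as well.
   go .eq (v-eq h) -[1+ zero ] e' = tr (*ˡ (x≈y⇒x-y≈0 same)) (tr (*0 _) (sym (tr (*ʳ (*0 _)) (0* _))))
    where
    l≡ : l ≡ Z.suc k
    l≡ = E.sym (cong Z.suc (sub-add k l >> cong (Z._+ l) (E.sym e')) >> ZP.suc-pred l)
    same : pos j l ≈ Q * pos i k
    same = tr (rf (cong₂ pos (FinP.toℕ-injective (E.sym h)) l≡)) (pos-suc i k)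
   go .eq (v-eq h) -[1+ suc m ] e' = tr (0* _) (sym (tr (*ʳ (*0 _)) (0* _)))
  private
   clear2 : ∀ i j a b -> Σ ℕ \ M -> Σ ℕ \ A -> Σ ℕ \ B -> (pos i a * q^ M ≈ mι (I i , A , 0)) × (pos j b * q^ M ≈ mι (I j , B , 0)) × (a Z.+ + M ≡ + A) × (b Z.+ + M ≡ + B)
   clear2 i j a b with clear a (∣ a ∣ N.+ ∣ b ∣) (NP.m≤m+n _ _) | clear b (∣ a ∣ N.+ ∣ b ∣) (NP.m≤n+m _ _)
   ... | A , ea , za | B , eb , zb = ∣ a ∣ N.+ ∣ b ∣ , A , B , one i a A ea , one j b B eb , za , zb
    where
    one : ∀ i x A -> qz x * q^ (∣ a ∣ N.+ ∣ b ∣) ≈ q^ A -> pos i x * q^ (∣ a ∣ N.+ ∣ b ∣) ≈ mι (I i , A , 0)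
    one i x A e = tr (*a _ _ _) (tr (*ˡ e) (tr (mι-mul (I i , 0 , 0) (0 , A , 0)) (rf (cong (\ x -> mι (x , A , 0)) (NP.+-identityʳ (I i))))))
  pos≉row : ∀ i j a b -> ¬ i ≡ j -> ¬ (pos i a ≈ pos j b)
  pos≉row i j a b ne e with clear2 i j a b
  ... | M , A , B , ea , eb , _ , _ = ne (I-inj i j (cong proj₁ (mι-inj _ _ (tr (sym ea) (tr (*ʳ e) eb)))))
  pos≉col : ∀ i a b -> ¬ a ≡ b -> ¬ (pos i a ≈ pos i b)
  pos≉col i a b ne e with clear2 i i a b
  ... | M , A , B , ea , eb , za , zb = ne (ℤ-cancel a b (+ M) (za >> cong (\ x -> + proj₁ (proj₂ x)) (mι-inj _ _ (tr (sym ea) (tr (*ʳ e) eb))) >> E.sym zb))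
  pos~0 : ∀ i a -> ¬ (pos i a ≈ 0#)
  pos~0 i a = *-~0 (mι~0 _) (qz~0 a)
  pos≉p : ∀ i j a b -> ¬ (pos i a ≈ p * pos j b)
  pos≉p i j a b e with clear2 i j a b
  ... | M , A , B , ea , eb , _ , _ = bad (mι-inj (I i N.+ 0 , A N.+ 0 , 1) (I j N.+ 0 , B N.+ 1 , 0) (begin mι ((I i , A , 0) ⊗m (0 , 0 , 1)) ≈⟨ mι-mul _ _ ⟨ mι (I i , A , 0) * Tt ≈⟨ *ʳ (tr (sym ea) (*ʳ e)) ⟩ ((p * pos j b) * q^ M) * Tt ≈⟨ solve 4 (\ p x m t -> ((p :* x) :* m) :* t := (x :* m) :* (p :* t)) refl p (pos j b) (q^ M) Tt ⟩ (pos j b * q^ M) * (p * Tt) ≈⟨ *~ eb pT ⟩ mι (I j , B , 0) * Q ≈⟨ mι-mul _ _ ⟩ mι ((I j , B , 0) ⊗m (0 , 1 , 0)) ∎))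
   where
   bad : ∀ {x y z w : ℕ} -> ¬ (_≡_ {A = Mono} (x , y , 1) (z , w , 0))
   bad ()
  ιH : Hom Ser Frac
  ιH = record { ev = ι ; ev-cong = ι-cong ; ev-+ = ι-+ ; ev-* = ι-* ; ev-1 = ι-1 }
  -- Different rows carry different powers of s. After q is cleared, the coefficient of s^(I i) in
  -- the sum is a single power of q, which determines entry i.
  sep : ∀ κ μ -> ¬ κ ≡ μ -> ¬ (Σs (\ i -> pos i (get κ i)) ≈ Σs (\ i -> pos i (get μ i)))
  sep κ μ ne e = ne (vec-ext κ μ (\ i -> ℤ-cancel _ _ (+ M) (eA κ Mκ i >> (cong +_ (same i)) >> E.sym (eA μ Mμ i))))
   where
   vabs : ∀ {m} -> Vec ℤ m -> ℕ
   vabs [] = 0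
   vabs (a ∷ v) = ∣ a ∣ N.+ vabs v
   vabs-≥ : ∀ {m} (v : Vec ℤ m) i -> ∣ get v i ∣ N.≤ vabs v
   vabs-≥ (a ∷ v) zero = NP.m≤m+n _ _
   vabs-≥ (a ∷ v) (suc i) = ≤-trans (vabs-≥ v i) (NP.m≤n+m _ _)
   M : ℕ
   M = vabs κ N.+ vabs μ
   Mκ : ∀ i -> ∣ get κ i ∣ N.≤ M
   Mκ i = ≤-trans (vabs-≥ κ i) (NP.m≤m+n _ _)
   Mμ : ∀ i -> ∣ get μ i ∣ N.≤ M
   Mμ i = ≤-trans (vabs-≥ μ i) (NP.m≤n+m _ _)
   A : (v : Vec ℤ n) -> (∀ i -> ∣ get v i ∣ N.≤ M) -> Fin n -> ℕ
   A v b i = proj₁ (clear (get v i) M (b i))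
   eA : ∀ v b i -> get v i Z.+ + M ≡ + A v b i
   eA v b i = proj₂ (proj₂ (clear (get v i) M (b i)))
   total : ∀ v b -> Σs (\ i -> pos i (get v i)) * q^ M ≈ ι (S.Σs (\ i -> M3 (I i , A v b i , 0)))
   total v b = tr (*c _ _) (tr (Σ-*ˡ _ _) (tr (Σs-cong (\ i -> tr (*c _ _) (tr (*a _ _ _) (tr (*ˡ (proj₁ (proj₂ (clear (get v i) M (b i))))) (tr (mι-mul (I i , 0 , 0) (0 , A v b i , 0)) (tr (rf (cong (\ x -> mι (x , A v b i , 0)) (NP.+-identityʳ (I i)))) (mι-def _))))))) (sym (Hom.ev-Σs ιH _))))
   sums : S.Σs (\ i -> M3 (I i , A κ Mκ i , 0)) S.≈ S.Σs (\ i -> M3 (I i , A μ Mμ i , 0))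
   sums = ι-injective (tr (sym (total κ Mκ)) (tr (*ʳ e) (total μ Mμ)))
   coeff : ∀ (B : Fin n -> ℕ) i -> S.Σs (\ i -> M3 (I i , B i , 0)) (I i) R.≈ m2 (B i) 0
   coeff B i = R.tr (Σs-at _ (I i)) (R.tr (PickKit.Σ-single R i _ (\ j ne -> mon-off (I j) _ (I i) (\ z -> ne (I-inj j i z)))) (mon-at (I i) _))
   same : ∀ i -> A κ Mκ i ≡ A μ Mμ i
   same i = proj₁ (mono-inj _ 0 _ 0 (R.tr (R.sym (coeff (A κ Mκ) i)) (R.tr (sums (I i)) (coeff (A μ Mμ) i))))
  p≉1 : ¬ (1# + - p ≈ 0#)
  p≉1 e = bad (mι-inj (0 , 0 , 1) (0 , 1 , 0) (tr (sym (il Tt)) (tr (*ʳ (x-y≈0⇒x≈y e)) pT)))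
   where
   bad : ¬ (_≡_ {A = Mono} (0 , 0 , 1) (0 , 1 , 0))
   bad ()
  params : Params Frac n
  params = record { q = Q ; t = Tt ; p = p ; r = r ; pt = pT ; pr = pr-1 ; p≉1 = p≉1 ; q~0 = mι~0 _ ; t~0 = mι~0 _ ; pos = pos ; pos-suc = pos-suc ; pos~0 = pos~0 ; pos≉row = pos≉row ; pos≉col = pos≉col ; pos≉p = pos≉p ; sep = sep ; w = \ i j -> wo (ord i j) ; w⁻ = \ i j -> wo⁻ (ord i j) ; w-inv = \ i j -> w-inv (ord i j) ; w-diag = \ i -> rf (cong wo (ord-refl (toℕ i))) ; w-opp = \ i j ne -> tr (*ˡ (rf (cong wo (ord-flip (toℕ i) (toℕ j))))) (w-opp (ord i j) (\ e -> ne (ord-eq i j e))) ; τ = τ ; τ-step = τ-step ; τ-shift = \ i j k l -> rf (cong (tz (ord i j)) (shift-both k l)) ; τ-diag = \ i k -> rf (cong (tz (ord i i)) (ZP.+-inverseʳ k)) ; τ-vanish = \ i k -> tr (rf (cong₂ tz (ord-refl (toℕ i)) (minus-one k))) refl ; τ~0 = \ i j k l ne -> tz~0 (ord i j) (k Z.- l) (\ e -> ne (ord-eq i j e)) }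
   where
   w-inv : ∀ o -> wo o * wo⁻ o ≈ 1#
   w-inv (lt d) = il 1#
   w-inv (gt d) = pr-1
   w-inv eq = il 1#
   w-opp : ∀ o -> ¬ o ≡ eq -> wo o * wo (flip o) ≈ p
   w-opp (lt d) _ = il p
   w-opp (gt d) _ = *1 p
   w-opp eq ne = absurd (ne E.refl)
   pred-of : ∀ k l -> k Z.- Z.suc l ≡ Z.pred (k Z.- l)
   pred-of k l = cong (\ z -> k Z.+ z) (ZP.neg-distrib-+ Z.1ℤ l) >> E.sym (ZP.+-assoc k Z.-1ℤ (Z.- l)) >> cong (Z._- l) (ZP.+-comm k Z.-1ℤ) >> ZP.+-assoc Z.-1ℤ k (Z.- l)
   shift-both : ∀ k l -> Z.suc k Z.- Z.suc l ≡ k Z.- l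
   shift-both k l = pred-of (Z.suc k) l >> cong Z.pred (sub-suc k l) >> ZP.pred-suc _
   minus-one : ∀ k -> k Z.- Z.suc k ≡ -[1+ 0 ]
   minus-one k = pred-of k k >> cong Z.pred (ZP.+-inverseʳ k)

-- The scalar vanishes: the value at s = 0 and invariance under s ↦ q s.

module Base where
 open Kit
 open Ser
 open Frac
 open Comp
 open Core
 open Comm
 open Spec
 open Model
 open import Data.Vec using (tabulate; replicate)
 constant : ∀ {n} {A : Set} (_~_ : A -> A -> Set) -> (∀ {x} -> x ~ x) -> (∀ {x y} -> x ~ y -> y ~ x) -> (∀ {x y z} -> x ~ y -> y ~ z -> x ~ z) -> (χ : Vec ℤ n -> A) -> (∀ i κ -> χ κ ~ χ (dn i κ)) -> ∀ κ μ -> χ κ ~ χ μ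
 constant _~_ r s t χ h [] [] = r
 constant {suc n} {A} _~_ r s t χ h (a ∷ κ) (b ∷ μ) = t (t (to0 a κ) (constant _~_ r s t (\ v -> χ (+ 0 ∷ v)) (\ i v -> h (suc i) (+ 0 ∷ v)) κ μ)) (s (to0 b μ))
  where
  to0 : ∀ a κ -> χ (a ∷ κ) ~ χ (+ 0 ∷ κ)
  to0 (+ zero) κ = r
  to0 (+ suc k) κ = t (h zero (+ suc k ∷ κ)) (to0 (+ k) κ)
  to0 -[1+ zero ] κ = s (h zero (+ 0 ∷ κ))
  to0 -[1+ suc k ] κ = t (s (h zero (-[1+ k ] ∷ κ))) (to0 -[1+ k ] κ)
 module BaseDef (Se : Setting) (n : ℕ) where
  open Setting Se
  open ModelDef Se n
  private
   module R = RingKit R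
   module DR = DomainKit R dom
   module S = RingKit Ser
  open RingKit Frac
  open PickKit Frac using (Π-single)
  open GridKit Frac
  open DomainKit Frac FracDom
  open Field FracField using (inv; inv-r)
  open CommDef Frac FracField n params
  open CoreDef Frac FracField n params using (T)
  open CompKit Frac
  open SpDef Ser R SerDom dom ev0
  private
   module F0 = FracDef R dom
   K0 : CRing
   K0 = F0.Frac
   module K0 = RingKit K0
   module PK0 = PickKit K0
   module CK0 = CompKit K0
   module I0 = Field F0.FracField
  bin0 : Ord -> ℤ -> Set
  bin0 o e = (bin (numM o e) 0 R.≈ bin (denM o e) 0) × ¬ (bin (denM o e) 0 R.≈ R.0#)
  -- Off the diagonal, numerator and denominator have the same nonzero constant term in s, so the
  -- step ratio becomes 1: at s = 0 distinct rows decouple.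
  bin-0 : ∀ o e -> ¬ o ≡ eq -> bin0 o e
  bin-0 (lt d) (+ k) _ = R.refl , \ z -> m2~0 0 0 (R.tr (R.sym (R.tr (R.+ˡ R.-0#≈0#) (R.+0 _))) z)
  bin-0 (lt d) -[1+ k ] _ = R.refl , \ z -> m2~0 (suc k) 0 (R.tr (R.sym (R.tr (R.+ˡ R.-0#≈0#) (R.+0 _))) z)
  bin-0 (gt d) (+ k) _ = R.refl , \ z -> m2~0 (suc k) 1 (R.sym (R.x-y≈0⇒x≈y z))
  bin-0 (gt d) -[1+ k ] _ = R.refl , \ z -> m2~0 0 1 (R.sym (R.x-y≈0⇒x≈y z))
  bin-0 eq e ne = absurd (ne E.refl)
  st-sp : ∀ o e -> ¬ o ≡ eq -> Sp (st o e) K0.1#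
  st-sp o e ne = mkSp (bin (numM o e)) (bin (denM o e)) (st-den o e) (proj₂ (bin-0 o e ne)) (K0.tr (K0.il _) (F0.ι-cong (R.sym (proj₁ (bin-0 o e ne)))))
  bin-eq~0 : ∀ k -> ¬ (bin (denM eq (+ k)) 0 R.≈ R.0#)
  bin-eq~0 k z with mono-inj 0 0 (suc k) 0 (R.x-y≈0⇒x≈y z)
  ... | () , _
  stv : ℕ -> K0.Car
  stv k = F0.ι (bin (numM eq (+ k)) 0) K0.* I0.inv (F0.ι (bin (denM eq (+ k)) 0)) (F0.ι~0 (bin-eq~0 k))
  st-eq-sp : ∀ k -> Sp (st eq (+ k)) (stv k)
  st-eq-sp k = mkSp (bin (numM eq (+ k))) (bin (denM eq (+ k))) (st-den eq (+ k)) (bin-eq~0 k) (K0.tr (K0.*a _ _ _) (K0.tr (K0.*ˡ (K0.tr (K0.*c _ _) (I0.inv-r _ _))) (K0.*1 _)))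
  hv : ℤ -> K0.Car
  hv (+ zero) = K0.1#
  hv (+ suc k) = hv (+ k) K0.* stv k
  hv -[1+ k ] = K0.0#
  tv : Ord -> ℤ -> K0.Car
  tv eq a = hv a
  tv _ a = K0.1#
  tz-sp : ∀ o a -> Sp (tz o a) (tv o a)
  tz-sp eq (+ zero) = sp-1
  tz-sp eq (+ suc k) = sp-* (tz-sp eq (+ k)) (st-eq-sp k)
  tz-sp eq -[1+ k ] = sp-0
  tz-sp (lt d) (+ zero) = sp-1
  tz-sp (gt d) (+ zero) = sp-1
  tz-sp (lt d) (+ suc k) = sp-cong refl (K0.il _) (sp-* (tz-sp (lt d) (+ k)) (st-sp (lt d) (+ k) (\ ())))
  tz-sp (gt d) (+ suc k) = sp-cong refl (K0.il _) (sp-* (tz-sp (gt d) (+ k)) (st-sp (gt d) (+ k) (\ ())))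
  tz-sp (lt d) -[1+ zero ] = sp-inv (st-sp (lt d) -[1+ 0 ] (\ ())) (inv-r _ _) (K0.il _)
  tz-sp (gt d) -[1+ zero ] = sp-inv (st-sp (gt d) -[1+ 0 ] (\ ())) (inv-r _ _) (K0.il _)
  tz-sp (lt d) -[1+ suc k ] = sp-cong refl (K0.il _) (sp-* (tz-sp (lt d) -[1+ k ]) (sp-inv (st-sp (lt d) -[1+ suc k ] (\ ())) (inv-r _ _) (K0.il _)))
  tz-sp (gt d) -[1+ suc k ] = sp-cong refl (K0.il _) (sp-* (tz-sp (gt d) -[1+ k ]) (sp-inv (st-sp (gt d) -[1+ suc k ] (\ ())) (inv-r _ _) (K0.il _)))
  tv-off : ∀ (i j : Fin n) a -> ¬ i ≡ j -> tv (ord i j) a K0.≈ K0.1#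
  tv-off i j a ne with ord i j | E.inspect (ord i) j
  ... | lt d | _ = K0.refl
  ... | gt d | _ = K0.refl
  ... | eq | E.[ e ] = absurd (ne (ord-eq i j e))
  hh : (Fin n -> ℤ) -> K0.Car
  hh m = K0.Πs (\ i -> hv (m i))
  T-sp : ∀ κ μ -> Sp (T κ μ) (hh (\ i -> get κ i Z.- get μ i))
  T-sp κ μ = sp-cong refl (K0.Πs-cong (\ i -> K0.tr (PK0.Π-single i _ (\ j ne -> tv-off i j _ (\ e -> ne (E.sym e)))) (K0.rf (cong (\ o -> tv o (get κ i Z.- get μ i)) (ord-refl (toℕ i)))))) (sp-Π (\ i -> sp-Π (\ j -> tz-sp (ord i j) (get κ i Z.- get μ j))))
  Wi-sp : ∀ κ -> Sp (Wi κ) K0.1#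
  Wi-sp κ = sp-inv (sp-cong refl (K0.Π-one _ (\ i -> K0.rf (cong hv (ZP.+-inverseʳ (get κ i))))) (T-sp κ κ)) (T-Wi κ) (K0.il _)
  hm : Vec ℕ n -> K0.Car
  hm m = hh (\ i -> + get m i)
  T-∖-sp : ∀ κ m -> Sp (T κ (κ ∖ m)) (hm m)
  T-∖-sp κ m = sp-cong refl (K0.Πs-cong (\ i -> K0.rf (cong hv (back i)))) (T-sp κ (κ ∖ m))
   where
   back : ∀ i -> get κ i Z.- get (κ ∖ m) i ≡ + get m i
   back i = cong (\ z -> get κ i Z.- z) (lookup-∖ i κ m) >> cong (\ z -> get κ i Z.+ z) (ZP.neg-distrib-+ (get κ i) (Z.- + get m i) >> cong (\ z -> Z.- get κ i Z.+ z) (ZP.neg-involutive (+ get m i))) >> E.sym (ZP.+-assoc (get κ i) (Z.- get κ i) (+ get m i)) >> cong (Z._+ + get m i) (ZP.+-inverseʳ (get κ i)) >> ZP.+-identityˡ _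
  T-∔-sp : ∀ μ m -> Sp (T (μ ∔ m) μ) (hm m)
  T-∔-sp μ m = sp-cong refl (K0.Πs-cong (\ i -> K0.rf (cong hv (back i)))) (T-sp (μ ∔ m) μ)
   where
   back : ∀ i -> get (μ ∔ m) i Z.- get μ i ≡ + get m i
   back i = cong (Z._- get μ i) (lookup-∔ i μ m >> ZP.+-comm (get μ i) (+ get m i)) >> ZP.+-assoc (+ get m i) (get μ i) (Z.- get μ i) >> cong (\ z -> + get m i Z.+ z) (ZP.+-inverseʳ (get μ i)) >> ZP.+-identityʳ _
  δ0 : Vec ℤ n -> Vec ℤ n -> K0.Car
  δ0 κ μ with μ ≟v κ
  ... | yes _ = K0.1#
  ... | no _ = K0.0#
  δ-sp : ∀ κ μ -> Sp (δ κ μ) (δ0 κ μ)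
  δ-sp κ μ with μ ≟v κ
  ... | yes _ = sp-1
  ... | no _ = sp-0
  -- With decoupled rows U and V turn into convolutions with the weights `hm`, one downwards and one
  -- upwards, and translations of ℤⁿ commute.
  X-sp : ∀ l k κ -> Sp (X l k (δ κ) κ) K0.0#
  X-sp l k κ = sp-cong refl values (sp-+ (sp-Σc n l (\ m -> sp-* (T-∖-sp κ m) (sp-* (Wi-sp (κ ∖ m)) (sp-Σc n k (\ m' -> sp-* (T-∔-sp (κ ∖ m) m') (sp-* (Wi-sp (κ ∖ m ∔ m')) (δ-sp κ (κ ∖ m ∔ m')))))))) (sp-neg (sp-Σc n k (\ m' -> sp-* (T-∔-sp κ m') (sp-* (Wi-sp (κ ∔ m')) (sp-Σc n l (\ m -> sp-* (T-∖-sp (κ ∔ m') m) (sp-* (Wi-sp (κ ∔ m' ∖ m)) (δ-sp κ (κ ∔ m' ∖ m))))))))))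
   where
   flat : ∀ l k (G : Vec ℕ n -> Vec ℕ n -> K0.Car) -> CK0.Σc n l (\ m -> hm m K0.* (K0.1# K0.* CK0.Σc n k (\ m' -> hm m' K0.* (K0.1# K0.* G m m')))) K0.≈ CK0.Σc n l (\ m -> CK0.Σc n k (\ m' -> (hm m K0.* hm m') K0.* G m m'))
   flat l k G = CK0.Σc-cong n l (\ m -> K0.tr (K0.*ˡ (K0.il _)) (K0.tr (CK0.Σc-*ˡ n k (hm m) _) (CK0.Σc-cong n k (\ m' -> K0.tr (K0.*ˡ (K0.*ˡ (K0.il _))) (K0.sym (K0.*a _ _ _))))))
   values : CK0.Σc n l (\ m -> hm m K0.* (K0.1# K0.* CK0.Σc n k (\ m' -> hm m' K0.* (K0.1# K0.* δ0 κ (κ ∖ m ∔ m'))))) K0.+ K0.- CK0.Σc n k (\ m' -> hm m' K0.* (K0.1# K0.* CK0.Σc n l (\ m -> hm m K0.* (K0.1# K0.* δ0 κ (κ ∔ m' ∖ m))))) K0.≈ K0.0#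
   values = K0.x≈y⇒x-y≈0 (K0.tr (flat l k (\ m m' -> δ0 κ (κ ∖ m ∔ m'))) (K0.tr (CK0.Σc-swap n l n k _) (K0.tr (CK0.Σc-cong n k (\ m' -> CK0.Σc-cong n l (\ m -> K0.*~ (K0.*c _ _) (K0.rf (cong (δ0 κ) (E.sym (∔-∖-comm κ m' m))))))) (K0.sym (flat k l (\ m' m -> δ0 κ (κ ∔ m' ∖ m)))))))
  σ : Hom Ser Ser
  σ = dilate q
  σ-inj : ∀ A -> Hom.ev σ A S.≈ S.0# -> A S.≈ S.0#
  σ-inj A e k = DR.zero-product (pow q k) (A k) (e k) (pow~0 q~0 k)
  module Ex = ExtendDef Ser Ser SerDom SerDom σ σ-inj
  σ̂ : Hom Frac Frac
  σ̂ = Ex.extend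
  module H = Hom σ̂
  σ-M3 : ∀ a b c -> Hom.ev σ (M3 (a , b , c)) S.≈ M3 (a , a N.+ b , c)
  σ-M3 a b c k with a N.≟ k
  ... | yes E.refl = R.tr (R.*ˡ (mon-at a _)) (R.tr (R.tr (R.sym (R.*a _ _ _)) (R.*ʳ (R.sym (pow-+ q a b)))) (R.sym (mon-at a _)))
  ... | no ne = R.tr (R.*ˡ (mon-off a _ k ne)) (R.tr (R.*0 _) (R.sym (mon-off a _ k ne)))
  σ-mι : ∀ a b c -> H.ev (mι (a , b , c)) ≈ mι (a , a N.+ b , c)
  σ-mι a b c = tr (H.ev-cong (mι-def _)) (tr (Ex.extend-ι _) (tr (ι-cong (σ-M3 a b c)) (sym (mι-def _))))
  σ-inv : ∀ x y -> H.ev x ≈ y -> x ≈ y -> ∀ h -> H.ev (inv x h) ≈ inv x h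
  σ-inv x y e e' h = cancelˡ x h (begin x * H.ev (inv x h) ≈⟨ *ʳ (tr e' (sym e)) ⟩ H.ev x * H.ev (inv x h) ≈⟨ H.ev-* _ _ ⟨ H.ev (x * inv x h) ≈⟨ H.ev-cong (inv-r x h) ⟩ H.ev 1# ≈⟨ H.ev-1 ⟩ 1# ≈⟨ inv-r x h ⟨ x * inv x h ∎)
  σ-Q : H.ev Q ≈ Q
  σ-Q = σ-mι 0 1 0
  σ-Tt : H.ev Tt ≈ Tt
  σ-Tt = σ-mι 0 0 1
  σ-qz : ∀ a -> H.ev (qz a) ≈ qz a
  σ-qz (+ k) = σ-mι 0 k 0
  σ-qz -[1+ k ] = σ-inv _ _ (σ-mι 0 (suc k) 0) refl _
  σ-wo : ∀ o -> H.ev (wo o) ≈ wo o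
  σ-wo (lt d) = H.ev-1
  σ-wo (gt d) = tr (H.ev-* _ _) (*~ σ-Q (σ-inv _ _ σ-Tt refl _))
  σ-wo eq = H.ev-1
  σ-s^ : ∀ k -> H.ev (s^ k) ≈ s^ k * q^ k
  σ-s^ k = tr (σ-mι k 0 0) (sym (tr (mι-mul (k , 0 , 0) (0 , k , 0)) (rf (cong₂ (\ x y -> mι (x , y , 0)) (NP.+-identityʳ k) (E.sym (NP.+-identityʳ k))))))
  gap : Fin n -> Fin n -> ℤ
  gap i j = + I i Z.- + I j
  rel : (i j : Fin n) -> ¬ i ≡ j -> ∀ e -> Rel i j (ord i j) e
  rel i j ne e = go (ord i j) (ordView (toℕ i) (toℕ j))
   where
   go : ∀ o -> OrdView (toℕ i) (toℕ j) o -> Rel i j o e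
   go .(lt d) (v-lt d h) = st-lt i j d e h
   go .(gt d) (v-gt d h) = st-gt i j d e h
   go .eq (v-eq h) = absurd (ne (FinP.toℕ-injective h))
  -- The substitution multiplies s^(I i) by q^(I i). In the step relation this has the same effect
  -- as increasing the difference of the entries by I i - I j.
  σ-st : ∀ i j -> ¬ i ≡ j -> ∀ e -> H.ev (st (ord i j) e) ≈ st (ord i j) (e Z.+ gap i j)
  σ-st i j ne e = cancelˡ B B~0 (cancelˡ (q^ (I j)) (mι~0 _) (begin q^ (I j) * (B * H.ev a) ≈⟨ solve 3 (\ x y z -> x :* (y :* z) := z :* (x :* y)) refl _ _ _ ⟩ H.ev a * (q^ (I j) * B) ≈⟨ *ˡ (scaled Q) ⟨ H.ev a * ((Xj * q^ (I j)) + - (Q * ((Yi * q^ (I i)) * qz e))) ≈⟨ *ˡ (apply σ-Q) ⟨ H.ev a * H.ev (Xj + - (Q * (Yi * qz e))) ≈⟨ H.ev-* _ _ ⟨ H.ev (a * (Xj + - (Q * (Yi * qz e)))) ≈⟨ H.ev-cong (rel i j ne e) ⟩ H.ev (wo o * (Xj + - (Tt * (Yi * qz e)))) ≈⟨ tr (H.ev-* _ _) (*~ (σ-wo o) (tr (apply σ-Tt) (scaled Tt))) ⟩ wo o * (q^ (I j) * (Xj + - (Tt * (Yi * z')))) ≈⟨ solve 3 (\ x y z -> x :* (y :* z) := y :* (x :* z)) refl _ _ _ ⟩ q^ (I j) * (wo o * (Xj + - (Tt * (Yi * z')))) ≈⟨ *ˡ (rel i j ne (e Z.+ gap i j)) ⟨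 q^ (I j) * (st o (e Z.+ gap i j) * B) ≈⟨ *ˡ (*c _ _) ⟩ q^ (I j) * (B * st o (e Z.+ gap i j)) ∎))
   where
   o = ord i j
   a = st o e
   Xj = s^ (I j)
   Yi = s^ (I i)
   z' = qz (e Z.+ gap i j)
   B = Xj + - (Q * (Yi * z'))
   B~0 : ¬ (B ≈ 0#)
   B~0 h = pos≉row j i (+ 0) (Z.suc (e Z.+ gap i j)) (\ e -> ne (E.sym e)) (tr (tr (*ˡ mι-1) (*1 _)) (tr (x-y≈0⇒x≈y h) (sym (pos-suc i (e Z.+ gap i j)))))
   apply : ∀ {C} -> H.ev C ≈ C -> H.ev (Xj + - (C * (Yi * qz e))) ≈ (Xj * q^ (I j)) + - (C * ((Yi * q^ (I i)) * qz e))
   apply {C} hC = tr (H.ev-+ _ _) (+~ (σ-s^ _) (tr (H.ev-neg _) (-~ (tr (H.ev-* _ _) (*~ hC (tr (H.ev-* _ _) (*~ (σ-s^ _) (σ-qz e))))))))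
   qI : q^ (I i) * qz e ≈ q^ (I j) * z'
   qI = tr (sym (qz-+ (+ I i) e)) (tr (rf (cong qz idx)) (qz-+ (+ I j) (e Z.+ gap i j)))
    where
    idx : + I i Z.+ e ≡ + I j Z.+ (e Z.+ gap i j)
    idx = E.sym (cong (\ w -> + I j Z.+ w) (cong (\ w -> e Z.+ w) (ZP.+-comm (+ I i) (Z.- + I j)) >> E.sym (ZP.+-assoc e (Z.- + I j) (+ I i)) >> cong (Z._+ + I i) (ZP.+-comm e (Z.- + I j)) >> ZP.+-assoc (Z.- + I j) e (+ I i)) >> E.sym (ZP.+-assoc (+ I j) (Z.- + I j) (e Z.+ + I i)) >> cong (Z._+ (e Z.+ + I i)) (ZP.+-inverseʳ (+ I j)) >> ZP.+-identityˡ _ >> ZP.+-comm e (+ I i))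
   scaled : ∀ C -> (Xj * q^ (I j)) + - (C * ((Yi * q^ (I i)) * qz e)) ≈ q^ (I j) * (Xj + - (C * (Yi * z')))
   scaled C = begin (Xj * q^ (I j)) + - (C * ((Yi * q^ (I i)) * qz e)) ≈⟨ +ˡ (-~ (*ˡ (tr (*a _ _ _) (*ˡ qI)))) ⟩ (Xj * q^ (I j)) + - (C * (Yi * (q^ (I j) * z'))) ≈⟨ solve 5 (\ x q c y z -> x :* q :+ :- (c :* (y :* (q :* z))) := q :* (x :+ :- (c :* (y :* z)))) refl Xj (q^ (I j)) C Yi z' ⟩ q^ (I j) * (Xj + - (C * (Yi * z'))) ∎
  σ-tz : ∀ i j -> ¬ i ≡ j -> ∀ a -> tz (ord i j) (a Z.+ gap i j) ≈ tz (ord i j) (gap i j) * H.ev (tz (ord i j) a)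
  σ-tz i j ne = go
   where
   o = ord i j
   g = gap i j
   ne' : ¬ o ≡ eq
   ne' e = ne (ord-eq i j e)
   step : ∀ a b -> Z.suc a ≡ b -> (tz o (a Z.+ g) ≈ tz o g * H.ev (tz o a)) -> tz o (b Z.+ g) ≈ tz o g * H.ev (tz o b)
   step a b E.refl h = begin tz o (Z.suc a Z.+ g) ≈⟨ rf (cong (tz o) (ZP.+-assoc Z.1ℤ a g)) ⟩ tz o (Z.suc (a Z.+ g)) ≈⟨ tz-suc o (a Z.+ g) ne' ⟩ tz o (a Z.+ g) * st o (a Z.+ g) ≈⟨ *~ h (sym (σ-st i j ne a)) ⟩ (tz o g * H.ev (tz o a)) * H.ev (st o a) ≈⟨ tr (*a _ _ _) (*ˡ (sym (H.ev-* _ _))) ⟩ tz o g * H.ev (tz o a * st o a) ≈⟨ *ˡ (H.ev-cong (tz-suc o a ne')) ⟨ tz o g * H.ev (tz o (Z.suc a)) ∎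
   unstep : ∀ a b -> Z.suc a ≡ b -> (tz o (b Z.+ g) ≈ tz o g * H.ev (tz o b)) -> tz o (a Z.+ g) ≈ tz o g * H.ev (tz o a)
   unstep a b E.refl h = cancelˡ (st o (a Z.+ g)) (st~0 o _) (begin st o (a Z.+ g) * tz o (a Z.+ g) ≈⟨ *c _ _ ⟩ tz o (a Z.+ g) * st o (a Z.+ g) ≈⟨ tz-suc o (a Z.+ g) ne' ⟨ tz o (Z.suc (a Z.+ g)) ≈⟨ rf (cong (tz o) (ZP.+-assoc Z.1ℤ a g)) ⟨ tz o (Z.suc a Z.+ g) ≈⟨ h ⟩ tz o g * H.ev (tz o (Z.suc a)) ≈⟨ *ˡ (tr (H.ev-cong (tz-suc o a ne')) (H.ev-* _ _)) ⟩ tz o g * (H.ev (tz o a) * H.ev (st o a)) ≈⟨ *ˡ (*ˡ (σ-st i j ne a)) ⟩ tz o g * (H.ev (tz o a) * st o (a Z.+ g)) ≈⟨ solve 3 (\ x y z -> x :* (y :* z) := z :* (x :* y)) refl _ _ _ ⟩ st o (a Z.+ g) * (tz o g * H.ev (tz o a)) ∎)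
   go : ∀ a -> tz o (a Z.+ g) ≈ tz o g * H.ev (tz o a)
   go (+ zero) = tr (rf (cong (tz o) (ZP.+-identityˡ g))) (sym (tr (*ˡ H.ev-1) (*1 _)))
   go (+ suc k) = step (+ k) _ E.refl (go (+ k))
   go -[1+ zero ] = unstep -[1+ 0 ] (+ 0) E.refl (go (+ 0))
   go -[1+ suc k ] = unstep -[1+ suc k ] -[1+ k ] E.refl (go -[1+ k ])
  σ-tz-eq : ∀ a -> H.ev (tz eq a) ≈ tz eq a
  σ-tz-eq (+ zero) = H.ev-1
  σ-tz-eq (+ suc k) = tr (H.ev-* _ _) (*~ (σ-tz-eq (+ k)) (tr (H.ev-* _ _) (*~ (fixed (0 , 0 , 0) (0 , k , 1) E.refl E.refl) (σ-inv _ _ (fixed (0 , 0 , 0) (0 , suc k , 0) E.refl E.refl) refl _))))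
   where
   fixed : ∀ m m' -> proj₁ m ≡ 0 -> proj₁ m' ≡ 0 -> H.ev (ι (bin (m , m'))) ≈ ι (bin (m , m'))
   fixed (a , b , c) (a' , b' , c') E.refl E.refl = tr (H.ev-cong (ι-bin _)) (tr (H.ev-+ _ _) (tr (+~ (σ-mι 0 b c) (tr (H.ev-neg _) (-~ (σ-mι 0 b' c')))) (sym (ι-bin _))))
  σ-tz-eq -[1+ k ] = H.ev-0
  -- Adding I i to entry i turns the position s^(I i) q^a into (q s)^(I i) q^a, so that translation
  -- by `ρ` imitates the substitution s ↦ q s.
  ρ : Vec ℕ n
  ρ = tabulate I
  NN : Car
  NN = grid (\ i j -> tz (ord i j) (gap i j))
  -- The constant `NN` is due to the normalisation of `tz` at difference 0 rather than at the gap.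
  -- It cancels against the one in `Wi-shift`.
  T-shift : ∀ κ μ -> T (κ ∔ ρ) (μ ∔ ρ) ≈ NN * H.ev (T κ μ)
  T-shift κ μ = tr (Πs-cong (\ i -> tr (Πs-cong (\ j -> entry i j)) (Π-* _ _))) (tr (Π-* _ _) (*ˡ (sym (tr (H.ev-Πs _) (Πs-cong (\ i -> H.ev-Πs _))))))
   where
   rearr : ∀ i j -> get (κ ∔ ρ) i Z.- get (μ ∔ ρ) j ≡ (get κ i Z.- get μ j) Z.+ gap i j
   rearr i j = cong₂ (\ x y -> x Z.- y) (lookup-∔ i κ ρ >> cong (\ z -> get κ i Z.+ + z) (VecP.lookup∘tabulate I i)) (lookup-∔ j μ ρ >> cong (\ z -> get μ j Z.+ + z) (VecP.lookup∘tabulate I j)) >> lemma (get κ i) (+ I i) (get μ j) (+ I j)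
    where
    lemma : ∀ a b c d -> (a Z.+ b) Z.- (c Z.+ d) ≡ (a Z.- c) Z.+ (b Z.- d)
    lemma a b c d = cong (\ z -> (a Z.+ b) Z.+ z) (ZP.neg-distrib-+ c d) >> ZP.+-assoc a b _ >> cong (\ z -> a Z.+ z) (E.sym (ZP.+-assoc b (Z.- c) (Z.- d)) >> cong (Z._- d) (ZP.+-comm b (Z.- c)) >> ZP.+-assoc (Z.- c) b (Z.- d)) >> E.sym (ZP.+-assoc a (Z.- c) (b Z.- d))
   entry : ∀ i j -> tz (ord i j) (get (κ ∔ ρ) i Z.- get (μ ∔ ρ) j) ≈ tz (ord i j) (gap i j) * H.ev (tz (ord i j) (get κ i Z.- get μ j))
   entry i j with i FinP.≟ j
   ... | no ne = tr (rf (cong (tz (ord i j)) (rearr i j))) (σ-tz i j ne (get κ i Z.- get μ j))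
   ... | yes E.refl = tr (rf (cong (tz (ord i i)) (rearr i i >> cong (\ z -> (get κ i Z.- get μ i) Z.+ z) (ZP.+-inverseʳ (+ I i)) >> ZP.+-identityʳ (get κ i Z.- get μ i)))) (tr (sym (tr (H.ev-cong (rf (cong (\ o -> tz o (get κ i Z.- get μ i)) (ord-refl (toℕ i))))) (tr (σ-tz-eq (get κ i Z.- get μ i)) (rf (cong (\ o -> tz o (get κ i Z.- get μ i)) (E.sym (ord-refl (toℕ i)))))))) (tr (sym (il _)) (*ʳ (sym (rf (cong (tz (ord i i)) (ZP.+-inverseʳ (+ I i))))))))
  Wi-shift : ∀ κ -> NN * Wi (κ ∔ ρ) ≈ H.ev (Wi κ)
  Wi-shift κ = cancelˡ (H.ev (T κ κ)) nz (begin H.ev (T κ κ) * (NN * Wi (κ ∔ ρ)) ≈⟨ solve 3 (\ a b c -> a :* (b :* c) := (b :* a) :* c) refl _ _ _ ⟩ (NN * H.ev (T κ κ)) * Wi (κ ∔ ρ) ≈⟨ *ʳ (T-shift κ κ) ⟨ T (κ ∔ ρ) (κ ∔ ρ) * Wi (κ ∔ ρ) ≈⟨ T-Wi (κ ∔ ρ) ⟩ 1# ≈⟨ one ⟨ H.ev (T κ κ) * H.ev (Wi κ) ∎)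
   where
   one : H.ev (T κ κ) * H.ev (Wi κ) ≈ 1#
   one = tr (sym (H.ev-* _ _)) (tr (H.ev-cong (T-Wi κ)) H.ev-1)
   nz : ¬ (H.ev (T κ κ) ≈ 0#)
   nz z = 1~0 (tr (sym one) (tr (*ʳ z) (0* _)))
  term-shift : ∀ κ μ ν x y -> y ≈ H.ev x -> T (κ ∔ ρ) (μ ∔ ρ) * (Wi (ν ∔ ρ) * y) ≈ H.ev (T κ μ * (Wi ν * x))
  term-shift κ μ ν x y e = begin T (κ ∔ ρ) (μ ∔ ρ) * (Wi (ν ∔ ρ) * y) ≈⟨ *~ (T-shift κ μ) (*ˡ e) ⟩ (NN * H.ev (T κ μ)) * (Wi (ν ∔ ρ) * H.ev x) ≈⟨ solve 4 (\ n t w x -> (n :* t) :* (w :* x) := t :* ((n :* w) :* x)) refl _ _ _ _ ⟩ H.ev (T κ μ) * ((NN * Wi (ν ∔ ρ)) * H.ev x) ≈⟨ *ˡ (*ʳ (Wi-shift ν)) ⟩ H.ev (T κ μ) * (H.ev (Wi ν) * H.ev x) ≈⟨ *ˡ (H.ev-* _ _) ⟨ H.ev (T κ μ) * H.ev (Wi ν * x) ≈⟨ H.ev-* _ _ ⟨ H.ev (T κ μ * (Wi ν * x)) ∎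
  Shifted : Fun -> Fun -> Set
  Shifted φ φ' = ∀ μ -> φ' (μ ∔ ρ) ≈ H.ev (φ μ)
  U-shift : ∀ l φ φ' -> Shifted φ φ' -> Shifted (U l φ) (U l φ')
  U-shift l φ φ' h κ = tr (Σc-cong n l (\ m -> tr (rf (cong (\ x -> T (κ ∔ ρ) x * (Wi x * φ' x)) (∔-∖-comm κ ρ m))) (term-shift κ (κ ∖ m) (κ ∖ m) _ _ (h (κ ∖ m))))) (sym (H.ev-Σc n l _))
  V-shift : ∀ l φ φ' -> Shifted φ φ' -> Shifted (V l φ) (V l φ')
  V-shift l φ φ' h μ = tr (Σc-cong n l (\ m -> tr (rf (cong (\ x -> T x (μ ∔ ρ) * (Wi x * φ' x)) (∔-comm μ ρ m))) (term-shift (μ ∔ m) μ (μ ∔ m) _ _ (h (μ ∔ m))))) (sym (H.ev-Σc n l _))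
  X-shift : ∀ l k φ φ' -> Shifted φ φ' -> Shifted (X l k φ) (X l k φ')
  X-shift l k φ φ' h κ = tr (+~ (U-shift l (V k φ) (V k φ') (V-shift k φ φ' h) κ) (-~ (V-shift k (U l φ) (U l φ') (U-shift l φ φ' h) κ))) (sym (tr (H.ev-+ _ _) (+ˡ (H.ev-neg _))))
  ∔-inj : ∀ {k} (κ μ : Vec ℤ k) m -> κ ∔ m ≡ μ ∔ m -> κ ≡ μ
  ∔-inj [] [] [] e = E.refl
  ∔-inj (a ∷ κ) (b ∷ μ) (c ∷ m) e = cong₂ _∷_ (ℤ-cancel a b (+ c) (VecP.∷-injectiveˡ e)) (∔-inj κ μ m (VecP.∷-injectiveʳ e))
  δ-shift : ∀ κ -> Shifted (δ κ) (δ (κ ∔ ρ))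
  δ-shift κ μ with μ ≟v κ
  ... | yes E.refl = tr (δ-same (μ ∔ ρ)) (sym H.ev-1)
  ... | no ne = tr (δ-diff (κ ∔ ρ) (μ ∔ ρ) (\ e -> ne (∔-inj μ κ ρ e))) (sym H.ev-0)
  -- Let x = a / b with b 0 ≠ 0, so a 0 = 0. Invariance gives a σ(b) = σ(a) b; if a had a first
  -- nonzero coefficient, at index v, comparing coefficients there would yield 1 = q^v, hence v = 0,
  -- which a 0 = 0 excludes.
  invariant-zero : ∀ x -> Sp x K0.0# -> x ≈ H.ev x -> x ≈ 0#
  invariant-zero x (mkSp a b xb nb cb) inv-x = zero-product (ι b) x (tr (*c _ _) (tr xb (tr (ι-cong a≈0) ι-0))) (ι~0 (\ e -> nb (e 0)))
   where
   open SerDef.SerDomain R dom using (leading)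
   σa σb : S.Car
   σa = Hom.ev σ a
   σb = Hom.ev σ b
   a0 : a 0 R.≈ R.0#
   a0 = F0.ι-injective (K0.tr (K0.sym cb) (K0.tr (K0.0* _) (K0.sym F0.ι-0)))
   σxb : x * ι σb ≈ ι σa
   σxb = begin x * ι σb ≈⟨ *~ inv-x (sym (Ex.extend-ι b)) ⟩ H.ev x * H.ev (ι b) ≈⟨ H.ev-* _ _ ⟨ H.ev (x * ι b) ≈⟨ H.ev-cong xb ⟩ H.ev (ι a) ≈⟨ Ex.extend-ι a ⟩ ι σa ∎
   cross : a S.* σb S.≈ σa S.* b
   cross = ι-injective (begin ι (a S.* σb) ≈⟨ ι-* _ _ ⟩ ι a * ι σb ≈⟨ *ʳ xb ⟨ (x * ι b) * ι σb ≈⟨ solve 3 (\ x b c -> (x :* b) :* c := (x :* c) :* b) refl _ _ _ ⟩ (x * ι σb) * ι b ≈⟨ *ʳ σxb ⟩ ι σa * ι b ≈⟨ ι-* _ _ ⟨ ι (σa S.* b) ∎)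
   lead : ∀ (A B : S.Car) v -> (∀ k -> k N.< v -> A k R.≈ R.0#) -> (A S.* B) v R.≈ A v R.* B 0
   lead A B v z = R.tr (R.sumR-single (suc v) v _ ≤-refl (\ { k (N.s≤s k≤v) ne -> R.tr (R.*ʳ (z k (NP.≤∧≢⇒< k≤v ne))) (R.0* _) })) (R.*ˡ (R.rf (cong B (NP.n∸n≡0 v))))
   a≈0 : a S.≈ S.0#
   a≈0 k = DR.stable _ _ (\ nz -> leading a (\ z -> nz (z k)) (\ { (v , below , nv) -> bad v below nv }))
    where
    bad : ∀ v -> (∀ k -> k N.< v -> a k R.≈ R.0#) -> ¬ (a v R.≈ R.0#) -> ⊥
    bad zero _ nv = nv a0
    bad (suc v) below nv = impossible (mono-inj 0 0 (suc v) 0 (R.*ʳ (DR.cancelˡ (a (suc v) R.* b 0) (DR.*-~0 nv nb) eqn)))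
     where
     eqn : (a (suc v) R.* b 0) R.* R.1# R.≈ (a (suc v) R.* b 0) R.* pow q (suc v)
     eqn = R.tr (R.tr (R.*a _ _ _) (R.*ˡ (R.*c _ _))) (R.tr (R.sym (lead a σb (suc v) below)) (R.tr (cross (suc v)) (R.tr (lead σa b (suc v) (\ k lt -> R.tr (R.*ˡ (below k lt)) (R.*0 _))) (R.solve 3 (\ p a b -> (p R.:* a) R.:* b R.:= (a R.:* b) R.:* p) R.refl _ _ _))))
     impossible : ∀ {A : Set} -> (0 ≡ suc v) × A -> ⊥
     impossible (() , _)
  -- Since χ does not depend on the vector, it may be compared at κ and at κ ∔ ρ, where it is the
  -- image of χ κ under s ↦ q s.
  base : ∀ l k (χ : Fun) -> (∀ φ κ -> X l k φ κ ≈ χ κ * φ κ) -> (∀ i κ -> χ κ ≈ χ (dn i κ)) -> ∀ κ -> χ κ ≈ 0#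
  base l k χ hχ hdn κ = invariant-zero (χ κ) (sp-cong (Xδ κ) K0.refl (X-sp l k κ)) (begin χ κ ≈⟨ constant _≈_ refl sym tr χ hdn κ (κ ∔ ρ) ⟩ χ (κ ∔ ρ) ≈⟨ Xδ (κ ∔ ρ) ⟨ X l k (δ (κ ∔ ρ)) (κ ∔ ρ) ≈⟨ X-shift l k (δ κ) (δ (κ ∔ ρ)) (δ-shift κ) κ ⟩ H.ev (X l k (δ κ) κ) ≈⟨ H.ev-cong (Xδ κ) ⟩ H.ev (χ κ) ∎)
   where
   Xδ : ∀ κ -> X l k (δ κ) κ ≈ χ κ
   Xδ κ = tr (hχ (δ κ) κ) (tr (*ˡ (δ-same κ)) (*1 _))
  open Commute base public

-- The commutation written out in matrix entries.

module Exch where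
 open Kit
 open Ser
 open Frac
 open Comp
 open Core
 open Comm
 open Spec
 open Model
 open Base
 open import Data.Vec using (sum)
 total : ∀ {n} -> Vec ℤ n -> ℤ
 total [] = + 0
 total (a ∷ κ) = a Z.+ total κ
 private
  ℤ-interchange : ∀ a b c d -> (a Z.+ b) Z.+ (c Z.+ d) ≡ (a Z.+ c) Z.+ (b Z.+ d)
  ℤ-interchange a b c d = ZP.+-assoc a b (c Z.+ d) >> cong (\ z -> a Z.+ z) (E.sym (ZP.+-assoc b c d) >> cong (Z._+ d) (ZP.+-comm b c) >> ZP.+-assoc c b d) >> E.sym (ZP.+-assoc a c (b Z.+ d))
 total-∔ : ∀ {n} (κ : Vec ℤ n) m -> total (κ ∔ m) ≡ total κ Z.+ + sum m
 total-∔ [] [] = E.refl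
 total-∔ (a ∷ κ) (b ∷ m) = cong (\ z -> (a Z.+ + b) Z.+ z) (total-∔ κ m) >> ℤ-interchange a (+ b) (total κ) (+ sum m)
 ∖-∔ : ∀ {n} (κ : Vec ℤ n) m -> κ ∖ m ∔ m ≡ κ
 ∖-∔ [] [] = E.refl
 ∖-∔ (a ∷ κ) (b ∷ m) = cong₂ _∷_ (ZP.+-assoc a (Z.- + b) (+ b) >> cong (\ z -> a Z.+ z) (ZP.+-inverseˡ (+ b)) >> ZP.+-identityʳ a) (∖-∔ κ m)
 ∔-∖ : ∀ {n} (κ : Vec ℤ n) m -> κ ∔ m ∖ m ≡ κ
 ∔-∖ κ m = ∔-∖-comm κ m m >> (∖-∔ κ m)
 ℤ-cancelˡ : ∀ a b c -> a Z.+ b ≡ a Z.+ c -> b ≡ c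
 ℤ-cancelˡ a b c e = E.sym (back b) >> cong (\ z -> Z.- a Z.+ z) e >> back c
  where
  back : ∀ x -> Z.- a Z.+ (a Z.+ x) ≡ x
  back x = E.sym (ZP.+-assoc (Z.- a) a x) >> cong (Z._+ x) (ZP.+-inverseˡ a) >> ZP.+-identityˡ x
 ∔-injʳ : ∀ {n} (κ : Vec ℤ n) m m' -> κ ∔ m ≡ κ ∔ m' -> m ≡ m'
 ∔-injʳ [] [] [] e = E.refl
 ∔-injʳ (a ∷ κ) (b ∷ m) (c ∷ m') e = cong₂ _∷_ (ZP.+-injective (ℤ-cancelˡ a (+ b) (+ c) (VecP.∷-injectiveˡ e))) (∔-injʳ κ m m' (VecP.∷-injectiveʳ e))
 compare : ∀ {n} (κ μ : Vec ℤ n) -> (Σ (Vec ℕ n) \ m -> κ ≡ μ ∔ m) ⊎ (Σ (Fin n) \ i -> Σ ℕ \ k -> get κ i Z.- get μ i ≡ -[1+ k ])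
 compare [] [] = inj₁ ([] , E.refl)
 compare (a ∷ κ) (b ∷ μ) with a Z.- b | E.inspect (\ x -> x Z.- b) a | compare κ μ
 ... | -[1+ k ] | E.[ e ] | _ = inj₂ (zero , k , e)
 ... | + c | _ | inj₂ (i , k , e) = inj₂ (suc i , k , e)
 ... | + c | E.[ e ] | inj₁ (m , em) = inj₁ (c ∷ m , cong₂ _∷_ (E.sym (cong (\ z -> b Z.+ z) (E.sym e) >> ZP.+-comm b (a Z.- b) >> ZP.+-assoc a (Z.- b) b >> cong (\ z -> a Z.+ z) (ZP.+-inverseˡ b) >> ZP.+-identityʳ a)) em)
 ∔-diff : ∀ {n} (μ : Vec ℤ n) m i -> get (μ ∔ m) i Z.- get μ i ≡ + get m i
 ∔-diff μ m i = cong (Z._- get μ i) (lookup-∔ i μ m >> ZP.+-comm (get μ i) (+ get m i)) >> ZP.+-assoc (+ get m i) (get μ i) (Z.- get μ i) >> cong (\ z -> + get m i Z.+ z) (ZP.+-inverseʳ (get μ i)) >> ZP.+-identityʳ _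
 module CompSingle (R : CRing) where
  open RingKit R
  open CompKit R
  Σc-zero∈ : ∀ n l (g : Vec ℕ n -> Car) -> (∀ m -> sum m ≡ l -> g m ≈ 0#) -> Σc n l g ≈ 0#
  Σc-zero∈ n l g h = tr (Σc-cong∈ n l h) (Σc-zero n l (\ _ -> 0#) (\ _ -> refl))
  Σc-single : ∀ n l (m0 : Vec ℕ n) (g : Vec ℕ n -> Car) -> sum m0 ≡ l -> (∀ m -> ¬ m ≡ m0 -> g m ≈ 0#) -> Σc n l g ≈ g m0
  Σc-single zero zero [] g s h = refl
  Σc-single (suc n) zero (zero ∷ m0) g s h = Σc-single n zero m0 _ s (\ m ne -> h (0 ∷ m) (\ e -> ne (VecP.∷-injectiveʳ e)))
  Σc-single (suc n) (suc l) (zero ∷ m0) g s h = tr (+~ (Σc-single n (suc l) m0 _ s (\ m ne -> h (0 ∷ m) (\ e -> ne (VecP.∷-injectiveʳ e)))) (Σc-zero (suc n) l _ (\ { (a ∷ m) -> h (suc a ∷ m) (\ ()) }))) (+0 _)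
  Σc-single (suc n) (suc l) (suc c ∷ m0) g s h = tr (+~ (Σc-zero n (suc l) _ (\ m -> h (0 ∷ m) (\ ()))) (Σc-single (suc n) l (c ∷ m0) _ (NP.suc-injective s) (\ { (a ∷ m) ne -> h (suc a ∷ m) (\ { E.refl -> ne E.refl }) }))) (0+ _)
 module ExchDef (Se : Setting) (n : ℕ) where
  open Setting Se using (R)
  open ModelDef Se n
  open RingKit Frac
  open PickKit Frac using (Π-zero)
  open CompKit Frac
  open CompSingle Frac
  open DomainKit Frac FracDom
  open CommDef Frac FracField n params
  open CoreDef Frac FracField n params using (T)
  open BaseDef Se n using (commute)
  T-neg : ∀ κ μ i k -> get κ i Z.- get μ i ≡ -[1+ k ] -> T κ μ ≈ 0#
  T-neg κ μ i k e = Π-zero i _ (Π-zero i _ (rf (cong₂ tz (ord-refl (toℕ i)) e)))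
  private
   total-sum : ∀ (κ μ : Vec ℤ n) l m -> κ ≡ μ ∔ m -> total κ ≡ total μ Z.+ + l -> sum m ≡ l
   total-sum κ μ l m E.refl t = ZP.+-injective (ℤ-cancelˡ (total μ) _ _ (E.sym (total-∔ μ m) >> t))
  -- If some entry of κ lies below that of μ, both sides are 0: no composition leads from κ to μ,
  -- and T κ μ contains a diagonal factor at a negative difference. Otherwise exactly one
  -- composition contributes.
  U-δ : ∀ l κ μ -> total κ ≡ total μ Z.+ + l -> U l (δ μ) κ ≈ T κ μ * Wi μ
  U-δ l κ μ t with compare κ μ
  ... | inj₁ (m , e) = tr (Σc-single n l m _ (total-sum κ μ l m e t) off) (reflexive' (cong (_∖ m) e >> (∔-∖ μ m)))
   where
   off : ∀ m' -> ¬ m' ≡ m -> T κ (κ ∖ m') * (Wi (κ ∖ m') * δ μ (κ ∖ m')) ≈ 0#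
   off m' ne = tr (*ˡ (tr (*ˡ (δ-diff μ (κ ∖ m') (\ e' -> ne (∔-injʳ μ m' m (cong (_∔ m') (E.sym e') >> (∖-∔ κ m') >> e))))) (*0 _))) (*0 _)
   reflexive' : ∀ {x} -> x ≡ μ -> T κ x * (Wi x * δ μ x) ≈ T κ μ * Wi μ
   reflexive' E.refl = *ˡ (tr (*ˡ (δ-same μ)) (*1 _))
  ... | inj₂ (i , k , e) = tr (Σc-zero n l _ all-zero) (sym (tr (*ʳ (T-neg κ μ i k e)) (0* _)))
   where
   all-zero : ∀ m -> T κ (κ ∖ m) * (Wi (κ ∖ m) * δ μ (κ ∖ m)) ≈ 0#
   all-zero m = tr (*ˡ (tr (*ˡ (δ-diff μ (κ ∖ m) (\ e' -> bad (E.sym (cong (\ x -> get x i Z.- get μ i) (cong (_∔ m) (E.sym e') >> (∖-∔ κ m)) >> e) >> ∔-diff μ m i)))) (*0 _))) (*0 _)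
    where
    bad : ∀ {a b} -> ¬ -[1+ a ] ≡ + b
    bad ()
  V-δ : ∀ l κ μ -> total κ ≡ total μ Z.+ + l -> V l (δ κ) μ ≈ T κ μ * Wi κ
  V-δ l κ μ t with compare κ μ
  ... | inj₁ (m , e) = tr (Σc-single n l m _ (total-sum κ μ l m e t) off) (reflexive' (E.sym e))
   where
   off : ∀ m' -> ¬ m' ≡ m -> T (μ ∔ m') μ * (Wi (μ ∔ m') * δ κ (μ ∔ m')) ≈ 0#
   off m' ne = tr (*ˡ (tr (*ˡ (δ-diff κ (μ ∔ m') (\ e' -> ne (∔-injʳ μ m' m (e' >> e))))) (*0 _))) (*0 _)
   reflexive' : ∀ {x} -> x ≡ κ -> T x μ * (Wi x * δ κ x) ≈ T κ μ * Wi κ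
   reflexive' E.refl = *ˡ (tr (*ˡ (δ-same κ)) (*1 _))
  ... | inj₂ (i , k , e) = tr (Σc-zero n l _ all-zero) (sym (tr (*ʳ (T-neg κ μ i k e)) (0* _)))
   where
   all-zero : ∀ m -> T (μ ∔ m) μ * (Wi (μ ∔ m) * δ κ (μ ∔ m)) ≈ 0#
   all-zero m = tr (*ˡ (tr (*ˡ (δ-diff κ (μ ∔ m) (\ e' -> bad (E.sym e >> cong (\ x -> get x i Z.- get μ i) (E.sym e') >> ∔-diff μ m i)))) (*0 _))) (*0 _)
    where
    bad : ∀ {a b} -> ¬ -[1+ a ] ≡ + b
    bad ()
  total-∖ : ∀ (κ : Vec ℤ n) m -> total κ ≡ total (κ ∖ m) Z.+ + sum m
  total-∖ κ m = cong total (E.sym (∖-∔ κ m)) >> total-∔ (κ ∖ m) m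
  -- `commute` applied to the δ at μ and read at λ'. The balance of totals makes `U-δ` and `V-δ`
  -- applicable, and the factor Wi μ common to both sides is cancelled.
  exchangeK : ∀ k l λ' μ -> total λ' Z.+ + k ≡ total μ Z.+ + l -> Σc n k (\ m -> T (λ' ∔ m) λ' * (Wi (λ' ∔ m) * T (λ' ∔ m) μ)) ≈ Σc n l (\ m -> T λ' (λ' ∖ m) * (Wi (λ' ∖ m) * T μ (λ' ∖ m)))
  exchangeK k l λ' μ t = cancelˡ (Wi μ) Wi~0 (begin Wi μ * Σc n k (\ m -> T (λ' ∔ m) λ' * (Wi (λ' ∔ m) * T (λ' ∔ m) μ)) ≈⟨ Σc-*ˡ n k _ _ ⟩ Σc n k (\ m -> Wi μ * (T (λ' ∔ m) λ' * (Wi (λ' ∔ m) * T (λ' ∔ m) μ))) ≈⟨ Σc-cong∈ n k (\ m s -> tr (solve 4 (\ w a b c -> w :* (a :* (b :* c)) := a :* (b :* (c :* w))) refl _ _ _ _) (*ˡ (*ˡ (sym (U-δ l (λ' ∔ m) μ (total-∔ λ' m >> cong (\ z -> total λ' Z.+ + z) s >> t)))))) ⟩ V k (U l (δ μ)) λ' ≈⟨ commute l k (δ μ) λ' ⟨ U l (V k (δ μ)) λ' ≈⟨ Σc-cong∈ n l (\ m s -> tr (*ˡ (*ˡ (V-δ k μ (λ' ∖ m) (ℤ-cancelʳ (+ l) (E.sym t >> lhs m s))))) (solve 4 (\ w a b c -> a :* (b :* (c :* w)) := w :* (a :* (b :* c))) refl _ _ _ _)) ⟩ Σc n l (\ m ->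 Wi μ * (T λ' (λ' ∖ m) * (Wi (λ' ∖ m) * T μ (λ' ∖ m)))) ≈⟨ Σc-*ˡ n l _ _ ⟨ Wi μ * Σc n l (\ m -> T λ' (λ' ∖ m) * (Wi (λ' ∖ m) * T μ (λ' ∖ m))) ∎)
   where
   Wi~0 : ¬ (Wi μ ≈ 0#)
   Wi~0 z = 1~0 (tr (sym (T-Wi μ)) (tr (*ˡ z) (*0 _)))
   ℤ-cancelʳ : ∀ c {a b} -> a Z.+ c ≡ b Z.+ c -> a ≡ b
   ℤ-cancelʳ c {a} {b} e = ℤ-cancelˡ c a b (ZP.+-comm c a >> e >> ZP.+-comm b c)
   lhs : ∀ m -> sum m ≡ l -> total λ' Z.+ + k ≡ (total (λ' ∖ m) Z.+ + k) Z.+ + l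
   lhs m E.refl = cong (Z._+ + k) (total-∖ λ' m) >> ZP.+-assoc (total (λ' ∖ m)) (+ sum m) (+ k) >> cong (\ z -> total (λ' ∖ m) Z.+ z) (ZP.+-comm (+ sum m) (+ k)) >> E.sym (ZP.+-assoc (total (λ' ∖ m)) (+ k) (+ sum m))

-- Specialisation s = t and interlacing.

module SpecT where
 open Kit
 open Ser
 open Frac
 open Comp
 open Core
 open Comm
 open Spec
 open Model
 open Exch
 open import Data.Integer using (+≤+; -≤+; -≤-)
 open import Data.Fin using (fromℕ<)
 open import Data.Vec using (sum)
 -- The inequalities κ 0 ≥ μ 0 ≥ κ 1 ≥ μ 1 ≥ ... spelled out for every pair of rows, since the pair
 -- weight is a product over all pairs.
 Ok : Ord -> ℤ -> ℤ -> Set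
 Ok (lt d) a b = b Z.≤ a
 Ok eq a b = b Z.≤ a
 Ok (gt d) a b = a Z.≤ b
 ok? : ∀ o a b -> Dec (Ok o a b)
 ok? (lt d) a b = b ZP.≤? a
 ok? eq a b = b ZP.≤? a
 ok? (gt d) a b = a ZP.≤? b
 Inter : ∀ {n} -> Vec ℤ n -> Vec ℤ n -> Set
 Inter {n} κ μ = (i j : Fin n) -> Ok (ord i j) (get κ i) (get μ j)
 inter? : ∀ {n} (κ μ : Vec ℤ n) -> Dec (Inter κ μ)
 inter? κ μ = FinP.all? (\ i -> FinP.all? (\ j -> ok? (ord i j) (get κ i) (get μ j)))
 -- The second index of the f into which τ of the two rows turns at s = t.
 dd : Ord -> ℕ
 dd (lt d) = suc d
 dd eq = 0
 dd (gt d) = d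
 ordℕ-lt : ∀ i d -> ordℕ i (suc d N.+ i) ≡ lt d
 ordℕ-lt zero d = cong lt (NP.+-identityʳ d)
 ordℕ-lt (suc i) d = cong (ordℕ i) (NP.+-suc d i) >> ordℕ-lt i d
 ord-lt : ∀ {n} (i j : Fin n) d -> toℕ j ≡ suc d N.+ toℕ i -> ord i j ≡ lt d
 ord-lt i j d e = cong (ordℕ (toℕ i)) e >> ordℕ-lt (toℕ i) d
 flipO : Ord -> Ord
 flipO (lt d) = gt d
 flipO (gt d) = lt d
 flipO eq = eq
 ordℕ-flip : ∀ i j -> ordℕ j i ≡ flipO (ordℕ i j)
 ordℕ-flip zero zero = E.refl
 ordℕ-flip zero (suc j) = E.refl
 ordℕ-flip (suc i) zero = E.refl
 ordℕ-flip (suc i) (suc j) = ordℕ-flip i j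
 ord-gt : ∀ {n} (i j : Fin n) d -> toℕ i ≡ suc d N.+ toℕ j -> ord i j ≡ gt d
 ord-gt i j d e = ordℕ-flip (toℕ j) (toℕ i) >> cong flipO (ord-lt j i d e)
 pred-fin : ∀ {n} (i j : Fin n) d -> toℕ j ≡ suc d N.+ toℕ i -> Σ (Fin n) \ k -> toℕ k ≡ d N.+ toℕ i
 pred-fin {n} i j d e = fromℕ< inside , FinP.toℕ-fromℕ< inside
  where
  inside : d N.+ toℕ i N.< n
  inside = NP.<-trans (subst (d N.+ toℕ i N.<_) (E.sym e) ≤-refl) (FinP.toℕ<n j)
 module Adjacent {n} (κ μ : Vec ℤ n) (κ≥μ : ∀ i -> get μ i Z.≤ get κ i) where
  Bad : Set
  Bad = Σ (Fin n) \ i -> Σ (Fin n) \ j -> (ord i j ≡ gt 0) × (get μ j Z.< get κ i)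
  bad? : Dec Bad
  bad? = FinP.any? (\ i -> FinP.any? (\ j -> is0 (ord i j) ×-dec (get μ j ZP.<? get κ i)))
   where
   open import Relation.Nullary.Decidable using (_×-dec_)
   is0 : ∀ o -> Dec (o ≡ gt 0)
   is0 (lt d) = no (\ ())
   is0 eq = no (\ ())
   is0 (gt zero) = yes E.refl
   is0 (gt (suc d)) = no (\ ())
  module _ (nb : ¬ Bad) where
   next : ∀ i j -> toℕ i ≡ suc (toℕ j) -> get κ i Z.≤ get μ j
   next i j e = ZP.≮⇒≥ (\ lt -> nb (i , j , ord-gt i j 0 e , lt))
   down : ∀ d i j -> toℕ j ≡ d N.+ toℕ i -> get μ j Z.≤ get μ i
   down zero i j e = ZP.≤-reflexive (cong (get μ) (FinP.toℕ-injective e))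
   down (suc d) i j e with pred-fin i j d e
   ... | k , ek = ZP.≤-trans (κ≥μ j) (ZP.≤-trans (next j k (e >> cong suc (E.sym ek))) (down d i k ek))
   inter : Inter κ μ
   inter i j = go (ord i j) (ordView (toℕ i) (toℕ j))
    where
    go : ∀ o -> OrdView (toℕ i) (toℕ j) o -> Ok o (get κ i) (get μ j)
    go .(lt d) (v-lt d e) = ZP.≤-trans (down (suc d) i j e) (κ≥μ i)
    go .eq (v-eq e) = subst (\ k -> get μ k Z.≤ get κ i) (FinP.toℕ-injective e) (κ≥μ i)
    go .(gt d) (v-gt d e) with pred-fin j i d e
    ... | k , ek = ZP.≤-trans (next i k (e >> cong suc (E.sym ek))) (down d j k ek)
  -- Given μ ≤ κ, the inequalities between adjacent rows imply all the others. So a failure is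
  -- visible in a pair of adjacent rows, which is where τ acquires a zero at s = t.
  fails : ¬ Inter κ μ -> Bad
  fails ni with bad?
  ... | yes b = b
  ... | no nb = absurd (ni (inter nb))
 record Eval (Se : Setting) : Set₁ where
  open Setting Se
  open RingKit R
  open PickKit R
  field
   evt : Hom (SerDef.Ser R) R
   evt-mon : ∀ a x -> Hom.ev evt (MonDef.mon R a x) ≈ pow t a * x
   fR gR : ℕ -> ℕ -> Car
   f-0 : ∀ d -> fR 0 d ≈ 1#
   f-suc : ∀ k d -> fR (suc k) d * (1# + - (pow q (suc k) * pow t d)) ≈ fR k d * (1# + - (pow q k * pow t (suc d)))
   f-g : ∀ k d -> fR k d * gR k d ≈ 1#
 module SpecTDef (Se : Setting) (Ev : Eval Se) (n : ℕ) where
  open Setting Se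
  open Eval Ev
  open ModelDef Se n
  private
   module R = RingKit R
   module DR = DomainKit R dom
   module S = RingKit Ser
   module CR = CompKit R
   module GR = GridKit R
  open RingKit Frac
  open PickKit Frac using (Π-zero)
  open GridKit Frac
  open DomainKit Frac FracDom
  open Field FracField using (inv; inv-r)
  open CommDef Frac FracField n params using (Wi; T-Wi)
  open CoreDef Frac FracField n params using (T)
  open CompKit Frac
  open ExchDef Se n using (exchangeK; T-neg)
  open SpDef Ser R SerDom dom evt
  private
   module F0 = FracDef R dom
   K0 : CRing
   K0 = F0.Frac
   module K0 = RingKit K0
   module PK0 = PickKit K0
   module GK0 = GridKit K0
   module CK0 = CompKit K0
   module I0 = Field F0.FracField
   module DK0 = DomainKit K0 F0.FracDom
   module ev = Hom evt
  M2 : Mono -> R.Car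
  M2 (a , b , c) = m2 b (a N.+ c)
  ev-M3 : ∀ m -> ev.ev (M3 m) R.≈ M2 m
  ev-M3 (a , b , c) = R.tr (evt-mon a _) (R.tr (R.solve 3 (\ x y z -> x R.:* (y R.:* z) R.:= y R.:* (x R.:* z)) R.refl _ _ _) (R.*ˡ (R.sym (pow-+ t a c))))
  b2 : Mono × Mono -> R.Car
  b2 (m , m') = M2 m R.+ R.- M2 m'
  ev-bin : ∀ mm -> ev.ev (bin mm) R.≈ b2 mm
  ev-bin (m , m') = R.tr (ev.ev-+ _ _) (R.+~ (ev-M3 m) (R.tr (ev.ev-neg _) (R.-~ (ev-M3 m'))))
  b2~0 : ∀ mm -> ¬ (proj₁ (proj₂ (proj₁ mm)) ≡ proj₁ (proj₂ (proj₂ mm)) × proj₁ (proj₁ mm) N.+ proj₂ (proj₂ (proj₁ mm)) ≡ proj₁ (proj₂ mm) N.+ proj₂ (proj₂ (proj₂ mm))) -> ¬ (b2 mm R.≈ R.0#)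
  b2~0 ((a , b , c) , (a' , b' , c')) ne e = ne (mono-inj b (a N.+ c) b' (a' N.+ c') (R.x-y≈0⇒x≈y e))
  den~0 : ∀ o e -> ¬ (b2 (denM o e) R.≈ R.0#)
  den~0 (lt d) (+ k) = b2~0 (denM (lt d) (+ k)) (\ { (() , _) })
  den~0 (lt d) -[1+ k ] = b2~0 (denM (lt d) -[1+ k ]) (\ { (_ , ()) })
  den~0 (gt d) (+ k) = b2~0 (denM (gt d) (+ k)) (\ { (() , _) })
  den~0 (gt d) -[1+ k ] = b2~0 (denM (gt d) -[1+ k ]) (\ { (_ , e) -> NP.1+n≢0 (E.sym (NP.+-comm d 1) >> NP.suc-injective e) })
  den~0 eq (+ k) = b2~0 (denM eq (+ k)) (\ { (() , _) })
  den~0 eq -[1+ k ] = b2~0 (denM eq -[1+ k ]) (\ { (() , _) })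
  num~0 : ∀ o k -> ¬ o ≡ eq -> ¬ (b2 (numM o -[1+ k ]) R.≈ R.0#)
  num~0 (lt d) k _ = b2~0 (numM (lt d) -[1+ k ]) (\ { (() , _) })
  num~0 (gt d) k _ = b2~0 (numM (gt d) -[1+ k ]) (\ { (() , _) })
  num~0 eq k ne = absurd (ne E.refl)
  quot0 : (a b : R.Car) -> ¬ (b R.≈ R.0#) -> K0.Car
  quot0 a b nb = F0.ι a K0.* I0.inv (F0.ι b) (F0.ι~0 nb)
  quot0-* : ∀ a b nb -> quot0 a b nb K0.* F0.ι b K0.≈ F0.ι a
  quot0-* a b nb = K0.tr (K0.*a _ _ _) (K0.tr (K0.*ˡ (K0.tr (K0.*c _ _) (I0.inv-r _ _))) (K0.*1 _))
  stv : Ord -> ℤ -> K0.Car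
  stv o e = quot0 (b2 (numM o e)) (b2 (denM o e)) (den~0 o e)
  st-sp : ∀ o e -> Sp (st o e) (stv o e)
  st-sp o e = mkSp (bin (numM o e)) (bin (denM o e)) (st-den o e) (\ z -> den~0 o e (R.tr (R.sym (ev-bin (denM o e))) z)) (K0.tr (K0.*ˡ (F0.ι-cong (ev-bin (denM o e)))) (K0.tr (quot0-* _ _ (den~0 o e)) (F0.ι-cong (R.sym (ev-bin (numM o e))))))
  st⁻v : ∀ o k -> ¬ o ≡ eq -> K0.Car
  st⁻v o k ne = quot0 (b2 (denM o -[1+ k ])) (b2 (numM o -[1+ k ])) (num~0 o k ne)
  st⁻-sp : ∀ o k (ne : ¬ o ≡ eq) h -> Sp (inv (st o -[1+ k ]) h) (st⁻v o k ne)
  st⁻-sp o k ne h = sp-inv (st-sp o -[1+ k ]) (inv-r _ _) (DK0.cancelˡ (F0.ι (b2 (denM o -[1+ k ]))) (F0.ι~0 (den~0 o _)) (K0.tr (K0.solve 3 (\ d a b -> d K0.:* (a K0.:* b) K0.:= (a K0.:* d) K0.:* b) K0.refl _ _ _) (K0.tr (K0.*ʳ (quot0-* _ _ (den~0 o -[1+ k ]))) (K0.tr (K0.*c _ _) (K0.tr (quot0-* _ _ (num~0 o k ne)) (K0.sym (K0.*1 _)))))))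
  tz-sp : ∀ o a -> Σ K0.Car \ c -> Sp (tz o a) c
  tz-sp o (+ zero) = K0.1# , sp-1
  tz-sp o (+ suc m) = _ , sp-* (proj₂ (tz-sp o (+ m))) (st-sp o (+ m))
  tz-sp eq -[1+ m ] = K0.0# , sp-0
  tz-sp (lt d) -[1+ zero ] = _ , st⁻-sp (lt d) 0 (\ ()) _
  tz-sp (gt d) -[1+ zero ] = _ , st⁻-sp (gt d) 0 (\ ()) _
  tz-sp (lt d) -[1+ suc m ] = _ , sp-* (proj₂ (tz-sp (lt d) -[1+ m ])) (st⁻-sp (lt d) (suc m) (\ ()) _)
  tz-sp (gt d) -[1+ suc m ] = _ , sp-* (proj₂ (tz-sp (gt d) -[1+ m ])) (st⁻-sp (gt d) (suc m) (\ ()) _)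
  ratio-step : ∀ {X Y A B : R.Car} nb -> Y R.* B R.≈ X R.* A -> F0.ι X K0.* quot0 A B nb K0.≈ F0.ι Y
  ratio-step {X} {Y} {A} {B} nb h = DK0.cancelˡ (F0.ι B) (F0.ι~0 nb) (K0.tr (K0.solve 3 (\ d a b -> d K0.:* (a K0.:* b) K0.:= a K0.:* (b K0.:* d)) K0.refl _ _ _) (K0.tr (K0.*ˡ (quot0-* _ _ nb)) (K0.tr (K0.sym (F0.ι-* _ _)) (K0.tr (F0.ι-cong (R.sym h)) (K0.tr (F0.ι-* _ _) (K0.*c _ _))))))
  G : Ord -> ℤ -> R.Car
  G o a = fR ∣ a ∣ (dd o)
  Gi : Ord -> ℤ -> R.Car
  Gi o a = gR ∣ a ∣ (dd o)
  private
   one : m2 0 0 R.≈ R.1#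
   one = R.il R.1#
   f-rel : ∀ k D D' -> D' ≡ D -> fR (suc k) D R.* (m2 0 0 R.+ R.- m2 (suc k) D') R.≈ fR k D R.* (m2 0 0 R.+ R.- m2 k (D' N.+ 1))
   f-rel k D .D E.refl = R.tr (R.*ˡ (R.+ʳ one)) (R.tr (f-suc k D) (R.*ˡ (R.+~ (R.sym one) (R.-~ (R.*ˡ (R.rf (cong (pow t) (NP.+-comm 1 D))))))))
   f-rel⁻ : ∀ k d -> fR (suc k) d R.* (m2 (suc k) (suc d N.+ 0) R.+ R.- m2 0 1) R.≈ fR k d R.* (m2 k (suc d N.+ 1) R.+ R.- m2 0 1)
   f-rel⁻ k d = begin′
    where
    module B = RingKit R
    begin′ : fR (suc k) d R.* (m2 (suc k) (suc d N.+ 0) R.+ R.- m2 0 1) R.≈ fR k d R.* (m2 k (suc d N.+ 1) R.+ R.- m2 0 1)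
    begin′ = R.tr (R.*ˡ (R.+ʳ (R.*ˡ (R.rf (cong (\ x -> t R.* pow t x) (NP.+-identityʳ d)))))) (R.tr (R.solve 4 (\ f Q t D -> f R.:* (Q R.:* (t R.:* D) R.:+ R.:- (R.:1 R.:* (t R.:* R.:1))) R.:= (R.:- t) R.:* (f R.:* (R.:1 R.:+ R.:- (Q R.:* D)))) R.refl _ (pow q (suc k)) t (pow t d)) (R.tr (R.*ˡ (f-suc k d)) (R.tr (R.solve 4 (\ f Q t D -> (R.:- t) R.:* (f R.:* (R.:1 R.:+ R.:- (Q R.:* D))) R.:= f R.:* (Q R.:* (t R.:* D) R.:+ R.:- (R.:1 R.:* (t R.:* R.:1)))) R.refl _ (pow q k) t (pow t (suc d))) (R.*ˡ (R.+ʳ (R.*ˡ (R.rf (cong (\ x -> t R.* pow t x) (NP.+-comm 1 d)))))))))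
  -- The step ratios become the ratios of consecutive values of f. For i > j interlacing makes the
  -- difference nonpositive, and the inverses of the ratios take this role.
  tz-good : ∀ o a b -> Ok o a b -> Sp (tz o (a Z.- b)) (F0.ι (G o (a Z.- b)))
  tz-good o a b h = go o (a Z.- b) (sign o h)
   where
   Sign : Ord -> ℤ -> Set
   Sign (lt d) x = + 0 Z.≤ x
   Sign eq x = + 0 Z.≤ x
   Sign (gt d) x = x Z.≤ + 0
   sign : ∀ o -> Ok o a b -> Sign o (a Z.- b)
   sign (lt d) h = ZP.i≤j⇒0≤j-i h
   sign eq h = ZP.i≤j⇒0≤j-i h
   sign (gt d) h = ZP.i≤j⇒i-j≤0 h
   base0 : ∀ d -> K0.1# K0.≈ F0.ι (fR 0 d)
   base0 d = K0.sym (K0.tr (F0.ι-cong (f-0 d)) F0.ι-1)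
   go : ∀ o x -> Sign o x -> Sp (tz o x) (F0.ι (G o x))
   go o (+ zero) h = sp-cong refl (base0 (dd o)) sp-1
   go (lt d) (+ suc k) (+≤+ _) = sp-cong refl (ratio-step (den~0 (lt d) (+ k)) (R.tr (f-rel k (suc d) (suc d N.+ 0) (NP.+-identityʳ (suc d))) cg)) (sp-* (go (lt d) (+ k) (+≤+ N.z≤n)) (st-sp (lt d) (+ k)))
    where
    cg : fR k (suc d) R.* (m2 0 0 R.+ R.- m2 k (suc d N.+ 0 N.+ 1)) R.≈ fR k (suc d) R.* (m2 0 0 R.+ R.- m2 k (suc d N.+ 1))
    cg = R.*ˡ (R.+ˡ (R.-~ (R.*ˡ (R.rf (cong (\ x -> pow t (x N.+ 1)) (NP.+-identityʳ (suc d)))))))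
   go eq (+ suc k) (+≤+ _) = sp-cong refl (ratio-step (den~0 eq (+ k)) (f-rel k 0 0 E.refl)) (sp-* (go eq (+ k) (+≤+ N.z≤n)) (st-sp eq (+ k)))
   go (gt d) (+ suc k) (+≤+ ())
   go (gt d) -[1+ zero ] h = sp-cong refl (K0.tr (K0.sym (K0.il _)) (K0.tr (K0.*ʳ (base0 d)) (ratio-step (num~0 (gt d) 0 (\ ())) (f-rel⁻ 0 d)))) (st⁻-sp (gt d) 0 (\ ()) _)
   go (gt d) -[1+ suc k ] h = sp-cong refl (ratio-step (num~0 (gt d) (suc k) (\ ())) (f-rel⁻ (suc k) d)) (sp-* (go (gt d) -[1+ k ] -≤+) (st⁻-sp (gt d) (suc k) (\ ()) _))
  -- For adjacent rows the step at difference 0 has numerator s q - q t, which vanishes at s = t,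
  -- and every positive difference includes this step.
  tz-bad : ∀ k -> Sp (tz (gt 0) (+ suc k)) K0.0#
  tz-bad zero = sp-cong refl zero-val (sp-* sp-1 (st-sp (gt 0) (+ 0)))
   where
   zero-val : K0.1# K0.* stv (gt 0) (+ 0) K0.≈ K0.0#
   zero-val = K0.tr (K0.il _) (K0.tr (K0.*ʳ (K0.tr (F0.ι-cong (R.-‿inverseʳ _)) F0.ι-0)) (K0.0* _))
  tz-bad (suc k) = sp-cong refl (K0.0* _) (sp-* (tz-bad k) (st-sp (gt 0) (+ suc k)))
  -- The quotient of tz (y + k) by tz y as a product of step ratios. These have regular
  -- specialisations, so the quotient is regular even where tz y becomes 0.
  rat : Ord -> ℤ -> ℕ -> Car
  rat o y zero = 1#
  rat o y (suc k) = rat o y k * st o (y Z.+ + k)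
  tz-rat : ∀ o y k -> ¬ o ≡ eq -> tz o (y Z.+ + k) ≈ tz o y * rat o y k
  tz-rat o y zero ne = tr (rf (cong (tz o) (ZP.+-identityʳ y))) (sym (*1 _))
  tz-rat o y (suc k) ne = begin tz o (y Z.+ + suc k) ≈⟨ rf (cong (tz o) (ℤ-+-suc y k)) ⟩ tz o (Z.suc (y Z.+ + k)) ≈⟨ tz-suc o (y Z.+ + k) ne ⟩ tz o (y Z.+ + k) * st o (y Z.+ + k) ≈⟨ *ʳ (tz-rat o y k ne) ⟩ (tz o y * rat o y k) * st o (y Z.+ + k) ≈⟨ *a _ _ _ ⟩ tz o y * rat o y (suc k) ∎
  rat-sp : ∀ o y k -> Σ K0.Car \ c -> Sp (rat o y k) c
  rat-sp o y zero = K0.1# , sp-1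
  rat-sp o y (suc k) = _ , sp-* (proj₂ (rat-sp o y k)) (st-sp o (y Z.+ + k))
  TG : (Fin n -> Fin n -> ℤ) -> Car
  TG x = grid (\ i j -> tz (ord i j) (x i j))
  module _ (x y z : Fin n -> Fin n -> ℤ) (yi : Car) (hy : TG y * yi ≈ 1#) (y-diag : ∀ i -> y i i ≡ + 0) (dz : ∀ i j -> Σ ℕ \ k -> z i j ≡ y i j Z.+ + k) where
   -- The inverse yi may have a pole at s = t. As z exceeds y, the pole is absorbed entry by entry:
   -- z / y is a `rat` off the diagonal, and y is trivial on it. The remaining factor x then brings
   -- the zero of `tz-bad`.
   quotient-bad : ∀ i j -> ord i j ≡ gt 0 -> (Σ ℕ \ k -> x i j ≡ + suc k) -> Sp (TG x * (yi * TG z)) K0.0#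
   quotient-bad i0 j0 o0 (k0 , e0) = sp-cong quotient zero-val (sp-Π (\ i -> sp-Π (\ j -> proj₂ (E-sp i j))))
    where
    Ent : ∀ o (x y z : ℤ) k -> Car
    Ent eq x y z k = tz eq x * tz eq z
    Ent o x y z k = tz o x * rat o y k
    Ent-spec : ∀ o x y z k -> (o ≡ eq -> y ≡ + 0) -> z ≡ y Z.+ + k -> Ent o x y z k * tz o y ≈ tz o x * tz o z
    Ent-spec eq x y z k hy hz = tr (*ˡ (rf (cong (tz eq) (hy E.refl)))) (*1 _)
    Ent-spec (lt d) x y z k _ hz = tr (*a _ _ _) (*ˡ (tr (*c _ _) (tr (sym (tz-rat (lt d) y k (\ ()))) (rf (cong (tz (lt d)) (E.sym hz))))))
    Ent-spec (gt d) x y z k _ hz = tr (*a _ _ _) (*ˡ (tr (*c _ _) (tr (sym (tz-rat (gt d) y k (\ ()))) (rf (cong (tz (gt d)) (E.sym hz))))))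
    Ent-sp : ∀ o x y z k -> Σ K0.Car \ c -> Sp (Ent o x y z k) c
    Ent-sp eq x y z k = _ , sp-* (proj₂ (tz-sp eq x)) (proj₂ (tz-sp eq z))
    Ent-sp (lt d) x y z k = _ , sp-* (proj₂ (tz-sp (lt d) x)) (proj₂ (rat-sp (lt d) y k))
    Ent-sp (gt d) x y z k = _ , sp-* (proj₂ (tz-sp (gt d) x)) (proj₂ (rat-sp (gt d) y k))
    E : Fin n -> Fin n -> Car
    E i j = Ent (ord i j) (x i j) (y i j) (z i j) (proj₁ (dz i j))
    E-sp : ∀ i j -> Σ K0.Car \ c -> Sp (E i j) c
    E-sp i j = Ent-sp (ord i j) _ _ _ _
    E-spec : ∀ i j -> E i j * tz (ord i j) (y i j) ≈ tz (ord i j) (x i j) * tz (ord i j) (z i j)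
    E-spec i j = Ent-spec (ord i j) _ _ _ _ (\ e -> cong (y i) (E.sym (ord-eq i j e)) >> y-diag i) (proj₂ (dz i j))
    grid-* : (A B : Fin n -> Fin n -> Car) -> grid (\ i j -> A i j * B i j) ≈ grid A * grid B
    grid-* A B = tr (Πs-cong (\ i -> Π-* (A i) (B i))) (Π-* _ _)
    quotient : grid E ≈ TG x * (yi * TG z)
    quotient = begin grid E ≈⟨ *1 _ ⟨ grid E * 1# ≈⟨ *ˡ hy ⟨ grid E * (TG y * yi) ≈⟨ *a _ _ _ ⟨ (grid E * TG y) * yi ≈⟨ *ʳ (tr (sym (grid-* E _)) (tr (Πs-cong (\ i -> Πs-cong (\ j -> E-spec i j))) (grid-* _ _))) ⟩ (TG x * TG z) * yi ≈⟨ solve 3 (\ a b c -> (a :* b) :* c := a :* (c :* b)) refl _ _ _ ⟩ TG x * (yi * TG z) ∎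
    E0 : Sp (E i0 j0) K0.0#
    E0 = subst₂ (\ o x -> Sp (Ent o x (y i0 j0) (z i0 j0) (proj₁ (dz i0 j0))) K0.0#) (E.sym o0) (E.sym e0) (sp-cong refl (K0.0* _) (sp-* (tz-bad k0) (proj₂ (rat-sp (gt 0) (y i0 j0) (proj₁ (dz i0 j0))))))
    zero-val : K0.Πs (\ i -> K0.Πs (\ j -> proj₁ (E-sp i j))) K0.≈ K0.0#
    zero-val = PK0.Π-zero i0 _ (PK0.Π-zero j0 _ (sp-unique (proj₂ (E-sp i0 j0)) E0))
  diff : Vec ℤ n -> Vec ℤ n -> Fin n -> Fin n -> ℤ
  diff κ μ i j = get κ i Z.- get μ j
  Gg Gig : Vec ℤ n -> Vec ℤ n -> R.Car
  Gg κ μ = GR.grid (\ i j -> G (ord i j) (diff κ μ i j))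
  Gig κ μ = GR.grid (\ i j -> Gi (ord i j) (diff κ μ i j))
  opaque
   TT : Vec ℤ n -> Vec ℤ n -> R.Car
   TT κ μ with inter? κ μ
   ... | yes _ = Gg κ μ
   ... | no _ = R.0#
   TT-yes : ∀ κ μ -> Inter κ μ -> TT κ μ ≡ Gg κ μ
   TT-yes κ μ h with inter? κ μ
   ... | yes _ = E.refl
   ... | no nh = absurd (nh h)
   TT-no : ∀ κ μ -> ¬ Inter κ μ -> TT κ μ ≡ R.0#
   TT-no κ μ nh with inter? κ μ
   ... | yes h = absurd (nh h)
   ... | no _ = E.refl
  WW : Vec ℤ n -> R.Car
  WW κ = Gig κ κ
  ι0H : Hom R K0
  ι0H = record { ev = F0.ι ; ev-cong = F0.ι-cong ; ev-+ = F0.ι-+ ; ev-* = F0.ι-* ; ev-1 = F0.ι-1 }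
  ι-grid : (A : Fin n -> Fin n -> R.Car) -> F0.ι (GR.grid A) K0.≈ GK0.grid (\ i j -> F0.ι (A i j))
  ι-grid A = K0.tr (Hom.ev-Πs ι0H _) (K0.Πs-cong (\ i -> Hom.ev-Πs ι0H _))
  T-good : ∀ κ μ -> Inter κ μ -> Sp (T κ μ) (F0.ι (Gg κ μ))
  T-good κ μ h = sp-cong refl (K0.sym (ι-grid _)) (sp-Π (\ i -> sp-Π (\ j -> tz-good (ord i j) _ _ (h i j))))
  Wi-good : ∀ κ -> Inter κ κ -> Sp (Wi κ) (F0.ι (WW κ))
  Wi-good κ h = sp-inv (T-good κ κ h) (T-Wi κ) (K0.tr (K0.sym (F0.ι-* _ _)) (K0.tr (F0.ι-cong (R.tr (R.sym (R.Π-* _ _)) (R.Π-one _ (\ i -> R.tr (R.sym (R.Π-* _ _)) (R.Π-one _ (\ j -> f-g _ _)))))) F0.ι-1))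
  term-good : ∀ {κ1 μ1 κ2 μ2 ν} -> Inter κ1 μ1 -> Inter κ2 μ2 -> Inter ν ν -> Sp (T κ1 μ1 * (Wi ν * T κ2 μ2)) (F0.ι (TT κ1 μ1 R.* (WW ν R.* TT κ2 μ2)))
  term-good {κ1} {μ1} {κ2} {μ2} {ν} h1 h2 h = sp-cong refl (K0.sym (K0.tr (F0.ι-cong (R.*~ (R.rf (TT-yes κ1 μ1 h1)) (R.*ˡ (R.rf (TT-yes κ2 μ2 h2))))) (K0.tr (F0.ι-* _ _) (K0.*ˡ (F0.ι-* _ _))))) (sp-* (T-good κ1 μ1 h1) (sp-* (Wi-good ν h) (T-good κ2 μ2 h2)))
  term-zero1 : ∀ {κ1 μ1 κ2 μ2 ν x} -> ¬ Inter κ1 μ1 -> Sp x K0.0# -> Sp x (F0.ι (TT κ1 μ1 R.* (WW ν R.* TT κ2 μ2)))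
  term-zero1 {κ1} {μ1} nh = sp-cong refl (K0.sym (K0.tr (F0.ι-cong (R.tr (R.*ʳ (R.rf (TT-no κ1 μ1 nh))) (R.0* _))) F0.ι-0))
  term-zero2 : ∀ {κ1 μ1 κ2 μ2 ν x} -> ¬ Inter κ2 μ2 -> Sp x K0.0# -> Sp x (F0.ι (TT κ1 μ1 R.* (WW ν R.* TT κ2 μ2)))
  term-zero2 {κ1} {μ1} {κ2} {μ2} nh = sp-cong refl (K0.sym (K0.tr (F0.ι-cong (R.tr (R.*ˡ (R.tr (R.*ˡ (R.rf (TT-no κ2 μ2 nh))) (R.*0 _))) (R.*0 _))) F0.ι-0))
  private
   neg-not-inter : ∀ (κ μ : Vec ℤ n) i k -> get κ i Z.- get μ i ≡ -[1+ k ] -> ¬ Inter κ μ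
   neg-not-inter κ μ i k e h = bad (subst (+ 0 Z.≤_) e (ZP.i≤j⇒0≤j-i le))
    where
    le : get μ i Z.≤ get κ i
    le = subst (\ o -> Ok o (get κ i) (get μ i)) (ord-refl (toℕ i)) (h i i)
    bad : ¬ (+ 0 Z.≤ -[1+ k ])
    bad ()
   pos-part : ∀ a b -> b Z.< a -> Σ ℕ \ k -> a Z.- b ≡ + suc k
   pos-part a b b<a with a Z.- b | E.inspect (\ x -> x Z.- b) a
   ... | + suc k | _ = k , E.refl
   ... | + zero | E.[ e ] = absurd (ZP.<-irrefl (E.sym (ZP.i-j≡0⇒i≡j a b e)) b<a)
   ... | -[1+ k ] | E.[ e ] = absurd (bad (subst (+ 0 Z.≤_) e (ZP.i≤j⇒0≤j-i (ZP.<⇒≤ b<a))))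
    where
    bad : ¬ (+ 0 Z.≤ -[1+ k ])
    bad ()
   ge : ∀ (μ : Vec ℤ n) m i -> get μ i Z.≤ get (μ ∔ m) i
   ge μ m i = subst (get μ i Z.≤_) (E.sym (lookup-∔ i μ m)) (ZP.i≤i+j (get μ i) (+ get m i))
   same-zero : ∀ (κ : Vec ℤ n) i -> diff κ κ i i ≡ + 0
   same-zero κ i = ZP.+-inverseʳ (get κ i)
   shift-sub : ∀ a b c m -> a ≡ c Z.+ + m -> a Z.- b ≡ (c Z.- b) Z.+ + m
   shift-sub a b c m E.refl = ZP.+-assoc c (+ m) (Z.- b) >> cong (\ z -> c Z.+ z) (ZP.+-comm (+ m) (Z.- b)) >> E.sym (ZP.+-assoc c (Z.- b) (+ m))
   shift-sub′ : ∀ a b c m -> c ≡ b Z.+ + m -> a Z.- b ≡ (a Z.- c) Z.+ + m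
   shift-sub′ a b c m E.refl = E.sym (ZP.+-assoc a (Z.- (b Z.+ + m)) (+ m) >> cong (\ z -> a Z.+ z) (cong (Z._+ + m) (ZP.neg-distrib-+ b (+ m)) >> ZP.+-assoc (Z.- b) (Z.- + m) (+ m) >> cong (\ z -> Z.- b Z.+ z) (ZP.+-inverseˡ (+ m)) >> ZP.+-identityʳ (Z.- b)))
   -- A vector with an interlacing partner is weakly decreasing, so its weight `Wi` has no pole at s
   -- = t.
   self-upper : (κ μ : Vec ℤ n) -> Inter κ μ -> Inter κ κ
   self-upper κ μ h i j with ord i j | E.inspect (ord i) j
   ... | lt d | E.[ e ] = ZP.≤-trans (subst (\ o -> Ok o (get κ j) (get μ i)) (ord-flip (toℕ i) (toℕ j) >> cong flip e) (h j i)) (subst (\ o -> Ok o (get κ i) (get μ i)) (ord-refl (toℕ i)) (h i i))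
   ... | gt d | E.[ e ] = ZP.≤-trans (subst (\ o -> Ok o (get κ i) (get μ j)) e (h i j)) (subst (\ o -> Ok o (get κ j) (get μ j)) (ord-refl (toℕ j)) (h j j))
   ... | eq | E.[ e ] = ZP.≤-reflexive (cong (get κ) (E.sym (ord-eq i j e)))
   self-lower : (κ μ : Vec ℤ n) -> Inter κ μ -> Inter μ μ
   self-lower κ μ h i j with ord i j | E.inspect (ord i) j
   ... | lt d | E.[ e ] = ZP.≤-trans (subst (\ o -> Ok o (get κ j) (get μ j)) (ord-refl (toℕ j)) (h j j)) (subst (\ o -> Ok o (get κ j) (get μ i)) (ord-flip (toℕ i) (toℕ j) >> cong flip e) (h j i))
   ... | gt d | E.[ e ] = ZP.≤-trans (subst (\ o -> Ok o (get κ i) (get μ i)) (ord-refl (toℕ i)) (h i i)) (subst (\ o -> Ok o (get κ i) (get μ j)) e (h i j))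
   ... | eq | E.[ e ] = ZP.≤-reflexive (cong (get μ) (E.sym (ord-eq i j e)))
  -- If both pairs interlace, each of the three factors is regular. If one pair does not, the zero
  -- of its T enters as x in `quotient-bad`, and the T of the other pair is used as z to absorb the
  -- pole of `Wi κ`.
  upper-sp : ∀ κ λ' μ m -> κ ≡ λ' ∔ m -> Sp (T κ λ' * (Wi κ * T κ μ)) (F0.ι (TT κ λ' R.* (WW κ R.* TT κ μ)))
  upper-sp κ λ' μ m E.refl with compare κ μ
  ... | inj₂ (i , k , e) = term-zero2 {κ} {λ'} {κ} {μ} {κ} (neg-not-inter κ μ i k e) (sp-cong (sym (tr (*ˡ (tr (*ˡ (T-neg κ μ i k e)) (*0 _))) (*0 _))) K0.refl sp-0)
  ... | inj₁ (m' , e) with inter? κ λ' | inter? κ μ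
  ...   | yes h1 | yes h2 = term-good {κ} {λ'} {κ} {μ} {κ} h1 h2 (self-upper κ λ' h1)
  ...   | no n1 | _ = term-zero1 {κ} {λ'} {κ} {μ} {κ} n1 (bad (Adjacent.fails κ λ' (ge λ' m) n1))
   where
   bad : Adjacent.Bad κ λ' (ge λ' m) -> Sp (T κ λ' * (Wi κ * T κ μ)) K0.0#
   bad (i , j , o , b<a) = quotient-bad (diff κ λ') (diff κ κ) (diff κ μ) (Wi κ) (T-Wi κ) (same-zero κ) (\ i j -> get m' j , shift-sub′ (get κ i) (get μ j) (get κ j) (get m' j) (cong (\ v -> get v j) e >> lookup-∔ j μ m')) i j o (pos-part _ _ b<a)
  ...   | yes _ | no n2 = term-zero2 {κ} {λ'} {κ} {μ} {κ} n2 (bad (Adjacent.fails κ μ geμ n2))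
   where
   geμ : ∀ i -> get μ i Z.≤ get κ i
   geμ i = subst (\ v -> get μ i Z.≤ get v i) (E.sym e) (ge μ m' i)
   bad : Adjacent.Bad κ μ geμ -> Sp (T κ λ' * (Wi κ * T κ μ)) K0.0#
   bad (i , j , o , b<a) = sp-cong (solve 3 (\ a b c -> a :* (b :* c) := c :* (b :* a)) refl _ _ _) K0.refl (quotient-bad (diff κ μ) (diff κ κ) (diff κ λ') (Wi κ) (T-Wi κ) (same-zero κ) (\ i j -> get m j , shift-sub′ (get κ i) (get λ' j) (get κ j) (get m j) (lookup-∔ j λ' m)) i j o (pos-part _ _ b<a))
  lower-sp : ∀ κ λ' μ m -> λ' ≡ κ ∔ m -> Sp (T λ' κ * (Wi κ * T μ κ)) (F0.ι (TT λ' κ R.* (WW κ R.* TT μ κ)))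
  lower-sp κ λ' μ m E.refl with compare μ κ
  ... | inj₂ (i , k , e) = term-zero2 {λ'} {κ} {μ} {κ} {κ} (neg-not-inter μ κ i k e) (sp-cong (sym (tr (*ˡ (tr (*ˡ (T-neg μ κ i k e)) (*0 _))) (*0 _))) K0.refl sp-0)
  ... | inj₁ (m' , e) with inter? λ' κ | inter? μ κ
  ...   | yes h1 | yes h2 = term-good {λ'} {κ} {μ} {κ} {κ} h1 h2 (self-lower λ' κ h1)
  ...   | no n1 | _ = term-zero1 {λ'} {κ} {μ} {κ} {κ} n1 (bad (Adjacent.fails λ' κ (ge κ m) n1))
   where
   bad : Adjacent.Bad λ' κ (ge κ m) -> Sp (T λ' κ * (Wi κ * T μ κ)) K0.0#
   bad (i , j , o , b<a) = quotient-bad (diff λ' κ) (diff κ κ) (diff μ κ) (Wi κ) (T-Wi κ) (same-zero κ) (\ i j -> get m' i , shift-sub (get μ i) (get κ j) (get κ i) (get m' i) (cong (\ v -> get v i) e >> lookup-∔ i κ m')) i j o (pos-part _ _ b<a)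
  ...   | yes _ | no n2 = term-zero2 {λ'} {κ} {μ} {κ} {κ} n2 (bad (Adjacent.fails μ κ geμ n2))
   where
   geμ : ∀ i -> get κ i Z.≤ get μ i
   geμ i = subst (\ v -> get κ i Z.≤ get v i) (E.sym e) (ge κ m' i)
   bad : Adjacent.Bad μ κ geμ -> Sp (T λ' κ * (Wi κ * T μ κ)) K0.0#
   bad (i , j , o , b<a) = sp-cong (solve 3 (\ a b c -> a :* (b :* c) := c :* (b :* a)) refl _ _ _) K0.refl (quotient-bad (diff μ κ) (diff κ κ) (diff λ' κ) (Wi κ) (T-Wi κ) (same-zero κ) (\ i j -> get m i , shift-sub (get λ' i) (get κ j) (get κ i) (get m i) (lookup-∔ i κ m)) i j o (pos-part _ _ b<a))
  exchange : ∀ k l λ' μ -> total λ' Z.+ + k ≡ total μ Z.+ + l -> CR.Σc n k (\ m -> TT (λ' ∔ m) λ' R.* (WW (λ' ∔ m) R.* TT (λ' ∔ m) μ)) R.≈ CR.Σc n l (\ m -> TT λ' (λ' ∖ m) R.* (WW (λ' ∖ m) R.* TT μ (λ' ∖ m)))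
  exchange k l λ' μ t = F0.ι-injective (K0.tr (Hom.ev-Σc ι0H n k _) (K0.tr (sp-unique (sp-Σc n k (\ m -> upper-sp (λ' ∔ m) λ' μ m E.refl)) (sp-cong (sym (exchangeK k l λ' μ t)) K0.refl (sp-Σc n l (\ m -> lower-sp (λ' ∖ m) λ' μ m (E.sym (∖-∔ λ' m)))))) (K0.sym (Hom.ev-Σc ι0H n l _))))

-- The q-adic limit and the skew Cauchy identity.

module Limit where
 open Kit
 open Ser
 open Frac
 open Comp
 open Core
 open Spec
 open Model
 open Exch
 open SpecT
 open import Data.Fin using (fromℕ)
 open import Data.Vec using (sum; updateAt)
 abs : ℤ -> ℕ
 abs = ∣_∣
 module QuotDef (R : CRing) (I : RingKit.Car R) where
  open RingKit R
  _≈ᵢ_ : Car -> Car -> Set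
  x ≈ᵢ y = Σ Car \ z -> x ≈ y + I * z
  lift : ∀ {x y} -> x ≈ y -> x ≈ᵢ y
  lift h = 0# , tr h (solve 2 (\ y i -> y := y :+ i :* :0) refl _ I)
  Quot : CRing
  Quot = record { Carrier = Car ; _≈_ = _≈ᵢ_ ; _+_ = _+_ ; _*_ = _*_ ; -_ = -_ ; 0# = 0# ; 1# = 1# ; isCommutativeRing = record { isRing = record { +-isAbelianGroup = record { isGroup = record { isMonoid = record { isSemigroup = record { isMagma = record { isEquivalence = record { refl = lift refl ; sym = \ { {x} {y} (z , h) -> - z , tr (solve 3 (\ y i z -> y := (y :+ i :* z) :+ i :* :- z) refl y I z) (+ʳ (sym h)) } ; trans = \ { {x} {y} {w} (z , h) (z' , h') -> z' + z , tr h (tr (+ʳ h') (solve 4 (\ w i a b -> (w :+ i :* a) :+ i :* b := w :+ i :* (a :+ b)) refl w I z' z)) } } ; ∙-cong = \ { {x} {x'} {y} {y'} (z , h) (z' , h') -> z + z' , tr (+~ h h') (solve 5 (\ x y i a b -> (x :+ i :* a) :+ (y :+ i :* b) := (x :+ y) :+ i :* (a :+ b)) refl x' y' I z z') } } ; assoc = \ x y z -> lift (+a x y z) } ; identity = (\ x -> lift (0+ x)) , (\ x -> lift (+0 x)) } ; inverse = (\ x -> lift (-‿inverseˡ x)) , (\ x -> lift (-‿inverseʳ x)) ; ⁻¹-cong = \ { {x} {y} (z , h) -> - z , tr (-~ h) (solve 3 (\ y i z -> :- (y :+ i :* z) := :- y :+ i :* :- z) refl y I z) } } ; comm = \ x y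 -> lift (+c x y) } ; *-cong = \ { {x} {x'} {y} {y'} (z , h) (z' , h') -> (x' * z' + z * y') + (z * z') * I , tr (*~ h h') (solve 5 (\ x y i a b -> (x :+ i :* a) :* (y :+ i :* b) := x :* y :+ i :* ((x :* b :+ a :* y) :+ (a :* b) :* i)) refl x' y' I z z') } ; *-assoc = \ x y z -> lift (*a x y z) ; *-identity = (\ x -> lift (il x)) , (\ x -> lift (*1 x)) ; distrib = (\ x y z -> lift (distribˡ x y z)) , (\ x y z -> lift (distribʳ x y z)) } ; *-comm = \ x y -> lift (*c x y) } }
  reduce : Hom R Quot
  reduce = record { ev = \ x -> x ; ev-cong = lift ; ev-+ = \ _ _ -> lift refl ; ev-* = \ _ _ -> lift refl ; ev-1 = lift refl }
 -- The powers of q have intersection 0, so that congruences modulo all of them amount to an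
 -- equality.
 Separated : Setting -> Set
 Separated Se = ∀ x -> (∀ L -> Σ (RingKit.Car (Setting.R Se)) \ y -> RingKit._≈_ (Setting.R Se) x (RingKit._*_ (Setting.R Se) (PickKit.pow (Setting.R Se) (Setting.q Se) L) y)) -> RingKit._≈_ (Setting.R Se) x (RingKit.0# (Setting.R Se))
 module LimitDef (Se : Setting) (Ev : Eval Se) (n0 : ℕ) (separated : Separated Se) where
  open Setting Se
  open Eval Ev
  n : ℕ
  n = suc n0
  open SpecTDef Se Ev n
  private
   module R = RingKit R
   module CR = CompKit R
   module GR = GridKit R
   module PR = PickKit R
  last : Fin n
  last = fromℕ n0
  rowdd : Fin n -> ℕ
  rowdd i = dd (ord i last)
  -- The factors that the last column contributes to the pair weight of κ with a vector whose last
  -- entry is 0, and their inverses. In the limit just these factors are replaced by constants.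
  P Pi : Vec ℤ n -> R.Car
  P κ = R.Πs (\ i -> fR (abs (get κ i)) (rowdd i))
  Pi κ = R.Πs (\ i -> gR (abs (get κ i)) (rowdd i))
  -- The terms of the two sides that are left in the limit. `Pi κ` on one side, and P τ, Pi λ', Pi μ
  -- on the other, correct for the last columns that have become constant.
  upper lower : Vec ℤ n -> Vec ℤ n -> Vec ℤ n -> R.Car
  upper λ' μ κ = TT κ λ' R.* (WW κ R.* (TT κ μ R.* Pi κ))
  lower λ' μ τ = TT λ' τ R.* (WW τ R.* (TT μ τ R.* (P τ R.* (Pi λ' R.* Pi μ))))
  clr : Vec ℕ n -> Vec ℕ n
  clr m = updateAt m last (\ _ -> 0)
  add : ℕ -> Vec ℕ n -> Vec ℕ n
  add L m = updateAt m last (L N.+_)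
  last-not-gt : ∀ (i : Fin n) d -> ¬ ord i last ≡ gt d
  last-not-gt i d e with ord i last | ordView (toℕ i) (toℕ last)
  last-not-gt i d E.refl | .(gt d) | v-gt .d e' = NP.<-irrefl E.refl (≤-trans (≤-trans (≤-reflexive (cong suc (E.sym (FinP.toℕ-fromℕ n0) >> E.refl))) (≤-trans (N.s≤s (NP.m≤n+m (toℕ last) d)) (≤-reflexive (E.sym e')))) (NP.≤-pred (FinP.toℕ<n i)))
  col-last : ∀ (i : Fin n) a b -> b Z.≤ a -> Ok (ord i last) a b
  col-last i a b h with ord i last | E.inspect (ord i) last
  ... | lt d | _ = h
  ... | eq | _ = h
  ... | gt d | E.[ e ] = absurd (last-not-gt i d e)
  col-last⁻ : ∀ (i : Fin n) a b -> Ok (ord i last) a b -> b Z.≤ a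
  col-last⁻ i a b h with ord i last | E.inspect (ord i) last
  ... | lt d | _ = h
  ... | eq | _ = h
  ... | gt d | E.[ e ] = absurd (last-not-gt i d e)
  row-last : (j : Fin n) -> ¬ j ≡ last -> Σ ℕ \ d -> ord last j ≡ gt d
  row-last j ne with ord last j | E.inspect (ord last) j
  ... | gt d | _ = d , E.refl
  ... | eq | E.[ e ] = absurd (ne (E.sym (ord-eq′ e)))
   where
   ord-eq′ : ord last j ≡ eq -> last ≡ j
   ord-eq′ e = ModelDef.ord-eq Se n last j e
  ... | lt d | E.[ e ] = absurd (last-not-gt j d (ordℕ-flip (toℕ last) (toℕ j) >> cong flipO e))
  setLast : Vec ℤ n -> ℤ -> Vec ℤ n
  setLast κ a = updateAt κ last (\ _ -> a)
  set-last : ∀ κ a -> get (setLast κ a) last ≡ a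
  set-last κ a = VecP.lookup∘updateAt last κ
  set-other : ∀ κ a i -> ¬ i ≡ last -> get (setLast κ a) i ≡ get κ i
  set-other κ a i ne = VecP.lookup∘updateAt′ i last ne κ
  module AtLevel (L : ℕ) where
   open QuotDef R (PR.pow q L)
   private
    module Q = RingKit Quot
    module GQ = GridKit Quot
    module PQ = PickKit Quot
    module CQ = CompKit Quot
    module red = Hom reduce
   pow-split : ∀ k -> L N.≤ k -> PR.pow q k R.≈ PR.pow q L R.* PR.pow q (k N.∸ L)
   pow-split k le = R.tr (R.rf (cong (PR.pow q) (E.sym (NP.m+[n∸m]≡n le)))) (ModelDef.pow-+ Se n q L (k N.∸ L))
   -- The ratio (1 - q^k t^(d+1)) / (1 - q^(k+1) t^d) is 1 modulo q^L as soon as k ≥ L.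
   f-next : ∀ k d -> L N.≤ k -> fR (suc k) d ≈ᵢ fR k d
   f-next k d le = z , R.tr (R.solve 4 (\ F f a b -> F R.:= (F R.:* (R.:1 R.:+ R.:- a) R.:+ R.:- (f R.:* (R.:1 R.:+ R.:- b))) R.:+ (f R.:+ (F R.:* a R.:+ R.:- (f R.:* b)))) R.refl F f0 _ _) (R.tr (R.+~ (R.x≈y⇒x-y≈0 (f-suc k d)) (R.+ˡ split)) (R.0+ _))
    where
    F = fR (suc k) d
    f0 = fR k d
    w = PR.pow q (k N.∸ L)
    z = F R.* ((q R.* w) R.* PR.pow t d) R.+ R.- (f0 R.* (w R.* PR.pow t (suc d)))
    split : F R.* (PR.pow q (suc k) R.* PR.pow t d) R.+ R.- (f0 R.* (PR.pow q k R.* PR.pow t (suc d))) R.≈ PR.pow q L R.* z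
    split = R.tr (R.+~ (R.*ˡ (R.*ʳ (R.*ˡ (pow-split k le)))) (R.-~ (R.*ˡ (R.*ʳ (pow-split k le))))) (R.solve 7 (\ F f q p w t s -> F R.:* ((q R.:* (p R.:* w)) R.:* t) R.:+ R.:- (f R.:* ((p R.:* w) R.:* s)) R.:= p R.:* (F R.:* ((q R.:* w) R.:* t) R.:+ R.:- (f R.:* (w R.:* s)))) R.refl F f0 q (PR.pow q L) w (PR.pow t d) (PR.pow t (suc d)))
   f-const : ∀ a d -> fR (L N.+ a) d Q.≈ fR L d
   f-const zero d = lift (R.rf (cong (\ k -> fR k d) (NP.+-identityʳ L)))
   f-const (suc a) d = Q.tr (lift (R.rf (cong (\ k -> fR k d) (NP.+-suc L a)))) (Q.tr (f-next (L N.+ a) d (NP.m≤m+n L a)) (f-const a d))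
   g-const : ∀ a d -> gR (L N.+ a) d Q.≈ gR L d
   g-const a d = Q.tr (Q.sym (Q.*1 _)) (Q.tr (Q.*ˡ (Q.sym (lift (f-g L d)))) (Q.tr (Q.solve 3 (\ x y z -> x Q.:* (y Q.:* z) Q.:= (y Q.:* x) Q.:* z) Q.refl _ _ _) (Q.tr (Q.*ʳ (Q.tr (Q.*ʳ (Q.sym (f-const a d))) (lift (f-g (L N.+ a) d)))) (Q.il _))))
   C Ci : R.Car
   C = R.Πs (\ i -> fR L (rowdd i))
   Ci = R.Πs (\ i -> gR L (rowdd i))
   red-Π : ∀ {m} (f : Fin m -> R.Car) -> R.Πs f Q.≈ Q.Πs f
   red-Π = red.ev-Πs
   red-grid : (A : Fin n -> Fin n -> R.Car) -> GR.grid A Q.≈ GQ.grid A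
   red-grid A = Q.tr (red-Π _) (Q.Πs-cong (\ i -> red-Π _))
   abs-add : ∀ a -> + 0 Z.≤ a -> ∀ x -> (abs (a Z.- Z.- (+ (L N.+ x)))) ≡ L N.+ (x N.+ (abs a))
   abs-add (+ k) _ x = cong (\ z -> (abs (+ k Z.+ z))) (ZP.neg-involutive (+ (L N.+ x))) >> NP.+-comm k (L N.+ x) >> NP.+-assoc L x k
   abs-sub : ∀ a -> + 0 Z.≤ a -> ∀ x -> (abs (Z.- (+ (L N.+ x)) Z.- a)) ≡ L N.+ (x N.+ (abs a))
   abs-sub a h x = E.sym (ZP.∣-i∣≡∣i∣ (Z.- (+ (L N.+ x)) Z.- a)) >> cong abs (ZP.neg-distrib-+ (Z.- (+ (L N.+ x))) (Z.- a) >> ZP.+-comm (Z.- Z.- (+ (L N.+ x))) (Z.- Z.- a) >> cong (Z._+ (Z.- Z.- (+ (L N.+ x)))) (ZP.neg-involutive a)) >> abs-add a h x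
   hat : Vec ℤ n -> ℕ -> Vec ℤ n
   hat μ x = setLast μ (Z.- (+ (L N.+ x)))
   neg-≤ : ∀ {a} -> + 0 Z.≤ a -> ∀ x -> Z.- (+ x) Z.≤ a
   neg-≤ {+ k} _ zero = Z.+≤+ N.z≤n
   neg-≤ {+ k} _ (suc x) = Z.-≤+
   Ok-subst : ∀ {o a a' b b'} -> a ≡ a' -> b ≡ b' -> Ok o a b -> Ok o a' b'
   Ok-subst E.refl E.refl h = h
   -- Replacing the last entry of the lower argument by - (L + x) only moves the last column of the grid.
   hat-inter : ∀ κ μ x -> get μ last ≡ + 0 -> (∀ i -> + 0 Z.≤ get κ i) -> Inter κ μ -> Inter κ (hat μ x)
   hat-inter κ μ x z nn h i j with j FinP.≟ last
   ... | yes E.refl = col-last i _ _ (subst (Z._≤ get κ i) (E.sym (set-last μ _)) (neg-≤ (nn i) (L N.+ x)))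
   ... | no ne = Ok-subst E.refl (E.sym (set-other μ _ j ne)) (h i j)
   hat-inter⁻ : ∀ κ μ x -> get μ last ≡ + 0 -> (∀ i -> + 0 Z.≤ get κ i) -> Inter κ (hat μ x) -> Inter κ μ
   hat-inter⁻ κ μ x z nn h i j with j FinP.≟ last
   ... | yes E.refl = col-last i _ _ (subst (Z._≤ get κ i) (E.sym z) (nn i))
   ... | no ne = Ok-subst E.refl (set-other μ _ j ne) (h i j)
   hat-G : ∀ κ μ x -> get μ last ≡ + 0 -> (∀ i -> + 0 Z.≤ get κ i) -> Gg κ (hat μ x) Q.≈ Gg κ μ R.* (C R.* Pi κ)
   hat-G κ μ x z nn = Q.tr (red-grid _) (Q.tr (GQ.grid-col last _ _ (\ a -> fR L (rowdd a) R.* gR (abs (get κ a)) (rowdd a)) col other) (Q.*~ (Q.sym (red-grid _)) (Q.tr (Q.sym (red-Π _)) (lift (R.Π-* _ _)))))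
    where
    col : ∀ a -> G (ord a last) (diff κ (hat μ x) a last) Q.≈ G (ord a last) (diff κ μ a last) R.* (fR L (rowdd a) R.* gR (abs (get κ a)) (rowdd a))
    col a = Q.tr (Q.tr (lift (R.rf (cong (\ b -> fR b (rowdd a)) (cong (\ b -> (abs (get κ a Z.- b))) (set-last μ _) >> abs-add _ (nn a) x)))) (f-const _ _)) (Q.sym (lift (R.tr (R.*ʳ (R.rf (cong (\ b -> fR b (rowdd a)) (cong abs (cong (\ b -> get κ a Z.- b) z >> ZP.+-identityʳ (get κ a)))))) (R.tr (R.solve 3 (\ x y z -> x R.:* (y R.:* z) R.:= y R.:* (x R.:* z)) R.refl _ _ _) (R.tr (R.*ˡ (f-g _ _)) (R.*1 _))))))
    other : ∀ a b -> ¬ b ≡ last -> G (ord a b) (diff κ (hat μ x) a b) Q.≈ G (ord a b) (diff κ μ a b)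
    other a b ne = lift (R.rf (cong (\ c -> G (ord a b) (get κ a Z.- c)) (set-other μ _ b ne)))
   TT-kill : ∀ κ μ {y} -> ¬ Inter κ μ -> TT κ μ R.* y R.≈ R.0#
   TT-kill κ μ nh = R.tr (R.*ʳ (R.rf (TT-no κ μ nh))) (R.0* _)
   hat-TT : ∀ κ μ x -> get μ last ≡ + 0 -> (∀ i -> + 0 Z.≤ get κ i) -> TT κ (hat μ x) Q.≈ TT κ μ R.* (C R.* Pi κ)
   hat-TT κ μ x z nn with inter? κ μ
   ... | yes h = Q.tr (lift (R.rf (TT-yes κ (hat μ x) (hat-inter κ μ x z nn h)))) (Q.tr (hat-G κ μ x z nn) (lift (R.*ʳ (R.rf (E.sym (TT-yes κ μ h))))))
   ... | no nh = lift (R.tr (R.rf (TT-no κ (hat μ x) (\ h -> nh (hat-inter⁻ κ μ x z nn h)))) (R.sym (TT-kill κ μ nh)))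
   nonneg-above : ∀ κ λ' -> get λ' last ≡ + 0 -> Inter κ λ' -> ∀ i -> + 0 Z.≤ get κ i
   nonneg-above κ λ' z h i = subst (Z._≤ get κ i) z (col-last⁻ i _ _ (h i last))
   upper-term : ∀ κ λ' μ -> get λ' last ≡ + 0 -> get μ last ≡ + 0 -> TT κ λ' R.* (WW κ R.* TT κ (hat μ 0)) Q.≈ C R.* upper λ' μ κ
   upper-term κ λ' μ zλ zμ with inter? κ λ'
   ... | no nh = lift (R.tr (TT-kill κ λ' nh) (R.sym (R.tr (R.*ˡ (TT-kill κ λ' nh)) (R.*0 _))))
   ... | yes h = Q.tr (Q.*ˡ (Q.*ˡ (hat-TT κ μ 0 zμ (nonneg-above κ λ' zλ h)))) (lift (R.solve 5 (\ g w t c p -> g R.:* (w R.:* (t R.:* (c R.:* p))) R.:= c R.:* (g R.:* (w R.:* (t R.:* p)))) R.refl _ _ _ C _))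
   module Lower (λ' μ τ : Vec ℤ n) (x : ℕ) (zλ : get λ' last ≡ + 0) (zμ : get μ last ≡ + 0) (zτ : get τ last ≡ + 0) (nλ : ∀ i -> + 0 Z.≤ get λ' i) (nμ : ∀ i -> + 0 Z.≤ get μ i) where
    τ̂ μ̂ : Vec ℤ n
    τ̂ = hat τ x
    μ̂ = hat μ 0
    module Given (hλ : Inter λ' τ) where
     nτ : ∀ j -> + 0 Z.≤ get τ j
     nτ j with j FinP.≟ last
     ... | yes E.refl = ZP.≤-reflexive (E.sym zτ)
     ... | no ne with row-last j ne
     ...   | d , e = subst (Z._≤ get τ j) zλ (subst (\ o -> Ok o (get λ' last) (get τ j)) e (hλ last j))
     inter-to : Inter μ τ -> Inter μ̂ τ̂
     inter-to h i j with i FinP.≟ last | j FinP.≟ last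
     ... | yes E.refl | yes E.refl = col-last last _ _ (subst₂ Z._≤_ (E.sym (set-last τ _)) (E.sym (set-last μ _)) (ZP.neg-mono-≤ (Z.+≤+ (NP.+-monoʳ-≤ L N.z≤n))))
     ... | yes E.refl | no ne with row-last j ne
     ...   | d , e = subst (\ o -> Ok o (get μ̂ last) (get τ̂ j)) (E.sym e) (subst₂ Z._≤_ (E.sym (set-last μ _)) (E.sym (set-other τ _ j ne)) (neg-≤ (nτ j) (L N.+ 0)))
     inter-to h i j | no ne | yes E.refl = col-last i _ _ (subst₂ Z._≤_ (E.sym (set-last τ _)) (E.sym (set-other μ _ i ne)) (neg-≤ (nμ i) (L N.+ x)))
     inter-to h i j | no ne | no ne' = Ok-subst (E.sym (set-other μ _ i ne)) (E.sym (set-other τ _ j ne')) (h i j)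
     inter-from : Inter μ̂ τ̂ -> Inter μ τ
     inter-from h i j with i FinP.≟ last | j FinP.≟ last
     ... | i? | yes E.refl = col-last i _ _ (subst (Z._≤ get μ i) (E.sym zτ) (nμ i))
     ... | yes E.refl | no ne with row-last j ne
     ...   | d , e = subst (\ o -> Ok o (get μ last) (get τ j)) (E.sym e) (subst (Z._≤ get τ j) (E.sym zμ) (nτ j))
     inter-from h i j | no ne | no ne' = Ok-subst (set-other μ _ i ne) (set-other τ _ j ne') (h i j)
     Z Ẑ : Fin n -> Fin n -> R.Car
     Z i j = G (ord i j) (diff μ τ i j) R.* Gi (ord i j) (diff τ τ i j)
     Ẑ i j = G (ord i j) (diff μ̂ τ̂ i j) R.* Gi (ord i j) (diff τ̂ τ̂ i j)
     -- The change of the last column. At its corner the two lowered last entries differ by x, which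
     -- gives the kernel coefficient f(x, 0). Elsewhere f and its inverse are taken beyond L and
     -- cancel, so only the old entries must be divided out.
     rr : Fin n -> R.Car
     rr i with i FinP.≟ last
     ... | yes _ = fR x 0
     ... | no _ = gR (abs (get μ i)) (rowdd i) R.* fR (abs (get τ i)) (rowdd i)
     at0 : ∀ a b -> b ≡ + 0 -> (abs (a Z.- b)) ≡ (abs a)
     at0 a b E.refl = cong abs (ZP.+-identityʳ a)
     corner : (abs (Z.- (+ (L N.+ 0)) Z.- Z.- (+ (L N.+ x)))) ≡ x
     corner = cong abs (ZP.+-comm (Z.- (+ (L N.+ 0))) (Z.- Z.- (+ (L N.+ x))) >> cong (Z._- + (L N.+ 0)) (ZP.neg-involutive (+ (L N.+ x)))) >> cong abs (ZP.m-n≡m⊖n (L N.+ x) (L N.+ 0)) >> cong abs (ZP.+-cancelˡ-⊖ L x 0) >> E.refl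
     1f : ∀ d -> fR 0 d R.* gR 0 d R.≈ R.1#
     1f d = f-g 0 d
     g-0 : ∀ d -> gR 0 d R.≈ R.1#
     g-0 d = R.tr (R.sym (R.il _)) (R.tr (R.*ʳ (R.sym (f-0 d))) (f-g 0 d))
     ordll : ord last last ≡ eq
     ordll = ModelDef.ord-refl Se n (toℕ last)
     ddll : ∀ {y} -> fR y (rowdd last) ≡ fR y 0
     ddll {y} = cong (\ o -> fR y (dd o)) ordll
     col : ∀ a -> Ẑ a last Q.≈ Z a last R.* rr a
     col a with a FinP.≟ last
     ... | yes E.refl = lift (R.tr (R.*~ (R.rf (cong (\ y -> fR y (rowdd last)) (cong₂ (\ y z -> (abs (y Z.- z))) (set-last μ _) (set-last τ _) >> corner) >> ddll)) (R.tr (R.rf (cong (\ y -> gR (abs y) (rowdd last)) (ZP.+-inverseʳ (get τ̂ last)))) (g-0 _))) (R.tr (R.*c _ _) (R.*ʳ (R.sym (R.tr (R.*~ (R.rf (cong (\ y -> fR y (rowdd last)) (cong₂ (\ y z -> (abs (y Z.- z))) zμ zτ))) (R.rf (cong (\ y -> gR (abs y) (rowdd last)) (ZP.+-inverseʳ (get τ last))))) (1f _))))))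
     ... | no ne = Q.tr (Q.*~ (Q.tr (lift (R.rf (cong (\ y -> fR y (rowdd a)) (cong₂ (\ y z -> (abs (y Z.- z))) (set-other μ _ a ne) (set-last τ _) >> abs-add _ (nμ a) x)))) (f-const _ _)) (Q.tr (lift (R.rf (cong (\ y -> gR y (rowdd a)) (cong₂ (\ y z -> (abs (y Z.- z))) (set-other τ _ a ne) (set-last τ _) >> abs-add _ (nτ a) x)))) (g-const _ _))) (Q.tr (lift (f-g L (rowdd a))) (Q.sym (lift (R.tr (R.*ʳ (R.*~ (R.rf (cong (\ y -> fR y (rowdd a)) (at0 (get μ a) _ zτ))) (R.rf (cong (\ y -> gR y (rowdd a)) (at0 (get τ a) _ zτ))))) (R.tr (R.solve 4 (\ a b c d -> (a R.:* b) R.:* (c R.:* d) R.:= (a R.:* c) R.:* (d R.:* b)) R.refl _ _ _ _) (R.tr (R.*~ (f-g _ _) (f-g _ _)) (R.il _)))))))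
     other : ∀ a b -> ¬ b ≡ last -> Ẑ a b Q.≈ Z a b
     other a b nb with a FinP.≟ last
     ... | no na = lift (R.*~ (R.rf (cong₂ (\ y z -> G (ord a b) (y Z.- z)) (set-other μ _ a na) (set-other τ _ b nb))) (R.rf (cong₂ (\ y z -> Gi (ord a b) (y Z.- z)) (set-other τ _ a na) (set-other τ _ b nb))))
     ... | yes E.refl = Q.tr (Q.*~ (Q.tr (lift (R.rf (cong (\ y -> fR y D) (cong₂ (\ y z -> (abs (y Z.- z))) (set-last μ _) (set-other τ _ b nb) >> abs-sub _ (nτ b) 0)))) (f-const _ _)) (Q.tr (lift (R.rf (cong (\ y -> gR y D) (cong₂ (\ y z -> (abs (y Z.- z))) (set-last τ _) (set-other τ _ b nb) >> abs-sub _ (nτ b) x)))) (g-const _ _))) (Q.tr (lift (f-g L D)) (Q.sym (lift (R.tr (R.*ʳ (R.rf (cong (\ y -> fR (abs (y Z.- get τ b)) D) (zμ >> E.sym zτ)))) (f-g _ D)))))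
      where D = dd (ord last b)
     Πrr : R.Πs rr R.≈ fR x 0 R.* (Pi μ R.* P τ)
     Πrr = R.tr (PR.Π-pick last rr (\ i -> gR (abs (get μ i)) (rowdd i) R.* fR (abs (get τ i)) (rowdd i)) (fR x 0) here there) (R.*ˡ (R.Π-* _ _))
      where
      here : rr last R.≈ fR x 0 R.* (gR (abs (get μ last)) (rowdd last) R.* fR (abs (get τ last)) (rowdd last))
      here with last FinP.≟ last
      ... | no ne = absurd (ne E.refl)
      ... | yes _ = R.sym (R.tr (R.*ˡ (R.tr (R.*~ (R.tr (R.rf (cong (\ y -> gR (abs y) (rowdd last)) zμ)) (g-0 _)) (R.tr (R.rf (cong (\ y -> fR (abs y) (rowdd last)) zτ)) (f-0 _))) (R.il _))) (R.*1 _))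
      there : ∀ j -> ¬ j ≡ last -> rr j R.≈ gR (abs (get μ j)) (rowdd j) R.* fR (abs (get τ j)) (rowdd j)
      there j ne with j FinP.≟ last
      ... | yes e = absurd (ne e)
      ... | no _ = R.refl
     grid-* : (A B : Fin n -> Fin n -> R.Car) -> GR.grid (\ i j -> A i j R.* B i j) R.≈ GR.grid A R.* GR.grid B
     grid-* A B = R.tr (R.Πs-cong (\ i -> R.Π-* (A i) (B i))) (R.Π-* _ _)
     moving : Gg μ̂ τ̂ R.* WW τ̂ Q.≈ (Gg μ τ R.* WW τ) R.* (fR x 0 R.* (Pi μ R.* P τ))
     moving = Q.tr (lift (R.sym (grid-* _ _))) (Q.tr (red-grid Ẑ) (Q.tr (GQ.grid-col last Z Ẑ rr col other) (Q.*~ (Q.tr (Q.sym (red-grid Z)) (lift (grid-* _ _))) (Q.tr (Q.sym (red-Π rr)) (lift Πrr)))))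
    lower-term : TT λ' τ̂ R.* (WW τ̂ R.* TT μ̂ τ̂) Q.≈ C R.* (fR x 0 R.* lower λ' μ τ)
    lower-term with inter? λ' τ
    ... | no nh = lift (R.tr (R.tr (R.*ʳ (R.rf (TT-no λ' τ̂ (\ h -> nh (hat-inter⁻ λ' τ x zτ nλ h))))) (R.0* _)) (R.sym (R.tr (R.*ˡ (R.tr (R.*ˡ (TT-kill λ' τ nh)) (R.*0 _))) (R.*0 _))))
    ... | yes h with inter? μ τ
    ...   | no nh = lift (R.tr (R.tr (R.*ˡ (R.tr (R.*ˡ (R.rf (TT-no μ̂ τ̂ (\ h' -> nh (inter-from h'))))) (R.*0 _))) (R.*0 _)) (R.sym (R.tr (R.*ˡ (R.tr (R.*ˡ (R.tr (R.*ˡ (R.tr (R.*ˡ (TT-kill μ τ nh)) (R.*0 _))) (R.*0 _))) (R.*0 _))) (R.*0 _))))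
     where
     open Given h
    ...   | yes h' = Q.tr (Q.*~ (Q.tr (lift (R.rf (TT-yes λ' τ̂ (hat-inter λ' τ x zτ nλ h)))) (hat-G λ' τ x zτ nλ)) (Q.tr (Q.*c _ _) (Q.tr (Q.*ʳ (lift (R.rf (TT-yes μ̂ τ̂ (inter-to h'))))) moving))) (lift (R.tr (R.solve 8 (\ g c p m w f q s -> (g R.:* (c R.:* p)) R.:* ((m R.:* w) R.:* (f R.:* (q R.:* s))) R.:= c R.:* (f R.:* (g R.:* (w R.:* (m R.:* (s R.:* (p R.:* q))))))) R.refl (Gg λ' τ) C (Pi λ') (Gg μ τ) (WW τ) (fR x 0) (Pi μ) (P τ)) (R.*ˡ (R.*ˡ (R.*~ (R.rf (E.sym (TT-yes λ' τ h))) (R.*ˡ (R.*ʳ (R.rf (E.sym (TT-yes μ τ h'))))))))))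
     where
     open Given h
   collect-last : ∀ M l (g : Vec ℕ n -> R.Car) -> (∀ m -> get m last N.< M -> g m R.≈ R.0#) -> CR.Σc n (M N.+ l) g R.≈ CR.Σc n l (\ m -> g (add M m))
   collect-last zero l g z = CR.Σc-cong n l (\ m -> R.rf (cong g (E.sym (VecP.updateAt-id-local last m E.refl))))
   collect-last (suc M) l g z = R.tr (CR.Σc-Bd last (M N.+ l) g) (R.tr (R.+ʳ (CR.Bd-zero last (suc (M N.+ l)) g (\ m e -> z m (subst (N._< suc M) (E.sym e) (N.s≤s N.z≤n))))) (R.tr (R.0+ _) (R.tr (collect-last M l (\ m -> g (inc last m)) (\ m lt -> z (inc last m) (subst (N._< suc M) (E.sym (VecP.lookup∘updateAt last m)) (N.s≤s lt)))) (CR.Σc-cong n l (\ m -> R.rf (cong g (VecP.updateAt-updateAt-local last m E.refl)))))))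
   total-set : ∀ {k} (μ : Vec ℤ k) i a -> total (updateAt μ i (\ _ -> a)) Z.+ get μ i ≡ total μ Z.+ a
   total-set (b ∷ μ) zero a = cong (Z._+ b) (ZP.+-comm a (total μ)) >> ZP.+-comm (total μ Z.+ a) b >> E.sym (ZP.+-assoc b (total μ) a)
   total-set (b ∷ μ) (suc i) a = ZP.+-assoc b _ _ >> cong (\ z -> b Z.+ z) (total-set μ i a) >> E.sym (ZP.+-assoc b (total μ) a)
   -- `exchange` is used with the last entry of μ at -L and with l increased by L to balance the
   -- totals. Terms that take less than L from the last entry of λ' vanish, since the lower vector
   -- has to stay below μ there; the surplus beyond L becomes the last part of m. The constant C is
   -- a unit and is cancelled.
   at-level : ∀ k l λ' μ -> get λ' last ≡ + 0 -> get μ last ≡ + 0 -> (∀ i -> + 0 Z.≤ get λ' i) -> (∀ i -> + 0 Z.≤ get μ i) -> total λ' Z.+ + k ≡ total μ Z.+ + l -> CR.Σc n k (\ m -> upper λ' μ (λ' ∔ m)) Q.≈ CR.Σc n l (\ m -> fR (get m last) 0 R.* lower λ' μ (λ' ∖ clr m))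
   at-level k l λ' μ zλ zμ nλ nμ tt = cancel (Q.tr (lift (CR.Σc-*ˡ n k C _)) (Q.tr (red.ev-Σc n k _) (Q.tr (CQ.Σc-cong n k (\ m -> Q.sym (upper-term (λ' ∔ m) λ' μ zλ zμ))) (Q.tr (Q.sym (red.ev-Σc n k _)) (Q.tr (lift (exchange k (L N.+ l) λ' (hat μ 0) totals)) (Q.tr (lift (collect-last L l _ below)) (Q.tr (red.ev-Σc n l _) (Q.tr (CQ.Σc-cong n l (\ m -> low m)) (Q.tr (Q.sym (red.ev-Σc n l _)) (lift (R.sym (CR.Σc-*ˡ n l C _))))))))))))
    where
    cancel : ∀ {x y} -> C R.* x Q.≈ C R.* y -> x Q.≈ y
    cancel {x} {y} h = Q.tr (one x) (Q.tr (Q.*ˡ h) (Q.sym (one y)))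
     where
     one : ∀ x -> x Q.≈ Ci R.* (C R.* x)
     one x = lift (R.sym (R.tr (R.sym (R.*a _ _ _)) (R.tr (R.*ʳ (R.tr (R.*c _ _) (R.tr (R.sym (R.Π-* _ _)) (R.Π-one _ (\ i -> f-g L (rowdd i)))))) (R.il x))))
    totals : total λ' Z.+ + k ≡ total (hat μ 0) Z.+ + (L N.+ l)
    totals = tt >> E.sym (cong (Z._+ + (L N.+ l)) th >> ZP.+-assoc (total μ) (Z.- + (L N.+ 0)) (+ (L N.+ l)) >> cong (\ z -> total μ Z.+ z) (ZP.-m+n≡n⊖m (L N.+ 0) (L N.+ l) >> ZP.+-cancelˡ-⊖ L l 0 >> E.refl))
     where
     th : total (hat μ 0) ≡ total μ Z.+ (Z.- + (L N.+ 0))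
     th = E.sym (ZP.+-identityʳ _) >> cong (\ z -> total (hat μ 0) Z.+ z) (E.sym zμ) >> total-set μ last _
    τ-last : ∀ m -> get (λ' ∖ m) last ≡ Z.- (+ get m last)
    τ-last m = lookup-∖ last λ' m >> cong (Z._- + get m last) zλ >> ZP.+-identityˡ _
    below : ∀ m -> get m last N.< L -> TT λ' (λ' ∖ m) R.* (WW (λ' ∖ m) R.* TT (hat μ 0) (λ' ∖ m)) R.≈ R.0#
    below m m<L = R.tr (R.*ˡ (R.tr (R.*ˡ (R.rf (TT-no (hat μ 0) (λ' ∖ m) fail))) (R.*0 _))) (R.*0 _)
     where
     fail : ¬ Inter (hat μ 0) (λ' ∖ m)
     fail h = NP.<-irrefl E.refl (≤-trans m<L (ZP.drop‿+≤+ (subst (\ z -> + z Z.≤ + get m last) (NP.+-identityʳ L) (ZP.neg-cancel-≤ (subst₂ Z._≤_ (τ-last m) (set-last μ _) (col-last⁻ last _ _ (h last last)))))))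
    hat-eq : ∀ m -> λ' ∖ add L m ≡ hat (λ' ∖ clr m) (get m last)
    hat-eq m = vec-ext _ _ each
     where
     each : ∀ i -> get (λ' ∖ add L m) i ≡ get (hat (λ' ∖ clr m) (get m last)) i
     each i with i FinP.≟ last
     ... | yes E.refl = τ-last (add L m) >> cong (\ z -> Z.- (+ z)) (VecP.lookup∘updateAt last m) >> E.sym (set-last (λ' ∖ clr m) _)
     ... | no ne = lookup-∖ i λ' (add L m) >> cong (\ z -> get λ' i Z.- + z) (VecP.lookup∘updateAt′ i last ne m >> E.sym (VecP.lookup∘updateAt′ i last ne m)) >> E.sym (lookup-∖ i λ' (clr m)) >> E.sym (set-other (λ' ∖ clr m) _ i ne)
    clr-last : ∀ m -> get (λ' ∖ clr m) last ≡ + 0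
    clr-last m = τ-last (clr m) >> cong (\ z -> Z.- (+ z)) (VecP.lookup∘updateAt last m)
    low : ∀ m -> TT λ' (λ' ∖ add L m) R.* (WW (λ' ∖ add L m) R.* TT (hat μ 0) (λ' ∖ add L m)) Q.≈ C R.* (fR (get m last) 0 R.* lower λ' μ (λ' ∖ clr m))
    low m = Q.tr (lift (R.rf (cong (\ τ -> TT λ' τ R.* (WW τ R.* TT (hat μ 0) τ)) (hat-eq m)))) (Lower.lower-term λ' μ (λ' ∖ clr m) (get m last) zλ zμ (clr-last m) nλ nμ)
  -- The last part of m does not enter the vector λ' ∖ `clr m`. It only counts degrees and carries
  -- the coefficient f(j, 0) of the kernel.
  skew-cauchy : ∀ k l λ' μ -> get λ' last ≡ + 0 -> get μ last ≡ + 0 -> (∀ i -> + 0 Z.≤ get λ' i) -> (∀ i -> + 0 Z.≤ get μ i) -> total λ' Z.+ + k ≡ total μ Z.+ + l -> CR.Σc n k (\ m -> upper λ' μ (λ' ∔ m)) R.≈ CR.Σc n l (\ m -> fR (get m last) 0 R.* lower λ' μ (λ' ∖ clr m))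
  skew-cauchy k l λ' μ zλ zμ nλ nμ tt = R.x-y≈0⇒x≈y (separated _ (\ L -> let (z , h) = AtLevel.at-level L k l λ' μ zλ zμ nλ nμ tt in
   z , R.tr (R.+ʳ h) (R.solve 2 (\ y x -> (y R.:+ x) R.:+ R.:- y R.:= x) R.refl _ _)))

-- The power series of the statement as a ring, the ground ring in q and t, and f.

module Inst where
 open import Defs hiding (pow)
 open Kit
 open Ser
 open Spec
 open Model
 open SpecT
 open import Data.Bool using (Bool; true; false; _∧_)
 open import Data.Nat using (_≡ᵇ_)
 open import Data.Integer using (0ℤ; 1ℤ)
 ℤR : CRing
 ℤR = ZP.+-*-commutativeRing
 ℤDom : Domain ℤR
 ℤDom = record { stable = \ x y nn -> st (x ZP.≟ y) nn ; 1~0 = \ () ; nzd = \ x y e nx ny -> go (ZP.i*j≡0⇒i≡0∨j≡0 x e) nx ny }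
  where
  st : ∀ {x y : ℤ} -> Dec (x ≡ y) -> ¬ ¬ (x ≡ y) -> x ≡ y
  st (yes e) _ = e
  st (no ne) nn = absurd (nn ne)
  go : ∀ {x y : ℤ} -> x ≡ 0ℤ ⊎ y ≡ 0ℤ -> ¬ x ≡ 0ℤ -> ¬ y ≡ 0ℤ -> ⊥
  go (inj₁ e) nx ny = nx e
  go (inj₂ e) nx ny = ny e
 module ZS = SerDef ℤR
 module SS = SerDef ZS.Ser
 module PP = SerDef SS.Ser
 module ZK = RingKit ℤR
 module MZ = MonDef ℤR
 module MS = MonDef ZS.Ser
 module MP = MonDef SS.Ser
 module ZSR = RingKit ZS.Ser
 module SSR = RingKit SS.Ser
 private module PPR = RingKit PP.Ser
 sumTo≡ : ∀ n {g h : ℕ -> ℤ} -> (∀ i -> i N.< n -> g i ≡ h i) -> sumTo n g ≡ ZK.sumR n h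
 sumTo≡ zero e = E.refl
 sumTo≡ (suc n) e = cong₂ Z._+_ (sumTo≡ n (\ i i<n -> e i (NP.m<n⇒m<1+n i<n))) (e n ≤-refl)
 ⊗-coeff : ∀ (A B : PS) x y z -> (A ⊗ B) x y z ≡ ZK.sumR (suc x) (\ i -> ZK.sumR (suc y) (\ j -> ZK.sumR (suc z) (\ k -> A i j k Z.* B (x N.∸ i) (y N.∸ j) (z N.∸ k))))
 ⊗-coeff A B x y z = sumTo≡ (suc x) (\ i _ -> sumTo≡ (suc y) (\ j _ -> sumTo≡ (suc z) (\ k _ -> E.refl)))
 -- A coefficient of a product depends only on coefficients of lower or equal degrees. This is what
 -- makes truncation compatible with multiplication.
 ⊗-local : ∀ {A A' B B' : PS} x y z -> (∀ i j k -> i N.≤ x -> j N.≤ y -> k N.≤ z -> A i j k ≡ A' i j k) -> (∀ i j k -> i N.≤ x -> j N.≤ y -> k N.≤ z -> B i j k ≡ B' i j k) -> (A ⊗ B) x y z ≡ (A' ⊗ B') x y z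
 ⊗-local {A} {A'} {B} {B'} x y z ha hb = ⊗-coeff A B x y z >> E.trans (ZK.sumR-cong< (suc x) (\ { i (N.s≤s i≤) -> ZK.sumR-cong< (suc y) (\ { j (N.s≤s j≤) -> ZK.sumR-cong< (suc z) (\ { k (N.s≤s k≤) -> cong₂ Z._*_ (ha i j k i≤ j≤ k≤) (hb _ _ _ (NP.m∸n≤m x i) (NP.m∸n≤m y j) (NP.m∸n≤m z k)) }) }) })) (E.sym (⊗-coeff A' B' x y z))
 ⋆-⊗ : ∀ (A B : PS) x y z -> (A ⊗ B) x y z ≡ (A PP.⋆ B) x y z
 ⋆-⊗ A B x y z = ⊗-coeff A B x y z >> E.sym (CollapseDef.sumR-at ZS.Ser (suc x) _ y z >> CollapseDef.sumR-at ℤR (suc x) _ z >> ZK.sumR-cong (suc x) (\ i -> CollapseDef.sumR-at ℤR (suc y) _ z))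
 mono1 : ∀ c z -> MZ.mon c 1ℤ z ≡ ind (c ≡ᵇ z)
 mono1 zero zero = E.refl
 mono1 zero (suc z) = E.refl
 mono1 (suc c) zero = E.refl
 mono1 (suc c) (suc z) = mono1 c z
 mono2 : ∀ b c y z -> MS.mon b (MZ.mon c 1ℤ) y z ≡ ind ((b ≡ᵇ y) ∧ (c ≡ᵇ z))
 mono2 zero c zero z = mono1 c z
 mono2 zero c (suc y) z = E.refl
 mono2 (suc b) c zero z = E.refl
 mono2 (suc b) c (suc y) z = mono2 b c y z
 mono3 : ∀ a b c x y z -> MP.mon a (MS.mon b (MZ.mon c 1ℤ)) x y z ≡ mono a b c x y z
 mono3 zero b c zero y z = mono2 b c y z
 mono3 zero b c (suc x) y z = E.refl
 mono3 (suc a) b c zero y z = E.refl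
 mono3 (suc a) b c (suc x) y z = mono3 a b c x y z
 opaque
  PSR : CRing
  PSR = PP.Ser
 module P = RingKit PSR
 module PK = PickKit PSR
 opaque
  unfolding PSR
  el : PS -> P.Car
  el A = A
  coeff : P.Car -> PS
  coeff A = A
  ≈-intro : ∀ {A B} -> (∀ x y z -> coeff A x y z ≡ coeff B x y z) -> A P.≈ B
  ≈-intro e = e
  ≈-elim : ∀ {A B} -> A P.≈ B -> ∀ x y z -> coeff A x y z ≡ coeff B x y z
  ≈-elim e = e
  coeff-el : ∀ A x y z -> coeff (el A) x y z ≡ A x y z
  coeff-el A x y z = E.refl
  coeff-0 : ∀ x y z -> coeff P.0# x y z ≡ 0ℤ
  coeff-0 x y z = E.refl
  coeff-+ : ∀ A B x y z -> coeff (A P.+ B) x y z ≡ coeff A x y z Z.+ coeff B x y z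
  coeff-+ A B x y z = E.refl
  coeff-neg : ∀ A x y z -> coeff (P.- A) x y z ≡ Z.- coeff A x y z
  coeff-neg A x y z = E.refl
  coeff-* : ∀ A B x y z -> coeff (A P.* B) x y z ≡ (coeff A ⊗ coeff B) x y z
  coeff-* A B x y z = E.sym (⋆-⊗ A B x y z)
  el-𝟙 : el 𝟙 P.≈ P.1#
  el-𝟙 x y z = E.sym (mono3 0 0 0 x y z) >> go x y z
   where
   go : ∀ x y z -> MP.mon 0 (MS.mon 0 (MZ.mon 0 1ℤ)) x y z ≡ PPR.1# x y z
   go zero zero z = E.refl
   go zero (suc y) z = E.refl
   go (suc x) y z = E.refl
  mono-* : ∀ a b c a' b' c' -> (el (mono a b c) P.* el (mono a' b' c')) P.≈ el (mono (a N.+ a') (b N.+ b') (c N.+ c'))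
  mono-* a b c a' b' c' = PPR.tr (PPR.*~ (\ x y z -> E.sym (mono3 a b c x y z)) (\ x y z -> E.sym (mono3 a' b' c' x y z))) (PPR.tr (MP.mon-mul a a' _ _) (PPR.tr (MP.mon-cong (a N.+ a') (SSR.tr (MS.mon-mul b b' _ _) (MS.mon-cong (b N.+ b') (MZ.mon-mul c c' 1ℤ 1ℤ)))) (mono3 (a N.+ a') (b N.+ b') (c N.+ c'))))
 private
  s-shift : ∀ x y z -> mono 1 0 0 x y z ≡ PP.shift 1 (PP.const SSR.1#) x y z
  s-shift zero y z = E.refl
  s-shift (suc zero) zero zero = E.refl
  s-shift (suc zero) zero (suc z) = E.refl
  s-shift (suc zero) (suc y) z = E.refl
  s-shift (suc (suc x)) y z = E.refl
  s-times : ∀ (X : PPR.Car) x y z -> (mono 1 0 0 PP.⋆ X) x y z ≡ PP.shift 1 X x y z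
  s-times X x y z = PPR.*ʳ {X} {mono 1 0 0} {PP.shift 1 (PP.const SSR.1#)} s-shift x y z >> MP.shift-mul 1 (PP.const SSR.1#) X x y z >> MP.shift-cong 1 {PP.const SSR.1# PP.⋆ X} {X} (PPR.il X) x y z
 opaque
  unfolding PSR el coeff
  coeff-s-zero : ∀ X y z -> coeff (el (mono 1 0 0) P.* X) 0 y z ≡ 0ℤ
  coeff-s-zero X y z = s-times X 0 y z
  coeff-s-suc : ∀ X x y z -> coeff (el (mono 1 0 0) P.* X) (suc x) y z ≡ coeff X x y z
  coeff-s-suc X x y z = s-times X (suc x) y z
 el-⊗ : ∀ A B -> el (A ⊗ B) P.≈ el A P.* el B
 el-⊗ A B = ≈-intro (\ x y z -> coeff-el (A ⊗ B) x y z >> ⊗-local x y z (\ i j k _ _ _ -> E.sym (coeff-el A i j k)) (\ i j k _ _ _ -> E.sym (coeff-el B i j k)) >> E.sym (coeff-* (el A) (el B) x y z))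
 *-local : ∀ A A' B B' x y z -> (∀ i j k -> i N.≤ x -> j N.≤ y -> k N.≤ z -> coeff A i j k ≡ coeff A' i j k) -> (∀ i j k -> i N.≤ x -> j N.≤ y -> k N.≤ z -> coeff B i j k ≡ coeff B' i j k) -> coeff (A P.* B) x y z ≡ coeff (A' P.* B') x y z
 *-local A A' B B' x y z ha hb = coeff-* A B x y z >> ⊗-local x y z ha hb >> E.sym (coeff-* A' B' x y z)
 coeff-sumR : ∀ N (g : ℕ -> P.Car) x y z -> coeff (P.sumR N g) x y z ≡ ZK.sumR N (\ i -> coeff (g i) x y z)
 coeff-sumR zero g x y z = coeff-0 x y z
 coeff-sumR (suc N) g x y z = coeff-+ _ _ x y z >> cong (Z._+ coeff (g N) x y z) (coeff-sumR N g x y z)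
 mon : ℕ -> ℕ -> ℕ -> P.Car
 mon a b c = el (mono a b c)
 mon-cong : ∀ {a b c a' b' c'} -> a ≡ a' -> b ≡ b' -> c ≡ c' -> mon a b c P.≈ mon a' b' c'
 mon-cong E.refl E.refl E.refl = P.refl
 mon-pow : ∀ a b c m -> PK.pow (mon a b c) m P.≈ mon (a N.* m) (b N.* m) (c N.* m)
 mon-pow a b c zero = P.tr (P.sym el-𝟙) (mon-cong (E.sym (NP.*-zeroʳ a)) (E.sym (NP.*-zeroʳ b)) (E.sym (NP.*-zeroʳ c)))
 mon-pow a b c (suc m) = P.tr (P.*ˡ (mon-pow a b c m)) (P.tr (mono-* a b c _ _ _) (mon-cong (E.sym (NP.*-suc a m)) (E.sym (NP.*-suc b m)) (E.sym (NP.*-suc c m))))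
 el-oneMinus : ∀ a b c -> el (oneMinus a b c) P.≈ P.1# P.+ P.- mon a b c
 el-oneMinus a b c = P.tr (≈-intro (\ x y z -> coeff-el (oneMinus a b c) x y z >> E.sym (coeff-+ _ _ x y z >> cong₂ Z._+_ (coeff-el 𝟙 x y z) (coeff-neg _ x y z >> cong Z.-_ (coeff-el (mono a b c) x y z))))) (P.+ʳ el-𝟙)
 ≡ᵇ-true : ∀ a x -> (a ≡ᵇ x) ≡ true -> a ≡ x
 ≡ᵇ-true zero zero e = E.refl
 ≡ᵇ-true (suc a) (suc x) e = cong suc (≡ᵇ-true a x e)
 mono-off : ∀ a b c x y z -> ¬ (a ≡ x × b ≡ y × c ≡ z) -> mono a b c x y z ≡ 0ℤ
 mono-off a b c x y z ne with a ≡ᵇ x in ea | b ≡ᵇ y in eb | c ≡ᵇ z in ec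
 ... | false | _ | _ = E.refl
 ... | true | false | _ = E.refl
 ... | true | true | false = E.refl
 ... | true | true | true = absurd (ne (≡ᵇ-true a x ea , ≡ᵇ-true b y eb , ≡ᵇ-true c z ec))
 module Geometric (a b c : ℕ) (pos : 1 N.≤ a N.+ b N.+ c) where
  X G : P.Car
  X = mon a b c
  G = el (geo a b c)
  partial : ℕ -> P.Car
  partial N = P.sumR N (PK.pow X)
  telescope : ∀ N -> (P.1# P.+ P.- X) P.* partial N P.≈ P.1# P.+ P.- PK.pow X N
  telescope zero = P.tr (P.*0 _) (P.sym (P.-‿inverseʳ _))
  telescope (suc N) = P.tr (P.distribˡ _ _ _) (P.tr (P.+ʳ (telescope N)) (P.solve 2 (\ x p -> (P.:1 P.:+ P.:- p) P.:+ (P.:1 P.:+ P.:- x) P.:* p P.:= P.:1 P.:+ P.:- (x P.:* p)) P.refl X (PK.pow X N)))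
  pow-coeff : ∀ m x y z -> coeff (PK.pow X m) x y z ≡ mono (a N.* m) (b N.* m) (c N.* m) x y z
  pow-coeff m x y z = ≈-elim (mon-pow a b c m) x y z >> coeff-el (mono (a N.* m) (b N.* m) (c N.* m)) x y z
  pow-high : ∀ m x y z -> x N.+ y N.+ z N.< m -> coeff (PK.pow X m) x y z ≡ 0ℤ
  pow-high m x y z small = pow-coeff m x y z >> mono-off (a N.* m) (b N.* m) (c N.* m) x y z (\ { (E.refl , E.refl , E.refl) -> NP.<-irrefl E.refl (NP.<-≤-trans small (≤-trans (≤-reflexive (E.sym (NP.*-identityˡ m))) (≤-trans (NP.*-monoˡ-≤ m pos) (≤-reflexive (NP.*-distribʳ-+ m (a N.+ b) c >> cong (N._+ c N.* m) (NP.*-distribʳ-+ m a b)))))) })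
  -- As a + b + c ≥ 1, powers beyond the degree x + y + z do not contribute. The arbitrary excess e
  -- permits one partial sum to represent all lower coefficients at once in `geo-inverse`.
  geo-partial : ∀ e x y z -> coeff G x y z ≡ coeff (partial (e N.+ suc (x N.+ y N.+ z))) x y z
  geo-partial e x y z = coeff-el (geo a b c) x y z >> sumTo≡ (suc (x N.+ y N.+ z)) (\ i _ -> E.sym (pow-coeff i x y z)) >> extend e >> E.sym (coeff-sumR (e N.+ suc (x N.+ y N.+ z)) _ x y z)
   where
   g : ℕ -> ℤ
   g i = coeff (PK.pow X i) x y z
   extend : ∀ e -> ZK.sumR (suc (x N.+ y N.+ z)) g ≡ ZK.sumR (e N.+ suc (x N.+ y N.+ z)) g
   extend zero = E.refl
   extend (suc e) = extend e >> E.sym (cong (\ w -> ZK.sumR (e N.+ suc (x N.+ y N.+ z)) g Z.+ w) (pow-high (e N.+ suc (x N.+ y N.+ z)) x y z (NP.m≤n+m _ e)) >> ZP.+-identityʳ _)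
  geo-inverse : el (oneMinus a b c) P.* G P.≈ P.1#
  geo-inverse = P.tr (P.*ʳ (el-oneMinus a b c)) (≈-intro (\ x y z -> let N = suc (x N.+ y N.+ z) in
   *-local (P.1# P.+ P.- X) (P.1# P.+ P.- X) G (partial N) x y z (\ _ _ _ _ _ _ -> E.refl) (\ i j k hi hj hk -> geo-partial (N N.∸ suc (i N.+ j N.+ k)) i j k >> cong (\ M -> coeff (partial M) i j k) (NP.m∸n+n≡m (N.s≤s (NP.+-mono-≤ (NP.+-mono-≤ hi hj) hk)))) >>
   ≈-elim (telescope N) x y z >> coeff-+ _ _ x y z >> cong (\ w -> coeff P.1# x y z Z.+ w) (coeff-neg _ x y z >> cong Z.-_ (pow-high N x y z ≤-refl)) >> ZP.+-identityʳ _))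
 open Geometric public using (geo-inverse)
 f̂ f̂⁻ : ℕ -> ℕ -> P.Car
 f̂ k d = el (f k d)
 f̂⁻ k d = el (finv k d)
 f-step : ∀ k d -> f̂ (suc k) d P.* (P.1# P.+ P.- mon 0 (suc k) d) P.≈ f̂ k d P.* (P.1# P.+ P.- mon 0 k (suc d))
 f-step k d = P.tr (P.*~ (P.tr (el-⊗ _ _) (P.*ˡ (P.tr (el-⊗ _ _) (P.*ʳ (el-oneMinus 0 k (suc d)))))) (P.sym (el-oneMinus 0 (suc k) d))) (P.tr (P.solve 4 (\ a b g o -> (a P.:* (b P.:* g)) P.:* o P.:= (a P.:* b) P.:* (o P.:* g)) P.refl (f̂ k d) _ (el (geo 0 (suc k) d)) (el (oneMinus 0 (suc k) d))) (P.tr (P.*ˡ (geo-inverse 0 (suc k) d (N.s≤s N.z≤n))) (P.*1 _)))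
 f-finv : ∀ k d -> f̂ k d P.* f̂⁻ k d P.≈ P.1#
 f-finv zero d = P.tr (P.*~ el-𝟙 el-𝟙) (P.il _)
 f-finv (suc k) d = P.tr (P.*~ (P.tr (el-⊗ _ _) (P.*ˡ (el-⊗ _ _))) (P.tr (el-⊗ _ _) (P.*ˡ (el-⊗ _ _)))) (P.tr (P.solve 6 (\ a b c d e h -> (a P.:* (b P.:* c)) P.:* (d P.:* (e P.:* h)) P.:= (a P.:* d) P.:* ((b P.:* h) P.:* (e P.:* c))) P.refl (f̂ k d) (el (oneMinus 0 k (suc d))) (el (geo 0 (suc k) d)) (f̂⁻ k d) (el (oneMinus 0 (suc k) d)) (el (geo 0 k (suc d)))) (P.tr (P.*~ (f-finv k d) (P.tr (P.*~ (geo-inverse 0 k (suc d) (≤-trans (N.s≤s N.z≤n) (NP.m≤n+m (suc d) k))) (geo-inverse 0 (suc k) d (N.s≤s N.z≤n))) (P.il _))) (P.il _)))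
 module SwapDef (R : CRing) where
  private
   module R = RingKit R
   module S = SerDef R
   module T = SerDef S.Ser
   module C = CollapseDef R
  swap : Hom T.Ser T.Ser
  swap = record { ev = \ A i j -> A j i ; ev-cong = \ e i j -> e j i ; ev-+ = \ _ _ _ _ -> R.refl ; ev-* = mul ; ev-1 = \ { zero zero -> R.refl ; zero (suc j) -> R.refl ; (suc i) zero -> R.refl ; (suc i) (suc j) -> R.refl } }
   where
   mul : ∀ A B i j -> (A T.⋆ B) j i R.≈ ((\ i j -> A j i) T.⋆ (\ i j -> B j i)) i j
   mul A B i j = R.tr (C.sumR-at (suc j) _ i) (R.tr (R.sumR-swap (suc j) (suc i) _) (R.sym (C.sumR-at (suc i) _ j)))
 constH : (R : CRing) -> Hom R (SerDef.Ser R)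
 constH R = record { ev = const ; ev-cong = \ { e zero -> e ; e (suc k) -> refl } ; ev-+ = \ { x y zero -> refl ; x y (suc k) -> sym (0+ _) } ; ev-* = \ x y k -> sym (MonDef.const-mul R x y k) ; ev-1 = \ _ -> refl }
  where
  open RingKit R
  open SerDef R
 infixr 9 _∘H_
 _∘H_ : ∀ {A B C} -> Hom B C -> Hom A B -> Hom A C
 _∘H_ {C = C} G F = record { ev = \ x -> G.ev (F.ev x) ; ev-cong = \ e -> G.ev-cong (F.ev-cong e) ; ev-+ = \ x y -> C.tr (G.ev-cong (F.ev-+ x y)) (G.ev-+ _ _) ; ev-* = \ x y -> C.tr (G.ev-cong (F.ev-* x y)) (G.ev-* _ _) ; ev-1 = C.tr (G.ev-cong F.ev-1) G.ev-1 }
  where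
  module C = RingKit C
  module G = Hom G
  module F = Hom F
 open SwapDef ℤR using (swap)
 -- The ground ring has t outside and q inside, so that t is the variable for which
 -- the auxiliary variable of the perturbed lattice is substituted.
 module VarDef (R : CRing) where
  open RingKit R
  open PickKit R using (pow)
  open SerDef R
  open MonDef R renaming (mon to mon1; mon-cong to mon1-cong)
  private
   module S = RingKit Ser
   module SK = PickKit Ser
  var : S.Car
  var = mon1 1 1#
  var-pow : ∀ n -> SK.pow var n S.≈ mon1 n 1#
  var-pow zero = S.refl {S.1#}
  var-pow (suc n) = S.tr {var S.* SK.pow var n} {var S.* mon1 n 1#} {mon1 (suc n) 1#} (S.*ˡ {var} {SK.pow var n} {mon1 n 1#} (var-pow n)) (S.tr {var S.* mon1 n 1#} {mon1 (suc n) (1# * 1#)} {mon1 (suc n) 1#} (mon-mul 1 n 1# 1#) (mon1-cong (suc n) (il 1#)))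
  const-pow : ∀ c n -> SK.pow (const c) n S.≈ const (pow c n)
  const-pow c zero = S.refl {S.1#}
  const-pow c (suc n) = S.tr {const c S.* SK.pow (const c) n} {const c S.* const (pow c n)} {const (c * pow c n)} (S.*ˡ {const c} {SK.pow (const c) n} {const (pow c n)} (const-pow c n)) (const-mul c (pow c n))
  term : ∀ c a b -> (SK.pow (const c) a S.* SK.pow var b) S.≈ mon1 b (pow c a)
  term c a b = S.tr {SK.pow (const c) a S.* SK.pow var b} {const (pow c a) S.* mon1 b 1#} {mon1 b (pow c a)} (S.*~ {SK.pow (const c) a} {const (pow c a)} {SK.pow var b} {mon1 b 1#} (const-pow c a) (var-pow b)) (S.tr {const (pow c a) S.* mon1 b 1#} {mon1 b (pow c a * 1#)} {mon1 b (pow c a)} (mon-mul 0 b (pow c a) 1#) (mon1-cong b (*1 (pow c a))))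
  Separates : Car -> Set
  Separates c = ∀ x -> (∀ L -> Σ Car \ y -> x ≈ pow c L * y) -> x ≈ 0#
  const-separates : ∀ c -> Separates c -> ∀ x -> (∀ L -> Σ S.Car \ y -> x S.≈ (SK.pow (const c) L S.* y)) -> x S.≈ S.0#
  const-separates c sep x h k = sep (x k) (\ L -> let (y , e) = h L in y k ,
   tr (e k) (tr (S.*ʳ {y} {SK.pow (const c) L} {const (pow c L)} (const-pow c L) k) (const-⋆ (pow c L) y k)))
  var-separates : ∀ x -> (∀ L -> Σ S.Car \ y -> x S.≈ (SK.pow var L S.* y)) -> x S.≈ S.0#
  var-separates x h k = let (y , e) = h (suc k) in
   tr (e k) (tr (S.*ʳ {y} {SK.pow var (suc k)} {mon1 (suc k) 1#} (var-pow (suc k)) k) (tr (shift-mul (suc k) (const 1#) y k) (below k (const 1# S.* y))))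
   where
   below : ∀ k (A : S.Car) -> shift (suc k) A k ≈ 0#
   below zero A = refl
   below (suc k) A = below k A
  pow-var-shift : ∀ a x -> (SK.pow var a S.* x) S.≈ shift a x
  pow-var-shift a x = S.tr {SK.pow var a S.* x} {mon1 a 1# S.* x} {shift a x} (S.*ʳ {x} {SK.pow var a} {mon1 a 1#} (var-pow a)) (S.tr {mon1 a 1# S.* x} {shift a (const 1# S.* x)} {shift a x} (shift-mul a (const 1#) x) (shift-cong a (S.il x)))
  module _ (1~0 : ¬ (1# ≈ 0#)) where
   var-injective : ∀ a b -> SK.pow var a S.≈ SK.pow var b -> a ≡ b
   var-injective a b e = proj₁ (mon-inj a b 1# 1# (S.tr {mon1 a 1#} {SK.pow var a} {mon1 b 1#} (S.sym {SK.pow var a} {mon1 a 1#} (var-pow a)) (S.tr {SK.pow var a} {SK.pow var b} {mon1 b 1#} e (var-pow b))) 1~0)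
   var~0 : ¬ (var S.≈ S.0#)
   var~0 e = 1~0 (e 1)
   term-injective : ∀ c -> (∀ a -> ¬ (pow c a ≈ 0#)) -> (∀ a b -> pow c a ≈ pow c b -> a ≡ b) -> ∀ a b a' b' -> (SK.pow (const c) a S.* SK.pow var b) S.≈ (SK.pow (const c) a' S.* SK.pow var b') -> (a ≡ a') × (b ≡ b')
   term-injective c nz inj a b a' b' e = inj a a' (proj₂ both) , proj₁ both
    where
    both : (b ≡ b') × (pow c a ≈ pow c a')
    both = mon-inj b b' (pow c a) (pow c a') (\ k -> tr (sym (term c a b k)) (tr (e k) (term c a' b' k))) (nz a)
 opaque
  Inner : CRing
  Inner = ZS.Ser
 module VQ = VarDef ℤR
 module VT = VarDef Inner
 module In = RingKit Inner
 module InK = PickKit Inner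
 opaque
  unfolding Inner
  x0 : In.Car
  x0 = VQ.var
  innerDom : Domain Inner
  innerDom = SerDef.SerDomain.SerDom ℤR ℤDom
  x0~0 : ¬ (x0 In.≈ In.0#)
  x0~0 = VQ.var~0 (\ ())
  x₀-injective : ∀ a b -> InK.pow x0 a In.≈ InK.pow x0 b -> a ≡ b
  x₀-injective = VQ.var-injective (\ ())
  x0-separates : VT.Separates x0
  x0-separates = VQ.var-separates
 x0-pow~0 : ∀ a -> ¬ (InK.pow x0 a In.≈ In.0#)
 x0-pow~0 zero = Domain.1~0 innerDom
 x0-pow~0 (suc a) = DomainKit.*-~0 Inner innerDom x0~0 (x0-pow~0 a)
 opaque
  ground : CRing
  ground = SerDef.Ser Inner
 module gr = RingKit ground
 module GK = PickKit ground
 opaque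
  unfolding ground
  q0 t0 : gr.Car
  q0 = SerDef.const Inner x0
  t0 = VT.var
  groundDom : Domain ground
  groundDom = SerDef.SerDomain.SerDom Inner innerDom
  q0~0 : ¬ (q0 gr.≈ gr.0#)
  q0~0 e = x0~0 (e 0)
  t0~0 : ¬ (t0 gr.≈ gr.0#)
  t0~0 = VT.var~0 (Domain.1~0 innerDom)
  mono-injective : ∀ a b c d -> GK.pow q0 a gr.* GK.pow t0 b gr.≈ GK.pow q0 c gr.* GK.pow t0 d -> (a ≡ c) × (b ≡ d)
  mono-injective = VT.term-injective (Domain.1~0 innerDom) x0 x0-pow~0 x₀-injective
  evt0 : Hom (SerDef.Ser ground) ground
  evt0 = CollapseDef.collapse Inner
  evt0-mon : ∀ a x -> Hom.ev evt0 (MonDef.mon ground a x) gr.≈ GK.pow t0 a gr.* x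
  evt0-mon a x k = In.tr (CollapseDef.col-mon Inner a x k) (In.sym (VT.pow-var-shift a x k))
  separated : ∀ x -> (∀ L -> Σ gr.Car \ y -> x gr.≈ GK.pow q0 L gr.* y) -> x gr.≈ gr.0#
  separated = VT.const-separates x0 x0-separates
 opaque
  unfolding ground Inner PSR
  -- The two variables q and t change places and the result is regarded as constant in s. Conversely
  -- `fromPS` takes the coefficient of s^0, so the round trip fixes the series that do not involve
  -- s.
  toPS : Hom ground PSR
  toPS = constH SS.Ser ∘H swap
  fromPS : Hom PSR ground
  fromPS = swap ∘H MP.ev0
 private
  monomial : ∀ a b y z -> ℤ
  monomial a b y z = MonDef.mon ZS.Ser b (PickKit.pow ZS.Ser VQ.var a) z y
  monomial-ind : ∀ a b y z -> ind ((a ≡ᵇ y) ∧ (b ≡ᵇ z)) ≡ monomial a b y z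
  monomial-ind a b y z = cong ind (∧-comm (a ≡ᵇ y) (b ≡ᵇ z)) >> E.sym (mono2 b a z y) >> MS.mon-cong b {MZ.mon a 1ℤ} {PickKit.pow ZS.Ser VQ.var a} (\ k -> E.sym (VQ.var-pow a k)) z y
   where
   open import Data.Bool.Properties using (∧-comm)
 opaque
  unfolding ground Inner PSR el coeff q0 x0 toPS
  from-mon : ∀ a b -> Hom.ev fromPS (mon 0 a b) gr.≈ GK.pow q0 a gr.* GK.pow t0 b
  from-mon a b z y = monomial-ind a b y z >> E.sym (VT.term x0 a b z y)
  coeff-to : ∀ X x y z -> coeff (Hom.ev toPS X) (suc x) y z ≡ 0ℤ
  coeff-to X x y z = E.refl
  to-from : (A : PS) -> (∀ x y z -> A (suc x) y z ≡ 0ℤ) -> Hom.ev toPS (Hom.ev fromPS (el A)) P.≈ el A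
  to-from A h zero y z = E.refl
  to-from A h (suc x) y z = E.sym (h x y z)
 module to = Hom toPS
 module from = Hom fromPS
 setting : Setting
 setting = record { R = ground ; dom = groundDom ; q = q0 ; t = t0 ; q~0 = q0~0 ; t~0 = t0~0 ; mono-inj = mono-injective }
 from-diff : ∀ a b -> from.ev (P.1# P.+ P.- mon 0 a b) gr.≈ gr.1# gr.+ gr.- (GK.pow q0 a gr.* GK.pow t0 b)
 from-diff a b = gr.tr (from.ev-+ _ _) (gr.+~ from.ev-1 (gr.tr (from.ev-neg _) (gr.-~ (from-mon a b))))
 eval : Eval setting
 eval = record { evt = evt0 ; evt-mon = evt0-mon ; fR = \ k d -> from.ev (f̂ k d) ; gR = \ k d -> from.ev (f̂⁻ k d) ; f-0 = \ d -> gr.tr (from.ev-cong el-𝟙) from.ev-1 ; f-suc = \ k d -> gr.tr (gr.*ˡ (gr.sym (from-diff (suc k) d))) (gr.tr (gr.sym (from.ev-* _ _)) (gr.tr (from.ev-cong (f-step k d)) (gr.tr (from.ev-* _ _) (gr.*ˡ (from-diff k (suc d)))))) ; f-g = \ k d -> gr.tr (gr.sym (from.ev-* _ _)) (gr.tr (from.ev-cong (f-finv k d)) from.ev-1) }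
 private
  sumTo-zero : ∀ n {g : ℕ -> ℤ} -> (∀ i -> g i ≡ 0ℤ) -> sumTo n g ≡ 0ℤ
  sumTo-zero n e = sumTo≡ n (\ i _ -> e i) >> ZK.sumR-zero n (\ _ _ -> E.refl)
  fixes : PS -> Set
  fixes A = to.ev (from.ev (el A)) P.≈ el A
  fixes-⊗ : ∀ A B -> fixes A -> fixes B -> fixes (A ⊗ B)
  fixes-⊗ A B a b = P.tr (to.ev-cong (from.ev-cong (el-⊗ A B))) (P.tr (to.ev-cong (from.ev-* _ _)) (P.tr (to.ev-* _ _) (P.tr (P.*~ a b) (P.sym (el-⊗ A B)))))
  fixes-oneMinus : ∀ b c -> fixes (oneMinus 0 b c)
  fixes-oneMinus b c = to-from _ (\ _ _ _ -> E.refl)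
  fixes-geo : ∀ b c -> fixes (geo 0 b c)
  fixes-geo b c = to-from _ (\ x y z -> sumTo-zero (suc (suc (x N.+ y N.+ z))) (\ _ -> E.refl))
 to-f : ∀ k d -> to.ev (from.ev (f̂ k d)) P.≈ f̂ k d
 to-f zero d = to-from _ (\ _ _ _ -> E.refl)
 to-f (suc k) d = fixes-⊗ _ _ (to-f k d) (fixes-⊗ _ _ (fixes-oneMinus k (suc d)) (fixes-geo (suc k) d))
 to-finv : ∀ k d -> to.ev (from.ev (f̂⁻ k d)) P.≈ f̂⁻ k d
 to-finv zero d = to-from _ (\ _ _ _ -> E.refl)
 to-finv (suc k) d = fixes-⊗ _ _ (to-finv k d) (fixes-⊗ _ _ (fixes-oneMinus (suc k) d) (fixes-geo k (suc d)))

-- The skew Cauchy identity summed with powers of a nilpotent variable.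

module Assembly where
 open Kit
 open Comp
 open Spec
 open Model renaming (lt to ahead; gt to behind; eq to level)
 open Exch
 open SpecT
 open Limit
 open import Data.Fin using (fromℕ)
 open import Data.Vec using (sum; updateAt; zipWith; map; replicate)
 import Data.Product.Properties as ×P
 open import Relation.Nullary.Decidable using (_×-dec_)
 emb : ∀ {n} -> Vec ℕ n -> Vec ℤ n
 emb = map +_
 infixl 6 _⊹_ _⊖_
 _⊹_ _⊖_ : ∀ {n} -> Vec ℕ n -> Vec ℕ n -> Vec ℕ n
 _⊹_ = zipWith N._+_
 _⊖_ = zipWith N._∸_
 emb-⊹ : ∀ {n} (κ m : Vec ℕ n) -> emb κ ∔ m ≡ emb (κ ⊹ m)
 emb-⊹ [] [] = E.refl
 emb-⊹ (a ∷ κ) (b ∷ m) = cong (_ ∷_) (emb-⊹ κ m)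
 total-emb : ∀ {n} (κ : Vec ℕ n) -> total (emb κ) ≡ + sum κ
 total-emb [] = E.refl
 total-emb (a ∷ κ) = cong (\ z -> + a Z.+ z) (total-emb κ)
 sum-⊹ : ∀ {n} (κ m : Vec ℕ n) -> sum (κ ⊹ m) ≡ sum κ N.+ sum m
 sum-⊹ κ m = ZP.+-injective (E.sym (total-emb (κ ⊹ m)) >> cong total (E.sym (emb-⊹ κ m)) >> total-∔ (emb κ) m >> cong (Z._+ + sum m) (total-emb κ))
 _⊆_ : ∀ {n} -> Vec ℕ n -> Vec ℕ n -> Set
 μ ⊆ κ = ∀ i -> get μ i N.≤ get κ i
 ⊆? : ∀ {n} (μ κ : Vec ℕ n) -> Dec (μ ⊆ κ)
 ⊆? μ κ = FinP.all? (\ i -> get μ i N.≤? get κ i)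
 ⊹-⊖ : ∀ {n} (κ μ : Vec ℕ n) -> μ ⊆ κ -> μ ⊹ (κ ⊖ μ) ≡ κ
 ⊹-⊖ [] [] h = E.refl
 ⊹-⊖ (a ∷ κ) (b ∷ μ) h = cong₂ _∷_ (NP.m+[n∸m]≡n (h zero)) (⊹-⊖ κ μ (\ i -> h (suc i)))
 ⊹-⊇ : ∀ {n} (κ m : Vec ℕ n) -> κ ⊆ (κ ⊹ m)
 ⊹-⊇ (a ∷ κ) (b ∷ m) zero = NP.m≤m+n a b
 ⊹-⊇ (a ∷ κ) (b ∷ m) (suc i) = ⊹-⊇ κ m i
 ⊹-inj : ∀ {n} (κ m m' : Vec ℕ n) -> κ ⊹ m ≡ κ ⊹ m' -> m ≡ m'
 ⊹-inj [] [] [] e = E.refl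
 ⊹-inj (a ∷ κ) (b ∷ m) (c ∷ m') e = cong₂ _∷_ (NP.+-cancelˡ-≡ a b c (VecP.∷-injectiveˡ e)) (⊹-inj κ m m' (VecP.∷-injectiveʳ e))
 sum-mono : ∀ {n} (μ κ : Vec ℕ n) -> μ ⊆ κ -> sum μ N.≤ sum κ
 sum-mono [] [] h = N.z≤n
 sum-mono (a ∷ μ) (b ∷ κ) h = NP.+-mono-≤ (h zero) (sum-mono μ κ (\ i -> h (suc i)))
 lookup≤sum : ∀ {n} (m : Vec ℕ n) i -> get m i N.≤ sum m
 lookup≤sum (a ∷ m) zero = NP.m≤m+n a _
 lookup≤sum (a ∷ m) (suc i) = ≤-trans (lookup≤sum m i) (NP.m≤n+m _ a)
 total-mono : ∀ {n} (κ μ : Vec ℤ n) -> (∀ i -> get κ i Z.≤ get μ i) -> total κ Z.≤ total μ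
 total-mono [] [] h = ZP.≤-refl
 total-mono (a ∷ κ) (b ∷ μ) h = ZP.+-mono-≤ (h zero) (total-mono κ μ (\ i -> h (suc i)))
 ℕvec-ext : ∀ {n} (κ μ : Vec ℕ n) -> (∀ i -> get κ i ≡ get μ i) -> κ ≡ μ
 ℕvec-ext [] [] h = E.refl
 ℕvec-ext (a ∷ κ) (b ∷ μ) h = cong₂ _∷_ (h zero) (ℕvec-ext κ μ (\ i -> h (suc i)))
 Inter⇒⊆ : ∀ {n} (κ μ : Vec ℕ n) -> Inter (emb κ) (emb μ) -> μ ⊆ κ
 Inter⇒⊆ {n} κ μ h i = ZP.drop‿+≤+ (subst₂ Z._≤_ (VecP.lookup-map i +_ μ) (VecP.lookup-map i +_ κ) (subst (\ o -> Ok o (get (emb κ) i) (get (emb μ) i)) (ordii (toℕ i)) (h i i)))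
  where
  ordii : ∀ i -> ordℕ i i ≡ level
  ordii zero = E.refl
  ordii (suc i) = ordii i
 Inter⇒next : ∀ {n} (κ μ : Vec ℕ n) -> Inter (emb κ) (emb μ) -> ∀ i j -> toℕ i ≡ suc (toℕ j) -> get κ i N.≤ get μ j
 Inter⇒next κ μ h i j e = ZP.drop‿+≤+ (subst₂ Z._≤_ (VecP.lookup-map i +_ κ) (VecP.lookup-map j +_ μ) (subst (\ o -> Ok o (get (emb κ) i) (get (emb μ) j)) (ord-gt i j 0 e) (h i j)))
 module SumKit (C : CRing) where
  open RingKit C
  open CompKit C
  open CompSingle C
  -- A finite sum over the range `In`, reduced to the properties that `reindex` needs; it is used
  -- for vectors and for pairs of a number and a vector.
  record Summ (X : Set) : Set₁ where
   field
    sumOf : (X -> Car) -> Car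
    In : X -> Set
    in? : ∀ x -> Dec (In x)
    cong∈ : ∀ {g h} -> (∀ x -> In x -> g x ≈ h x) -> sumOf g ≈ sumOf h
    zero∈ : ∀ g -> (∀ x -> In x -> g x ≈ 0#) -> sumOf g ≈ 0#
    single : ∀ x0 g -> In x0 -> (∀ x -> ¬ x ≡ x0 -> g x ≈ 0#) -> sumOf g ≈ g x0
  only : ∀ {A : Set} -> Dec A -> Car -> Car
  only (yes _) x = x
  only (no _) x = 0#
  only-yes : ∀ {A : Set} (d : Dec A) x -> A -> only d x ≈ x
  only-yes (yes _) x a = refl
  only-yes (no na) x a = absurd (na a)
  only-no : ∀ {A : Set} (d : Dec A) x -> ¬ A -> only d x ≈ 0#
  only-no (yes a) x na = absurd (na a)
  only-no (no _) x na = refl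
  only-0 : ∀ {A : Set} (d : Dec A) x -> (A -> x ≈ 0#) -> only d x ≈ 0#
  only-0 (yes a) x h = h a
  only-0 (no _) x h = refl
  -- Both sides equal the sum of the matrix that carries g x at (x , φ x) and 0 elsewhere.
  reindex : ∀ {X Y : Set} (S : Summ X) (T : Summ Y) (_≟_ : (y y' : Y) -> Dec (y ≡ y')) -> ((M : X -> Y -> Car) -> Summ.sumOf S (\ x -> Summ.sumOf T (M x)) ≈ Summ.sumOf T (\ y -> Summ.sumOf S (\ x -> M x y))) -> (φ : X -> Y) (g : X -> Car) (h : Y -> Car) -> (∀ x -> Summ.In S x -> ¬ Summ.In T (φ x) -> g x ≈ 0#) -> (∀ y -> Summ.In T y -> (Σ X \ x0 -> Summ.In S x0 × φ x0 ≡ y × h y ≈ g x0 × (∀ x -> φ x ≡ y -> ¬ x ≡ x0 -> g x ≈ 0#)) ⊎ (h y ≈ 0# × (∀ x -> Summ.In S x -> φ x ≡ y -> g x ≈ 0#))) -> Summ.sumOf S g ≈ Summ.sumOf T h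
  reindex {X} {Y} S T _≟_ swap φ g h out back = tr (S.cong∈ rows) (tr (swap M) (T.cong∈ cols))
   where
   module S = Summ S
   module T = Summ T
   M : X -> Y -> Car
   M x y = only (φ x ≟ y) (g x)
   rows : ∀ x -> S.In x -> g x ≈ T.sumOf (M x)
   rows x ix with T.in? (φ x)
   ... | yes iy = sym (tr (T.single (φ x) (M x) iy (\ y ne -> only-no (φ x ≟ y) _ (\ e -> ne (E.sym e)))) (only-yes (φ x ≟ φ x) _ E.refl))
   ... | no ny = tr z (sym (T.zero∈ (M x) (\ y _ -> only-0 (φ x ≟ y) _ (\ _ -> z))))
    where z = out x ix ny
   cols : ∀ y -> T.In y -> S.sumOf (\ x -> M x y) ≈ h y
   cols y iy with back y iy
   ... | inj₁ (x0 , ix , e , hg , others) = tr (S.single x0 (\ x -> M x y) ix (\ x ne -> only-0 (φ x ≟ y) _ (\ e' -> others x e' ne))) (tr (only-yes (φ x0 ≟ y) _ e) (sym hg))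
   ... | inj₂ (hz , others) = tr (S.zero∈ _ (\ x ix -> only-0 (φ x ≟ y) _ (\ e' -> others x ix e'))) (sym hz)
  Σc-sumR : ∀ n l k (h : Vec ℕ n -> ℕ -> Car) -> Σc n l (\ m -> sumR k (h m)) ≈ sumR k (\ i -> Σc n l (\ m -> h m i))
  Σc-sumR n l zero h = Σc-zero n l _ (\ _ -> refl)
  Σc-sumR n l (suc k) h = tr (Σc-+ n l _ _) (+ʳ (Σc-sumR n l k h))
  sumR-split : ∀ d e f -> sumR (d N.+ e) f ≈ sumR d f + sumR e (\ k -> f (d N.+ k))
  sumR-split d zero f = tr (rf (cong (\ k -> sumR k f) (NP.+-identityʳ d))) (sym (+0 _))
  sumR-split d (suc e) f = tr (rf (cong (\ k -> sumR k f) (NP.+-suc d e))) (tr (+ʳ (sumR-split d e f)) (+a _ _ _))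
  -- Needed because the two sides of the skew Cauchy identity are indexed by k and l with |λ'| + k =
  -- |μ| + l, so that one index runs ahead of the other by the difference of the totals.
  sumR-shift : ∀ B d (a b : ℕ -> Car) -> (∀ k -> k N.< d -> a k ≈ 0#) -> (∀ l -> a (d N.+ l) ≈ b l) -> (∀ l -> B N.≤ d N.+ l -> b l ≈ 0#) -> sumR B a ≈ sumR B b
  sumR-shift B d a b lo eqs hi with d N.≤? B
  ... | no nd = tr (sumR-zero B (\ k lt -> lo k (NP.<-trans lt (NP.≰⇒> nd)))) (sym (sumR-zero B (\ l _ -> hi l (≤-trans (NP.<⇒≤ (NP.≰⇒> nd)) (NP.m≤m+n d l)))))
  ... | yes le = begin sumR B a ≈⟨ rf (cong (\ k -> sumR k a) (E.sym Beq)) ⟩ sumR (d N.+ e) a ≈⟨ sumR-split d e a ⟩ sumR d a + sumR e (\ k -> a (d N.+ k)) ≈⟨ +~ (sumR-zero d lo) (sumR-cong e eqs) ⟩ 0# + sumR e b ≈⟨ +c _ _ ⟩ sumR e b + 0# ≈⟨ +ˡ (sumR-zero d (\ k _ -> hi (e N.+ k) (≤-trans (≤-reflexive (E.sym Beq)) (NP.+-monoʳ-≤ d (NP.m≤m+n e k))))) ⟨ sumR e b + sumR d (\ k -> b (e N.+ k)) ≈⟨ sumR-split e d b ⟨ sumR (e N.+ d) b ≈⟨ rf (cong (\ k -> sumR k b) (NP.+-comm e d >> Beq)) ⟩ sumR B b ∎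
   where
   e : ℕ
   e = B N.∸ d
   Beq : d N.+ e ≡ B
   Beq = NP.m+[n∸m]≡n le
  module Vecs (n B : ℕ) where
   -- The range of totals below B is complete for sums weighted by z to the power of the total,
   -- provided z^B = 0.
   SS : (Vec ℕ n -> Car) -> Car
   SS g = sumR B (\ N -> Σc n N g)
   SS-cong∈ : ∀ {g h} -> (∀ κ -> sum κ N.< B -> g κ ≈ h κ) -> SS g ≈ SS h
   SS-cong∈ e = sumR-cong< B (\ N lt -> Σc-cong∈ n N (\ m s -> e m (subst (N._< B) (E.sym s) lt)))
   SS-cong : ∀ {g h} -> (∀ κ -> g κ ≈ h κ) -> SS g ≈ SS h
   SS-cong e = SS-cong∈ (\ κ _ -> e κ)
   SS-zero : ∀ g -> (∀ κ -> sum κ N.< B -> g κ ≈ 0#) -> SS g ≈ 0#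
   SS-zero g e = sumR-zero B (\ N lt -> Σc-zero∈ n N g (\ m s -> e m (subst (N._< B) (E.sym s) lt)))
   SS-single : ∀ κ₀ g -> sum κ₀ N.< B -> (∀ κ -> ¬ κ ≡ κ₀ -> g κ ≈ 0#) -> SS g ≈ g κ₀
   SS-single κ₀ g i h = tr (sumR-single B (sum κ₀) _ i (\ N _ ne -> Σc-zero∈ n N g (\ m s -> h m (\ e -> ne (E.sym s >> cong sum e))))) (Σc-single n (sum κ₀) κ₀ g E.refl h)
   SS-+ : ∀ g h -> SS (\ κ -> g κ + h κ) ≈ SS g + SS h
   SS-+ g h = tr (sumR-cong B (\ N -> Σc-+ n N g h)) (sumR-+ B _ _)
   SS-*ˡ : ∀ c g -> c * SS g ≈ SS (\ κ -> c * g κ)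
   SS-*ˡ c g = tr (sumR-*ˡ B c _) (sumR-cong B (\ N -> Σc-*ˡ n N c g))
   SS-sumR : ∀ k (h : Vec ℕ n -> ℕ -> Car) -> SS (\ κ -> sumR k (h κ)) ≈ sumR k (\ i -> SS (\ κ -> h κ i))
   SS-sumR k h = tr (sumR-cong B (\ N -> Σc-sumR n N k h)) (sumR-swap B k _)
   SS-Σc : ∀ l (h : Vec ℕ n -> Vec ℕ n -> Car) -> SS (\ κ -> Σc n l (h κ)) ≈ Σc n l (\ m -> SS (\ κ -> h κ m))
   SS-Σc l h = tr (sumR-cong B (\ N -> Σc-swap n N n l h)) (sym (Σc-sumR n l B _))
   SS-swap : (h : Vec ℕ n -> Vec ℕ n -> Car) -> SS (\ κ -> SS (h κ)) ≈ SS (\ μ -> SS (\ κ -> h κ μ))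
   SS-swap h = tr (SS-sumR B _) (sumR-cong B (\ N -> SS-Σc N h))
   vecs : Summ (Vec ℕ n)
   vecs = record { sumOf = SS ; In = \ κ -> sum κ N.< B ; in? = \ κ -> sum κ N.<? B ; cong∈ = SS-cong∈ ; zero∈ = SS-zero ; single = SS-single }
   pairs : Summ (ℕ × Vec ℕ n)
   pairs = record { sumOf = \ g -> sumR B (\ j -> SS (\ τ -> g (j , τ))) ; In = \ { (j , τ) -> j N.< B × sum τ N.< B } ; in? = \ { (j , τ) -> (j N.<? B) ×-dec (sum τ N.<? B) } ; cong∈ = \ e -> sumR-cong< B (\ j lt -> SS-cong∈ (\ τ i -> e (j , τ) (lt , i))) ; zero∈ = \ g e -> sumR-zero B (\ j lt -> SS-zero _ (\ τ i -> e (j , τ) (lt , i))) ; single = \ { (j , τ) g (lt , i) e -> tr (sumR-single B j _ lt (\ k _ ne -> SS-zero _ (\ σ _ -> e (k , σ) (\ x -> ne (cong proj₁ x))))) (SS-single τ _ i (\ σ ne -> e (j , σ) (\ x -> ne (cong proj₂ x)))) } }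
 module AssemblyDef (Se : Setting) (Ev : Eval Se) (n0 : ℕ) (separated : Separated Se) (C : CRing) (H : Hom (Setting.R Se) C) (s : RingKit.Car C) (B : ℕ) (s-nil : RingKit._≈_ C (PickKit.pow C s B) (RingKit.0# C)) where
  open Setting Se using (R)
  open Eval Ev
  open LimitDef Se Ev n0 separated using (n; last; row-last; rowdd; P; Pi; upper; lower; clr; skew-cauchy)
  open SpecTDef Se Ev n using (TT; WW; TT-yes; TT-no)
  open RingKit C
  open PickKit C using (pow)
  open CompKit C
  open SumKit C
  open Vecs n B
  open Hom H
  private
   module R = RingKit R
   module CR = CompKit R
  -- The correction factors of the limit are distributed: `Pi` goes to the upper argument of a pair
  -- weight and `P` to the vertex weight `Ṽ`. With this choice both sides of the skew Cauchy
  -- identity take the same shape.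
  T̃ : Vec ℕ n -> Vec ℕ n -> Car
  T̃ κ μ = ev (TT (emb κ) (emb μ) R.* Pi (emb κ))
  Ṽ : Vec ℕ n -> Car
  Ṽ κ = ev (WW (emb κ) R.* P (emb κ))
  g : ℕ -> Car
  g j = ev (fR j 0)
  T̃-zero : ∀ κ μ -> ¬ Inter (emb κ) (emb μ) -> T̃ κ μ ≈ 0#
  T̃-zero κ μ nh = tr (ev-cong (R.tr (R.*ʳ (R.rf (TT-no _ _ nh))) (R.0* _))) ev-0
  T̃-⊈ : ∀ κ μ -> ¬ (μ ⊆ κ) -> T̃ κ μ ≈ 0#
  T̃-⊈ κ μ nh = T̃-zero κ μ (\ h -> nh (Inter⇒⊆ κ μ h))
  T̃-small : ∀ κ μ -> sum κ N.< sum μ -> T̃ κ μ ≈ 0#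
  T̃-small κ μ lt = T̃-⊈ κ μ (\ h -> NP.<⇒≱ lt (sum-mono μ κ h))
  private
   Pi-P : ∀ κ -> Pi κ R.* P κ R.≈ R.1#
   Pi-P κ = R.tr (R.*c _ _) (R.tr (R.sym (R.Π-* _ _)) (R.Π-one _ (\ i -> f-g _ _)))
  upper-T̃ : ∀ κ λ' μ -> ev (upper (emb λ') (emb μ) (emb κ)) ≈ T̃ κ λ' * (Ṽ κ * T̃ κ μ)
  upper-T̃ κ λ' μ = sym (tr (tr (*ˡ (sym (ev-* _ _))) (sym (ev-* _ _))) (ev-cong (R.tr (R.solve 5 (\ a p w q b -> (a R.:* p) R.:* ((w R.:* q) R.:* (b R.:* p)) R.:= (p R.:* q) R.:* (a R.:* (w R.:* (b R.:* p)))) R.refl _ (Pi (emb κ)) _ (P (emb κ)) _) (R.tr (R.*ʳ (Pi-P (emb κ))) (R.il _)))))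
  lower-T̃ : ∀ τ λ' μ -> ev (lower (emb λ') (emb μ) (emb τ)) ≈ T̃ λ' τ * (Ṽ τ * T̃ μ τ)
  lower-T̃ τ λ' μ = sym (tr (tr (*ˡ (sym (ev-* _ _))) (sym (ev-* _ _))) (ev-cong (R.solve 6 (\ a p w q b r -> (a R.:* p) R.:* ((w R.:* q) R.:* (b R.:* r)) R.:= a R.:* (w R.:* (b R.:* (q R.:* (p R.:* r))))) R.refl _ (Pi (emb λ')) _ (P (emb τ)) _ (Pi (emb μ)))))
  emb-0 : ∀ (κ : Vec ℕ n) i -> get κ i ≡ 0 -> get (emb κ) i ≡ + 0
  emb-0 κ i e = (VecP.lookup-map i +_ κ) >> (cong +_ e)
  emb-nonneg : ∀ (κ : Vec ℕ n) i -> + 0 Z.≤ get (emb κ) i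
  emb-nonneg κ i = subst (+ 0 Z.≤_) (E.sym (VecP.lookup-map i +_ κ)) (Z.+≤+ N.z≤n)
  module Cauchy (λ' μ : Vec ℕ n) (zλ : get λ' last ≡ 0) (zμ : get μ last ≡ 0) where
   U : Vec ℕ n -> Car
   U κ = T̃ κ λ' * (Ṽ κ * T̃ κ μ)
   D : Vec ℤ n -> Car
   D τ = ev (lower (emb λ') (emb μ) τ)
   X Y : ℕ -> Car
   X k = Σc n k (\ m -> U (λ' ⊹ m))
   Y l = Σc n l (\ m -> g (get m last) * D (emb λ' ∖ clr m))
   X≈Y : ∀ k l -> sum λ' N.+ k ≡ sum μ N.+ l -> X k ≈ Y l
   X≈Y k l e = tr (Σc-cong n k (\ m -> tr (sym (upper-T̃ (λ' ⊹ m) λ' μ)) (rf (cong (\ κ -> ev (upper (emb λ') (emb μ) κ)) (E.sym (emb-⊹ λ' m)))))) (tr (sym (ev-Σc n k _)) (tr (ev-cong (skew-cauchy k l (emb λ') (emb μ) (emb-0 λ' last zλ) (emb-0 μ last zμ) (emb-nonneg λ') (emb-nonneg μ) (cong (Z._+ + k) (total-emb λ') >> (cong +_ e) >> E.sym (cong (Z._+ + l) (total-emb μ))))) (tr (ev-Σc n l _) (Σc-cong n l (\ m -> ev-* _ _)))))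
   X-zero : ∀ k -> sum λ' N.+ k N.< sum μ -> X k ≈ 0#
   X-zero k lt = CompSingle.Σc-zero∈ C n k _ (\ m e -> tr (*ˡ (tr (*ˡ (T̃-small (λ' ⊹ m) μ (subst (N._< sum μ) (E.sym (sum-⊹ λ' m >> cong (sum λ' N.+_) e)) lt))) (*0 _))) (*0 _))
   D-not1 : ∀ τ -> ¬ Inter (emb λ') τ -> D τ ≈ 0#
   D-not1 τ nh = tr (ev-cong (R.tr (R.*ʳ (R.rf (TT-no _ _ nh))) (R.0* _))) ev-0
   D-not2 : ∀ τ -> ¬ Inter (emb μ) τ -> D τ ≈ 0#
   D-not2 τ nh = tr (ev-cong (R.tr (R.*ˡ (R.tr (R.*ˡ (R.tr (R.*ʳ (R.rf (TT-no _ _ nh))) (R.0* _))) (R.*0 _))) (R.*0 _))) ev-0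
   clr-⊆ : ∀ m -> clr m ⊆ m
   clr-⊆ m i with i FinP.≟ last
   ... | yes E.refl = ≤-trans (≤-reflexive (VecP.lookup∘updateAt last m)) N.z≤n
   ... | no ne = ≤-reflexive (VecP.lookup∘updateAt′ i last ne m)
   Y-zero : ∀ l -> sum μ N.+ l N.< sum λ' -> Y l ≈ 0#
   Y-zero l lt = CompSingle.Σc-zero∈ C n l _ (\ m e -> tr (*ˡ (D-not2 (emb λ' ∖ clr m) (\ h -> NP.<⇒≱ lt (bound m e h)))) (*0 _))
    where
    diag : (τ : Vec ℤ n) -> Inter (emb μ) τ -> ∀ i -> get τ i Z.≤ get (emb μ) i
    diag τ h i = subst (\ o -> Ok o (get (emb μ) i) (get τ i)) (ModelDef.ord-refl Se n (toℕ i)) (h i i)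
    bound : ∀ m -> sum m ≡ l -> Inter (emb μ) (emb λ' ∖ clr m) -> sum λ' N.≤ sum μ N.+ l
    bound m e h = ZP.drop‿+≤+ (ZP.≤-trans (ZP.≤-reflexive (E.sym (total-emb λ') >> cong total (E.sym (∖-∔ (emb λ') (clr m))) >> total-∔ (emb λ' ∖ clr m) (clr m))) (ZP.+-mono-≤ (ZP.≤-trans (total-mono (emb λ' ∖ clr m) (emb μ) (diag (emb λ' ∖ clr m) h)) (ZP.≤-reflexive (total-emb μ))) (Z.+≤+ (≤-trans (sum-mono (clr m) m (clr-⊆ m)) (≤-reflexive e)))))
   module Weighted (z : Car) (z-nil : ∀ k -> B N.≤ k -> pow z k ≈ 0#) (λ<B : sum λ' N.< B) where
    -- The total of the upper vector κ that corresponds to the lower vector τ and the kernel index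
    -- j.
    e0 : Vec ℕ n -> ℕ -> ℕ
    e0 τ j = (sum λ' N.+ sum μ N.+ j) N.∸ sum τ
    hh : ℕ × Vec ℕ n -> Car
    hh (j , τ) = pow z (e0 τ j) * (g j * (T̃ λ' τ * (Ṽ τ * T̃ μ τ)))
    vanish : ∀ {x} k -> B N.≤ k -> pow z k * x ≈ 0#
    vanish k le = tr (*ʳ (z-nil k le)) (0* _)
    above : SS (\ κ -> pow z (sum κ) * U κ) ≈ SS (\ m -> pow z (sum (λ' ⊹ m)) * U (λ' ⊹ m))
    above = sym (reindex vecs vecs (VecP.≡-dec N._≟_) SS-swap (λ' ⊹_) _ _ (\ m _ out -> vanish _ (NP.≮⇒≥ out)) back)
     where
     back : ∀ κ -> sum κ N.< B -> _
     back κ lt with ⊆? λ' κ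
     ... | yes h = inj₁ (κ ⊖ λ' , NP.≤-<-trans (≤-trans (NP.m≤n+m _ (sum λ')) (≤-reflexive (E.sym (sum-⊹ λ' (κ ⊖ λ')) >> cong sum (⊹-⊖ κ λ' h)))) lt , ⊹-⊖ κ λ' h , rf (cong (\ κ -> pow z (sum κ) * U κ) (E.sym (⊹-⊖ κ λ' h))) , (\ m e ne -> absurd (ne (⊹-inj λ' m (κ ⊖ λ') (e >> E.sym (⊹-⊖ κ λ' h))))))
     ... | no nh = inj₂ (tr (*ˡ (tr (*ʳ (T̃-⊈ κ λ' nh)) (0* _))) (*0 _) , (\ m _ e -> absurd (nh (subst (λ' ⊆_) e (⊹-⊇ λ' m)))))
    shifted : sumR B (\ k -> pow z (sum λ' N.+ k) * X k) ≈ sumR B (\ l -> pow z (sum μ N.+ l) * Y l)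
    shifted with NP.≤-total (sum λ') (sum μ)
    ... | inj₁ le = sumR-shift B d _ _ (\ k lt -> tr (*ˡ (X-zero k (subst (sum λ' N.+ k N.<_) de (NP.+-monoʳ-< (sum λ') lt)))) (*0 _)) (\ l -> *~ (rf (cong (pow z) (same l))) (X≈Y _ _ (same l))) (\ l h -> vanish _ (≤-trans h (NP.+-monoˡ-≤ l (NP.m∸n≤m (sum μ) (sum λ')))))
     where
     d = sum μ N.∸ sum λ'
     de : sum λ' N.+ d ≡ sum μ
     de = NP.m+[n∸m]≡n le
     same : ∀ l -> sum λ' N.+ (d N.+ l) ≡ sum μ N.+ l
     same l = E.sym (NP.+-assoc (sum λ') d l) >> cong (N._+ l) de
    ... | inj₂ le = sym (sumR-shift B d _ _ (\ k lt -> tr (*ˡ (Y-zero k (subst (sum μ N.+ k N.<_) de (NP.+-monoʳ-< (sum μ) lt)))) (*0 _)) (\ l -> *~ (rf (cong (pow z) (same l))) (sym (X≈Y _ _ (E.sym (same l))))) (\ l h -> vanish _ (≤-trans h (NP.+-monoˡ-≤ l (NP.m∸n≤m (sum λ') (sum μ))))))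
     where
     d = sum λ' N.∸ sum μ
     de : sum μ N.+ d ≡ sum λ'
     de = NP.m+[n∸m]≡n le
     same : ∀ l -> sum μ N.+ (d N.+ l) ≡ sum λ' N.+ l
     same l = E.sym (NP.+-assoc (sum μ) d l) >> cong (N._+ l) de
    gg : Vec ℕ n -> Car
    gg m = pow z (sum μ N.+ sum m) * (g (get m last) * D (emb λ' ∖ clr m))
    lookup-⊖ : ∀ i (κ m : Vec ℕ n) -> get (κ ⊖ m) i ≡ get κ i N.∸ get m i
    lookup-⊖ i κ m = VecP.lookup-zipWith N._∸_ i κ m
    -- A composition encodes the kernel index, its last part, and the lower vector, obtained by
    -- subtracting the remaining parts from λ'.
    φ : Vec ℕ n -> ℕ × Vec ℕ n
    φ m = get m last , λ' ⊖ clr m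
    φ-⊆ : ∀ m -> (λ' ⊖ clr m) ⊆ λ'
    φ-⊆ m i = subst (N._≤ get λ' i) (E.sym (lookup-⊖ i λ' (clr m))) (NP.m∸n≤m (get λ' i) (get (clr m) i))
    nonneg : (τ : Vec ℤ n) -> get τ last ≡ + 0 -> Inter (emb λ') τ -> ∀ i -> + 0 Z.≤ get τ i
    nonneg τ zτ h i with i FinP.≟ last
    ... | yes E.refl = ZP.≤-reflexive (E.sym zτ)
    ... | no ne with row-last i ne
    ...   | d , e = subst (Z._≤ get τ i) (emb-0 λ' last zλ) (subst (\ o -> Ok o (get (emb λ') last) (get τ i)) e (h last i))
    clr-last : ∀ m -> get (clr m) last ≡ 0
    clr-last m = VecP.lookup∘updateAt last m
    -- Truncated subtraction is injective only below λ'. Compositions that leave this range lead to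
    -- a negative entry, hence to no interlacing and to the weight 0.
    inside : ∀ m -> clr m ⊆ λ' ⊎ gg m ≈ 0#
    inside m with ⊆? (clr m) λ'
    ... | yes h = inj₁ h
    ... | no nh = inj₂ (tr (*ˡ (tr (*ˡ (D-not1 (emb λ' ∖ clr m) fail)) (*0 _))) (*0 _))
     where
     at : ∀ i -> get (emb λ' ∖ clr m) i ≡ + get λ' i Z.- + get (clr m) i
     at i = lookup-∖ i (emb λ') (clr m) >> cong (Z._- + get (clr m) i) (VecP.lookup-map i +_ λ')
     fail : ¬ Inter (emb λ') (emb λ' ∖ clr m)
     fail h = nh (\ i -> ZP.drop‿+≤+ (ZP.0≤i-j⇒j≤i (subst (+ 0 Z.≤_) (at i) (nonneg (emb λ' ∖ clr m) (at last >> cong₂ (\ a b -> + a Z.- + b) zλ (clr-last m)) h i))))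
    below : SS gg ≈ sumR B (\ j -> SS (\ τ -> hh (j , τ)))
    below = reindex vecs pairs (×P.≡-dec N._≟_ (VecP.≡-dec N._≟_)) (\ M -> tr (SS-sumR B _) (sumR-cong B (\ j -> SS-swap _))) φ gg hh (\ m lt out -> absurd (out (NP.≤-<-trans (lookup≤sum m last) lt , NP.≤-<-trans (sum-mono (λ' ⊖ clr m) λ' (φ-⊆ m)) λ<B))) back
     where
     back : ∀ y -> _ -> _
     back (j , τ) (lj , lτ) with ⊆? τ λ'
     ... | no nh = inj₂ (tr (*ˡ (tr (*ˡ (tr (*ʳ (T̃-⊈ λ' τ nh)) (0* _))) (*0 _))) (*0 _) , (\ m _ e -> absurd (nh (subst (_⊆ λ') (cong proj₂ e) (φ-⊆ m)))))
     ... | yes h = split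
      where
      x0 : Vec ℕ n
      x0 = updateAt (λ' ⊖ τ) last (\ _ -> j)
      ⊖-last : get (λ' ⊖ τ) last ≡ 0
      ⊖-last = lookup-⊖ last λ' τ >> cong (N._∸ get τ last) zλ >> NP.0∸n≡0 (get τ last)
      clr-x0 : clr x0 ≡ λ' ⊖ τ
      clr-x0 = ℕvec-ext _ _ each
       where
       each : ∀ i -> get (clr x0) i ≡ get (λ' ⊖ τ) i
       each i with i FinP.≟ last
       ... | yes E.refl = clr-last x0 >> E.sym ⊖-last
       ... | no ne = VecP.lookup∘updateAt′ i last ne x0 >> VecP.lookup∘updateAt′ i last ne (λ' ⊖ τ)
      double : λ' ⊖ (λ' ⊖ τ) ≡ τ
      double = ℕvec-ext _ _ (\ i -> lookup-⊖ i λ' (λ' ⊖ τ) >> cong (get λ' i N.∸_) (lookup-⊖ i λ' τ) >> NP.m∸[m∸n]≡n (h i))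
      φ-x0 : φ x0 ≡ (j , τ)
      φ-x0 = cong₂ _,_ (VecP.lookup∘updateAt last (λ' ⊖ τ)) (cong (λ' ⊖_) clr-x0 >> double)
      sum-update : ∀ {k} (v : Vec ℕ k) i -> get v i ≡ 0 -> sum (updateAt v i (\ _ -> j)) ≡ sum v N.+ j
      sum-update (a ∷ v) zero E.refl = NP.+-comm j (sum v)
      sum-update (a ∷ v) (suc i) e = cong (a N.+_) (sum-update v i e) >> E.sym (NP.+-assoc a (sum v) j)
      exponent : sum μ N.+ sum x0 ≡ e0 τ j
      exponent = E.sym (cong (N._∸ sum τ) rearranged >> NP.m+n∸m≡n (sum τ) _)
       where
       sumλ : sum τ N.+ sum (λ' ⊖ τ) ≡ sum λ'
       sumλ = E.sym (sum-⊹ τ (λ' ⊖ τ)) >> cong sum (⊹-⊖ λ' τ h)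
       open import Data.Nat.Solver using (module +-*-Solver)
       rearranged : sum λ' N.+ sum μ N.+ j ≡ sum τ N.+ (sum μ N.+ sum x0)
       rearranged = cong (\ a -> a N.+ sum μ N.+ j) (E.sym sumλ) >> E.trans (+-*-Solver.solve 4 (\ a b c d -> a +-*-Solver.:+ b +-*-Solver.:+ c +-*-Solver.:+ d +-*-Solver.:= a +-*-Solver.:+ (c +-*-Solver.:+ (b +-*-Solver.:+ d))) E.refl (sum τ) (sum (λ' ⊖ τ)) (sum μ) j) (cong (\ a -> sum τ N.+ (sum μ N.+ a)) (E.sym (sum-update (λ' ⊖ τ) last ⊖-last)))
      unique : ∀ m -> φ m ≡ (j , τ) -> m ≡ x0 ⊎ gg m ≈ 0#
      unique m e with inside m
      ... | inj₂ zero-g = inj₂ zero-g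
      ... | inj₁ sub = inj₁ (ℕvec-ext _ _ each)
       where
       each : ∀ i -> get m i ≡ get x0 i
       each i with i FinP.≟ last
       ... | yes E.refl = cong proj₁ e >> E.sym (VecP.lookup∘updateAt last (λ' ⊖ τ))
       ... | no ne = E.sym (VecP.lookup∘updateAt′ i last ne m) >> (E.sym (NP.m∸[m∸n]≡n (sub i)) >> cong (get λ' i N.∸_) (E.sym (lookup-⊖ i λ' (clr m)) >> cong (\ v -> get v i) (cong proj₂ e)) >> E.sym (lookup-⊖ i λ' τ)) >> E.sym (VecP.lookup∘updateAt′ i last ne (λ' ⊖ τ))
      τ-emb : emb λ' ∖ clr x0 ≡ emb τ
      τ-emb = cong (emb λ' ∖_) clr-x0 >> cong (_∖ (λ' ⊖ τ)) (cong emb (E.sym (⊹-⊖ λ' τ h)) >> E.sym (emb-⊹ τ (λ' ⊖ τ))) >> (∔-∖ (emb τ) (λ' ⊖ τ))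
      value : hh (j , τ) ≈ gg x0
      value = *~ (rf (cong (pow z) (E.sym exponent))) (*~ (rf (cong g (E.sym (VecP.lookup∘updateAt last (λ' ⊖ τ))))) (tr (sym (lower-T̃ τ λ' μ)) (rf (cong D (E.sym τ-emb)))))
      split : _
      split with sum x0 N.<? B
      ... | yes lt = inj₁ (x0 , lt , φ-x0 , value , (\ m e ne -> go (unique m e) ne))
       where
       go : ∀ {m} -> m ≡ x0 ⊎ gg m ≈ 0# -> ¬ m ≡ x0 -> gg m ≈ 0#
       go (inj₁ e) ne = absurd (ne e)
       go (inj₂ z0) _ = z0
      -- The only possible preimage is beyond the range of the sum. Its exponent is then at least B,
      -- so the term on the right vanishes by nilpotency.
      ... | no nlt = inj₂ (tr value (vanish _ big) , (\ m lt e -> go lt (unique m e)))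
       where
       big : B N.≤ sum μ N.+ sum x0
       big = ≤-trans (NP.≮⇒≥ nlt) (NP.m≤n+m _ (sum μ))
       go : ∀ {m} -> sum m N.< B -> m ≡ x0 ⊎ gg m ≈ 0# -> gg m ≈ 0#
       go lt (inj₁ E.refl) = absurd (nlt lt)
       go lt (inj₂ z0) = z0
    -- The homogeneous identities `X≈Y` added up with weights z^|κ|, after both sides are indexed by
    -- compositions.
    cauchy : SS (\ κ -> pow z (sum κ) * U κ) ≈ sumR B (\ j -> SS (\ τ -> hh (j , τ)))
    cauchy = begin SS (\ κ -> pow z (sum κ) * U κ) ≈⟨ above ⟩ SS (\ m -> pow z (sum (λ' ⊹ m)) * U (λ' ⊹ m)) ≈⟨ sumR-cong B (\ k -> tr (Σc-cong∈ n k (\ m e -> *ʳ (rf (cong (pow z) (sum-⊹ λ' m >> cong (sum λ' N.+_) e))))) (sym (Σc-*ˡ n k _ _))) ⟩ sumR B (\ k -> pow z (sum λ' N.+ k) * X k) ≈⟨ shifted ⟩ sumR B (\ l -> pow z (sum μ N.+ l) * Y l) ≈⟨ sumR-cong B (\ l -> tr (Σc-*ˡ n l _ _) (Σc-cong∈ n l (\ m e -> *ʳ (rf (cong (\ k -> pow z (sum μ N.+ k)) (E.sym e)))))) ⟩ SS gg ≈⟨ below ⟩ sumR B (\ j -> SS (\ τ -> hh (j , τ))) ∎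

-- The word of raising and lowering steps and its matrix entry.

module Star where
 open Kit
 open Comp
 open Spec
 open Model renaming (lt to ahead; gt to behind; eq to level)
 open SpecT
 open Limit
 open Assembly
 open import Data.Fin using (fromℕ; inject₁)
 open import Data.Vec using (sum; replicate)
 module PowKit (C : CRing) where
  open RingKit C
  open PickKit C using (pow)
  pow-+ : ∀ x a b -> pow x (a N.+ b) ≈ pow x a * pow x b
  pow-+ x zero b = sym (il _)
  pow-+ x (suc a) b = tr (*ˡ (pow-+ x a b)) (sym (*a _ _ _))
  pow-* : ∀ x y k -> pow (x * y) k ≈ pow x k * pow y k
  pow-* x y zero = sym (il _)
  pow-* x y (suc k) = tr (*ˡ (pow-* x y k)) (solve 4 (\ x y p q -> (x :* y) :* (p :* q) := (x :* p) :* (y :* q)) refl x y _ _)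
  pow-nil : ∀ x B -> pow x B ≈ 0# -> ∀ k -> B N.≤ k -> pow x k ≈ 0#
  pow-nil x B e k B≤k = tr (rf (cong (pow x) (E.sym (NP.m+[n∸m]≡n B≤k)))) (tr (pow-+ x B (k N.∸ B)) (tr (*ʳ e) (0* _)))
  pow-nil* : ∀ x y B -> pow x B ≈ 0# -> ∀ k -> B N.≤ k -> pow (x * y) k ≈ 0#
  pow-nil* x y B e k B≤k = tr (pow-* x y k) (tr (*ʳ (pow-nil x B e k B≤k)) (0* _))
 module StarDef (Se : Setting) (Ev : Eval Se) (n0 : ℕ) (separated : Separated Se) (C : CRing) (H : Hom (Setting.R Se) C) (s : RingKit.Car C) (B : ℕ) (s-nil : RingKit._≈_ C (PickKit.pow C s B) (RingKit.0# C)) where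
  open AssemblyDef Se Ev n0 separated C H s B s-nil public
  open LimitDef Se Ev n0 separated using (n; last; P; Pi)
  open SpecTDef Se Ev n using (TT; WW; TT-yes)
  open RingKit C
  open PickKit C using (pow)
  open PowKit C
  open SumKit C
  open Vecs n B public
  open Hom H using (ev; ev-cong; ev-1)
  private
   module R = RingKit (Setting.R Se)
   module Ev = Eval Ev
  𝟎 : Vec ℕ n
  𝟎 = replicate n 0
  _≟𝟎 : (κ : Vec ℕ n) -> Dec (κ ≡ 𝟎)
  κ ≟𝟎 = VecP.≡-dec N._≟_ κ 𝟎
  sum-𝟎 : sum 𝟎 ≡ 0
  sum-𝟎 = go n
   where
   go : ∀ m -> sum (replicate m 0) ≡ 0
   go zero = E.refl
   go (suc m) = go m
  -- Sum over the c diagonals to the right of a given diagonal κ, of which the last is empty. The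
  -- power of s for κ is included, its vertex weight is not.
  Ψ : ℕ -> Vec ℕ n -> Car
  Ψ zero κ = only (κ ≟𝟎) 1#
  Ψ (suc c) κ = pow s (sum κ) * SS (\ μ -> T̃ κ μ * (Ṽ μ * Ψ c μ))
  kill1 : ∀ {x y z} -> x ≈ 0# -> z * (x * y) ≈ 0#
  kill1 e = tr (*ˡ (tr (*ʳ e) (0* _))) (*0 _)
  kill2 : ∀ {x y z} -> x ≈ 0# -> z * (y * x) ≈ 0#
  kill2 e = tr (*ˡ (tr (*ˡ e) (*0 _))) (*0 _)
  -- Each interlacing step away from `𝟎` adds at most one row. This guarantees the last entry 0 that
  -- the skew Cauchy identity asks for.
  Ψ-rows : ∀ c κ i -> c N.≤ toℕ i -> ¬ get κ i ≡ 0 -> Ψ c κ ≈ 0#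
  Ψ-rows zero κ i _ ne = only-no (κ ≟𝟎) 1# (\ e -> ne (cong (\ v -> get v i) e >> VecP.lookup-replicate i 0))
  Ψ-rows (suc c) κ (suc i) (N.s≤s c≤i) ne = tr (*ˡ (SS-zero _ (\ μ _ -> each μ))) (*0 _)
   where
   each : ∀ μ -> T̃ κ μ * (Ṽ μ * Ψ c μ) ≈ 0#
   each μ with inter? (emb κ) (emb μ)
   ... | no nh = tr (*ʳ (T̃-zero κ μ nh)) (0* _)
   ... | yes h = kill2 (Ψ-rows c μ (inject₁ i) (≤-trans c≤i (≤-reflexive (E.sym (FinP.toℕ-inject₁ i)))) (\ e -> ne (NP.n≤0⇒n≡0 (≤-trans (Inter⇒next κ μ h (suc i) (inject₁ i) (cong suc (E.sym (FinP.toℕ-inject₁ i)))) (≤-reflexive e)))))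
  private
   emb-𝟎 : ∀ i -> get (emb 𝟎) i ≡ + 0
   emb-𝟎 i = emb-0 𝟎 i (VecP.lookup-replicate i 0)
   g-0 : ∀ d -> Ev.gR 0 d R.≈ R.1#
   g-0 d = R.tr (R.sym (R.il _)) (R.tr (R.*ʳ (R.sym (Ev.f-0 d))) (Ev.f-g 0 d))
   at-0 : (h : ℕ -> ℕ -> R.Car) -> (∀ d -> h 0 d R.≈ R.1#) -> ∀ {a b} -> a ≡ + 0 -> b ≡ + 0 -> ∀ d -> h (abs (a Z.- b)) d R.≈ R.1#
   at-0 h e E.refl E.refl d = e d
   at-0′ : (h : ℕ -> ℕ -> R.Car) -> (∀ d -> h 0 d R.≈ R.1#) -> ∀ {a} -> a ≡ + 0 -> ∀ d -> h (abs a) d R.≈ R.1#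
   at-0′ h e E.refl d = e d
   Ok-refl : ∀ o {a b} -> a ≡ b -> Ok o a b
   Ok-refl (ahead d) E.refl = ZP.≤-refl
   Ok-refl level E.refl = ZP.≤-refl
   Ok-refl (behind d) E.refl = ZP.≤-refl
  T̃-𝟎 : T̃ 𝟎 𝟎 ≈ 1#
  T̃-𝟎 = tr (ev-cong (R.tr (R.*~ (R.tr (R.rf (TT-yes (emb 𝟎) (emb 𝟎) (\ i j -> Ok-refl (ord i j) (emb-𝟎 i >> E.sym (emb-𝟎 j))))) (R.Π-one _ (\ i -> R.Π-one _ (\ j -> at-0 Ev.fR Ev.f-0 (emb-𝟎 i) (emb-𝟎 j) _)))) (R.Π-one _ (\ i -> at-0′ Ev.gR g-0 (emb-𝟎 i) _))) (R.il _))) ev-1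
  Ṽ-𝟎 : Ṽ 𝟎 ≈ 1#
  Ṽ-𝟎 = tr (ev-cong (R.tr (R.*~ (R.Π-one _ (\ i -> R.Π-one _ (\ j -> at-0 Ev.gR g-0 (emb-𝟎 i) (emb-𝟎 j) _))) (R.Π-one _ (\ i -> at-0′ Ev.fR Ev.f-0 (emb-𝟎 i) _))) (R.il _))) ev-1
  nonzero-entry : ∀ κ -> ¬ κ ≡ 𝟎 -> Σ (Fin n) \ i -> ¬ get κ i ≡ 0
  nonzero-entry κ ne with FinP.all? (\ i -> get κ i N.≟ 0)
  ... | yes h = absurd (ne (ℕvec-ext κ 𝟎 (\ i -> h i >> E.sym (VecP.lookup-replicate i 0))))
  ... | no nh = FinP.¬∀⟶∃¬ n _ (\ i -> get κ i N.≟ 0) nh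
  T̃-𝟎-off : ∀ κ -> ¬ κ ≡ 𝟎 -> T̃ 𝟎 κ ≈ 0#
  T̃-𝟎-off κ ne = let (i , nz) = nonzero-entry κ ne in T̃-⊈ 𝟎 κ (\ h -> nz (NP.n≤0⇒n≡0 (≤-trans (h i) (≤-reflexive (VecP.lookup-replicate i 0)))))
  Gf : Car -> Car
  Gf z = sumR B (\ j -> g j * pow z j)
  -- The factor collected by a raising step that moves past c lowering steps: the kernel at s^(e+1),
  -- ..., s^(e+c).
  X : ℕ -> ℕ -> Car
  X zero e = 1#
  X (suc c) e = Gf (pow s (suc e)) * X c (suc e)
  module Step (c e : ℕ) (c<n : suc c N.≤ n0) (λ' : Vec ℕ n) (λ<B : sum λ' N.< B) (zλ : get λ' last ≡ 0) (ih : ∀ τ -> sum τ N.< B -> SS (\ μ -> pow (pow s (suc e)) (sum μ) * (T̃ μ τ * (Ṽ μ * Ψ c μ))) ≈ X c (suc e) * (pow (pow s (suc e)) (sum τ) * Ψ c τ)) where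
   z S0 : Car
   -- One exponent more than e, because unfolding `Ψ (suc c) κ` produces a further factor s^|κ|.
   z = pow s (suc e)
   S0 = SS (\ τ -> T̃ λ' τ * (Ṽ τ * Ψ c τ))
   U : Vec ℕ n -> Vec ℕ n -> Car
   U μ κ = T̃ κ λ' * (Ṽ κ * T̃ κ μ)
   Q : Vec ℕ n -> Car
   Q τ = pow z (sum λ' N.∸ sum τ) * (T̃ λ' τ * Ṽ τ)
   x : Vec ℕ n -> Vec ℕ n -> Car
   x μ τ = pow z (sum μ) * (T̃ μ τ * (Ṽ μ * Ψ c μ))
   expand : ∀ κ -> pow (pow s e) (sum κ) * (T̃ κ λ' * (Ṽ κ * Ψ (suc c) κ)) ≈ SS (\ μ -> (Ṽ μ * Ψ c μ) * (pow z (sum κ) * U μ κ))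
   expand κ = tr (solve 5 (\ p t v q s -> p :* (t :* (v :* (q :* s))) := ((q :* p) :* (t :* v)) :* s) refl (pow (pow s e) (sum κ)) (T̃ κ λ') (Ṽ κ) (pow s (sum κ)) _) (tr (*ʳ (*ʳ (sym (pow-* s (pow s e) (sum κ))))) (tr (SS-*ˡ _ _) (SS-cong (\ μ -> solve 6 (\ z t v u w p -> (z :* (t :* v)) :* (u :* (w :* p)) := (w :* p) :* (z :* (t :* (v :* u)))) refl (pow z (sum κ)) (T̃ κ λ') (Ṽ κ) (T̃ κ μ) (Ṽ μ) (Ψ c μ)))))
   split : ∀ μ j τ -> (Ṽ μ * Ψ c μ) * (pow z ((sum λ' N.+ sum μ N.+ j) N.∸ sum τ) * (g j * (T̃ λ' τ * (Ṽ τ * T̃ μ τ)))) ≈ (g j * pow z j) * (Q τ * x μ τ)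
   split μ j τ with ⊆? τ λ'
   ... | no nh = tr (kill2 (tr (*ˡ (tr (*ʳ (T̃-⊈ λ' τ nh)) (0* _))) (*0 _))) (sym (kill1 (kill1 (T̃-⊈ λ' τ nh))))
   ... | yes h = tr (*ˡ (*ʳ (tr (rf (cong (pow z) exponent)) (tr (pow-+ z (sum λ' N.∸ sum τ) (sum μ N.+ j)) (*ˡ (pow-+ z (sum μ) j)))))) (solve 9 (\ w p a b d g t v u -> (w :* p) :* ((a :* (b :* d)) :* (g :* (t :* (v :* u)))) := (g :* d) :* ((a :* (t :* v)) :* (b :* (u :* (w :* p))))) refl (Ṽ μ) (Ψ c μ) (pow z (sum λ' N.∸ sum τ)) (pow z (sum μ)) (pow z j) (g j) (T̃ λ' τ) (Ṽ τ) (T̃ μ τ))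
    where
    exponent : (sum λ' N.+ sum μ N.+ j) N.∸ sum τ ≡ (sum λ' N.∸ sum τ) N.+ (sum μ N.+ j)
    exponent = cong (N._∸ sum τ) (NP.+-assoc (sum λ') (sum μ) j) >> NP.+-∸-comm (sum μ N.+ j) (sum-mono τ λ' h)
   rearranged : ∀ μ -> (Ṽ μ * Ψ c μ) * SS (\ κ -> pow z (sum κ) * U μ κ) ≈ sumR B (\ j -> SS (\ τ -> (g j * pow z j) * (Q τ * x μ τ)))
   rearranged μ with get μ last N.≟ 0
   ... | yes zμ = tr (*ˡ (Cauchy.Weighted.cauchy λ' μ zλ zμ z (pow-nil* s (pow s e) B s-nil) λ<B)) (tr (sumR-*ˡ B _ _) (sumR-cong B (\ j -> tr (SS-*ˡ _ _) (SS-cong (\ τ -> split μ j τ)))))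
   -- Here the Cauchy identity does not apply, but μ has too many rows for `Ψ c μ` to be nonzero.
   ... | no nz = tr (tr (*ʳ (tr (*ˡ Ψ0) (*0 _))) (0* _)) (sym (sumR-zero B (\ j _ -> SS-zero _ (\ τ _ -> kill2 (kill2 (tr (*ˡ Ψ0) (*0 _)))))))
    where
    Ψ0 : Ψ c μ ≈ 0#
    Ψ0 = Ψ-rows c μ last (≤-trans (NP.<⇒≤ c<n) (≤-reflexive (E.sym (FinP.toℕ-fromℕ n0)))) nz
   collapse : ∀ τ -> Q τ * (X c (suc e) * (pow z (sum τ) * Ψ c τ)) ≈ (X c (suc e) * pow z (sum λ')) * (T̃ λ' τ * (Ṽ τ * Ψ c τ))
   collapse τ with ⊆? τ λ'
   ... | no nh = tr (*ʳ (kill1 (T̃-⊈ λ' τ nh))) (tr (0* _) (sym (kill1 (T̃-⊈ λ' τ nh))))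
   ... | yes h = tr (solve 6 (\ a t v x b p -> (a :* (t :* v)) :* (x :* (b :* p)) := (x :* (a :* b)) :* (t :* (v :* p))) refl (pow z (sum λ' N.∸ sum τ)) (T̃ λ' τ) (Ṽ τ) (X c (suc e)) (pow z (sum τ)) (Ψ c τ)) (*ʳ (*ˡ (tr (sym (pow-+ z (sum λ' N.∸ sum τ) (sum τ))) (rf (cong (pow z) (NP.m∸n+n≡m (sum-mono τ λ' h)))))))
   inner : ∀ j -> SS (\ τ -> SS (\ μ -> (g j * pow z j) * (Q τ * x μ τ))) ≈ (g j * pow z j) * ((X c (suc e) * pow z (sum λ')) * S0)
   inner j = tr (SS-cong∈ (\ τ τ<B -> tr (sym (SS-*ˡ _ _)) (*ˡ (tr (sym (SS-*ˡ _ _)) (tr (*ˡ (ih τ τ<B)) (collapse τ)))))) (tr (sym (SS-*ˡ _ _)) (*ˡ (sym (SS-*ˡ _ _))))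
   step : SS (\ κ -> pow (pow s e) (sum κ) * (T̃ κ λ' * (Ṽ κ * Ψ (suc c) κ))) ≈ X (suc c) e * (pow (pow s e) (sum λ') * Ψ (suc c) λ')
   step = begin SS (\ κ -> pow (pow s e) (sum κ) * (T̃ κ λ' * (Ṽ κ * Ψ (suc c) κ))) ≈⟨ SS-cong expand ⟩ SS (\ κ -> SS (\ μ -> (Ṽ μ * Ψ c μ) * (pow z (sum κ) * U μ κ))) ≈⟨ SS-swap _ ⟩ SS (\ μ -> SS (\ κ -> (Ṽ μ * Ψ c μ) * (pow z (sum κ) * U μ κ))) ≈⟨ SS-cong (\ μ -> tr (sym (SS-*ˡ _ _)) (rearranged μ)) ⟩ SS (\ μ -> sumR B (\ j -> SS (\ τ -> (g j * pow z j) * (Q τ * x μ τ)))) ≈⟨ SS-sumR B _ ⟩ sumR B (\ j -> SS (\ μ -> SS (\ τ -> (g j * pow z j) * (Q τ * x μ τ)))) ≈⟨ sumR-cong B (\ j -> tr (SS-swap _) (inner j)) ⟩ sumR B (\ j -> (g j * pow z j) * ((X c (suc e) * pow z (sum λ')) * S0)) ≈⟨ sumR-*ʳ B _ _ ⟨ Gf z * ((X c (suc e) * pow z (sum λ')) * S0) ≈⟨ *ˡ (*ʳ (*ˡ (pow-* s (pow s e) (sum λ')))) ⟩ Gf z * ((X c (suc e) * (pow s (sum λ') * pow (pow s e) (sum λ'))) * S0) ≈⟨ solve 5 (\ g x a b s -> g :* ((x :* (a :* b)) :* s) := (g :* x) :* (b :* (a :* s))) refl (Gf z) (X c (suc e))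 (pow s (sum λ')) (pow (pow s e) (sum λ')) S0 ⟩ X (suc c) e * (pow (pow s e) (sum λ') * Ψ (suc c) λ') ∎
  -- Up to the power of s^e, `Ψ c` is an eigenvector of the raising step. Each lowering step is
  -- exchanged by the Cauchy identity, and at the end the step acts on `𝟎`, where only `T̃ 𝟎 𝟎` = 1
  -- remains.
  star : ∀ c e λ' -> c N.≤ n0 -> sum λ' N.< B -> SS (\ κ -> pow (pow s e) (sum κ) * (T̃ κ λ' * (Ṽ κ * Ψ c κ))) ≈ X c e * (pow (pow s e) (sum λ') * Ψ c λ')
  star zero e λ' _ λ<B = tr (SS-single 𝟎 _ (NP.≤-<-trans (≤-trans (≤-reflexive sum-𝟎) N.z≤n) λ<B) (\ κ ne -> kill2 (tr (*ˡ (only-no (κ ≟𝟎) 1# ne)) (*0 _)))) (tr (*~ (rf (cong (pow (pow s e)) sum-𝟎)) (*ˡ (tr (*~ Ṽ-𝟎 (only-yes (𝟎 ≟𝟎) 1# E.refl)) (il _)))) (tr (il _) (tr (*1 _) value)))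
   where
   value : T̃ 𝟎 λ' ≈ 1# * (pow (pow s e) (sum λ') * only (λ' ≟𝟎) 1#)
   value with λ' ≟𝟎
   ... | yes E.refl = tr T̃-𝟎 (sym (tr (il _) (tr (*1 _) (rf (cong (pow (pow s e)) sum-𝟎)))))
   ... | no ne = tr (T̃-𝟎-off λ' ne) (sym (tr (*ˡ (*0 _)) (*0 _)))
  star (suc c) e λ' c<n λ<B with get λ' last N.≟ 0
  ... | yes zλ = Step.step c e c<n λ' λ<B zλ (\ τ τ<B -> star c (suc e) τ (NP.<⇒≤ c<n) τ<B)
  ... | no nz = tr (SS-zero _ (\ κ _ -> each κ)) (sym (kill2 (Ψ-rows (suc c) λ' last low nz)))
   where
   low : suc c N.≤ toℕ last
   low = ≤-trans c<n (≤-reflexive (E.sym (FinP.toℕ-fromℕ n0)))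
   each : ∀ κ -> pow (pow s e) (sum κ) * (T̃ κ λ' * (Ṽ κ * Ψ (suc c) κ)) ≈ 0#
   each κ with ⊆? λ' κ
   ... | no nh = kill1 (T̃-⊈ κ λ' nh)
   ... | yes h = kill2 (tr (*ˡ (Ψ-rows (suc c) κ last low (\ e -> nz (NP.n≤0⇒n≡0 (≤-trans (h last) (≤-reflexive e)))))) (*0 _))
  -- The whole word read from one end: r raising steps towards the main diagonal, followed by the c
  -- lowering steps of `Ψ`.
  Θ : ℕ -> ℕ -> Vec ℕ n -> Car
  Θ zero c λ' = Ψ c λ'
  Θ (suc r) c λ' = pow s (sum λ') * SS (\ κ -> T̃ κ λ' * (Ṽ κ * Θ r c κ))
  Y : ℕ -> ℕ -> Car
  Y zero c = 1#
  Y (suc r) c = Y r c * X c r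
  Θ-value : ∀ r c λ' -> c N.≤ n0 -> sum λ' N.< B -> Θ r c λ' ≈ Y r c * (pow (pow s r) (sum λ') * Ψ c λ')
  Θ-value zero c λ' _ _ = sym (tr (il _) (tr (*ʳ (one (sum λ'))) (il _)))
   where
   one : ∀ k -> pow 1# k ≈ 1#
   one zero = refl
   one (suc k) = tr (il _) (one k)
  Θ-value (suc r) c λ' c≤n λ<B = begin pow s (sum λ') * SS (\ κ -> T̃ κ λ' * (Ṽ κ * Θ r c κ)) ≈⟨ *ˡ (SS-cong∈ (\ κ κ<B -> tr (*ˡ (*ˡ (Θ-value r c κ c≤n κ<B))) (solve 5 (\ t v y p w -> t :* (v :* (y :* (p :* w))) := y :* (p :* (t :* (v :* w)))) refl (T̃ κ λ') (Ṽ κ) (Y r c) (pow (pow s r) (sum κ)) (Ψ c κ)))) ⟩ pow s (sum λ') * SS (\ κ -> Y r c * (pow (pow s r) (sum κ) * (T̃ κ λ' * (Ṽ κ * Ψ c κ)))) ≈⟨ *ˡ (tr (sym (SS-*ˡ _ _)) (*ˡ (star c r λ' c≤n λ<B))) ⟩ pow s (sum λ') * (Y r c * (X c r * (pow (pow s r) (sum λ') * Ψ c λ'))) ≈⟨ solve 5 (\ a y x b p -> a :* (y :* (x :* (b :* p))) := (y :* x) :* ((a :* b) :* p)) refl (pow s (sum λ')) (Y r c) (X c r) (pow (pow s r) (sum λ')) (Ψ c λ') ⟩ (Y r c * X c r) * ((pow s (sum λ') * pow (pow s r) (sum λ')) * Ψ c λ') ≈⟨ *ˡ (*ʳ (pow-*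 s (pow s r) (sum λ'))) ⟨ Y (suc r) c * (pow (pow s (suc r)) (sum λ') * Ψ c λ') ∎
  Ψ-𝟎 : ∀ c -> 0 N.< B -> Ψ c 𝟎 ≈ 1#
  Ψ-𝟎 zero _ = only-yes (𝟎 ≟𝟎) 1# E.refl
  Ψ-𝟎 (suc c) 0<B = tr (*~ (rf (cong (pow s) sum-𝟎)) (SS-single 𝟎 _ (subst (N._< B) (E.sym sum-𝟎) 0<B) (\ κ ne -> tr (*ʳ (T̃-𝟎-off κ ne)) (0* _)))) (tr (il _) (tr (*~ T̃-𝟎 (tr (*~ Ṽ-𝟎 (Ψ-𝟎 c 0<B)) (il _))) (il _)))
  -- For a box of r rows and c columns a code has r + c vectors, the diagonals starting in rows r -
  -- 1 down to 0 and then those starting in columns 1 to c. The empty diagonal of row r is the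
  -- argument `𝟎` of `up`.
  Code : ℕ -> Set
  Code = Vec (Vec ℕ n)
  Sum : ∀ m -> (Code m -> Car) -> Car
  Sum zero h = h []
  Sum (suc m) h = SS (\ κ -> Sum m (\ v -> h (κ ∷ v)))
  Sum-*ˡ : ∀ m x h -> x * Sum m h ≈ Sum m (\ v -> x * h v)
  Sum-*ˡ zero x h = refl
  Sum-*ˡ (suc m) x h = tr (SS-*ˡ x _) (SS-cong (\ κ -> Sum-*ˡ m x _))
  down : ∀ c -> Vec ℕ n -> Code c -> Car
  down zero λ' [] = only (λ' ≟𝟎) 1#
  down (suc c) λ' (μ ∷ v) = pow s (sum λ') * (T̃ λ' μ * (Ṽ μ * down c μ v))
  up : ∀ r c -> Vec ℕ n -> Code (r N.+ c) -> Car
  up zero c λ' v = down c λ' v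
  up (suc r) c λ' (κ ∷ v) = pow s (sum λ') * (T̃ κ λ' * (Ṽ κ * up r c κ v))
  pull : ∀ m a t w h -> a * (t * (w * Sum m h)) ≈ Sum m (\ v -> a * (t * (w * h v)))
  pull m a t w h = tr (*ˡ (*ˡ (Sum-*ˡ m w h))) (tr (*ˡ (Sum-*ˡ m t _)) (Sum-*ˡ m a _))
  Sum-cong : ∀ m {h k : Code m -> Car} -> (∀ v -> h v ≈ k v) -> Sum m h ≈ Sum m k
  Sum-cong zero e = e []
  Sum-cong (suc m) e = SS-cong (\ κ -> Sum-cong m (\ v -> e (κ ∷ v)))
  Ψ-codes : ∀ c λ' -> Ψ c λ' ≈ Sum c (down c λ')
  Ψ-codes zero λ' = refl
  Ψ-codes (suc c) λ' = tr (SS-*ˡ _ _) (SS-cong (\ μ -> tr (*ˡ (*ˡ (*ˡ (Ψ-codes c μ)))) (pull c _ _ _ _)))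
  Θ-codes : ∀ r c λ' -> Θ r c λ' ≈ Sum (r N.+ c) (up r c λ')
  Θ-codes zero c λ' = Ψ-codes c λ'
  Θ-codes (suc r) c λ' = tr (SS-*ˡ _ _) (SS-cong (\ κ -> tr (*ˡ (*ˡ (*ˡ (Θ-codes r c κ)))) (pull (r N.+ c) _ _ _ _)))
  partition-function : ∀ r c -> c N.≤ n0 -> 0 N.< B -> Sum (r N.+ c) (up r c 𝟎) ≈ Y r c
  partition-function r c c≤n 0<B = tr (sym (Θ-codes r c 𝟎)) (tr (Θ-value r c 𝟎 c≤n (subst (N._< B) (E.sym sum-𝟎) 0<B)) (tr (*ˡ (tr (*~ (rf (cong (pow (pow s r)) sum-𝟎)) (Ψ-𝟎 c 0<B)) (il _))) (*1 _)))

-- Truncated power series, infinite products, and the q-binomial theorem.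

module Trunc where
 open import Defs hiding (pow)
 import Defs
 open Kit
 open Spec
 open Star using (module PowKit)
 open Inst
 open import Data.Integer using (0ℤ)
 module ProdKit (C : CRing) where
  open RingKit C
  open PickKit C using (pow)
  prodR : ℕ -> (ℕ -> Car) -> Car
  prodR zero F = 1#
  prodR (suc n) F = prodR n F * F n
  prodR-cong< : ∀ n {F G : ℕ -> Car} -> (∀ i -> i N.< n -> F i ≈ G i) -> prodR n F ≈ prodR n G
  prodR-cong< zero e = refl
  prodR-cong< (suc n) e = *~ (prodR-cong< n (\ i i<n -> e i (NP.m<n⇒m<1+n i<n))) (e n ≤-refl)
  prodR-cong : ∀ n {F G : ℕ -> Car} -> (∀ i -> F i ≈ G i) -> prodR n F ≈ prodR n G
  prodR-cong n e = prodR-cong< n (\ i _ -> e i)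
  prodR-* : ∀ n F G -> prodR n (\ i -> F i * G i) ≈ prodR n F * prodR n G
  prodR-* zero F G = sym (il _)
  prodR-* (suc n) F G = tr (*ʳ (prodR-* n F G)) (solve 4 (\ a b c d -> (a :* b) :* (c :* d) := (a :* c) :* (b :* d)) refl _ _ _ _)
  prodR-one : ∀ n {F : ℕ -> Car} -> (∀ i -> i N.< n -> F i ≈ 1#) -> prodR n F ≈ 1#
  prodR-one zero e = refl
  prodR-one (suc n) e = tr (*~ (prodR-one n (\ i i<n -> e i (NP.m<n⇒m<1+n i<n))) (e n ≤-refl)) (il _)
  prodR-head : ∀ n F -> prodR (suc n) F ≈ F 0 * prodR n (F ∘ suc)
  prodR-head zero F = *c _ _
  prodR-head (suc n) F = tr (*ʳ (prodR-head n F)) (*a _ _ _)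
  prodR-split : ∀ a b F -> prodR (a N.+ b) F ≈ prodR a F * prodR b (\ k -> F (a N.+ k))
  prodR-split a zero F = tr (rf (cong (\ k -> prodR k F) (NP.+-identityʳ a))) (sym (*1 _))
  prodR-split a (suc b) F = tr (rf (cong (\ k -> prodR k F) (NP.+-suc a b))) (tr (*ʳ (prodR-split a b F)) (*a _ _ _))
  prodR-extend : ∀ a b F -> a N.≤ b -> (∀ k -> a N.≤ k -> F k ≈ 1#) -> prodR b F ≈ prodR a F
  prodR-extend a b F a≤b e = tr (rf (cong (\ k -> prodR k F) (E.sym (NP.m+[n∸m]≡n a≤b)))) (tr (prodR-split a (b N.∸ a) F) (tr (*ˡ (prodR-one (b N.∸ a) (\ i _ -> e (a N.+ i) (NP.m≤m+n a i)))) (*1 _)))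
  prodR-agree : ∀ a b F -> (∀ k -> a N.≤ k -> F k ≈ 1#) -> (∀ k -> b N.≤ k -> F k ≈ 1#) -> prodR a F ≈ prodR b F
  prodR-agree a b F ea eb with NP.≤-total a b
  ... | inj₁ a≤b = sym (prodR-extend a b F a≤b ea)
  ... | inj₂ b≤a = prodR-extend b a F b≤a eb
  prodR-swap : ∀ m n (F : ℕ -> ℕ -> Car) -> prodR m (\ i -> prodR n (F i)) ≈ prodR n (\ j -> prodR m (\ i -> F i j))
  prodR-swap zero n F = sym (prodR-one n (\ _ _ -> refl))
  prodR-swap (suc m) n F = tr (*ʳ (prodR-swap m n F)) (sym (prodR-* n _ _))
  square : ℕ -> (ℕ -> ℕ -> Car) -> Car
  square n a = prodR n (\ i -> prodR n (a i))
  -- The entries with smaller index i: the row from the diagonal to the right and the column below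
  -- the diagonal. In a pair weight they are the factors with i ≤ j and those with i > j.
  hook : ℕ -> (ℕ -> ℕ -> Car) -> ℕ -> Car
  hook n a i = prodR (n N.∸ i) (\ m -> a i (i N.+ m)) * prodR (n N.∸ suc i) (\ m -> a (i N.+ suc m) i)
  square-hooks : ∀ n a -> square n a ≈ prodR n (hook n a)
  square-hooks zero a = refl
  square-hooks (suc n) a = begin square (suc n) a ≈⟨ prodR-head n _ ⟩ prodR (suc n) (a 0) * prodR n (\ i -> prodR (suc n) (a (suc i))) ≈⟨ *ˡ (tr (prodR-cong n (\ i -> prodR-head n (a (suc i)))) (prodR-* n _ _)) ⟩ prodR (suc n) (a 0) * (prodR n (\ i -> a (suc i) 0) * square n (\ i j -> a (suc i) (suc j))) ≈⟨ *a _ _ _ ⟨ hook (suc n) a 0 * square n (\ i j -> a (suc i) (suc j)) ≈⟨ *ˡ (square-hooks n _) ⟩ hook (suc n) a 0 * prodR n (hook n (\ i j -> a (suc i) (suc j))) ≈⟨ prodR-head n _ ⟨ prodR (suc n) (hook (suc n) a) ∎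
  opaque
   unfolding Πs
   Πs-prodR : ∀ n (h : ℕ -> Car) -> Πs {n} (\ i -> h (toℕ i)) ≈ prodR n h
   Πs-prodR zero h = refl
   Πs-prodR (suc n) h = tr (*ˡ (Πs-prodR n (h ∘ suc))) (sym (prodR-head n h))
  prodR-pow : ∀ n s e -> prodR n (\ i -> pow s (e i)) ≈ pow s (sumℕ n e)
  prodR-pow zero s e = refl
  prodR-pow (suc n) s e = tr (*ʳ (prodR-pow n s e)) (sym (PowKit.pow-+ C s (sumℕ n e) (e n)))
 module QBinDef (C : CRing) (q t : RingKit.Car C) (g : ℕ -> RingKit.Car C) (g-0 : RingKit._≈_ C (g 0) (RingKit.1# C)) (g-suc : ∀ j -> RingKit._≈_ C (RingKit._*_ C (g (suc j)) (RingKit._+_ C (RingKit.1# C) (RingKit.-_ C (PickKit.pow C q (suc j))))) (RingKit._*_ C (g j) (RingKit._+_ C (RingKit.1# C) (RingKit.-_ C (RingKit._*_ C (PickKit.pow C q j) t))))) where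
  open RingKit C
  open PickKit C using (pow)
  open ProdKit C
  open PowKit C
  Gs : ℕ -> Car -> Car
  Gs B z = sumR B (\ j -> g j * pow z j)
  -- The functional equation with its boundary term g B (1 - q^B) z^B.
  functional : ∀ B z -> Gs B z * (1# + - z) + (g B * (1# + - pow q B)) * pow z B ≈ (1# + - (z * t)) * Gs B (q * z)
  functional zero z = solve 3 (\ z a b -> :0 :* (:1 :+ :- z) :+ (a :* (:1 :+ :- :1)) :* :1 := (:1 :+ :- b) :* :0) refl z (g 0) (z * t)
  functional (suc B) z = begin (Gs B z + g B * Z) * (1# + - z) + (g (suc B) * (1# + - pow q (suc B))) * (z * Z) ≈⟨ +ˡ (*ʳ (g-suc B)) ⟩ (Gs B z + g B * Z) * (1# + - z) + (g B * (1# + - (qB * t))) * (z * Z) ≈⟨ solve 6 (\ G g Z z q t -> (G :+ g :* Z) :* (:1 :+ :- z) :+ (g :* (:1 :+ :- (q :* t))) :* (z :* Z) := (G :* (:1 :+ :- z) :+ (g :* (:1 :+ :- q)) :* Z) :+ (:1 :+ :- (z :* t)) :* (g :* (q :* Z))) refl (Gs B z) (g B) Z z qB t ⟩ (Gs B z * (1# + - z) + (g B * (1# + - qB)) * Z) + (1# + - (z * t)) * (g B * (qB * Z)) ≈⟨ +~ (functional B z) (*ˡ (*ˡ (sym (pow-* q z B)))) ⟩ (1# + - (z * t)) * Gs B (q * z) + (1# + - (z * t)) * (g B * pow (q * z) B) ≈⟨ distribˡ _ _ _ ⟨ (1# + - (z * t)) * Gs (suc B) (q * z) ∎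
   where
   Z = pow z B
   qB = pow q B
  module _ (B : ℕ) (B≥1 : 1 N.≤ B) (M : ℕ) (q-nil : pow q M ≈ 0#) where
   Gs-cong : ∀ {z z'} -> z ≈ z' -> Gs B z ≈ Gs B z'
   Gs-cong {z} {z'} e = sumR-cong B (\ j -> *ˡ (pow-cong j))
    where
    pow-cong : ∀ j -> pow z j ≈ pow z' j
    pow-cong zero = refl
    pow-cong (suc j) = *~ e (pow-cong j)
   Gs-0 : ∀ z -> z ≈ 0# -> Gs B z ≈ 1#
   Gs-0 z e = tr (rf (cong (\ k -> Gs k z) (E.sym (NP.m+[n∸m]≡n B≥1)))) (tr (sumR-head (B N.∸ 1) _) (tr (+~ (tr (*1 _) g-0) (sumR-zero (B N.∸ 1) (\ j _ -> tr (*ˡ (tr (*ʳ e) (0* _))) (*0 _)))) (+0 _)))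
   module _ (z : Car) (z-nil : pow z B ≈ 0#) where
    -- `functional` at the points q^m z with m < N. The boundary term disappears each time because
    -- z^B = 0.
    iterate : ∀ N -> Gs B z * prodR N (\ m -> 1# + - (pow q m * z)) ≈ prodR N (\ m -> 1# + - ((pow q m * z) * t)) * Gs B (pow q N * z)
    iterate zero = tr (*1 _) (tr (Gs-cong (sym (il z))) (sym (il _)))
    iterate (suc N) = begin Gs B z * (prodR N _ * (1# + - y)) ≈⟨ *a _ _ _ ⟨ (Gs B z * prodR N _) * (1# + - y) ≈⟨ *ʳ (iterate N) ⟩ (prodR N _ * Gs B y) * (1# + - y) ≈⟨ *a _ _ _ ⟩ prodR N _ * (Gs B y * (1# + - y)) ≈⟨ *ˡ (tr (sym (+0 _)) (tr (+ˡ (sym boundary)) (functional B y))) ⟩ prodR N _ * ((1# + - (y * t)) * Gs B (q * y)) ≈⟨ *a _ _ _ ⟨ prodR (suc N) (\ m -> 1# + - ((pow q m * z) * t)) * Gs B (q * y) ≈⟨ *ˡ (Gs-cong (sym (*a _ _ _))) ⟩ prodR (suc N) (\ m -> 1# + - ((pow q m * z) * t)) * Gs B (pow q (suc N) * z) ∎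
     where
     y : Car
     y = pow q N * z
     boundary : (g B * (1# + - pow q B)) * pow y B ≈ 0#
     boundary = tr (*ˡ (tr (pow-* (pow q N) z B) (tr (*ˡ z-nil) (*0 _)))) (*0 _)
    -- Cauchy's q-binomial theorem. The iteration ends after M steps, where q^M = 0 reduces the
    -- series at q^M z to its constant term 1.
    q-binomial : (I : ℕ -> Car) -> (∀ m -> (1# + - (pow q m * z)) * I m ≈ 1#) -> Gs B z ≈ prodR M (\ m -> 1# + - ((pow q m * z) * t)) * prodR M I
    q-binomial I inv = begin Gs B z ≈⟨ *1 _ ⟨ Gs B z * 1# ≈⟨ *ˡ (tr (sym (prodR-* M _ _)) (prodR-one M (\ m _ -> inv m))) ⟨ Gs B z * (prodR M (\ m -> 1# + - (pow q m * z)) * prodR M I) ≈⟨ *a _ _ _ ⟨ (Gs B z * prodR M (\ m -> 1# + - (pow q m * z))) * prodR M I ≈⟨ *ʳ (tr (iterate M) (tr (*ˡ (Gs-0 _ (tr (*ʳ q-nil) (0* _)))) (*1 _))) ⟩ prodR M (\ m -> 1# + - ((pow q m * z) * t)) * prodR M I ∎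
 module TruncDef (B M : ℕ) where
  infix 4 _≈t_
  -- Congruence modulo s^B and q^M. In the quotient both s and q are nilpotent, so the kernel series
  -- and the infinite products become finite, while the coefficients in the chosen range are
  -- retained.
  record _≈t_ (X Y : P.Car) : Set where
   constructor agree
   field at : ∀ x y z -> x N.< B -> y N.< M -> coeff X x y z ≡ coeff Y x y z
  open _≈t_ public
  lift : ∀ {X Y} -> X P.≈ Y -> X ≈t Y
  lift e = agree (\ x y z _ _ -> ≈-elim e x y z)
  Trunc : CRing
  Trunc = record { Carrier = P.Car ; _≈_ = _≈t_ ; _+_ = P._+_ ; _*_ = P._*_ ; -_ = P.-_ ; 0# = P.0# ; 1# = P.1# ; isCommutativeRing = record { isRing = record { +-isAbelianGroup = record { isGroup = record { isMonoid = record { isSemigroup = record { isMagma = record { isEquivalence = record { refl = agree (\ _ _ _ _ _ -> E.refl) ; sym = \ { (agree e) -> agree (\ x y z hx hy -> E.sym (e x y z hx hy)) } ; trans = \ { (agree e) (agree e') -> agree (\ x y z hx hy -> e x y z hx hy >> e' x y z hx hy) } } ; ∙-cong = \ { (agree e) (agree e') -> agree (\ x y z hx hy -> coeff-+ _ _ x y z >> cong₂ Z._+_ (e x y z hx hy) (e' x y z hx hy) >> E.sym (coeff-+ _ _ x y z)) } } ; assoc = \ x y z -> lift (P.+a x y z) } ; identity = (\ x -> lift (P.0+ x)) , (\ x -> lift (P.+0 x)) } ; inverse = (\ x -> lift (P.-‿inverseˡ x)) , (\ x -> lift (P.-‿inverseʳ x)) ; ⁻¹-cong = \ { (agree e) ->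 agree (\ x y z hx hy -> coeff-neg _ x y z >> cong Z.-_ (e x y z hx hy) >> E.sym (coeff-neg _ x y z)) } } ; comm = \ x y -> lift (P.+c x y) } ; *-cong = \ { {X} {X'} {Y} {Y'} (agree e) (agree e') -> agree (\ x y z hx hy -> *-local X X' Y Y' x y z (\ i j k hi hj _ -> e i j k (NP.≤-<-trans hi hx) (NP.≤-<-trans hj hy)) (\ i j k hi hj _ -> e' i j k (NP.≤-<-trans hi hx) (NP.≤-<-trans hj hy))) } ; *-assoc = \ x y z -> lift (P.*a x y z) ; *-identity = (\ x -> lift (P.il x)) , (\ x -> lift (P.*1 x)) ; distrib = (\ x y z -> lift (P.distribˡ x y z)) , (\ x y z -> lift (P.distribʳ x y z)) } ; *-comm = \ x y -> lift (P.*c x y) } }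
  reduce : Hom PSR Trunc
  reduce = record { ev = \ X -> X ; ev-cong = lift ; ev-+ = \ _ _ -> lift P.refl ; ev-* = \ _ _ -> lift P.refl ; ev-1 = lift P.refl }
  mon-nil : ∀ a b c -> (B N.≤ a -> mon a b c ≈t P.0#) × (M N.≤ b -> mon a b c ≈t P.0#)
  mon-nil a b c = (\ B≤a -> agree (\ x y z x<B _ -> kill x y z (\ { (E.refl , _ , _) -> NP.<⇒≱ x<B B≤a }))) , (\ M≤b -> agree (\ x y z _ y<M -> kill x y z (\ { (_ , E.refl , _) -> NP.<⇒≱ y<M M≤b })))
   where
   kill : ∀ x y z -> ¬ (a ≡ x × b ≡ y × c ≡ z) -> coeff (mon a b c) x y z ≡ coeff P.0# x y z
   kill x y z ne = coeff-el (mono a b c) x y z >> mono-off a b c x y z ne >> E.sym (coeff-0 x y z)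
 ŝ q̂ t̂ : P.Car
 ŝ = mon 1 0 0
 q̂ = mon 0 1 0
 t̂ = mon 0 0 1
 ŝ-pow : ∀ k -> PK.pow ŝ k P.≈ mon k 0 0
 ŝ-pow k = P.tr (mon-pow 1 0 0 k) (mon-cong {1 N.* k} {0 N.* k} {0 N.* k} {k} {0} {0} (NP.*-identityˡ k) E.refl E.refl)
 q̂-pow : ∀ k -> PK.pow q̂ k P.≈ mon 0 k 0
 q̂-pow k = P.tr (mon-pow 0 1 0 k) (mon-cong {0 N.* k} {1 N.* k} {0 N.* k} {0} {k} {0} E.refl (NP.*-identityˡ k) E.refl)
 module PP̂ = ProdKit PSR
 el-prodTo : ∀ n F -> el (prodTo n F) P.≈ PP̂.prodR n (\ i -> el (F i))
 el-prodTo zero F = el-𝟙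
 el-prodTo (suc n) F = P.tr (el-⊗ _ _) (P.*ʳ (el-prodTo n F))
 -- `infProd` cuts the product at a length that varies with the coefficient. If the factors from
 -- `bound x y` on are 1 modulo s^(x+1) and q^(y+1), all later cuts have the same coefficients
 -- there, and one length N serves the whole range.
 infProd-trunc : ∀ F (bound : ℕ -> ℕ -> ℕ) B M N -> (∀ x y z -> bound x y N.≤ suc (x N.+ y N.+ z)) -> (∀ x y -> x N.< B -> y N.< M -> bound x y N.≤ N) -> (∀ x y n -> bound x y N.≤ n -> TruncDef._≈t_ (suc x) (suc y) (el (F n)) P.1#) -> TruncDef._≈t_ B M (el (infProd F)) (PP̂.prodR N (\ i -> el (F i)))
 infProd-trunc F bound B M N h1 h2 h = TruncDef.agree (\ x y z x<B y<M -> coeff-el (infProd F) x y z >> E.sym (coeff-el (prodTo (suc (x N.+ y N.+ z)) F) x y z) >> TruncDef.at (finite x y z x<B y<M) x y z ≤-refl ≤-refl)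
  where
  same : ∀ x y n -> TruncDef._≈t_ (suc x) (suc y) (PP̂.prodR n (\ i -> el (F i))) (ProdKit.prodR (TruncDef.Trunc (suc x) (suc y)) n (\ i -> el (F i)))
  same x y zero = TruncDef.lift (suc x) (suc y) P.refl
  same x y (suc n) = RingKit.*ʳ (TruncDef.Trunc (suc x) (suc y)) (same x y n)
  finite : ∀ x y z -> x N.< B -> y N.< M -> TruncDef._≈t_ (suc x) (suc y) (el (prodTo (suc (x N.+ y N.+ z)) F)) (PP̂.prodR N (\ i -> el (F i)))
  finite x y z x<B y<M = T.tr (TruncDef.lift (suc x) (suc y) (el-prodTo (suc (x N.+ y N.+ z)) F)) (T.tr (same x y (suc (x N.+ y N.+ z))) (T.tr (TP.prodR-extend (bound x y) (suc (x N.+ y N.+ z)) (\ i -> el (F i)) (h1 x y z) (h x y)) (T.tr (T.sym (TP.prodR-extend (bound x y) N (\ i -> el (F i)) (h2 x y x<B y<M) (h x y))) (T.sym (same x y N)))))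
   where
   module T = RingKit (TruncDef.Trunc (suc x) (suc y))
   module TP = ProdKit (TruncDef.Trunc (suc x) (suc y))
 module RatioDef (B M : ℕ) (B≥1 : 1 N.≤ B) where
  open TruncDef B M public
  private
   module T = RingKit Trunc
   module TP = ProdKit Trunc
   module TK = PickKit Trunc
   module TW = PowKit Trunc
  prod-same : ∀ n F -> PP̂.prodR n F ≈t TP.prodR n F
  prod-same zero F = T.refl
  prod-same (suc n) F = T.*ʳ (prod-same n F)
  el-prodT : ∀ n F -> el (prodTo n F) ≈t TP.prodR n (\ i -> el (F i))
  el-prodT n F = T.tr (lift (el-prodTo n F)) (prod-same n _)
  pow-same : ∀ X n -> PK.pow X n ≡ TK.pow X n
  pow-same X zero = E.refl
  pow-same X (suc n) = cong (X P.*_) (pow-same X n)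
  s-nil : TK.pow ŝ B ≈t P.0#
  s-nil = T.tr (T.rf (E.sym (pow-same ŝ B))) (T.tr (lift (ŝ-pow B)) (proj₁ (mon-nil B 0 0) ≤-refl))
  q-nil : TK.pow q̂ M ≈t P.0#
  q-nil = T.tr (T.rf (E.sym (pow-same q̂ M))) (T.tr (lift (q̂-pow M)) (proj₂ (mon-nil 0 M 0) ≤-refl))
  mon-split : ∀ k m -> mon k m 0 ≈t TK.pow q̂ m P.* TK.pow ŝ k
  mon-split k m = lift (P.sym (P.tr (P.*~ (P.tr (P.rf (E.sym (pow-same q̂ m))) (q̂-pow m)) (P.tr (P.rf (E.sym (pow-same ŝ k))) (ŝ-pow k))) (P.tr (mono-* 0 m 0 k 0 0) (mon-cong {k} {m N.+ 0} {0} {k} {m} {0} E.refl (NP.+-identityʳ m) E.refl))))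
  mon-splitₜ : ∀ k m -> mon k m 1 ≈t (TK.pow q̂ m P.* TK.pow ŝ k) P.* t̂
  mon-splitₜ k m = T.tr (lift (P.sym (P.tr (mono-* k m 0 0 0 1) (mon-cong {k N.+ 0} {m N.+ 0} {1} {k} {m} {1} (NP.+-identityʳ k) (NP.+-identityʳ m) E.refl)))) (T.*ʳ (mon-split k m))
  gT : ℕ -> P.Car
  gT j = f̂ j 0
  gT-0 : gT 0 ≈t P.1#
  gT-0 = lift el-𝟙
  gT-suc : ∀ j -> gT (suc j) P.* (P.1# P.+ P.- TK.pow q̂ (suc j)) ≈t gT j P.* (P.1# P.+ P.- (TK.pow q̂ j P.* t̂))
  gT-suc j = T.tr (T.*ˡ (T.+ˡ (T.-~ (T.tr (T.rf (E.sym (pow-same q̂ (suc j)))) (lift (q̂-pow (suc j))))))) (T.tr (lift (f-step j 0)) (T.*ˡ (T.+ˡ (T.-~ (T.tr (lift (P.sym (P.tr (mono-* 0 j 0 0 0 1) (mon-cong {0} {j N.+ 0} {1} {0} {j} {1} E.refl (NP.+-identityʳ j) E.refl)))) (T.*ʳ (T.tr (lift (P.sym (q̂-pow j))) (T.rf (pow-same q̂ j)))))))))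
  open QBinDef Trunc q̂ t̂ gT gT-0 gT-suc using (Gs; Gs-0; q-binomial) public
  oneMinus-one : ∀ a b c -> mon a b c ≈t P.0# -> el (oneMinus a b c) ≈t P.1#
  oneMinus-one a b c e = T.tr (lift (el-oneMinus a b c)) (T.tr (T.+ˡ (T.tr (T.-~ e) T.-0#≈0#)) (T.+0 _))
  geo-one : ∀ a b c -> 1 N.≤ a N.+ b N.+ c -> mon a b c ≈t P.0# -> el (geo a b c) ≈t P.1#
  geo-one a b c pos e = T.tr (T.sym (T.il _)) (T.tr (T.*ʳ (T.sym (oneMinus-one a b c e))) (lift (geo-inverse a b c pos)))
 poch-trunc : ∀ B M k -> TruncDef._≈t_ B M (el (pochT k)) (PP̂.prodR M (\ n -> el (oneMinus k n 1)))
 poch-trunc B M k = infProd-trunc _ (\ _ y -> suc y) B M M (\ x y z -> N.s≤s (≤-trans (NP.m≤n+m y x) (NP.m≤m+n (x N.+ y) z))) (\ _ _ _ y<M -> y<M) (\ x y n y<n -> RatioDef.oneMinus-one (suc x) (suc y) (N.s≤s N.z≤n) k n 1 (proj₂ (TruncDef.mon-nil (suc x) (suc y) k n 1) y<n))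
 invPoch-trunc : ∀ B M k -> 1 N.≤ k -> TruncDef._≈t_ B M (el (invPoch k)) (PP̂.prodR M (\ n -> el (geo k n 0)))
 invPoch-trunc B M k k≥1 = infProd-trunc _ (\ _ y -> suc y) B M M (\ x y z -> N.s≤s (≤-trans (NP.m≤n+m y x) (NP.m≤m+n (x N.+ y) z))) (\ _ _ _ y<M -> y<M) (\ x y n y<n -> RatioDef.geo-one (suc x) (suc y) (N.s≤s N.z≤n) k n 0 (≤-trans k≥1 (≤-trans (NP.m≤m+n k n) (NP.m≤m+n (k N.+ n) 0))) (proj₂ (TruncDef.mon-nil (suc x) (suc y) k n 0) y<n))
 module RatioT (B M : ℕ) (B≥1 : 1 N.≤ B) where
  open RatioDef B M B≥1 public
  private
   module T = RingKit Trunc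
   module TP = ProdKit Trunc
   module TK = PickKit Trunc
   module TW = PowKit Trunc
  ratio-Gs : ∀ k -> el (ratio (suc k)) ≈t Gs B (TK.pow ŝ (suc k))
  ratio-Gs k = T.tr (lift (el-⊗ _ _)) (T.tr (T.*~ (T.tr (poch-trunc B M (suc k)) (T.tr (prod-same M _) (TP.prodR-cong M (\ m -> T.tr (lift (el-oneMinus (suc k) m 1)) (T.+ˡ (T.-~ (mon-splitₜ (suc k) m))))))) (T.tr (invPoch-trunc B M (suc k) (N.s≤s N.z≤n)) (prod-same M _))) (T.sym (q-binomial B B≥1 M q-nil (TK.pow ŝ (suc k)) (TW.pow-nil* ŝ (TK.pow ŝ k) B s-nil B ≤-refl) (\ m -> el (geo (suc k) m 0)) (\ m -> T.tr (T.*ʳ (T.tr (T.+ˡ (T.-~ (T.sym (mon-split (suc k) m)))) (lift (P.sym (el-oneMinus (suc k) m 0))))) (lift (geo-inverse (suc k) m 0 (N.s≤s N.z≤n)))))))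
  ratio-one : ∀ k -> B N.≤ k -> el (ratio k) ≈t P.1#
  ratio-one zero B≤0 = absurd (NP.<⇒≱ B≥1 B≤0)
  ratio-one (suc k) B≤k = T.tr (ratio-Gs k) (Gs-0 B B≥1 M q-nil _ (TW.pow-nil ŝ B s-nil (suc k) B≤k))
  pow-el : ∀ A n -> el (Defs.pow A n) ≈t TP.prodR n (\ _ -> el A)
  pow-el A zero = lift el-𝟙
  pow-el A (suc n) = T.tr (lift (el-⊗ _ _)) (T.*ʳ (pow-el A n))
 rhsAll-trunc : ∀ B M -> TruncDef._≈t_ B M (el rhsAll) (PP̂.prodR B (\ m -> el (Defs.pow (ratio (suc m)) (suc m))))
 rhsAll-trunc B M = infProd-trunc _ (\ x _ -> suc x) B M B (\ x y z -> N.s≤s (≤-trans (NP.m≤m+n x y) (NP.m≤m+n (x N.+ y) z))) (\ _ _ x<B _ -> x<B) (\ x y n x<n -> RingKit.tr (TruncDef.Trunc (suc x) (suc y)) (RatioT.pow-el (suc x) (suc y) (N.s≤s N.z≤n) (ratio (suc n)) (suc n)) (ProdKit.prodR-one (TruncDef.Trunc (suc x) (suc y)) (suc n) (\ _ _ -> RatioT.ratio-one (suc x) (suc y) (N.s≤s N.z≤n) (suc n) (NP.m≤n⇒m≤1+n x<n))))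
 module _ (B M : ℕ) (B≥1 : 1 N.≤ B) where
  open RatioT B M B≥1
  private
   module T = RingKit Trunc
   module TP = ProdKit Trunc
  -- The factors are grouped by m = i + j. For m < B there are m + 1 of them, and for m ≥ B they are
  -- 1 modulo s^B. Padding row i by 1 to the columns m of `pick` makes the two products
  -- interchangeable.
  rhsBox-rhsAll : el (rhsBox B B) ≈t el rhsAll
  rhsBox-rhsAll = T.tr (el-prodT B _) (T.tr (TP.prodR-cong B (\ i -> T.tr (el-prodT B _) (TP.prodR-cong B (\ j -> T.rf (cong (\ k -> el (ratio k)) (NP.+-comm (i N.+ j) 1)))))) (T.tr (TP.prodR-cong< B (\ i i<B -> row i i<B)) (T.tr (TP.prodR-swap B B _) (T.tr (TP.prodR-cong< B (\ m m<B -> column m m<B)) (T.sym (T.tr (rhsAll-trunc B M) (T.tr (prod-same B _) (TP.prodR-cong B (\ m -> pow-el _ (suc m))))))))))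
   where
   ρ : ℕ -> P.Car
   ρ m = el (ratio (suc m))
   pick : ℕ -> ℕ -> P.Car
   pick i m with i N.≤? m
   ... | yes _ = ρ m
   ... | no _ = P.1#
   pick-yes : ∀ i m -> i N.≤ m -> pick i m ≈t ρ m
   pick-yes i m h with i N.≤? m
   ... | yes _ = T.refl
   ... | no nh = absurd (nh h)
   pick-no : ∀ i m -> m N.< i -> pick i m ≈t P.1#
   pick-no i m h with i N.≤? m
   ... | yes le = absurd (NP.<⇒≱ h le)
   ... | no _ = T.refl
   row : ∀ i -> i N.< B -> TP.prodR B (\ j -> ρ (i N.+ j)) ≈t TP.prodR B (pick i)
   row i i<B = T.tr (T.sym (TP.prodR-cong B (\ j -> pick-yes i (i N.+ j) (NP.m≤m+n i j)))) (T.tr (TP.prodR-extend (B N.∸ i) B _ (NP.m∸n≤m B i) (\ k h -> T.tr (pick-yes i (i N.+ k) (NP.m≤m+n i k)) (ratio-one _ (NP.m≤n⇒m≤1+n (≤-trans (≤-reflexive (E.sym (NP.m+[n∸m]≡n (NP.<⇒≤ i<B)))) (NP.+-monoʳ-≤ i h)))))) (T.sym (T.tr (T.rf (cong (\ k -> TP.prodR k (pick i)) (E.sym (NP.m+[n∸m]≡n (NP.<⇒≤ i<B))))) (T.tr (TP.prodR-split i (B N.∸ i) (pick i)) (T.tr (T.*ʳ (TP.prodR-one i (\ m m<i -> pick-no i m m<i))) (T.il _))))))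
   column : ∀ m -> m N.< B -> TP.prodR B (\ i -> pick i m) ≈t TP.prodR (suc m) (\ _ -> ρ m)
   column m m<B = T.tr (TP.prodR-extend (suc m) B _ m<B (\ k h -> pick-no k m h)) (TP.prodR-cong< (suc m) (\ { i (N.s≤s i≤m) -> pick-yes i m i≤m }))

-- The weights along the diagonals of a plane partition multiply to F.

module Boxes where
 open import Defs hiding (pow)
 open Kit
 open Comp
 open Core using (module GridKit)
 open Spec
 open Model renaming (lt to ahead; gt to behind; eq to level)
 open SpecT
 open Limit
 open Assembly
 open Star
 open Inst
 open Trunc
 open import Data.Nat.Solver using (module +-*-Solver)
 open import Data.Fin using (fromℕ)
 open import Data.Vec using (sum; replicate; tabulate)
 dd-upper : ∀ i m -> dd (ordℕ i (i N.+ m)) ≡ m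
 dd-upper zero zero = E.refl
 dd-upper zero (suc m) = E.refl
 dd-upper (suc i) m = dd-upper i m
 dd-lower : ∀ i m -> dd (ordℕ (i N.+ suc m) i) ≡ m
 dd-lower zero m = E.refl
 dd-lower (suc i) m = dd-lower i m
 ∣-∣-∸ : ∀ a b -> b N.≤ a -> ∣ + a Z.- + b ∣ ≡ a N.∸ b
 ∣-∣-∸ a b h = cong ∣_∣ (ZP.m-n≡m⊖n a b >> ZP.⊖-≥ h) >> E.refl
 ∣-∣-∸′ : ∀ a b -> a N.≤ b -> ∣ + a Z.- + b ∣ ≡ b N.∸ a
 ∣-∣-∸′ a b h = ZP.∣i-j∣≡∣j-i∣ (+ a) (+ b) >> ∣-∣-∸ b a h
 private
  module S = +-*-Solver
  e1 : ∀ i m a -> (i N.+ m) N.+ suc a ≡ suc (i N.+ a) N.+ m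
  e1 = S.solve 3 (\ i m a -> (i S.:+ m) S.:+ (S.con 1 S.:+ a) S.:= (S.con 1 S.:+ (i S.:+ a)) S.:+ m) E.refl
  e2 : ∀ i m a -> (i N.+ m) N.+ a ≡ (i N.+ a) N.+ m
  e2 = S.solve 3 (\ i m a -> (i S.:+ m) S.:+ a S.:= (i S.:+ a) S.:+ m) E.refl
  e3 : ∀ i m a -> (i N.+ suc m) N.+ a ≡ (i N.+ suc a) N.+ m
  e3 = S.solve 3 (\ i m a -> (i S.:+ (S.con 1 S.:+ m)) S.:+ a S.:= (i S.:+ (S.con 1 S.:+ a)) S.:+ m) E.refl
  e4 : ∀ i m a -> (i N.+ suc m) N.+ a ≡ suc (i N.+ a) N.+ m
  e4 = S.solve 3 (\ i m a -> (i S.:+ (S.con 1 S.:+ m)) S.:+ a S.:= (S.con 1 S.:+ (i S.:+ a)) S.:+ m) E.refl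
 module _ (π : PlanePartition) where
  arr-row : ∀ i j m -> arr π i (j N.+ m) N.≤ arr π i j
  arr-row i j zero = ≤-reflexive (cong (arr π i) (NP.+-identityʳ j))
  arr-row i j (suc m) = ≤-trans (≤-reflexive (cong (arr π i) (NP.+-suc j m))) (≤-trans (row-mono π i (j N.+ m)) (arr-row i j m))
  arr-col : ∀ i j m -> arr π (i N.+ m) j N.≤ arr π i j
  arr-col i j zero = ≤-reflexive (cong (\ k -> arr π k j) (NP.+-identityʳ i))
  arr-col i j (suc m) = ≤-trans (≤-reflexive (cong (\ k -> arr π k j) (NP.+-suc i m))) (≤-trans (col-mono π (i N.+ m) j) (arr-col i j m))
  arr-mono : ∀ i j a b -> arr π (i N.+ a) (j N.+ b) N.≤ arr π i j
  arr-mono i j a b = ≤-trans (arr-row (i N.+ a) j b) (arr-col i j a)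
  arr-anti : ∀ {i j i' j'} -> i N.≤ i' -> j N.≤ j' -> arr π i' j' N.≤ arr π i j
  arr-anti {i} {j} {i'} {j'} hi hj = ≤-trans (≤-reflexive (cong₂ (arr π) (E.sym (NP.m+[n∸m]≡n hi)) (E.sym (NP.m+[n∸m]≡n hj)))) (arr-mono i j (i' N.∸ i) (j' N.∸ j))
  diagonal : ℕ -> ℕ -> ℕ -> ℕ
  diagonal a b i = arr π (i N.+ a) (i N.+ b)
 module BoxesDef (B M n0 : ℕ) (B≥1 : 1 N.≤ B) where
  open RatioT B M B≥1 public
  H : Hom ground Trunc
  H = reduce ∘H toPS
  open StarDef setting eval n0 separated Trunc H ŝ B s-nil public
  open LimitDef setting eval n0 separated using (n; last; rowdd)
  open SpecTDef setting eval n using (TT; WW; TT-yes; diff)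
  open RingKit Trunc
  open PickKit Trunc using (pow)
  open ProdKit Trunc
  open PowKit Trunc
  open SumKit Trunc using (only-yes)
  open Hom H using (ev; ev-cong; ev-*; ev-Πs)
  private
   module R = RingKit ground
   module GR = GridKit ground
   module Ev0 = Eval eval
  tab : (ℕ -> ℕ) -> Vec ℕ n
  tab κ = tabulate (\ i -> κ (toℕ i))
  lookup-tab : ∀ κ i -> get (emb (tab κ)) i ≡ + κ (toℕ i)
  lookup-tab κ i = (VecP.lookup-map i +_ (tab κ)) >> (cong +_ (VecP.lookup∘tabulate (\ i -> κ (toℕ i)) i))
  module Interlacing (κ μ : ℕ -> ℕ) (hi : ∀ i m -> μ (i N.+ m) N.≤ κ i) (lo : ∀ i m -> κ (i N.+ suc m) N.≤ μ i) where
   inter : Inter (emb (tab κ)) (emb (tab μ))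
   inter i j = subst₂ (Ok (ord i j)) (E.sym (lookup-tab κ i)) (E.sym (lookup-tab μ j)) (go (ord i j) (ordView (toℕ i) (toℕ j)))
    where
    go : ∀ o -> OrdView (toℕ i) (toℕ j) o -> Ok o (+ κ (toℕ i)) (+ μ (toℕ j))
    go .(ahead d) (v-lt d e) = Z.+≤+ (subst (\ k -> μ k N.≤ κ (toℕ i)) (E.sym (e >> NP.+-comm (suc d) (toℕ i))) (hi (toℕ i) (suc d)))
    go .level (v-eq e) = Z.+≤+ (subst (\ k -> μ k N.≤ κ (toℕ i)) (NP.+-identityʳ (toℕ i) >> e) (hi (toℕ i) 0))
    go .(behind d) (v-gt d e) = Z.+≤+ (subst (\ k -> κ k N.≤ μ (toℕ j)) (E.sym (e >> NP.+-comm (suc d) (toℕ j))) (lo (toℕ j) d))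
   module Grid (h h' : ℕ -> ℕ -> R.Car) (A A' : ℕ -> ℕ -> Car) (hA : ∀ k d -> ev (h k d) ≈ A k d) (hA' : ∀ k d -> ev (h' k d) ≈ A' k d) (A-inv : ∀ k d -> A k d * A' k d ≈ 1#) (μ0 : μ n0 ≡ 0) where
    a : ℕ -> ℕ -> Car
    a i j = A ∣ + κ i Z.- + μ j ∣ (dd (ordℕ i j))
    a' : ℕ -> Car
    a' i = A' (κ i) (dd (ordℕ i n0))
    upperF lowerF : ℕ -> ℕ -> Car
    upperF i m = A (κ i N.∸ μ (i N.+ m)) m
    lowerF i m = A (μ i N.∸ κ (i N.+ suc m)) m
    a-upper : ∀ i m -> a i (i N.+ m) ≈ upperF i m
    a-upper i m = rf (cong₂ A (∣-∣-∸ (κ i) (μ (i N.+ m)) (hi i m)) (dd-upper i m))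
    a-lower : ∀ i m -> a (i N.+ suc m) i ≈ lowerF i m
    a-lower i m = rf (cong₂ A (∣-∣-∸′ (κ (i N.+ suc m)) (μ i) (lo i m)) (dd-lower i m))
    entries : ev (GR.grid (\ i j -> h ∣ diff (emb (tab κ)) (emb (tab μ)) i j ∣ (dd (ord i j))) R.* R.Πs (\ i -> h' ∣ get (emb (tab κ)) i ∣ (rowdd i))) ≈ square n a * prodR n a'
    entries = tr (ev-* _ _) (*~ (tr (ev-Πs _) (tr (Πs-cong (\ i -> tr (ev-Πs _) (tr (Πs-cong (\ j -> tr (hA _ _) (rf (cong₂ (\ x y -> A ∣ x Z.- y ∣ (dd (ord i j))) (lookup-tab κ i) (lookup-tab μ j))))) (Πs-prodR n (a (toℕ i)))))) (Πs-prodR n (\ i -> prodR n (a i))))) (tr (ev-Πs _) (tr (Πs-cong (\ i -> tr (hA' _ _) (rf (cong₂ (\ x y -> A' ∣ x ∣ (dd (ordℕ (toℕ i) y))) (lookup-tab κ i) (FinP.toℕ-fromℕ n0))))) (Πs-prodR n a'))))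
    -- As the last entry of μ is 0, the final factor of the row part is A (κ i) (n0 - i), which the
    -- correction `a' i` inverts.
    hooks : ∀ i -> i N.≤ n0 -> hook n a i * a' i ≈ prodR (n0 N.∸ i) (upperF i) * prodR (n0 N.∸ i) (lowerF i)
    hooks i i≤n = begin (prodR (suc n0 N.∸ i) (\ m -> a i (i N.+ m)) * prodR (n0 N.∸ i) (\ m -> a (i N.+ suc m) i)) * a' i ≈⟨ *~ (*~ (tr (rf (cong (\ k -> prodR k (\ m -> a i (i N.+ m))) (NP.+-∸-assoc 1 i≤n))) (prodR-cong (suc (n0 N.∸ i)) (a-upper i))) (prodR-cong (n0 N.∸ i) (a-lower i))) (rf (cong (A' (κ i)) (cong (\ k -> dd (ordℕ i k)) (E.sym i+) >> dd-upper i (n0 N.∸ i)))) ⟩ ((prodR (n0 N.∸ i) (upperF i) * upperF i (n0 N.∸ i)) * prodR (n0 N.∸ i) (lowerF i)) * A' (κ i) (n0 N.∸ i) ≈⟨ solve 4 (\ x y z w -> ((x :* y) :* z) :* w := (x :* z) :* (y :* w)) refl _ _ _ _ ⟩ (prodR (n0 N.∸ i) (upperF i) * prodR (n0 N.∸ i) (lowerF i)) * (upperF i (n0 N.∸ i) * A' (κ i) (n0 N.∸ i)) ≈⟨ *ˡ (tr (*ʳ (rf (cong (\ k -> A (κ i N.∸ k) (n0 N.∸ i)) (cong μ i+ >> μ0)))) (A-inv _ _)) ⟩ (prodR (n0 N.∸ i) (upperF i) * prodR (n0 N.∸ i) (lowerF i)) * 1# ≈⟨ *1 _ ⟩ prodR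 (n0 N.∸ i) (upperF i) * prodR (n0 N.∸ i) (lowerF i) ∎
     where
     i+ : i N.+ (n0 N.∸ i) ≡ n0
     i+ = NP.m+[n∸m]≡n i≤n
    grid-form : square n a * prodR n a' ≈ prodR n0 (\ i -> prodR (n0 N.∸ i) (upperF i)) * prodR n0 (\ i -> prodR (n0 N.∸ i) (lowerF i))
    grid-form = tr (*ʳ (square-hooks n a)) (tr (sym (prodR-* n _ _)) (tr (prodR-cong< n (\ { i (N.s≤s i≤n) -> hooks i i≤n })) (tr (*ˡ (tr (rf (cong (\ k -> prodR k (upperF n0) * prodR k (lowerF n0)) (NP.n∸n≡0 n0))) (*1 _))) (tr (*1 _) (prodR-* n0 _ _)))))
  private
   ev-f : ∀ k d -> ev (Ev0.fR k d) ≈ f̂ k d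
   ev-f k d = lift (to-f k d)
   ev-g : ∀ k d -> ev (Ev0.gR k d) ≈ f̂⁻ k d
   ev-g k d = lift (to-finv k d)
   ff : ∀ k d -> f̂ k d * f̂⁻ k d ≈ 1#
   ff k d = lift (f-finv k d)
   gf : ∀ k d -> f̂⁻ k d * f̂ k d ≈ 1#
   gf k d = tr (*c _ _) (ff k d)
  -- The first product consists of factors that F attaches to the boxes of the diagonal κ, the
  -- second of factors attached to those of μ.
  T̃-form : ∀ κ μ -> (∀ i m -> μ (i N.+ m) N.≤ κ i) -> (∀ i m -> κ (i N.+ suc m) N.≤ μ i) -> μ n0 ≡ 0 -> T̃ (tab κ) (tab μ) ≈ prodR n0 (\ i -> prodR (n0 N.∸ i) (\ m -> f̂ (κ i N.∸ μ (i N.+ m)) m)) * prodR n0 (\ i -> prodR (n0 N.∸ i) (\ m -> f̂ (μ i N.∸ κ (i N.+ suc m)) m))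
  T̃-form κ μ hi lo μ0 = tr (ev-cong (R.*ʳ (R.rf (TT-yes _ _ (Interlacing.inter κ μ hi lo))))) (tr G.entries G.grid-form)
   where
   module G = Interlacing.Grid κ μ hi lo Ev0.fR Ev0.gR f̂ f̂⁻ ev-f ev-g ff μ0
  Ṽ-form : ∀ κ -> (∀ i m -> κ (i N.+ m) N.≤ κ i) -> κ n0 ≡ 0 -> Ṽ (tab κ) ≈ prodR n0 (\ i -> prodR (n0 N.∸ i) (\ m -> f̂⁻ (κ i N.∸ κ (i N.+ m)) m)) * prodR n0 (\ i -> prodR (n0 N.∸ i) (\ m -> f̂⁻ (κ i N.∸ κ (i N.+ suc m)) m))
  Ṽ-form κ hi κ0 = tr G.entries G.grid-form
   where
   module G = Interlacing.Grid κ κ hi (\ i m -> hi i (suc m)) Ev0.gR Ev0.fR f̂⁻ f̂ ev-g ev-f gf κ0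
  sum-tab : ∀ κ -> κ n0 ≡ 0 -> pow ŝ (sum (tab κ)) ≈ prodR n0 (\ i -> pow ŝ (κ i))
  sum-tab κ κ0 = tr (go n κ) (tr (*ˡ (rf (cong (pow ŝ) κ0))) (*1 _))
   where
   go : ∀ m (κ : ℕ -> ℕ) -> pow ŝ (sum (tabulate {n = m} (\ i -> κ (toℕ i)))) ≈ prodR m (\ i -> pow ŝ (κ i))
   go zero κ = refl
   go (suc m) κ = tr (pow-+ ŝ (κ 0) _) (tr (*ˡ (go m (\ i -> κ (suc i)))) (sym (prodR-head m _)))
  module Encode (π : PlanePartition) where
   encDown : ∀ c -> ℕ -> Code c
   encDown zero b = []
   encDown (suc c) b = tab (diagonal π 0 (suc b)) ∷ encDown c (suc b)
   enc : ∀ a c -> Code (a N.+ c)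
   enc zero c = encDown c 0
   enc (suc a) c = tab (diagonal π a 0) ∷ enc a c
  module Partition (π : PlanePartition) (r c : ℕ) (inBox : InBox r c π) (r≤n : r N.≤ n0) where
   open Encode π
   ar : ℕ -> ℕ -> ℕ
   ar = arr π
   D : ℕ -> ℕ -> ℕ -> ℕ
   D = diagonal π
   D-out : ∀ a b -> D a b n0 ≡ 0
   D-out a b = inBox _ _ (inj₁ (≤-trans r≤n (NP.m≤m+n n0 a)))
   -- The factors of index m at the box (x , y) in the definition of F: `Lf` involves the partition
   -- μ below, `Rf` the partition ν to the right, `Wf` the two denominators. `Xf` has them in the
   -- order of `Fbox`.
   Lf Rf Wf Xf : ℕ -> ℕ -> ℕ -> Car
   Lf x y m = f̂ (ar x y N.∸ ar (suc x N.+ m) (y N.+ m)) m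
   Rf x y m = f̂ (ar x y N.∸ ar (x N.+ m) (suc y N.+ m)) m
   Wf x y m = f̂⁻ (ar x y N.∸ ar (x N.+ m) (y N.+ m)) m * f̂⁻ (ar x y N.∸ ar (suc x N.+ m) (suc y N.+ m)) m
   Xf x y m = ((f̂ (ar x y N.∸ ar (suc x N.+ m) (y N.+ m)) m * f̂ (ar x y N.∸ ar (x N.+ m) (suc y N.+ m)) m) * f̂⁻ (ar x y N.∸ ar (x N.+ m) (y N.+ m)) m) * f̂⁻ (ar x y N.∸ ar (suc x N.+ m) (suc y N.+ m)) m
   along : (ℕ -> ℕ -> ℕ -> Car) -> ℕ -> ℕ -> Car
   along K a b = prodR n0 (\ i -> prodR (n0 N.∸ i) (K (i N.+ a) (i N.+ b)))
   Sa : ℕ -> ℕ -> Car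
   Sa a b = prodR n0 (\ i -> pow ŝ (D a b i))
   private
    f-idx : ∀ {x x' y y'} v m -> x ≡ x' -> y ≡ y' -> f̂ (v N.∸ ar x y) m ≈ f̂ (v N.∸ ar x' y') m
    f-idx v m E.refl E.refl = refl
    g-idx : ∀ {x x' y y'} v m -> x ≡ x' -> y ≡ y' -> f̂⁻ (v N.∸ ar x y) m ≈ f̂⁻ (v N.∸ ar x' y') m
    g-idx v m E.refl E.refl = refl
    near : ∀ {x y x' y' x'' y''} -> x' ≡ x'' -> y' ≡ y'' -> x N.≤ x'' -> y N.≤ y'' -> ar x' y' N.≤ ar x y
    near E.refl E.refl = arr-anti π
    ≤s : ∀ i m -> i N.≤ suc i N.+ m
    ≤s i m = NP.m≤n⇒m≤1+n (NP.m≤m+n i m)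
    ≤+ : ∀ i m -> i N.≤ i N.+ m
    ≤+ = NP.m≤m+n
   -- The weight of two neighbouring diagonals splits into a part owned by the boxes of the one and
   -- a part owned by the boxes of the other.
   link-up : ∀ a b -> T̃ (tab (D a b)) (tab (D (suc a) b)) ≈ along Lf a b * along Rf (suc a) b
   link-up a b = tr (T̃-form (D a b) (D (suc a) b) (\ i m -> near (e1 i m a) (e2 i m b) (≤s (i N.+ a) m) (≤+ (i N.+ b) m)) (\ i m -> near (e3 i m a) (e4 i m b) (≤+ (i N.+ suc a) m) (≤s (i N.+ b) m)) (D-out (suc a) b)) (*~ (prodR-cong n0 (\ i -> prodR-cong (n0 N.∸ i) (\ m -> f-idx (D a b i) m (e1 i m a) (e2 i m b)))) (prodR-cong n0 (\ i -> prodR-cong (n0 N.∸ i) (\ m -> f-idx (D (suc a) b i) m (e3 i m a) (e4 i m b)))))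
   link-down : ∀ a b -> T̃ (tab (D a b)) (tab (D a (suc b))) ≈ along Rf a b * along Lf a (suc b)
   link-down a b = tr (T̃-form (D a b) (D a (suc b)) (\ i m -> near (e2 i m a) (e1 i m b) (≤+ (i N.+ a) m) (≤s (i N.+ b) m)) (\ i m -> near (e4 i m a) (e3 i m b) (≤s (i N.+ a) m) (≤+ (i N.+ suc b) m)) (D-out a (suc b))) (*~ (prodR-cong n0 (\ i -> prodR-cong (n0 N.∸ i) (\ m -> f-idx (D a b i) m (e2 i m a) (e1 i m b)))) (prodR-cong n0 (\ i -> prodR-cong (n0 N.∸ i) (\ m -> f-idx (D a (suc b) i) m (e4 i m a) (e3 i m b)))))
   node : ∀ a b -> Ṽ (tab (D a b)) ≈ along Wf a b
   node a b = tr (Ṽ-form (D a b) (\ i m -> near (e2 i m a) (e2 i m b) (≤+ (i N.+ a) m) (≤+ (i N.+ b) m)) (D-out a b)) (tr (sym (prodR-* n0 _ _)) (prodR-cong n0 (\ i -> tr (sym (prodR-* (n0 N.∸ i) _ _)) (prodR-cong (n0 N.∸ i) (\ m -> *~ (g-idx (D a b i) m (e2 i m a) (e2 i m b)) (g-idx (D a b i) m (e4 i m a) (e4 i m b)))))))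
   box : ℕ -> ℕ -> Car
   box x y = pow ŝ (ar x y) * el (onSupport (ar x y) (Fbox π x y))
   -- Everything that belongs to the boxes of one diagonal: the halves of the links on its two
   -- sides, its vertex weight, and its power of s.
   Bx : ℕ -> ℕ -> Car
   Bx a b = ((Sa a b * along Rf a b) * along Lf a b) * along Wf a b
   -- If (x + m , y + m) is empty, so are the boxes below, to the right and diagonally after it; two
   -- equal values of f then meet their inverses. Hence the product over m may be cut anywhere
   -- beyond the support, in particular at n0 - i as well as at the bound of π.
   Xf-one : ∀ x y m -> ar (x N.+ m) (y N.+ m) ≡ 0 -> Xf x y m ≈ 1#
   Xf-one x y m z = tr (*~ (*~ (*~ (fz (below (≤-suc x) ≤-refl)) (fz (below ≤-refl (≤-suc y)))) (gz z)) (gz (below (≤-suc x) (≤-suc y)))) (tr (solve 2 (\ f g -> ((f :* f) :* g) :* g := (f :* g) :* (f :* g)) refl (f̂ (ar x y) m) (f̂⁻ (ar x y) m)) (tr (*~ (ff (ar x y) m) (ff (ar x y) m)) (il _)))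
    where
    ≤-suc : ∀ i -> i N.+ m N.≤ suc i N.+ m
    ≤-suc i = NP.n≤1+n (i N.+ m)
    below : ∀ {x' y'} -> x N.+ m N.≤ x' -> y N.+ m N.≤ y' -> ar x' y' ≡ 0
    below hx hy = NP.n≤0⇒n≡0 (≤-trans (arr-anti π hx hy) (≤-reflexive z))
    fz : ∀ {w} -> w ≡ 0 -> f̂ (ar x y N.∸ w) m ≈ f̂ (ar x y) m
    fz E.refl = refl
    gz : ∀ {w} -> w ≡ 0 -> f̂⁻ (ar x y N.∸ w) m ≈ f̂⁻ (ar x y) m
    gz E.refl = refl
   el-support : ∀ v X Z -> (v ≡ 0 -> Z ≈ 1#) -> el X ≈ Z -> el (onSupport v X) ≈ Z
   el-support zero X Z h0 h = tr (lift el-𝟙) (sym (h0 E.refl))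
   el-support (suc v) X Z h0 h = h
   Fterm : ℕ -> ℕ -> ℕ -> PS
   Fterm x y m = ((f (ar x y N.∸ ar (suc x N.+ m) (y N.+ m)) m ⊗ f (ar x y N.∸ ar (x N.+ m) (suc y N.+ m)) m) ⊗ finv (ar x y N.∸ ar (x N.+ m) (y N.+ m)) m) ⊗ finv (ar x y N.∸ ar (suc x N.+ m) (suc y N.+ m)) m
   el-Fterm : ∀ x y m -> el (Fterm x y m) ≈ Xf x y m
   el-Fterm x y m = lift (P.tr (el-⊗ _ _) (P.*ʳ (P.tr (el-⊗ _ _) (P.*ʳ (el-⊗ _ _)))))
   el-Fbox : ∀ x y -> el (onSupport (ar x y) (Fbox π x y)) ≈ prodR (suc (bound π)) (Xf x y)
   el-Fbox x y = el-support (ar x y) (Fbox π x y) (prodR (suc (bound π)) (Xf x y)) (\ z -> prodR-one (suc (bound π)) (\ m _ -> Xf-one x y m (NP.n≤0⇒n≡0 (≤-trans (arr-mono π x y m m) (≤-reflexive z))))) (tr (el-prodT (suc (bound π)) (Fterm x y)) (prodR-cong (suc (bound π)) (el-Fterm x y)))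
   box-factors : ∀ i x y -> i N.≤ x -> ((pow ŝ (ar x y) * prodR (n0 N.∸ i) (Rf x y)) * prodR (n0 N.∸ i) (Lf x y)) * prodR (n0 N.∸ i) (Wf x y) ≈ box x y
   box-factors i x y i≤x = tr (solve 4 (\ p r l w -> ((p :* r) :* l) :* w := p :* ((l :* r) :* w)) refl (pow ŝ (ar x y)) (prodR N (Rf x y)) (prodR N (Lf x y)) (prodR N (Wf x y))) (*ˡ (tr merged (tr (prodR-agree N (suc (bound π)) (Xf x y) beyond1 beyond2) (sym (el-Fbox x y)))))
    where
    N : ℕ
    N = n0 N.∸ i
    merged : (prodR N (Lf x y) * prodR N (Rf x y)) * prodR N (Wf x y) ≈ prodR N (Xf x y)
    merged = tr (*ʳ (sym (prodR-* N (Lf x y) (Rf x y)))) (tr (sym (prodR-* N (\ m -> Lf x y m * Rf x y m) (Wf x y))) (prodR-cong N (\ m -> sym (*a (Lf x y m * Rf x y m) (f̂⁻ (ar x y N.∸ ar (x N.+ m) (y N.+ m)) m) (f̂⁻ (ar x y N.∸ ar (suc x N.+ m) (suc y N.+ m)) m)))))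
    beyond1 : ∀ m -> N N.≤ m -> Xf x y m ≈ 1#
    beyond1 m h = Xf-one x y m (inBox (x N.+ m) (y N.+ m) (inj₁ (≤-trans r≤n (≤-trans (NP.m≤n+m∸n n0 i) (NP.+-mono-≤ i≤x h)))))
    beyond2 : ∀ m -> suc (bound π) N.≤ m -> Xf x y m ≈ 1#
    beyond2 m h = Xf-one x y m (zero-out π (x N.+ m) (y N.+ m) (inj₁ (≤-trans (≤-trans (NP.n≤1+n (bound π)) h) (NP.m≤n+m m x))))
   Bx-boxes : ∀ a b -> Bx a b ≈ prodR n0 (\ i -> box (i N.+ a) (i N.+ b))
   Bx-boxes a b = tr (*ʳ (tr (*ʳ (sym (prodR-* n0 p1 p2))) (sym (prodR-* n0 (\ i -> p1 i * p2 i) p3)))) (tr (sym (prodR-* n0 (\ i -> (p1 i * p2 i) * p3 i) p4)) (prodR-cong n0 (\ i -> box-factors i (i N.+ a) (i N.+ b) (NP.m≤m+n i a))))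
    where
    p1 p2 p3 p4 : ℕ -> Car
    p1 i = pow ŝ (D a b i)
    p2 i = prodR (n0 N.∸ i) (Rf (i N.+ a) (i N.+ b))
    p3 i = prodR (n0 N.∸ i) (Lf (i N.+ a) (i N.+ b))
    p4 i = prodR (n0 N.∸ i) (Wf (i N.+ a) (i N.+ b))
   tab-𝟎 : ∀ κ -> (∀ i -> κ i ≡ 0) -> tab κ ≡ 𝟎
   tab-𝟎 κ h = ℕvec-ext _ _ (\ i -> VecP.lookup∘tabulate (\ i -> κ (toℕ i)) i >> h (toℕ i) >> E.sym (VecP.lookup-replicate i 0))
   f̂-0 : ∀ v w m -> v ≡ 0 -> f̂ (v N.∸ w) m ≈ 1#
   f̂-0 v w m E.refl = tr (rf (cong (\ k -> f̂ k m) (NP.0∸n≡0 w))) (lift el-𝟙)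
   edge-one : ∀ a b -> (∀ i -> D a b i ≡ 0) -> Sa a b * along Rf a b ≈ 1#
   edge-one a b h = tr (*~ (prodR-one n0 (\ i _ -> rf (cong (pow ŝ) (h i)))) (prodR-one n0 (\ i _ -> prodR-one (n0 N.∸ i) (\ m _ -> f̂-0 (D a b i) (ar (i N.+ a N.+ m) (suc (i N.+ b) N.+ m)) m (h i))))) (il 1#)
   -- The factor `Sa` times `along Rf` is what the diagonal b owns of the part evaluated so far. The
   -- next link and vertex weight complete it to a `Bx`.
   down-value : ∀ c' b -> c N.≤ b N.+ c' -> down c' (tab (D 0 b)) (encDown c' b) ≈ (Sa 0 b * along Rf 0 b) * prodR c' (\ j -> Bx 0 (suc (b N.+ j)))
   down-value zero b h = tr (only-yes (tab (D 0 b) ≟𝟎) 1# (tab-𝟎 (D 0 b) zeros)) (sym (tr (*1 _) (edge-one 0 b zeros)))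
    where
    zeros : ∀ i -> D 0 b i ≡ 0
    zeros i = inBox (i N.+ 0) (i N.+ b) (inj₂ (≤-trans h (≤-trans (≤-reflexive (NP.+-identityʳ b)) (NP.m≤n+m b i))))
   down-value (suc c') b h = tr (*~ (sum-tab (D 0 b) (D-out 0 b)) (*~ (link-down 0 b) (*~ (node 0 (suc b)) (down-value c' (suc b) (≤-trans h (≤-reflexive (NP.+-suc b c'))))))) (tr (solve 7 (\ s r l w s' r' p -> s :* ((r :* l) :* (w :* ((s' :* r') :* p))) := (s :* r) :* ((((s' :* r') :* l) :* w) :* p)) refl (Sa 0 b) (along Rf 0 b) (along Lf 0 (suc b)) (along Wf 0 (suc b)) (Sa 0 (suc b)) (along Rf 0 (suc b)) (prodR c' (\ j -> Bx 0 (suc (suc b N.+ j))))) (*ˡ (sym (tr (prodR-head c' (\ j -> Bx 0 (suc (b N.+ j)))) (*~ (rf (cong (\ k -> Bx 0 (suc k)) (NP.+-identityʳ b))) (prodR-cong c' (\ j -> rf (cong (\ k -> Bx 0 (suc k)) (NP.+-suc b j)))))))))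
   up-value : ∀ a -> up a c (tab (D a 0)) (enc a c) ≈ (Sa a 0 * along Rf a 0) * (prodR a (\ i -> Bx i 0) * prodR c (\ j -> Bx 0 (suc j)))
   up-value zero = tr (down-value c 0 ≤-refl) (*ˡ (sym (il _)))
   up-value (suc a) = tr (*~ (sum-tab (D (suc a) 0) (D-out (suc a) 0)) (*~ (link-up a 0) (*~ (node a 0) (up-value a)))) (solve 8 (\ s r l w s' r' p p' -> s :* ((l :* r) :* (w :* ((s' :* r') :* (p :* p')))) := (s :* r) :* ((p :* (((s' :* r') :* l) :* w)) :* p')) refl (Sa (suc a) 0) (along Rf (suc a) 0) (along Lf a 0) (along Wf a 0) (Sa a 0) (along Rf a 0) (prodR a (\ i -> Bx i 0)) (prodR c (\ j -> Bx 0 (suc j))))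
   box-one : ∀ x y -> ar x y ≡ 0 -> box x y ≈ 1#
   box-one x y z = go (ar x y) z
    where
    go : ∀ v -> v ≡ 0 -> pow ŝ v * el (onSupport v (Fbox π x y)) ≈ 1#
    go v E.refl = tr (il (el 𝟙)) (lift el-𝟙)
   square-value : square (bound π) box ≈ pow ŝ (weight π) * el (F π)
   square-value = tr (prodR-cong b (\ i -> prodR-* b (\ j -> pow ŝ (ar i j)) (support i))) (tr (prodR-* b (\ i -> prodR b (\ j -> pow ŝ (ar i j))) (\ i -> prodR b (support i))) (*~ (tr (prodR-cong b (\ i -> prodR-pow b ŝ (ar i))) (prodR-pow b ŝ (\ i -> sumℕ b (ar i)))) (sym (tr (el-prodT b (\ i -> prodTo b (\ j -> onSupport (ar i j) (Fbox π i j)))) (prodR-cong b (\ i -> el-prodT b (\ j -> onSupport (ar i j) (Fbox π i j))))))))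
    where
    b : ℕ
    b = bound π
    support : ℕ -> ℕ -> Car
    support i j = el (onSupport (ar i j) (Fbox π i j))
   private
    b = bound π
    ray : ℕ -> Car
    ray i = prodR r (\ a -> box (i N.+ a) (i N.+ 0)) * prodR c (\ j -> box (i N.+ 0) (i N.+ suc j))
    out-row : ∀ x y -> b N.≤ x ⊎ r N.≤ x -> box x y ≈ 1#
    out-row x y (inj₁ h) = box-one x y (zero-out π x y (inj₁ h))
    out-row x y (inj₂ h) = box-one x y (inBox x y (inj₁ h))
    out-col : ∀ x y -> b N.≤ y ⊎ c N.≤ y -> box x y ≈ 1#
    out-col x y (inj₁ h) = box-one x y (zero-out π x y (inj₂ h))
    out-col x y (inj₂ h) = box-one x y (inBox x y (inj₂ h))
    ray-one : ∀ i -> b N.≤ i ⊎ r N.≤ i -> ray i ≈ 1#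
    ray-one i h = tr (*~ (prodR-one r (\ a _ -> out-row (i N.+ a) (i N.+ 0) (grow h a))) (prodR-one c (\ j _ -> out-row (i N.+ 0) (i N.+ suc j) (grow h 0)))) (il _)
     where
     grow : b N.≤ i ⊎ r N.≤ i -> ∀ a -> b N.≤ i N.+ a ⊎ r N.≤ i N.+ a
     grow (inj₁ h) a = inj₁ (≤-trans h (NP.m≤m+n i a))
     grow (inj₂ h) a = inj₂ (≤-trans h (NP.m≤m+n i a))
    hook-ray : ∀ i -> i N.< b -> hook b box i ≈ ray i
    hook-ray i i<b = tr (*ʳ (tr (rf (cong (\ k -> prodR k (\ m -> box i (i N.+ m))) bN)) (prodR-head N (\ m -> box i (i N.+ m))))) (tr (solve 3 (\ x y z -> (x :* y) :* z := (x :* z) :* y) refl (box i (i N.+ 0)) rightward downward) (tr (*ʳ (tr (*~ (rf (cong (\ k -> box k (i N.+ 0)) (E.sym (NP.+-identityʳ i)))) (prodR-cong N (\ m -> rf (cong (box (i N.+ suc m)) (E.sym (NP.+-identityʳ i)))))) (sym (prodR-head N (\ m -> box (i N.+ m) (i N.+ 0)))))) (*~ (prodR-agree (suc N) r (\ m -> box (i N.+ m) (i N.+ 0)) (\ k h -> out-row (i N.+ k) (i N.+ 0) (inj₁ (subst (N._≤ i N.+ k) iN (NP.+-monoʳ-≤ i h)))) (\ k h -> out-row (i N.+ k) (i N.+ 0) (inj₂ (≤-trans h (NP.m≤n+m k i))))) (tr (prodR-agree N c (\ m -> box i (i N.+ suc m)) (\ k h -> out-col i (i N.+ suc k) (inj₁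 (subst (N._≤ i N.+ suc k) iN (NP.+-monoʳ-≤ i (N.s≤s h))))) (\ k h -> out-col i (i N.+ suc k) (inj₂ (≤-trans h (≤-trans (NP.n≤1+n k) (NP.m≤n+m (suc k) i)))))) (prodR-cong c (\ m -> rf (cong (\ k -> box k (i N.+ suc m)) (E.sym (NP.+-identityʳ i)))))))))
     where
     N : ℕ
     N = b N.∸ suc i
     rightward downward : Car
     rightward = prodR N (\ m -> box i (i N.+ suc m))
     downward = prodR N (\ m -> box (i N.+ suc m) i)
     bN : b N.∸ i ≡ suc N
     bN = NP.+-cancelˡ-≡ i _ _ (NP.m+[n∸m]≡n (NP.<⇒≤ i<b) >> E.sym (NP.+-suc i N >> NP.m+[n∸m]≡n i<b))
     iN : i N.+ suc N ≡ b
     iN = NP.+-suc i N >> NP.m+[n∸m]≡n i<b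
   -- Boxes grouped by diagonal are regrouped by their place i on the diagonal, which gives the hook
   -- with corner (i , i).
   rays : prodR r (\ i -> Bx i 0) * prodR c (\ j -> Bx 0 (suc j)) ≈ prodR n0 ray
   rays = tr (*~ (tr (prodR-cong r (\ a -> Bx-boxes a 0)) (prodR-swap r n0 (\ a i -> box (i N.+ a) (i N.+ 0)))) (tr (prodR-cong c (\ j -> Bx-boxes 0 (suc j))) (prodR-swap c n0 (\ j i -> box (i N.+ 0) (i N.+ suc j))))) (sym (prodR-* n0 (\ i -> prodR r (\ a -> box (i N.+ a) (i N.+ 0))) (\ i -> prodR c (\ j -> box (i N.+ 0) (i N.+ suc j)))))
   code-value : up r c 𝟎 (enc r c) ≈ pow ŝ (weight π) * el (F π)
   code-value = tr (rf (cong (\ v -> up r c v (enc r c)) (E.sym (tab-𝟎 (D r 0) zeros)))) (tr (up-value r) (tr (*ʳ (edge-one r 0 zeros)) (tr (il _) (tr rays (tr (prodR-agree n0 b ray (\ i h -> ray-one i (inj₂ (≤-trans r≤n h))) (\ i h -> ray-one i (inj₁ h))) (tr (sym (prodR-cong< b (\ i i<b -> hook-ray i i<b))) (tr (sym (square-hooks b box)) square-value)))))))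
    where
    zeros : ∀ i -> D r 0 i ≡ 0
    zeros i = inBox (i N.+ r) (i N.+ 0) (inj₁ (NP.m≤n+m r i))

-- Codes correspond to plane partitions; comparison of coefficients.

module Enum where
 open import Defs hiding (pow)
 open Kit
 open Comp
 open Spec
 open SpecT
 open Assembly
 open Star
 open Inst
 open Trunc
 open Boxes
 open import Data.Integer using (0ℤ)
 open import Data.Fin using (fromℕ<)
 open import Data.List using (List; []; _∷_; map)
 open import Data.List.Membership.Propositional using (_∈_)
 open import Data.List.Relation.Unary.Any using (here; there)
 open import Data.List.Relation.Unary.All using (All; []; _∷_)
 open import Data.List.Relation.Unary.AllPairs using (AllPairs; []; _∷_)
 open import Data.Vec using (sum; replicate; tabulate)
 open import Data.Unit using (⊤)
 sumℕ-mono : ∀ n {f g : ℕ -> ℕ} -> (∀ i -> i N.< n -> f i N.≤ g i) -> sumℕ n f N.≤ sumℕ n g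
 sumℕ-mono zero h = N.z≤n
 sumℕ-mono (suc n) h = NP.+-mono-≤ (sumℕ-mono n (\ i i<n -> h i (NP.m<n⇒m<1+n i<n))) (h n ≤-refl)
 sumℕ-member : ∀ n (f : ℕ -> ℕ) i -> i N.< n -> f i N.≤ sumℕ n f
 sumℕ-member (suc n) f i (N.s≤s i≤n) with i N.≟ n
 ... | yes E.refl = NP.m≤n+m (f n) _
 ... | no ne = ≤-trans (sumℕ-member n f i (NP.≤∧≢⇒< i≤n ne)) (NP.m≤m+n _ (f n))
 sumℕ-split : ∀ a n (f : ℕ -> ℕ) -> sumℕ (a N.+ n) f ≡ sumℕ a f N.+ sumℕ n (\ i -> f (a N.+ i))
 sumℕ-split a zero f = cong (\ k -> sumℕ k f) (NP.+-identityʳ a) >> E.sym (NP.+-identityʳ _)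
 sumℕ-split a (suc n) f = cong (\ k -> sumℕ k f) (NP.+-suc a n) >> cong (N._+ f (a N.+ n)) (sumℕ-split a n f) >> NP.+-assoc (sumℕ a f) _ _
 sumℕ-zero : ∀ n {f : ℕ -> ℕ} -> (∀ i -> f i ≡ 0) -> sumℕ n f ≡ 0
 sumℕ-zero zero h = E.refl
 sumℕ-zero (suc n) h = cong₂ N._+_ (sumℕ-zero n h) (h n)
 sumℕ-shifted : ∀ n a N (f : ℕ -> ℕ) -> (∀ i -> N N.≤ i -> f i ≡ 0) -> sumℕ n (\ i -> f (a N.+ i)) N.≤ sumℕ N f
 sumℕ-shifted n a N f h = ≤-trans (NP.m≤n+m _ (sumℕ a f)) (≤-trans (≤-reflexive (E.sym (sumℕ-split a n f))) (≤-trans (NP.m≤m+n _ _) (≤-trans (≤-reflexive (E.sym (sumℕ-split (a N.+ n) N f) >> cong (\ k -> sumℕ k f) (NP.+-comm (a N.+ n) N))) (≤-reflexive (sumℕ-split N (a N.+ n) f >> cong (sumℕ N f N.+_) (sumℕ-zero (a N.+ n) (\ i -> h (N N.+ i) (NP.m≤m+n N i))) >> NP.+-identityʳ _)))))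
 sumℕ-count : ∀ n k (f : ℕ -> ℕ) -> k N.≤ n -> (∀ i -> i N.< k -> 1 N.≤ f i) -> k N.≤ sumℕ n f
 sumℕ-count n k f k≤n h = ≤-trans (count k h) (≤-trans (NP.m≤m+n _ _) (≤-reflexive (E.sym (sumℕ-split k (n N.∸ k) f) >> cong (\ m -> sumℕ m f) (NP.m+[n∸m]≡n k≤n))))
  where
  count : ∀ k -> (∀ i -> i N.< k -> 1 N.≤ f i) -> k N.≤ sumℕ k f
  count zero h = N.z≤n
  count (suc k) h = ≤-trans (≤-reflexive (NP.+-comm 1 k)) (NP.+-mono-≤ (count k (\ i i<k -> h i (NP.m<n⇒m<1+n i<k))) (h k ≤-refl))
 sumℕ-head : ∀ n (f : ℕ -> ℕ) -> sumℕ (suc n) f ≡ f 0 N.+ sumℕ n (f ∘ suc)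
 sumℕ-head n f = sumℕ-split 1 n f
 sum-tabulate : ∀ n (κ : ℕ -> ℕ) -> sum (tabulate {n = n} (κ ∘ toℕ)) ≡ sumℕ n κ
 sum-tabulate zero κ = E.refl
 sum-tabulate (suc n) κ = cong (κ 0 N.+_) (sum-tabulate n (κ ∘ suc)) >> E.sym (sumℕ-head n κ)
 module Weights (π : PlanePartition) where
  private
   b = bound π
   row : ℕ -> ℕ
   row x = sumℕ b (arr π x)
   row-out : ∀ x -> b N.≤ x -> row x ≡ 0
   row-out x h = sumℕ-zero b (\ j -> zero-out π x j (inj₁ h))
   entry≤row : ∀ x y -> arr π x y N.≤ row x
   entry≤row x y with y N.<? b
   ... | yes h = sumℕ-member b (arr π x) y h
   ... | no h = ≤-trans (≤-reflexive (zero-out π x y (inj₂ (NP.≮⇒≥ h)))) N.z≤n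
   inside : ∀ x y -> 1 N.≤ arr π x y -> (x N.< b) × (y N.< b)
   inside x y h = NP.≰⇒> (\ le -> NP.<-irrefl (E.sym (zero-out π x y (inj₁ le))) h) , NP.≰⇒> (\ le -> NP.<-irrefl (E.sym (zero-out π x y (inj₂ le))) h)
  diagonal≤weight : ∀ n a c -> sum (tabulate {n = n} (diagonal π a c ∘ toℕ)) N.≤ weight π
  diagonal≤weight n a c = ≤-trans (≤-reflexive (sum-tabulate n (diagonal π a c))) (≤-trans (sumℕ-mono n (\ i _ -> ≤-trans (entry≤row (i N.+ a) (i N.+ c)) (≤-reflexive (cong row (NP.+-comm i a))))) (sumℕ-shifted n a b row row-out))
  -- By monotonicity a nonzero entry in row i forces rows 0 to i to be nonzero, so the weight is at
  -- least i + 1; likewise for columns in the first row.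
  weight-box : ∀ w -> weight π N.≤ w -> InBox (suc w) (suc w) π
  weight-box w hw i j out with arr π i j N.≟ 0
  ... | yes e = e
  ... | no ne = absurd (go out)
   where
   pos : 1 N.≤ arr π i j
   pos = NP.n≢0⇒n>0 ne
   go : suc w N.≤ i ⊎ suc w N.≤ j -> ⊥
   go (inj₁ h) = NP.<⇒≱ (NP.<-≤-trans h (NP.n≤1+n i)) (≤-trans (sumℕ-count b (suc i) row (proj₁ (inside i j pos)) (\ { x (N.s≤s x≤i) -> ≤-trans pos (≤-trans (arr-anti π x≤i ≤-refl) (entry≤row x j)) })) hw)
   go (inj₂ h) = NP.<⇒≱ (NP.<-≤-trans h (NP.n≤1+n j)) (≤-trans (sumℕ-count b (suc j) (arr π 0) (proj₂ (inside i j pos)) (\ { y (N.s≤s y≤j) -> ≤-trans pos (arr-anti π N.z≤n y≤j) })) (≤-trans (sumℕ-member b row 0 (NP.≤-<-trans N.z≤n (proj₁ (inside i j pos)))) hw))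
 module EnumDef (B M n0 : ℕ) (B≥1 : 1 N.≤ B) where
  open BoxesDef B M n0 B≥1
  n : ℕ
  n = suc n0
  private
   module T = RingKit Trunc
   module TC = CompKit Trunc
   module TP = ProdKit Trunc
   module TK = PickKit Trunc
   module ZC = CompKit ℤR
   module ZV = SumKit.Vecs ℤR n B
  lk : Vec ℕ n -> ℕ -> ℕ
  lk κ i with i N.<? n
  ... | yes h = get κ (fromℕ< h)
  ... | no _ = 0
  lk-in : ∀ κ (i : Fin n) -> lk κ (toℕ i) ≡ get κ i
  lk-in κ i with toℕ i N.<? n
  ... | yes h = cong (get κ) (FinP.fromℕ<-toℕ i h)
  ... | no nh = absurd (nh (FinP.toℕ<n i))
  lk-𝟎 : ∀ i -> lk 𝟎 i ≡ 0
  lk-𝟎 i with i N.<? n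
  ... | yes h = VecP.lookup-replicate (fromℕ< h) 0
  ... | no _ = E.refl
  tab-lk : ∀ κ -> tab (lk κ) ≡ κ
  tab-lk κ = ℕvec-ext _ _ (\ i -> VecP.lookup∘tabulate (\ i -> lk κ (toℕ i)) i >> lk-in κ i)
  -- Interlacing of neighbouring diagonals as the two families of inequalities that become
  -- monotonicity along rows and along columns of the array.
  record Linked (κ μ : Vec ℕ n) : Set where
   field
    upper : ∀ i -> lk μ i N.≤ lk κ i
    lower : ∀ i -> lk κ (suc i) N.≤ lk μ i
  open Linked
  step-𝟎 : Linked 𝟎 𝟎
  step-𝟎 = record { upper = \ i -> ≤-refl ; lower = \ i -> ≤-trans (≤-reflexive (lk-𝟎 (suc i))) N.z≤n }
  step-inter : ∀ κ μ -> Inter (emb κ) (emb μ) -> Linked κ μ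
  step-inter κ μ h = record { upper = up′ ; lower = lo′ }
   where
   up′ : ∀ i -> lk μ i N.≤ lk κ i
   up′ i with i N.<? n
   ... | yes b = Inter⇒⊆ κ μ h (fromℕ< b)
   ... | no _ = N.z≤n
   lo′ : ∀ i -> lk κ (suc i) N.≤ lk μ i
   lo′ i with suc i N.<? n | i N.<? n
   ... | no _ | _ = N.z≤n
   ... | yes b | no nb = absurd (nb (NP.<-trans (NP.n<1+n i) b))
   ... | yes b | yes b' = Inter⇒next κ μ h (fromℕ< b) (fromℕ< b') (FinP.toℕ-fromℕ< b >> cong suc (E.sym (FinP.toℕ-fromℕ< b')))
  GoodD : ∀ c -> Vec ℕ n -> Code c -> Set
  GoodD zero λ' [] = λ' ≡ 𝟎
  GoodD (suc c) λ' (μ ∷ v) = Linked λ' μ × GoodD c μ v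
  GoodU : ∀ a c -> Vec ℕ n -> Code (a N.+ c) -> Set
  GoodU zero c λ' v = GoodD c λ' v
  GoodU (suc a) c λ' (κ ∷ v) = Linked κ λ' × GoodU a c κ v
  goodD? : ∀ c λ' v -> GoodD c λ' v ⊎ (down c λ' v T.≈ T.0#)
  goodD? zero λ' [] with λ' ≟𝟎
  ... | yes e = inj₁ e
  ... | no ne = inj₂ T.refl
  goodD? (suc c) λ' (μ ∷ v) with inter? (emb λ') (emb μ) | goodD? c μ v
  ... | no nh | _ = inj₂ (kill1 (T̃-zero λ' μ nh))
  ... | yes h | inj₁ g = inj₁ (step-inter λ' μ h , g)
  ... | yes h | inj₂ z = inj₂ (kill2 (T.tr (T.*ˡ z) (T.*0 _)))
  goodU? : ∀ a c λ' v -> GoodU a c λ' v ⊎ (up a c λ' v T.≈ T.0#)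
  goodU? zero c λ' v = goodD? c λ' v
  goodU? (suc a) c λ' (κ ∷ v) with inter? (emb κ) (emb λ') | goodU? a c κ v
  ... | no nh | _ = inj₂ (kill1 (T̃-zero κ λ' nh))
  ... | yes h | inj₁ g = inj₁ (step-inter κ λ' h , g)
  ... | yes h | inj₂ z = inj₂ (kill2 (T.tr (T.*ˡ z) (T.*0 _)))
  rightOf : ∀ c -> Vec ℕ n -> Code c -> ℕ -> Vec ℕ n
  rightOf c λ' v zero = λ'
  rightOf zero λ' [] (suc b) = 𝟎
  rightOf (suc c) λ' (μ ∷ v) (suc b) = rightOf c μ v b
  right : ∀ a c -> Vec ℕ n -> Code (a N.+ c) -> ℕ -> Vec ℕ n
  right zero c λ' v = rightOf c λ' v
  right (suc a) c λ' (κ ∷ v) = right a c κ v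
  -- A code lists the diagonals from the outermost inwards. The diagonal starting in row k is
  -- therefore found by counting down from a, and beyond a it is empty.
  left : ∀ a c -> Vec ℕ n -> Code (a N.+ c) -> ℕ -> Vec ℕ n
  left zero c λ' v zero = λ'
  left zero c λ' v (suc k) = 𝟎
  left (suc a) c λ' (κ ∷ v) k with k N.≟ suc a
  ... | yes _ = λ'
  ... | no _ = left a c κ v k
  left-top : ∀ a c λ' v -> left a c λ' v a ≡ λ'
  left-top zero c λ' v = E.refl
  left-top (suc a) c λ' (κ ∷ v) with suc a N.≟ suc a
  ... | yes _ = E.refl
  ... | no ne = absurd (ne E.refl)
  left-below : ∀ a c λ' κ v k -> ¬ k ≡ suc a -> left (suc a) c λ' (κ ∷ v) k ≡ left a c κ v k
  left-below a c λ' κ v k ne with k N.≟ suc a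
  ... | yes e = absurd (ne e)
  ... | no _ = E.refl
  left-out : ∀ a c λ' v k -> a N.< k -> left a c λ' v k ≡ 𝟎
  left-out zero c λ' v (suc k) _ = E.refl
  left-out (suc a) c λ' (κ ∷ v) k h = left-below a c λ' κ v k (\ e -> NP.<-irrefl (E.sym e) h) >> left-out a c κ v k (NP.<-trans (NP.n<1+n a) h)
  left-right : ∀ a c λ' v -> left a c λ' v 0 ≡ right a c λ' v 0
  left-right zero c λ' v = E.refl
  left-right (suc a) c λ' (κ ∷ v) = left-below a c λ' κ v 0 (\ ()) >> left-right a c κ v
  rightOf-step : ∀ c λ' v -> GoodD c λ' v -> ∀ b -> Linked (rightOf c λ' v b) (rightOf c λ' v (suc b))
  rightOf-step zero λ' [] E.refl zero = step-𝟎
  rightOf-step zero λ' [] e (suc b) = step-𝟎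
  rightOf-step (suc c) λ' (μ ∷ v) (s , g) zero = s
  rightOf-step (suc c) λ' (μ ∷ v) (s , g) (suc b) = rightOf-step c μ v g b
  rightOf-out : ∀ c λ' v -> GoodD c λ' v -> ∀ b -> c N.≤ b -> rightOf c λ' v b ≡ 𝟎
  rightOf-out zero λ' [] e zero _ = e
  rightOf-out zero λ' [] e (suc b) _ = E.refl
  rightOf-out (suc c) λ' (μ ∷ v) (_ , g) (suc b) (N.s≤s h) = rightOf-out c μ v g b h
  right-step : ∀ a c λ' v -> GoodU a c λ' v -> ∀ b -> Linked (right a c λ' v b) (right a c λ' v (suc b))
  right-step zero c λ' v g = rightOf-step c λ' v g
  right-step (suc a) c λ' (κ ∷ v) (_ , g) = right-step a c κ v g
  right-out : ∀ a c λ' v -> GoodU a c λ' v -> ∀ b -> c N.≤ b -> right a c λ' v b ≡ 𝟎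
  right-out zero c λ' v g = rightOf-out c λ' v g
  right-out (suc a) c λ' (κ ∷ v) (_ , g) = right-out a c κ v g
  left-step : ∀ a c λ' v -> GoodU a c λ' v -> ∀ k -> k N.< a -> Linked (left a c λ' v k) (left a c λ' v (suc k))
  left-step (suc a) c λ' (κ ∷ v) (s , g) k (N.s≤s k≤a) with k N.≟ a
  ... | yes E.refl = subst₂ Linked (E.sym (left-below a c λ' κ v a (\ e -> NP.1+n≢n (E.sym e)) >> left-top a c κ v)) (E.sym (left-top (suc a) c λ' (κ ∷ v))) s
  ... | no ne = subst₂ Linked (E.sym (left-below a c λ' κ v k (\ { E.refl -> NP.<-irrefl E.refl k≤a }))) (E.sym (left-below a c λ' κ v (suc k) (\ e -> ne (NP.suc-injective e)))) (left-step a c κ v g k (NP.≤∧≢⇒< k≤a ne))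
  module Decode (r c : ℕ) (v : Code (r N.+ c)) (good : GoodU r c 𝟎 v) where
   Lv Rv : ℕ -> Vec ℕ n
   Lv = left r c 𝟎 v
   Rv = right r c 𝟎 v
   Lv-out : ∀ k -> r N.≤ k -> Lv k ≡ 𝟎
   Lv-out k h with k N.≟ r
   ... | yes E.refl = left-top r c 𝟎 v
   ... | no ne = left-out r c 𝟎 v k (NP.≤∧≢⇒< h (\ e -> ne (E.sym e)))
   Lv-step : ∀ k -> Linked (Lv k) (Lv (suc k))
   Lv-step k with k N.<? r
   ... | yes h = left-step r c 𝟎 v good k h
   ... | no nh = subst₂ Linked (E.sym (Lv-out k (NP.≮⇒≥ nh))) (E.sym (Lv-out (suc k) (NP.m≤n⇒m≤1+n (NP.≮⇒≥ nh)))) step-𝟎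
   Rv-step : ∀ b -> Linked (Rv b) (Rv (suc b))
   Rv-step = right-step r c 𝟎 v good
   -- entry i x y is the entry in row i + x and column i + y.
   entry : ℕ -> ℕ -> ℕ -> ℕ
   entry i (suc x) (suc y) = entry (suc i) x y
   entry i x zero = lk (Lv x) i
   entry i zero (suc y) = lk (Rv (suc y)) i
   start : Linked (Lv 0) (Rv 1)
   start = subst (\ κ -> Linked κ (Rv 1)) (E.sym (left-right r c 𝟎 v)) (Rv-step 0)
   entry-row : ∀ i x y -> entry i x (suc y) N.≤ entry i x y
   entry-row i zero zero = upper start i
   entry-row i zero (suc y) = upper (Rv-step (suc y)) i
   entry-row i (suc zero) zero = lower (Lv-step 0) i
   entry-row i (suc (suc x)) zero = lower (Lv-step (suc x)) i
   entry-row i (suc x) (suc y) = entry-row (suc i) x y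
   entry-col : ∀ i x y -> entry i (suc x) y N.≤ entry i x y
   entry-col i zero zero = upper (Lv-step 0) i
   entry-col i (suc x) zero = upper (Lv-step (suc x)) i
   entry-col i zero (suc zero) = lower start i
   entry-col i zero (suc (suc y)) = lower (Rv-step (suc y)) i
   entry-col i (suc x) (suc y) = entry-col (suc i) x y
   entry-first : ∀ i x -> entry i x 0 ≡ lk (Lv x) i
   entry-first i zero = E.refl
   entry-first i (suc x) = E.refl
   row-bound : ∀ x y -> entry 0 x y N.≤ entry 0 x 0
   row-bound x zero = ≤-refl
   row-bound x (suc y) = ≤-trans (entry-row 0 x y) (row-bound x y)
   col-bound : ∀ x y -> entry 0 x y N.≤ entry 0 0 y
   col-bound zero y = ≤-refl
   col-bound (suc x) y = ≤-trans (entry-col 0 x y) (col-bound x y)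
   first-row : ∀ y -> c N.≤ y -> entry 0 0 y ≡ 0
   first-row zero h = cong (\ κ -> lk κ 0) (left-right r c 𝟎 v >> right-out r c 𝟎 v good 0 h) >> lk-𝟎 0
   first-row (suc y) h = cong (\ κ -> lk κ 0) (right-out r c 𝟎 v good (suc y) h) >> lk-𝟎 0
   outside : ∀ x y -> r N.≤ x ⊎ c N.≤ y -> entry 0 x y ≡ 0
   outside x y (inj₁ h) = NP.n≤0⇒n≡0 (≤-trans (row-bound x y) (≤-reflexive (entry-first 0 x >> cong (\ κ -> lk κ 0) (Lv-out x h) >> lk-𝟎 0)))
   outside x y (inj₂ h) = NP.n≤0⇒n≡0 (≤-trans (col-bound x y) (≤-reflexive (first-row y h)))
   decoded : PlanePartition
   decoded = record { arr = entry 0 ; bound = r N.+ c ; zero-out = \ { x y (inj₁ h) -> outside x y (inj₁ (≤-trans (NP.m≤m+n r c) h)) ; x y (inj₂ h) -> outside x y (inj₂ (≤-trans (NP.m≤n+m c r) h)) } ; row-mono = entry-row 0 ; col-mono = entry-col 0 }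
   entry-shift : ∀ i j a b -> entry j (i N.+ a) (i N.+ b) ≡ entry (i N.+ j) a b
   entry-shift zero j a b = E.refl
   entry-shift (suc i) j a b = entry-shift i (suc j) a b >> cong (\ k -> entry k a b) (NP.+-suc i j)
   tab-cong : ∀ {κ μ : ℕ -> ℕ} -> (∀ i -> κ i ≡ μ i) -> tab κ ≡ tab μ
   tab-cong h = VecP.tabulate-cong (\ i -> h (toℕ i))
   diagonal-entry : ∀ a b -> tab (diagonal decoded a b) ≡ tab (\ i -> entry i a b)
   diagonal-entry a b = tab-cong (\ i -> entry-shift i 0 a b >> cong (\ k -> entry k a b) (NP.+-identityʳ i))
   left-diagonal : ∀ a -> tab (diagonal decoded a 0) ≡ Lv a
   left-diagonal a = diagonal-entry a 0 >> tab-cong (\ i -> entry-first i a) >> tab-lk (Lv a)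
   right-diagonal : ∀ b -> tab (diagonal decoded 0 (suc b)) ≡ Rv (suc b)
   right-diagonal b = diagonal-entry 0 (suc b) >> tab-lk (Rv (suc b))
   open Encode decoded
   encDown-decoded : ∀ c′ b λ' (u : Code c′) -> (∀ j -> Rv (suc (b N.+ j)) ≡ rightOf c′ λ' u (suc j)) -> encDown c′ b ≡ u
   encDown-decoded zero b λ' [] h = E.refl
   encDown-decoded (suc c′) b λ' (μ ∷ u) h = cong₂ _∷_ (right-diagonal b >> cong (\ k -> Rv (suc k)) (E.sym (NP.+-identityʳ b)) >> h 0) (encDown-decoded c′ (suc b) μ u (\ j -> cong (\ k -> Rv (suc k)) (E.sym (NP.+-suc b j)) >> h (suc j)))
   enc-decoded : ∀ a λ' (u : Code (a N.+ c)) -> (∀ k -> k N.< a -> Lv k ≡ left a c λ' u k) -> (∀ j -> Rv (suc j) ≡ right a c λ' u (suc j)) -> enc a c ≡ u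
   enc-decoded zero λ' u hl hr = encDown-decoded c 0 λ' u hr
   enc-decoded (suc a) λ' (κ ∷ u) hl hr = cong₂ _∷_ (left-diagonal a >> hl a ≤-refl >> left-below a c λ' κ u a (\ e -> NP.1+n≢n (E.sym e)) >> left-top a c κ u) (enc-decoded a κ u (\ k k<a -> hl k (NP.m<n⇒m<1+n k<a) >> left-below a c λ' κ u k (\ { E.refl -> NP.<⇒≱ k<a (NP.n≤1+n a) })) hr)
   encoded : enc r c ≡ v
   encoded = enc-decoded r 𝟎 v (\ _ _ -> E.refl) (\ _ -> E.refl)
  open Encode
  encDown-injective : ∀ π ρ c b -> encDown π c b ≡ encDown ρ c b -> ∀ j -> j N.< c -> tab (diagonal π 0 (suc (b N.+ j))) ≡ tab (diagonal ρ 0 (suc (b N.+ j)))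
  encDown-injective π ρ (suc c) b e zero _ = subst (\ k -> tab (diagonal π 0 (suc k)) ≡ tab (diagonal ρ 0 (suc k))) (E.sym (NP.+-identityʳ b)) (VecP.∷-injectiveˡ e)
  encDown-injective π ρ (suc c) b e (suc j) (N.s≤s h) = subst (\ k -> tab (diagonal π 0 (suc k)) ≡ tab (diagonal ρ 0 (suc k))) (E.sym (NP.+-suc b j)) (encDown-injective π ρ c (suc b) (VecP.∷-injectiveʳ e) j h)
  enc-injective : ∀ π ρ a c -> enc π a c ≡ enc ρ a c -> (∀ k -> k N.< a -> tab (diagonal π k 0) ≡ tab (diagonal ρ k 0)) × (∀ j -> j N.< c -> tab (diagonal π 0 (suc j)) ≡ tab (diagonal ρ 0 (suc j)))
  enc-injective π ρ zero c e = (\ _ ()) , encDown-injective π ρ c 0 e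
  enc-injective π ρ (suc a) c e = lefts , proj₂ ih
   where
   ih = enc-injective π ρ a c (VecP.∷-injectiveʳ e)
   lefts : ∀ k -> k N.< suc a -> tab (diagonal π k 0) ≡ tab (diagonal ρ k 0)
   lefts k (N.s≤s k≤a) with k N.≟ a
   ... | yes E.refl = VecP.∷-injectiveˡ e
   ... | no ne = proj₁ ih k (NP.≤∧≢⇒< k≤a ne)
  tab-injective : ∀ {κ μ : ℕ -> ℕ} -> tab κ ≡ tab μ -> ∀ i -> i N.< n -> κ i ≡ μ i
  tab-injective {κ} {μ} e i h = E.sym (value κ) >> cong (\ v -> get v (fromℕ< h)) e >> value μ
   where
   value : ∀ κ -> get (tab κ) (fromℕ< h) ≡ κ i
   value κ = VecP.lookup∘tabulate (\ i -> κ (toℕ i)) (fromℕ< h) >> cong κ (FinP.toℕ-fromℕ< h)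
  -- The box (x , y) is entry min(x, y) of the diagonal that starts x - y rows down or y - x columns
  -- to the right. Inside the box this diagonal belongs to the code; outside both entries are 0.
  same-code : ∀ r c π ρ -> r N.≤ n0 -> InBox r c π -> InBox r c ρ -> enc π r c ≡ enc ρ r c -> SamePP π ρ
  same-code r c π ρ r≤n bπ bρ e x y with x N.<? r | y N.<? c
  ... | no nx | _ = bπ x y (inj₁ (NP.≮⇒≥ nx)) >> E.sym (bρ x y (inj₁ (NP.≮⇒≥ nx)))
  ... | yes _ | no ny = bπ x y (inj₂ (NP.≮⇒≥ ny)) >> E.sym (bρ x y (inj₂ (NP.≮⇒≥ ny)))
  ... | yes hx | yes hy with NP.≤-total y x
  ...   | inj₁ y≤x = subst₂ (\ x y -> arr π x y ≡ arr ρ x y) (NP.m+[n∸m]≡n y≤x) (NP.+-identityʳ y) (tab-injective {diagonal π (x N.∸ y) 0} {diagonal ρ (x N.∸ y) 0} (proj₁ (enc-injective π ρ r c e) (x N.∸ y) (NP.≤-<-trans (NP.m∸n≤m x y) hx)) y (NP.≤-<-trans y≤x (NP.<-≤-trans hx (NP.m≤n⇒m≤1+n r≤n))))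
  ...   | inj₂ x≤y = go (y N.∸ x) (NP.m+[n∸m]≡n x≤y)
   where
   x<n : x N.< n
   x<n = NP.<-≤-trans hx (NP.m≤n⇒m≤1+n r≤n)
   go : ∀ d -> x N.+ d ≡ y -> arr π x y ≡ arr ρ x y
   go zero ed = subst₂ (\ x y -> arr π x y ≡ arr ρ x y) (NP.+-identityʳ x) ed (tab-injective {diagonal π 0 0} {diagonal ρ 0 0} (proj₁ (enc-injective π ρ r c e) 0 (NP.≤-<-trans N.z≤n hx)) x x<n)
   go (suc d) ed = subst₂ (\ x y -> arr π x y ≡ arr ρ x y) (NP.+-identityʳ x) ed (tab-injective {diagonal π 0 (suc d)} {diagonal ρ 0 (suc d)} (proj₂ (enc-injective π ρ r c e) d (NP.<-trans (NP.n<1+n d) (NP.≤-<-trans (≤-trans (NP.m≤n+m (suc d) x) (≤-reflexive ed)) hy))) x x<n)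
  InRange : ∀ {m} -> Code m -> Set
  InRange [] = ⊤
  InRange (κ ∷ v) = (sum κ N.< B) × InRange v
  enc-range : ∀ π a c -> weight π N.< B -> InRange (enc π a c)
  enc-range π a c h = ups a
   where
   each : ∀ a b -> sum (tab (diagonal π a b)) N.< B
   each a b = NP.≤-<-trans (Weights.diagonal≤weight π n a b) h
   downs : ∀ c b -> InRange (encDown π c b)
   downs zero b = _
   downs (suc c) b = each 0 (suc b) , downs c (suc b)
   ups : ∀ a -> InRange (enc π a c)
   ups zero = downs c 0
   ups (suc a) = each a 0 , ups a
  SumZ : ∀ m -> (Code m -> ℤ) -> ℤ
  SumZ zero h = h []
  SumZ (suc m) h = ZV.SS (\ κ -> SumZ m (\ v -> h (κ ∷ v)))
  SumZ-zero : ∀ m h -> (∀ v -> h v ≡ 0ℤ) -> SumZ m h ≡ 0ℤ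
  SumZ-zero zero h e = e []
  SumZ-zero (suc m) h e = ZV.SS-zero _ (\ κ _ -> SumZ-zero m _ (\ v -> e (κ ∷ v)))
  SumZ-cong : ∀ m {h k : Code m -> ℤ} -> (∀ v -> h v ≡ k v) -> SumZ m h ≡ SumZ m k
  SumZ-cong zero e = e []
  SumZ-cong (suc m) e = ZV.SS-cong (\ κ -> SumZ-cong m (\ v -> e (κ ∷ v)))
  SumZ-+ : ∀ m h k -> SumZ m (\ v -> h v Z.+ k v) ≡ SumZ m h Z.+ SumZ m k
  SumZ-+ zero h k = E.refl
  SumZ-+ (suc m) h k = ZV.SS-cong (\ κ -> SumZ-+ m _ _) >> ZV.SS-+ _ _
  SumZ-single : ∀ m v0 h -> InRange v0 -> (∀ v -> ¬ v ≡ v0 -> h v ≡ 0ℤ) -> SumZ m h ≡ h v0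
  SumZ-single zero [] h _ _ = E.refl
  SumZ-single (suc m) (κ₀ ∷ v0) h (b , bs) e = ZV.SS-single κ₀ _ b (\ κ ne -> SumZ-zero m _ (\ v -> e (κ ∷ v) (\ x -> ne (VecP.∷-injectiveˡ x)))) >> SumZ-single m v0 _ bs (\ v ne -> e (κ₀ ∷ v) (\ x -> ne (VecP.∷-injectiveʳ x)))
  code? : ∀ {m} (u v : Code m) -> Dec (u ≡ v)
  code? = VecP.≡-dec (VecP.≡-dec N._≟_)
  onlyℤ offℤ : ∀ {A : Set} -> Dec A -> ℤ -> ℤ
  onlyℤ (yes _) x = x
  onlyℤ (no _) x = 0ℤ
  offℤ (yes _) x = 0ℤ
  offℤ (no _) x = x
  -- The head π is split off by separating the value of h at its code. Since the other codes are
  -- different, the remaining function agrees with h on the tail.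
  enumerate : ∀ {m} (e : PlanePartition -> Code m) L (h : Code m -> ℤ) -> AllPairs (\ π ρ -> ¬ e π ≡ e ρ) L -> (∀ π -> π ∈ L -> InRange (e π)) -> (∀ v -> (∀ π -> π ∈ L -> ¬ e π ≡ v) -> h v ≡ 0ℤ) -> SumZ m h ≡ sumList (map (h ∘ e) L)
  enumerate e [] h _ _ z = SumZ-zero _ h (\ v -> z v (\ _ ()))
  enumerate {m} e (π ∷ L) h (ne ∷ ps) range z = SumZ-cong m split >> SumZ-+ m h1 h2 >> cong₂ Z._+_ (SumZ-single m (e π) h1 (range π (here E.refl)) off >> on) (enumerate e L h2 ps (\ ρ i -> range ρ (there i)) rest >> agree-list L ne)
   where
   h1 h2 : Code m -> ℤ
   h1 v = onlyℤ (code? v (e π)) (h v)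
   h2 v = offℤ (code? v (e π)) (h v)
   split : ∀ v -> h v ≡ h1 v Z.+ h2 v
   split v with code? v (e π)
   ... | yes _ = E.sym (ZP.+-identityʳ (h v))
   ... | no _ = E.sym (ZP.+-identityˡ (h v))
   off : ∀ v -> ¬ v ≡ e π -> h1 v ≡ 0ℤ
   off v ne with code? v (e π)
   ... | yes x = absurd (ne x)
   ... | no _ = E.refl
   on : h1 (e π) ≡ h (e π)
   on with code? (e π) (e π)
   ... | yes _ = E.refl
   ... | no x = absurd (x E.refl)
   rest : ∀ v -> (∀ ρ -> ρ ∈ L -> ¬ e ρ ≡ v) -> h2 v ≡ 0ℤ
   rest v no-ρ with code? v (e π)
   ... | yes _ = E.refl
   ... | no x = z v (\ { ρ (here E.refl) y -> x (E.sym y) ; ρ (there i) y -> no-ρ ρ i y })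
   agree-list : ∀ L -> All (\ ρ -> ¬ e π ≡ e ρ) L -> sumList (map (h2 ∘ e) L) ≡ sumList (map (h ∘ e) L)
   agree-list [] [] = E.refl
   agree-list (ρ ∷ L) (x ∷ xs) = cong₂ Z._+_ keep (agree-list L xs)
    where
    keep : h2 (e ρ) ≡ h (e ρ)
    keep with code? (e ρ) (e π)
    ... | yes y = absurd (x (E.sym y))
    ... | no _ = E.refl
  coeff-Σc : ∀ k l (g : Vec ℕ k -> P.Car) x y z -> coeff (TC.Σc k l g) x y z ≡ ZC.Σc k l (\ m -> coeff (g m) x y z)
  coeff-Σc zero zero g x y z = E.refl
  coeff-Σc zero (suc l) g x y z = coeff-0 x y z
  coeff-Σc (suc k) zero g x y z = coeff-Σc k zero _ x y z
  coeff-Σc (suc k) (suc l) g x y z = coeff-+ _ _ x y z >> cong₂ Z._+_ (coeff-Σc k (suc l) _ x y z) (coeff-Σc (suc k) l _ x y z)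
  coeff-sumT : ∀ N (g : ℕ -> P.Car) x y z -> coeff (T.sumR N g) x y z ≡ ZK.sumR N (\ i -> coeff (g i) x y z)
  coeff-sumT zero g x y z = coeff-0 x y z
  coeff-sumT (suc N) g x y z = coeff-+ _ _ x y z >> cong (Z._+ coeff (g N) x y z) (coeff-sumT N g x y z)
  coeff-Sum : ∀ m (h : Code m -> P.Car) x y z -> coeff (Sum m h) x y z ≡ SumZ m (\ v -> coeff (h v) x y z)
  coeff-Sum zero h x y z = E.refl
  coeff-Sum (suc m) h x y z = coeff-sumT B _ x y z >> ZK.sumR-cong B (\ N -> coeff-Σc n N _ x y z) >> ZV.SS-cong (\ κ -> coeff-Sum m (\ v -> h (κ ∷ v)) x y z)
  -- Agreement with a series that does not involve s. For such a weight the factor ŝ^|π| alone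
  -- determines the degree in s in which it is visible.
  Free : P.Car -> Set
  Free X = Σ gr.Car \ Y -> X T.≈ to.ev Y
  free-1 : Free P.1#
  free-1 = gr.1# , lift (P.sym to.ev-1)
  free-* : ∀ {X Y} -> Free X -> Free Y -> Free (X P.* Y)
  free-* (x , e) (y , e') = x gr.* y , T.tr (T.*~ e e') (lift (P.sym (to.ev-* x y)))
  free-f : ∀ k d -> Free (f̂ k d)
  free-f k d = from.ev (f̂ k d) , lift (P.sym (to-f k d))
  free-finv : ∀ k d -> Free (f̂⁻ k d)
  free-finv k d = from.ev (f̂⁻ k d) , lift (P.sym (to-finv k d))
  free-prod : ∀ m {K : ℕ -> P.Car} -> (∀ i -> Free (K i)) -> Free (TP.prodR m K)
  free-prod zero h = free-1
  free-prod (suc m) h = free-* (free-prod m h) (h m)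
  free-cong : ∀ {X Y} -> X T.≈ Y -> Free Y -> Free X
  free-cong e (y , e') = y , T.tr e e'
  module InBoxed (π : PlanePartition) (r c : ℕ) (inBox : InBox r c π) (r≤n : r N.≤ n0) where
   open Partition π r c inBox r≤n
   free-F : Free (el (F π))
   free-F = free-cong (el-prodT (bound π) (\ i -> prodTo (bound π) (\ j -> onSupport (arr π i j) (Fbox π i j)))) (free-prod (bound π) (\ i -> free-cong (el-prodT (bound π) (\ j -> onSupport (arr π i j) (Fbox π i j))) (free-prod (bound π) (\ j -> free-cong (el-Fbox i j) (free-prod (suc (bound π)) (free-X i j))))))
    where
    free-X : ∀ i j m -> Free (Xf i j m)
    free-X i j m = free-* (free-* (free-* (free-f (arr π i j N.∸ arr π (suc i N.+ m) (j N.+ m)) m) (free-f (arr π i j N.∸ arr π (i N.+ m) (suc j N.+ m)) m)) (free-finv (arr π i j N.∸ arr π (i N.+ m) (j N.+ m)) m)) (free-finv (arr π i j N.∸ arr π (suc i N.+ m) (suc j N.+ m)) m)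
   coeff-pow : ∀ k X -> Free X -> ∀ w a b -> w N.< B -> a N.< M -> ¬ k ≡ w -> coeff (TK.pow ŝ k P.* X) w a b ≡ 0ℤ
   coeff-pow zero X (y , e) zero a b hw ha ne = absurd (ne E.refl)
   coeff-pow zero X (y , e) (suc w) a b hw ha ne = ≈-elim (P.il X) (suc w) a b >> at e (suc w) a b hw ha >> coeff-to y w a b
   coeff-pow (suc k) X fr zero a b hw ha ne = ≈-elim (P.*a ŝ (TK.pow ŝ k) X) 0 a b >> coeff-s-zero (TK.pow ŝ k P.* X) a b
   coeff-pow (suc k) X fr (suc w) a b hw ha ne = ≈-elim (P.*a ŝ (TK.pow ŝ k) X) (suc w) a b >> coeff-s-suc (TK.pow ŝ k P.* X) w a b >> coeff-pow k X fr w a b (NP.<-trans (NP.n<1+n w) hw) ha (\ e -> ne (cong suc e))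
   coeff-same : ∀ k X a b -> coeff (TK.pow ŝ k P.* X) k a b ≡ coeff X 0 a b
   coeff-same zero X a b = ≈-elim (P.il X) 0 a b
   coeff-same (suc k) X a b = ≈-elim (P.*a ŝ (TK.pow ŝ k) X) (suc k) a b >> coeff-s-suc (TK.pow ŝ k P.* X) k a b >> coeff-same k X a b
   code-coeff : ∀ w a b -> w N.< B -> a N.< M -> weight π ≡ w -> coeff (up r c 𝟎 (enc π r c)) w a b ≡ F π 0 a b
   code-coeff w a b hw ha E.refl = at code-value w a b hw ha >> coeff-same (weight π) (el (F π)) a b >> coeff-el (F π) 0 a b
   code-off : ∀ w a b -> w N.< B -> a N.< M -> ¬ weight π ≡ w -> coeff (up r c 𝟎 (enc π r c)) w a b ≡ 0ℤ
   code-off w a b hw ha ne = at code-value w a b hw ha >> coeff-pow (weight π) (el (F π)) free-F w a b hw ha ne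
  X-ratios : ∀ c e -> X c e T.≈ TP.prodR c (\ j -> el (ratio (suc (e N.+ j))))
  X-ratios zero e = T.refl
  X-ratios (suc c) e = T.tr (T.*~ (T.tr (T.sumR-cong B (\ j -> T.*ʳ (lift (to-f j 0)))) (T.sym (T.tr (T.rf (cong (\ k -> el (ratio (suc k))) (NP.+-identityʳ e))) (ratio-Gs e)))) (T.tr (X-ratios c (suc e)) (TP.prodR-cong c (\ j -> T.rf (cong (\ k -> el (ratio (suc k))) (E.sym (NP.+-suc e j))))))) (T.sym (TP.prodR-head c (\ j -> el (ratio (suc (e N.+ j))))))
  Y-rhs : ∀ r c -> Y r c T.≈ el (rhsBox r c)
  Y-rhs r c = T.sym (T.tr (el-prodT r (\ i -> prodTo c (\ j -> ratio (i N.+ j N.+ 1)))) (rows r))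
   where
   row : ∀ i -> el (prodTo c (\ j -> ratio (i N.+ j N.+ 1))) T.≈ X c i
   row i = T.tr (el-prodT c (\ j -> ratio (i N.+ j N.+ 1))) (T.tr (TP.prodR-cong c (\ j -> T.rf (cong (\ k -> el (ratio k)) (NP.+-comm (i N.+ j) 1)))) (T.sym (X-ratios c i)))
   rows : ∀ r -> TP.prodR r (\ i -> el (prodTo c (\ j -> ratio (i N.+ j N.+ 1)))) T.≈ Y r c
   rows zero = T.refl
   rows (suc r) = T.*~ (rows r) (row r)
  module Counting (r c : ℕ) (r≤n : r N.≤ n0) (c≤n : c N.≤ n0) (w a b : ℕ) (w<B : w N.< B) (a<M : a N.< M) (L : List PlanePartition) (enum : Enumerates (\ π -> InBox r c π × weight π ≡ w) L) where
   h : Code (r N.+ c) -> ℤ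
   h v = coeff (up r c 𝟎 v) w a b
   holds : ∀ π -> π ∈ L -> InBox r c π × weight π ≡ w
   holds = proj₁ enum
   distinct : ∀ L -> (∀ π -> π ∈ L -> InBox r c π) -> AllPairs (\ π ρ -> ¬ SamePP π ρ) L -> AllPairs (\ π ρ -> ¬ enc π r c ≡ enc ρ r c) L
   distinct [] box [] = []
   distinct (π ∷ L) box (x ∷ xs) = heads L (\ ρ i -> box ρ (there i)) x ∷ distinct L (\ ρ i -> box ρ (there i)) xs
    where
    heads : ∀ L -> (∀ ρ -> ρ ∈ L -> InBox r c ρ) -> All (\ ρ -> ¬ SamePP π ρ) L -> All (\ ρ -> ¬ enc π r c ≡ enc ρ r c) L
    heads [] _ [] = []
    heads (ρ ∷ L) bx (y ∷ ys) = (\ e -> y (same-code r c π ρ r≤n (box π (here E.refl)) (bx ρ (here E.refl)) e)) ∷ heads L (\ σ i -> bx σ (there i)) ys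
   enc-same : ∀ π ρ -> SamePP π ρ -> ∀ a c -> enc π a c ≡ enc ρ a c
   enc-same π ρ e a c = ups a
    where
    each : ∀ a b -> tab (diagonal π a b) ≡ tab (diagonal ρ a b)
    each a b = VecP.tabulate-cong (\ i -> e (toℕ i N.+ a) (toℕ i N.+ b))
    downs : ∀ c b -> encDown π c b ≡ encDown ρ c b
    downs zero b = E.refl
    downs (suc c) b = cong₂ _∷_ (each 0 (suc b)) (downs c (suc b))
    ups : ∀ a -> enc π a c ≡ enc ρ a c
    ups zero = downs c 0
    ups (suc a) = cong₂ _∷_ (each a 0) (ups a)
   -- Either a step of the code fails to interlace, or the code decodes to a plane partition in the
   -- box. If that has weight w, the completeness of L provides a member with the same code;
   -- otherwise it contributes nothing in degree w.
   missing : ∀ v -> (∀ π -> π ∈ L -> ¬ enc π r c ≡ v) -> h v ≡ 0ℤ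
   missing v no-π with goodU? r c 𝟎 v
   ... | inj₂ z = at z w a b w<B a<M >> coeff-0 w a b
   ... | inj₁ g = decide (weight π N.≟ w)
    where
    open Decode r c v g
    π : PlanePartition
    π = decoded
    decide : Dec (weight π ≡ w) -> h v ≡ 0ℤ
    decide (yes e) = let (ρ , i , s) = proj₁ (proj₂ enum) π (outside , e) in absurd (no-π ρ i (E.sym (enc-same π ρ s r c) >> encoded))
    decide (no ne) = cong h (E.sym encoded) >> InBoxed.code-off π r c outside r≤n w a b w<B a<M ne
   values : ∀ L -> (∀ π -> π ∈ L -> InBox r c π × weight π ≡ w) -> sumList (map (h ∘ (\ π -> enc π r c)) L) ≡ lhsCoeff L a b
   values [] _ = E.refl
   values (π ∷ L) hs = cong₂ Z._+_ (InBoxed.code-coeff π r c (proj₁ (hs π (here E.refl))) r≤n w a b w<B a<M (proj₂ (hs π (here E.refl)))) (values L (\ ρ i -> hs ρ (there i)))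
   boxed : lhsCoeff L a b ≡ rhsBox r c w a b
   boxed = E.sym (values L holds) >> E.sym (enumerate (\ π -> enc π r c) L h (distinct L (\ π i -> proj₁ (holds π i)) (proj₂ (proj₂ enum))) (\ π i -> enc-range π r c (subst (N._< B) (E.sym (proj₂ (holds π i))) w<B)) missing) >> E.sym (coeff-Sum (r N.+ c) (up r c 𝟎) w a b) >> at (T.tr (partition-function r c c≤n (NP.≤-<-trans N.z≤n w<B)) (Y-rhs r c)) w a b w<B a<M >> coeff-el (rhsBox r c) w a b
 theorem-box : (r c : ℕ) (w : ℕ) (L : List PlanePartition) -> Enumerates (\ π -> InBox r c π × weight π ≡ w) L -> (a b : ℕ) -> lhsCoeff L a b ≡ rhsBox r c w a b
 -- B = w + 1 and M = a + 1 are the smallest truncations that keep the coefficient of s^w q^a, and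
 -- n0 = r + c bounds both r and c.
 theorem-box r c w L enum a b = EnumDef.Counting.boxed (suc w) (suc a) (r N.+ c) (N.s≤s N.z≤n) r c (NP.m≤m+n r c) (NP.m≤n+m c r) w a b ≤-refl ≤-refl L enum
 -- Plane partitions of weight w fit into the square of side w + 1, and modulo s^(w+1) the product
 -- for this square is the infinite product.
 theorem-all : (w : ℕ) (L : List PlanePartition) -> Enumerates (\ π -> weight π ≡ w) L -> (a b : ℕ) -> lhsCoeff L a b ≡ rhsAll w a b
 theorem-all w L (holds , complete , distinct) a b = theorem-box (suc w) (suc w) w L ((\ π i -> Weights.weight-box π w (≤-reflexive (holds π i)) , holds π i) , (\ π h -> complete π (proj₂ h)) , distinct) a b >> E.sym (coeff-el (rhsBox (suc w) (suc w)) w a b) >> TruncDef.at (rhsBox-rhsAll (suc w) (suc a) (N.s≤s N.z≤n)) w a b ≤-refl ≤-refl >> coeff-el rhsAll w a b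

open Enum using (theorem-box; theorem-all)
open import Defs
open import Data.Nat using (_≤_)
open import Data.List using (List)

theoremA : (∀ (r c : ℕ) → 1 ≤ r → 1 ≤ c → ∀ (w : ℕ) (L : List PlanePartition) →
    Enumerates (λ π → InBox r c π × weight π ≡ w) L →
    ∀ (a b : ℕ) → lhsCoeff L a b ≡ rhsBox r c w a b)
    ×
    (∀ (w : ℕ) (L : List PlanePartition) →
    Enumerates (λ π → weight π ≡ w) L →
    ∀ (a b : ℕ) → lhsCoeff L a b ≡ rhsAll w a b)
theoremA = (λ r c _ _ → theorem-box r c) , theorem-all
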